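{- Let $p\geq 3$. (i) There is $n_0(p)$ such that if $n>n_0(p)$, $\binom{p}{2}$ divides $\binom{n}{2}$ and $p-1$ divides $n-1$, then for $k=\frac{n(n-1)}{p(p-1)}$ we have $M(k,n)=n(n-1)/p=(p-1)k$. (ii) As $n\to\infty$, for $k=\lfloor\frac{n(n-1)}{p(p-1)}\rfloor$ we have $\frac{n(n-1)}{p}-O(n)\leq M(k,n)\leq\frac{n(n-1)}{p}$ (the implied constant depending on $p$).
   Context: For a finite graph $G$, $\mathrm{Mad}(G)=\max\{2e(H)/|V(H)| : H\subseteq G,\ |V(H)|\geq 1\}$ ($0$ if edgeless). $M(k,n)$ is the maximum of $\sum_{i=1}^k\mathrm{Mad}(G_i)$ over all partitions of $E(K_n)$ into $k$ spanning subgraphs $G_1,\dots,G_k$. -}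

module Defs where

open import Data.Nat using (ℕ; zero; suc; _<ᵇ_)
open import Data.Bool using (Bool; true; false; _∧_; if_then_else_)
open import Data.Fin using (Fin; toℕ)
open import Data.Fin.Properties using () renaming (_≟_ to _≟ᶠ_)
open import Data.Vec using (Vec; []; _∷_; lookup)
open import Data.List using (List; []; _∷_; map; _++_; foldr; concatMap; allFin)
open import Data.Product using (_×_; _,_)
open import Data.Integer using (+_)
open import Data.Rational using (ℚ; 0ℚ; _/_; _⊔_; _+_)
open import Relation.Nullary.Decidable using (⌊_⌋)

-- A partition of E(K_n) into k spanning subgraphs G_1..G_k is given by a
-- colouring of the edges: the edge {i,j} with toℕ i < toℕ j lies in G_{c i j}.
-- (Values c i j with toℕ i ≥ toℕ j are irrelevant.)
Colouring : ℕ → ℕ → Set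
Colouring k n = Fin n → Fin n → Fin k

allSubsets : (n : ℕ) → List (Vec Bool n)
allSubsets zero = [] ∷ []
allSubsets (suc n) = map (true ∷_) (allSubsets n) ++ map (false ∷_) (allSubsets n)

countB : List Bool → ℕ
countB = foldr (λ b m → if b then suc m else m) 0

size : {n : ℕ} → Vec Bool n → ℕ
size [] = 0
size (true ∷ s) = suc (size s)
size (false ∷ s) = size s

pairs : (n : ℕ) → List (Fin n × Fin n)
pairs n = concatMap (λ i → map (λ j → (i , j)) (allFin n)) (allFin n)

edgesIn : {k n : ℕ} → Colouring k n → Fin k → Vec Bool n → ℕ
edgesIn {n = n} c a S =
  countB (map (λ { (i , j) → lookup S i ∧ lookup S j ∧ (toℕ i <ᵇ toℕ j)
                              ∧ ⌊ c i j ≟ᶠ a ⌋ })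
              (pairs n))

density : ℕ → ℕ → ℚ
density e zero = 0ℚ
density e (suc v) = (+ (2 Data.Nat.* e)) / suc v

-- Mad(G_a) = max over nonempty S ⊆ V of 2 e(G_a[S]) / |S|
-- (0 if G_a is edgeless, since all densities are then 0).
Mad : {k n : ℕ} → Colouring k n → Fin k → ℚ
Mad {n = n} c a = foldr (λ S m → density (edgesIn c a S) (size S) ⊔ m) 0ℚ (allSubsets n)

totalMad : {k n : ℕ} → Colouring k n → ℚ
totalMad {k} c = foldr (λ a s → Mad c a + s) 0ℚ (allFin k)

ℕtoℚ : ℕ → ℚ
ℕtoℚ m = (+ m) / 1

{-# OPTIONS --safe #-}

-- Upper bound: a subgraph with s vertices and e edges of a graph with E edges satisfies
-- 2 e / s ≤ (p − 1) / 2 + E / p, because 2 e ≤ s (s − 1), and the k right-hand sides add up to at most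
-- n (n − 1) / p.  Equality holds when the k graphs are edge-disjoint copies of K_p, so what is needed is
-- Wilson's theorem: for large n with p − 1 ∣ n − 1 and p (p − 1) ∣ n (n − 1), the graph K_n decomposes into
-- copies of K_p.  Part (ii) follows by decomposing K_m for the largest m ≤ n with m ≡ 1 (mod p (p − 1)).
--
-- Wilson's theorem, with k for the block size.
-- (a) There are infinitely many primes q ≡ 1 (mod N), and for N = k (k − 1) and q large there is a block in
--     the field of order q whose differences lie in prescribed cyclotomic classes, found greedily since these
--     classes are quasi-random.  Developing the block gives a design of order q.
-- (b) If every pair of v points lies in exactly λ blocks, replacing each point by λ ^ M points and spreading
--     the λ blocks through a pair over them removes the repetition and leaves a group divisible design.
--     Taking all k-subsets as blocks gives such designs with j groups for all small j ≥ k.  For admissible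
--     v ≥ k + 2 the constant vectors 1 + Λ z lie in the lattice spanned by the sets of pairs of k-subsets, so
--     that λ can be chosen to be a prime as in (a), and filling the groups yields designs whose order lies in
--     any prescribed admissible residue class.
-- (c) A transversal design with one truncated group extends the group divisible designs to all j ≥ k.  It
--     also appends a long progression of new points to a design with a hole, so that every admissible
--     residue class contains all large orders.
module Submission where

-- The arithmetic of group sizes shapes the proof. Blowing up or inflating by m requires an abelian
-- group of order m with many endomorphisms whose pairwise differences are bijective. Such orders
-- are closed under products and contain large primes, 2^t-th powers and the numbers t! z + 1. The
-- group divisible designs that exist for all numbers of groups have a group size w of the second
-- kind, a multiple of k (k - 1), so that their groups cannot in general be filled by designs. The
-- groups are therefore filled around a common hole of f points. A product of designs of orders f
-- and Q leaves f (Q - 1) points outside the hole, and Q, a power of a prime, is chosen so that f (Q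
-- - 1) = w g with g again an order of the above kind. This makes any number of groups of size g w
-- usable. In the final truncation only the short group together with the hole has to carry a
-- design. Its order is fixed and decides the residue class, while the long groups grow freely.

-- Ring solver with integer coefficients for an arbitrary commutative ring

module RingSolver where
  open import Level using (0ℓ)
  open import Algebra.Bundles using (CommutativeRing)
  open import Data.Nat as ℕ using (ℕ; zero; suc)
  open import Data.Integer as ℤ using (ℤ; +_; -[1+_]; _⊖_)
  import Data.Integer.Properties as ℤ
  open import Data.Maybe using (Maybe; just; nothing)
  open import Relation.Nullary using (yes; no)
  import Relation.Binary.PropositionalEquality as ≡
  open import Algebra.Solver.Ring.AlmostCommutativeRing using (fromCommutativeRing; _-Raw-AlmostCommutative⟶_)

  -- The solver normalises polynomials with computable coefficients. The canonical homomorphism from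
  -- ℤ provides them for every R, so that signs and constants are handled without computing in R.
  module IntegerSolver (R : CommutativeRing 0ℓ 0ℓ) where
    open CommutativeRing R
    open import Algebra.Properties.Semiring.Mult semiring
    open import Algebra.Properties.Ring ring
    open import Algebra.Properties.AbelianGroup +-abelianGroup using (⁻¹-∙-comm)
    open import Relation.Binary.Reasoning.Setoid setoid

    ⟦_⟧ : ℤ → Carrier
    ⟦ + n ⟧ = n × 1#
    ⟦ -[1+ n ] ⟧ = - (suc n × 1#)

    ⟦⟧-neg : ∀ i → ⟦ ℤ.- i ⟧ ≈ - ⟦ i ⟧
    ⟦⟧-neg (+ zero) = sym -0#≈0#
    ⟦⟧-neg (+ suc n) = refl
    ⟦⟧-neg -[1+ n ] = sym (-‿involutive _)

    ⟦⟧-⊖ : ∀ m n → ⟦ m ⊖ n ⟧ ≈ m × 1# + - (n × 1#)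
    ⟦⟧-⊖ zero zero = sym (-‿inverseʳ 0#)
    ⟦⟧-⊖ zero (suc n) = sym (+-identityˡ _)
    ⟦⟧-⊖ (suc m) zero = sym (trans (+-congˡ -0#≈0#) (+-identityʳ _))
    ⟦⟧-⊖ (suc m) (suc n) = begin
      ⟦ suc m ⊖ suc n ⟧                           ≡⟨ ≡.cong ⟦_⟧ (ℤ.[1+m]⊖[1+n]≡m⊖n m n) ⟩
      ⟦ m ⊖ n ⟧                                   ≈⟨ ⟦⟧-⊖ m n ⟩
      a + - b                                     ≈⟨ +-congʳ (sym (+-identityˡ a)) ⟩
      (0# + a) + - b                              ≈⟨ +-congʳ (+-congʳ (sym (-‿inverseˡ 1#))) ⟩
      ((- 1# + 1#) + a) + - b                     ≈⟨ +-congʳ (trans (+-assoc _ _ _) (+-comm _ _)) ⟩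
      ((1# + a) + - 1#) + - b                     ≈⟨ +-assoc _ _ _ ⟩
      (1# + a) + (- 1# + - b)                     ≈⟨ +-congˡ (⁻¹-∙-comm 1# b) ⟩
      (1# + a) + - (1# + b)                       ∎
      where a = m × 1#
            b = n × 1#

    ⟦⟧-+ : ∀ i j → ⟦ i ℤ.+ j ⟧ ≈ ⟦ i ⟧ + ⟦ j ⟧
    ⟦⟧-+ (+ m) (+ n) = ×-homo-+ 1# m n
    ⟦⟧-+ (+ m) -[1+ n ] = ⟦⟧-⊖ m (suc n)
    ⟦⟧-+ -[1+ m ] (+ n) = trans (⟦⟧-⊖ n (suc m)) (+-comm _ _)
    ⟦⟧-+ -[1+ m ] -[1+ n ] = begin
      - (suc (suc (m ℕ.+ n)) × 1#)            ≡⟨ ≡.cong (λ z → - (suc z × 1#)) (≡.sym (ℕ-+-suc m n)) ⟩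
      - ((suc m ℕ.+ suc n) × 1#)              ≈⟨ -‿cong (×-homo-+ 1# (suc m) (suc n)) ⟩
      - (suc m × 1# + suc n × 1#)             ≈⟨ sym (⁻¹-∙-comm _ _) ⟩
      - (suc m × 1#) + - (suc n × 1#)         ∎
      where open import Data.Nat.Properties using () renaming (+-suc to ℕ-+-suc)

    ⟦⟧-* : ∀ i j → ⟦ i ℤ.* j ⟧ ≈ ⟦ i ⟧ * ⟦ j ⟧
    ⟦⟧-* (+ m) (+ n) = trans (reflexive (≡.cong ⟦_⟧ (≡.sym (ℤ.pos-* m n)))) (×1-homo-* m n)
    ⟦⟧-* (+ m) -[1+ n ] = begin
      ⟦ (+ m) ℤ.* -[1+ n ] ⟧         ≡⟨ ≡.cong ⟦_⟧ (≡.trans (ℤ.-◃n≡-n (m ℕ.* suc n)) ≡.refl) ⟩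
      ⟦ ℤ.- (+ (m ℕ.* suc n)) ⟧      ≈⟨ ⟦⟧-neg (+ (m ℕ.* suc n)) ⟩
      - ((m ℕ.* suc n) × 1#)         ≈⟨ -‿cong (×1-homo-* m (suc n)) ⟩
      - (m × 1# * (suc n × 1#))      ≈⟨ -‿distribʳ-* _ _ ⟩
      m × 1# * - (suc n × 1#)        ∎
    ⟦⟧-* -[1+ m ] (+ n) = begin
      ⟦ -[1+ m ] ℤ.* (+ n) ⟧         ≡⟨ ≡.cong ⟦_⟧ (≡.trans (ℤ.-◃n≡-n (suc m ℕ.* n)) ≡.refl) ⟩
      ⟦ ℤ.- (+ (suc m ℕ.* n)) ⟧      ≈⟨ ⟦⟧-neg (+ (suc m ℕ.* n)) ⟩
      - ((suc m ℕ.* n) × 1#)         ≈⟨ -‿cong (×1-homo-* (suc m) n) ⟩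
      - (suc m × 1# * (n × 1#))      ≈⟨ -‿distribˡ-* _ _ ⟩
      - (suc m × 1#) * (n × 1#)      ∎
    ⟦⟧-* -[1+ m ] -[1+ n ] = begin
      (suc m ℕ.* suc n) × 1#                 ≈⟨ ×1-homo-* (suc m) (suc n) ⟩
      suc m × 1# * (suc n × 1#)              ≈⟨ sym (-‿involutive _) ⟩
      - - (suc m × 1# * (suc n × 1#))        ≈⟨ -‿cong (-‿distribʳ-* _ _) ⟩
      - (suc m × 1# * - (suc n × 1#))        ≈⟨ -‿distribˡ-* _ _ ⟩
      - (suc m × 1#) * - (suc n × 1#)        ∎

    private
      weak : ∀ i j → Maybe (⟦ i ⟧ ≈ ⟦ j ⟧)
      weak i j with i ℤ.≟ j
      ... | yes ≡.refl = just refl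
      ... | no _ = nothing

      homomorphism : ℤ.+-*-rawRing -Raw-AlmostCommutative⟶ fromCommutativeRing R
      homomorphism = record { ⟦_⟧ = ⟦_⟧ ; +-homo = ⟦⟧-+ ; *-homo = ⟦⟧-* ; -‿homo = ⟦⟧-neg ; 0-homo = refl ; 1-homo = ×-homo-1 1# }

    open import Algebra.Solver.Ring ℤ.+-*-rawRing (fromCommutativeRing R) homomorphism weak public using (solve; _:=_; _:+_; _:*_; _:-_; :-_; con)

-- Decompositions into complete graphs: groups, holes, products, truncation

module Designs where
  open import Data.Nat using (ℕ; zero; suc; _≤_; _<_; _<?_)
  open import Data.Nat.Properties using (<-irrelevant; ≤-irrelevant; ≮⇒≥; <⇒≱)
  open import Data.Fin using (Fin; zero; suc; toℕ; fromℕ<; punchOut; punchIn; inject≤)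
  open import Data.Fin.Properties using (_≟_; suc-injective; toℕ-injective; toℕ-fromℕ<; punchOut-injective; punchOut-cong; punchOut-punchIn; punchInᵢ≢i; toℕ<n; toℕ-inject≤)
  open import Data.Product using (Σ; _×_; _,_; proj₁; proj₂)
  open import Data.Sum using (_⊎_; inj₁; inj₂)
  open import Data.Unit using (⊤; tt)
  open import Data.Empty using (⊥; ⊥-elim)
  open import Relation.Nullary using (¬_; yes; no)
  open import Relation.Nullary.Decidable using (False; fromWitnessFalse; toWitnessFalse)
  open import Relation.Binary.PropositionalEquality using (_≡_; _≢_; refl; sym; trans; cong; cong₂; subst)
  open import Relation.Binary.Definitions using (DecidableEquality)
  open import Function.Bundles using (_↔_; Inverse)
  open import Data.Bool.Properties using (T-irrelevant)

  -- A decomposition of the graph with adjacency E into complete graphs of order k.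
  record Decomp (k : ℕ) (X : Set) (E : X → X → Set) : Set₁ where
    field
      Blk : Set
      pt : Blk → Fin k → X
      irr : ∀ {x} → ¬ E x x
      edge : ∀ B {a b} → a ≢ b → E (pt B a) (pt B b)
      cover : ∀ {x y} → E x y →
        Σ Blk λ B → Σ (Fin k) λ a → Σ (Fin k) λ b → a ≢ b × pt B a ≡ x × pt B b ≡ y
      uniq : ∀ {B B′ a b a′ b′} → a ≢ b → a′ ≢ b′ →
        pt B a ≡ pt B′ a′ → pt B b ≡ pt B′ b′ → B ≡ B′

  open Decomp

  -- The core of all recursive constructions: the edges of `E` are partitioned among embedded copies
  -- of graphs that are already decomposed. The last hypothesis is the disjointness, which
  -- identifies the copies before `uniq` inside one copy can apply.
  glue : ∀ {k} {X : Set} {E : X → X → Set} (J : Set) (Y : J → Set) (F : ∀ j → Y j → Y j → Set)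
    (φ : ∀ j → Y j → X) → (∀ j → Decomp k (Y j) (F j)) → (∀ {x} → ¬ E x x) →
    (∀ j {u v} → φ j u ≡ φ j v → u ≡ v) →
    (∀ j {u v} → F j u v → E (φ j u) (φ j v)) →
    (∀ {x y} → E x y → Σ J λ j → Σ (Y j) λ u → Σ (Y j) λ v → F j u v × φ j u ≡ x × φ j v ≡ y) →
    (∀ {j j′ u v u′ v′} → F j u v → F j′ u′ v′ → φ j u ≡ φ j′ u′ → φ j v ≡ φ j′ v′ → j ≡ j′) →
    Decomp k X E
  glue {k} {X} {E} J Y F φ D irrE φ-inj into onto one = record
    { Blk = Σ J (λ j → Blk (D j))
    ; pt = λ { (j , B) a → φ j (pt (D j) B a) }
    ; irr = irrE
    ; edge = λ { (j , B) a≢b → into j (edge (D j) B a≢b) }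
    ; cover = cov
    ; uniq = λ {B} {B′} → unq {B} {B′}
    }
    where
    cov : ∀ {x y} → E x y → Σ (Σ J λ j → Blk (D j)) λ { (j , B) → Σ (Fin k) λ a → Σ (Fin k) λ b →
      a ≢ b × φ j (pt (D j) B a) ≡ x × φ j (pt (D j) B b) ≡ y }
    cov e with onto e
    ... | j , u , v , f , refl , refl with cover (D j) f
    ... | B , a , b , a≢b , refl , refl = (j , B) , a , b , a≢b , refl , refl
    unq : ∀ {B B′ : Σ J (λ j → Blk (D j))} {a b a′ b′} → a ≢ b → a′ ≢ b′ →
      φ (proj₁ B) (pt (D (proj₁ B)) (proj₂ B) a) ≡ φ (proj₁ B′) (pt (D (proj₁ B′)) (proj₂ B′) a′) →
      φ (proj₁ B) (pt (D (proj₁ B)) (proj₂ B) b) ≡ φ (proj₁ B′) (pt (D (proj₁ B′)) (proj₂ B′) b′) → B ≡ B′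
    unq {j , B} {j′ , B′} p q e f with one (edge (D j) B p) (edge (D j′) B′ q) e f
    ... | refl = cong (j ,_) (uniq (D j) p q (φ-inj j e) (φ-inj j f))

  transport : ∀ {k} {X Y : Set} {E : X → X → Set} {F : Y → Y → Set} (φ : Y → X) →
    (∀ {x} → ¬ E x x) → (∀ {u v} → φ u ≡ φ v → u ≡ v) → (∀ {u v} → F u v → E (φ u) (φ v)) →
    (∀ {x y} → E x y → Σ Y λ u → Σ Y λ v → F u v × φ u ≡ x × φ v ≡ y) →
    Decomp k Y F → Decomp k X E
  transport φ irrE φ-inj into onto D =
    glue ⊤ (λ _ → _) (λ _ → _) (λ _ → φ) (λ _ → D) irrE (λ _ → φ-inj) (λ _ → into) (λ e → tt , onto e)
      (λ _ _ _ _ → refl)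

  Design : ℕ → Set → Set₁
  Design k X = Decomp k X _≢_

  -- Group divisible designs: the groups are the sets {j} × A.
  apart : {J A : Set} → J × A → J × A → Set
  apart p q = proj₁ p ≢ proj₁ q

  GDD : ℕ → Set → Set → Set₁
  GDD k J A = Decomp k (J × A) apart

  -- The edges inside `F` are left out, so that several copies can share `F` before it is filled
  -- once.
  hole : {F U : Set} → F ⊎ U → F ⊎ U → Set
  hole (inj₁ _) (inj₁ _) = ⊥
  hole (inj₁ _) (inj₂ _) = ⊤
  hole (inj₂ _) (inj₁ _) = ⊤
  hole (inj₂ u) (inj₂ v) = u ≢ v

  Holey : ℕ → Set → Set → Set₁
  Holey k F U = Decomp k (F ⊎ U) hole

  hole-irr : {F U : Set} {x : F ⊎ U} → ¬ hole x x
  hole-irr {x = inj₁ _} ()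
  hole-irr {x = inj₂ _} h = h refl

  hole⇒≢ : {F U : Set} {x y : F ⊎ U} → hole x y → x ≢ y
  hole⇒≢ h refl = hole-irr h

  Design-iso : ∀ {k} {X Y : Set} → X ↔ Y → Design k X → Design k Y
  Design-iso i = transport to (λ p → p refl) injective (λ p e → p (injective e))
    (λ {x} {y} p → from x , from y , (λ e → p (trans (sym (inverseˡ refl)) (trans (cong to e) (inverseˡ refl)))) , inverseˡ refl , inverseˡ refl)
    where open Inverse i
          injective : ∀ {u v} → to u ≡ to v → u ≡ v
          injective e = trans (sym (inverseʳ refl)) (trans (cong from e) (inverseʳ refl))

  GDD-iso : ∀ {k} {J J′ A A′ : Set} → J ↔ J′ → A ↔ A′ → GDD k J A → GDD k J′ A′
  GDD-iso i j = transport (λ { (x , a) → I.to x , J.to a }) (λ p → p refl)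
    (λ e → cong₂ _,_ (Iinj (cong proj₁ e)) (Jinj (cong proj₂ e))) (λ p e → p (Iinj e))
    (λ { {x , a} {y , b} p → (I.from x , J.from a) , (I.from y , J.from b)
       , (λ e → p (trans (sym (I.inverseˡ refl)) (trans (cong I.to e) (I.inverseˡ refl))))
       , cong₂ _,_ (I.inverseˡ refl) (J.inverseˡ refl) , cong₂ _,_ (I.inverseˡ refl) (J.inverseˡ refl) })
    where module I = Inverse i
          module J = Inverse j
          Iinj : ∀ {u v} → I.to u ≡ I.to v → u ≡ v
          Iinj e = trans (sym (I.inverseʳ refl)) (trans (cong I.from e) (I.inverseʳ refl))
          Jinj : ∀ {u v} → J.to u ≡ J.to v → u ≡ v
          Jinj e = trans (sym (J.inverseʳ refl)) (trans (cong J.from e) (J.inverseʳ refl))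

  fill-hole : ∀ {k} {F U : Set} → Holey k F U → Design k F → Design k (F ⊎ U)
  fill-hole {k} {F} {U} H D = glue (⊤ ⊎ ⊤) Y R φ D′ (λ p → p refl) inj into onto one
    where
    Y : ⊤ ⊎ ⊤ → Set
    Y (inj₁ _) = F ⊎ U
    Y (inj₂ _) = F
    R : ∀ j → Y j → Y j → Set
    R (inj₁ _) = hole
    R (inj₂ _) = _≢_
    φ : ∀ j → Y j → F ⊎ U
    φ (inj₁ _) x = x
    φ (inj₂ _) x = inj₁ x
    D′ : ∀ j → Decomp k (Y j) (R j)
    D′ (inj₁ _) = H
    D′ (inj₂ _) = D
    inj : ∀ j {u v} → φ j u ≡ φ j v → u ≡ v
    inj (inj₁ _) e = e
    inj (inj₂ _) refl = refl
    into : ∀ j {u v} → R j u v → φ j u ≢ φ j v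
    into (inj₁ _) h = hole⇒≢ h
    into (inj₂ _) n refl = n refl
    onto : ∀ {x y} → x ≢ y → Σ (⊤ ⊎ ⊤) λ j → Σ (Y j) λ u → Σ (Y j) λ v → R j u v × φ j u ≡ x × φ j v ≡ y
    onto {inj₁ x} {inj₁ y} n = inj₂ tt , x , y , (λ { refl → n refl }) , refl , refl
    onto {inj₁ x} {inj₂ y} n = inj₁ tt , _ , _ , tt , refl , refl
    onto {inj₂ x} {inj₁ y} n = inj₁ tt , _ , _ , tt , refl , refl
    onto {inj₂ x} {inj₂ y} n = inj₁ tt , _ , _ , (λ { refl → n refl }) , refl , refl
    one : ∀ {j j′ u v u′ v′} → R j u v → R j′ u′ v′ → φ j u ≡ φ j′ u′ → φ j v ≡ φ j′ v′ → j ≡ j′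
    one {inj₁ _} {inj₁ _} _ _ _ _ = refl
    one {inj₁ _} {inj₂ _} h _ refl refl = ⊥-elim h
    one {inj₂ _} {inj₁ _} _ h refl refl = ⊥-elim h
    one {inj₂ _} {inj₂ _} _ _ _ _ = refl

  -- Each group together with the common set `F` receives a copy of `H`. The hole keeps the edges
  -- inside `F` from being covered once per group.
  fill-groups : ∀ {k} {F J U : Set} → DecidableEquality J → GDD k J U → Holey k F U → Holey k F (J × U)
  fill-groups {k} {F} {J} {U} _≟J_ G H = glue (⊤ ⊎ J) Y R φ D′ (λ {x} → hole-irr {x = x}) inj into onto one
    where
    Y : ⊤ ⊎ J → Set
    Y (inj₁ _) = J × U
    Y (inj₂ _) = F ⊎ U
    R : ∀ j → Y j → Y j → Set
    R (inj₁ _) = apart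
    R (inj₂ _) = hole
    φ : ∀ j → Y j → F ⊎ (J × U)
    φ (inj₁ _) x = inj₂ x
    φ (inj₂ _) (inj₁ x) = inj₁ x
    φ (inj₂ j) (inj₂ x) = inj₂ (j , x)
    D′ : ∀ j → Decomp k (Y j) (R j)
    D′ (inj₁ _) = G
    D′ (inj₂ _) = H
    inj : ∀ j {u v} → φ j u ≡ φ j v → u ≡ v
    inj (inj₁ _) refl = refl
    inj (inj₂ _) {inj₁ _} {inj₁ _} refl = refl
    inj (inj₂ _) {inj₂ _} {inj₂ _} refl = refl
    into : ∀ j {u v} → R j u v → hole (φ j u) (φ j v)
    into (inj₁ _) n refl = n refl
    into (inj₂ _) {inj₁ _} {inj₂ _} h = h
    into (inj₂ _) {inj₂ _} {inj₁ _} h = h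
    into (inj₂ _) {inj₂ _} {inj₂ _} h refl = h refl
    onto : ∀ {x y} → hole x y → Σ (⊤ ⊎ J) λ j → Σ (Y j) λ u → Σ (Y j) λ v → R j u v × φ j u ≡ x × φ j v ≡ y
    onto {inj₁ x} {inj₂ (j , y)} n = inj₂ j , inj₁ x , inj₂ y , tt , refl , refl
    onto {inj₂ (j , x)} {inj₁ y} n = inj₂ j , inj₂ x , inj₁ y , tt , refl , refl
    onto {inj₂ (i , x)} {inj₂ (j , y)} n with i ≟J j
    ... | no i≢j = inj₁ tt , _ , _ , i≢j , refl , refl
    ... | yes refl = inj₂ i , inj₂ x , inj₂ y , (λ { refl → n refl }) , refl , refl
    one : ∀ {j j′ u v u′ v′} → R j u v → R j′ u′ v′ → φ j u ≡ φ j′ u′ → φ j v ≡ φ j′ v′ → j ≡ j′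
    one {inj₁ _} {inj₁ _} _ _ _ _ = refl
    one {inj₁ _} {inj₂ _} {u′ = inj₂ _} {inj₂ _} n _ refl refl = ⊥-elim (n refl)
    one {inj₂ _} {inj₁ _} {inj₂ _} {inj₂ _} _ n refl refl = ⊥-elim (n refl)
    one {inj₂ _} {inj₂ _} {inj₂ _} {_} {inj₂ _} _ _ refl _ = refl
    one {inj₂ _} {inj₂ _} {inj₁ _} {inj₂ _} {inj₁ _} {inj₂ _} _ _ _ refl = refl

  fill-groups₀ : ∀ {k} {J U : Set} → DecidableEquality J → GDD k J U → Design k U → Design k (J × U)
  fill-groups₀ {k} {J} {U} _≟J_ G D = transport out (λ p → p refl) (λ {u} {v} → out-inj {u} {v})
    (λ {u} {v} → out-≢ {u} {v}) (λ {x} {y} n → inj₂ x , inj₂ y , n , refl , refl)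
    (fill-groups {F = ⊥} _≟J_ G (transport inj₂ (λ {x} → hole-irr {x = x}) (λ { refl → refl }) (λ p → p)
      (λ { {inj₂ x} {inj₂ y} n → x , y , n , refl , refl }) D))
    where
    out : ⊥ ⊎ (J × U) → J × U
    out (inj₁ ())
    out (inj₂ x) = x
    out-inj : ∀ {u v} → out u ≡ out v → u ≡ v
    out-inj {inj₂ _} {inj₂ _} refl = refl
    out-≢ : ∀ {u v} → hole u v → out u ≢ out v
    out-≢ {inj₂ _} {inj₂ _} n = n

  -- Orthogonal arrays of strength two and index one; row₀ is a constant row.
  record OA (t : ℕ) (M : Set) : Set₁ where
    field
      Row : Set
      _≟R_ : DecidableEquality Row
      val : Row → Fin t → M
      solve : ∀ {i j} → i ≢ j → ∀ x y → Σ Row λ q → val q i ≡ x × val q j ≡ y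
      unique : ∀ {i j q q′} → i ≢ j → val q i ≡ val q′ i → val q j ≡ val q′ j → q ≡ q′
      row₀ : Row
      sym₀ : M
      val₀ : ∀ i → val row₀ i ≡ sym₀

  -- A row `q` places a copy of `G` at height `val q i` over each group `i`. Heights prescribed in
  -- two different groups determine one row, so every pair falls into exactly one copy.
  inflate : ∀ {k j M A} → OA j M → GDD k (Fin j) A → GDD k (Fin j) (M × A)
  inflate {k} {j} {M} {A} O G = glue Row (λ _ → Fin j × A) (λ _ → apart) (λ { q (i , a) → i , val q i , a })
    (λ _ → G) (λ p → p refl) (λ { q refl → refl }) (λ _ p → p)
    (λ { {i , x , a} {i′ , y , b} n → let q , e , f = solve n x y in
         q , (i , a) , (i′ , b) , n , cong (λ z → i , z , a) e , cong (λ z → i′ , z , b) f })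
    (λ { {q} {q′} {i , _} {j , _} {i′ , _} {j′ , _} n n′ e f → lem n e f })
    where
    open OA O
    lem : ∀ {q q′ i a j b i′ a′ j′ b′} → i ≢ j → (i , val q i , a) ≡ (i′ , val q′ i′ , a′) →
      (j , val q j , b) ≡ (j′ , val q′ j′ , b′) → q ≡ q′
    lem n e f with cong proj₁ e | cong proj₁ f
    ... | refl | refl = unique n (cong (λ z → proj₁ (proj₂ z)) e) (cong (λ z → proj₁ (proj₂ z)) f)

  -- The copy of the design over the constant row of the orthogonal array is left as a hole.
  product-hole : ∀ {k m} {F : Set} → DecidableEquality F → Design k F → OA k (Fin (suc m)) →
    Design k (Fin (suc m)) → Holey k F (F × Fin m)
  product-hole {k} {m} {F} _≟F_ D O D₁ = glue (F ⊎ (Blk D × Σ Row λ q → False (q ≟R row₀))) Y R φ D′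
    (λ {x} → hole-irr {x = x}) inj into onto one
    where
    open OA O
    -- The layer of `F` × Fin (suc m) at height `sym₀` becomes the hole; the other heights are
    -- renumbered by `punchOut`.
    enc : F → (y : Fin (suc m)) → F ⊎ (F × Fin m)
    enc x y with sym₀ ≟ y
    ... | yes _ = inj₁ x
    ... | no n = inj₂ (x , punchOut n)
    enc-inj : ∀ {x y x′ y′} → enc x y ≡ enc x′ y′ → x ≡ x′ × y ≡ y′
    enc-inj {x} {y} {x′} {y′} e with sym₀ ≟ y | sym₀ ≟ y′
    enc-inj refl | yes refl | yes refl = refl , refl
    enc-inj () | yes _ | no _
    enc-inj () | no _ | yes _
    enc-inj e | no n | no n′ = cong (λ { (inj₁ z) → z ; (inj₂ (z , _)) → z }) e
      , punchOut-injective n n′ (lem e)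
      where lem : ∀ {a b : F} {c d} → _≡_ {A = F ⊎ (F × Fin m)} (inj₂ (a , c)) (inj₂ (b , d)) → c ≡ d
            lem refl = refl
    dec₀ : ∀ x → enc x sym₀ ≡ inj₁ x
    dec₀ x with sym₀ ≟ sym₀
    ... | yes _ = refl
    ... | no n = ⊥-elim (n refl)
    dec₁ : ∀ x y → enc x (punchIn sym₀ y) ≡ inj₂ (x , y)
    dec₁ x y with sym₀ ≟ punchIn sym₀ y
    ... | yes e = ⊥-elim (punchInᵢ≢i sym₀ y (sym e))
    ... | no n = cong (λ z → inj₂ (x , z)) (trans (punchOut-cong sym₀ refl) (punchOut-punchIn sym₀))
    hole-enc : ∀ {x y x′ y′} → (x ≡ x′ → y ≢ y′) → (y ≡ sym₀ → y′ ≢ sym₀) → hole (enc x y) (enc x′ y′)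
    hole-enc {x} {y} {x′} {y′} n c with sym₀ ≟ y | sym₀ ≟ y′
    ... | yes refl | yes refl = ⊥-elim (c refl refl)
    ... | yes _ | no _ = tt
    ... | no _ | yes _ = tt
    ... | no p | no p′ = λ e → n (cong proj₁ e) (punchOut-injective p p′ (cong proj₂ e))
    dec : ∀ p → Σ F λ x → Σ (Fin (suc m)) λ y → enc x y ≡ p
    dec (inj₁ x) = x , sym₀ , dec₀ x
    dec (inj₂ (x , y)) = x , punchIn sym₀ y , dec₁ x y
    hole-dec : ∀ {x y x′ y′} → hole (enc x y) (enc x′ y′) → (x ≡ x′ → y ≢ y′) × (y ≡ sym₀ → y′ ≢ sym₀)
    hole-dec {x} {y} {x′} {y′} h = (λ { refl refl → hole-irr {x = enc x y} h })
      , (λ { refl refl → subst (hole (inj₁ x)) (dec₀ x′) (subst (λ z → hole z (enc x′ sym₀)) (dec₀ x) h) })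
    -- Fibres over the points of `F` carry `D₁`; a block of `D` with a row other than `row₀` gives
    -- one block. `False` instead of a negation makes the side condition proof-irrelevant, which
    -- `one` relies on.
    J = F ⊎ (Blk D × Σ Row λ q → False (q ≟R row₀))
    Y : J → Set
    Y (inj₁ _) = Fin (suc m)
    Y (inj₂ _) = Fin k
    R : ∀ j → Y j → Y j → Set
    R (inj₁ _) = _≢_
    R (inj₂ _) = _≢_
    φ : ∀ j → Y j → F ⊎ (F × Fin m)
    φ (inj₁ x) y = enc x y
    φ (inj₂ (B , q , _)) a = enc (pt D B a) (val q a)
    single : Decomp k (Fin k) _≢_
    single = record { Blk = ⊤ ; pt = λ _ a → a ; irr = λ p → p refl ; edge = λ _ p → p
      ; cover = λ {x} {y} n → tt , x , y , n , refl , refl ; uniq = λ _ _ _ _ → refl }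
    D′ : ∀ j → Decomp k (Y j) (R j)
    D′ (inj₁ _) = D₁
    D′ (inj₂ _) = single
    ptinj : ∀ B {a b} → pt D B a ≡ pt D B b → a ≡ b
    ptinj B {a} {b} e with a ≟ b
    ... | yes p = p
    ... | no n = ⊥-elim (edge D B n e)
    inj : ∀ j {u v} → φ j u ≡ φ j v → u ≡ v
    inj (inj₁ _) e = proj₂ (enc-inj e)
    inj (inj₂ (B , _)) e = ptinj B (proj₁ (enc-inj e))
    into : ∀ j {u v} → R j u v → hole (φ j u) (φ j v)
    into (inj₁ x) n = hole-enc (λ _ → n) (λ e f → n (trans e (sym f)))
    -- A row with the value `sym₀` in two columns would be the excluded constant row.
    into (inj₂ (B , q , q≢)) n = hole-enc (λ e → ⊥-elim (n (ptinj B e)))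
      (λ e f → toWitnessFalse q≢ (unique n (trans e (sym (val₀ _))) (trans f (sym (val₀ _)))))
    onto′ : ∀ {x y x′ y′} → hole (enc x y) (enc x′ y′) →
      Σ J λ j → Σ (Y j) λ u → Σ (Y j) λ v → R j u v × φ j u ≡ enc x y × φ j v ≡ enc x′ y′
    onto′ {x} {y} {x′} {y′} h with x ≟F x′
    ... | yes refl = inj₁ x , y , y′ , proj₁ (hole-dec h) refl , refl , refl
    ... | no n with cover D n
    ... | B , a , b , a≢b , refl , refl with solve a≢b y y′
    ... | q , refl , refl = inj₂ (B , q , fromWitnessFalse (λ { refl → proj₂ (hole-dec h) (val₀ a) (val₀ b) }))
          , a , b , a≢b , refl , refl
    onto : ∀ {x y} → hole x y → Σ J λ j → Σ (Y j) λ u → Σ (Y j) λ v → R j u v × φ j u ≡ x × φ j v ≡ y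
    onto {p} {p′} h with dec p | dec p′
    ... | x , y , refl | x′ , y′ , refl = onto′ h
    one : ∀ {j j′ u v u′ v′} → R j u v → R j′ u′ v′ → φ j u ≡ φ j′ u′ → φ j v ≡ φ j′ v′ → j ≡ j′
    one {inj₁ _} {inj₁ _} _ _ e _ = cong inj₁ (proj₁ (enc-inj e))
    one {inj₁ _} {inj₂ (B , _)} _ n e f = ⊥-elim (n (ptinj B (trans (sym (proj₁ (enc-inj e))) (proj₁ (enc-inj f)))))
    one {inj₂ (B , _)} {inj₁ _} n _ e f = ⊥-elim (n (ptinj B (trans (proj₁ (enc-inj e)) (sym (proj₁ (enc-inj f))))))
    one {inj₂ (B , q , p)} {inj₂ (B′ , q′ , p′)} n n′ e f with uniq D n n′ (proj₁ (enc-inj e)) (proj₁ (enc-inj f))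
    ... | refl with ptinj B (proj₁ (enc-inj e)) | ptinj B (proj₁ (enc-inj f))
    ... | refl | refl with unique n (proj₂ (enc-inj e)) (proj₂ (enc-inj f))
    ... | refl = cong (λ z → inj₂ (B , q , z)) (T-irrelevant p p′)

  -- Points and groups of a transversal design with s + 1 groups of order m, one of them truncated to r points.
  Trunc : ℕ → ℕ → ℕ → Set
  Trunc s m r = (Fin s × Fin m) ⊎ Fin r

  part : ∀ {s m r} → Trunc s m r → Fin s ⊎ ⊤
  part (inj₁ (i , _)) = inj₁ i
  part (inj₂ _) = inj₂ tt

  apartT : ∀ {s m r} {A : Set} → Trunc s m r × A → Trunc s m r × A → Set
  apartT p q = part (proj₁ p) ≢ part (proj₁ q)

  -- The rows of the array are the blocks of a transversal design. A row keeps its point in column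
  -- zero if that point survives the truncation, and loses it otherwise; block sizes s + 1 and s
  -- both occur, and `G₁` and `G₀` replace them.
  truncate : ∀ {k s m r A} → OA (suc s) (Fin m) → r ≤ m → GDD k (Fin s) A → GDD k (Fin (suc s)) A →
    Decomp k (Trunc s m r × A) apartT
  truncate {k} {s} {m} {r} {A} O r≤m G₀ G₁ = glue J Y R φ D′ (λ p → p refl) inj into onto one
    where
    open OA O
    J = (Σ Row λ q → toℕ (val q zero) < r) ⊎ (Σ Row λ q → r ≤ toℕ (val q zero))
    Y : J → Set
    Y (inj₁ _) = Fin (suc s) × A
    Y (inj₂ _) = Fin s × A
    R : ∀ j → Y j → Y j → Set
    R (inj₁ _) = apart
    R (inj₂ _) = apart
    φ : ∀ j → Y j → Trunc s m r × A
    φ (inj₁ (q , lt)) (zero , a) = inj₂ (fromℕ< lt) , a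
    φ (inj₁ (q , lt)) (suc i , a) = inj₁ (i , val q (suc i)) , a
    φ (inj₂ (q , _)) (i , a) = inj₁ (i , val q (suc i)) , a
    D′ : ∀ j → Decomp k (Y j) (R j)
    D′ (inj₁ _) = G₁
    D′ (inj₂ _) = G₀
    inj : ∀ j {u v} → φ j u ≡ φ j v → u ≡ v
    inj (inj₁ _) {zero , _} {zero , _} refl = refl
    inj (inj₁ _) {suc _ , _} {suc _ , _} refl = refl
    inj (inj₂ _) refl = refl
    into : ∀ j {u v} → R j u v → apartT (φ j u) (φ j v)
    into (inj₁ _) {zero , _} {zero , _} n _ = n refl
    into (inj₁ _) {zero , _} {suc _ , _} n ()
    into (inj₁ _) {suc _ , _} {zero , _} n ()
    into (inj₁ _) {suc _ , _} {suc _ , _} n refl = n refl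
    into (inj₂ _) n refl = n refl
    ext : ∀ {x : Fin m} {y : Fin r} → x ≡ inject≤ y r≤m → (lt : toℕ x < r) → fromℕ< lt ≡ y
    ext {y = y} refl lt = toℕ-injective (trans (toℕ-fromℕ< lt) (toℕ-inject≤ y r≤m))
    onto : ∀ {x y} → apartT x y → Σ J λ j → Σ (Y j) λ u → Σ (Y j) λ v → R j u v × φ j u ≡ x × φ j v ≡ y
    onto {inj₁ (i , x) , a} {inj₁ (j , y) , b} n with solve {suc i} {suc j} (λ { refl → n refl }) x y
    ... | q , refl , refl with toℕ (val q zero) <? r
    ... | yes lt = inj₁ (q , lt) , (suc i , a) , (suc j , b) , (λ { refl → n refl }) , refl , refl
    ... | no ge = inj₂ (q , ≮⇒≥ ge) , (i , a) , (j , b) , (λ { refl → n refl }) , refl , refl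
    onto {inj₁ (i , x) , a} {inj₂ y , b} n with solve {suc i} {zero} (λ ()) x (inject≤ y r≤m)
    ... | q , refl , e = inj₁ (q , lt) , (suc i , a) , (zero , b) , (λ ()) , refl , cong (λ z → inj₂ z , b) (ext e lt)
      where lt = subst (λ z → toℕ z < r) (sym e) (subst (_< r) (sym (toℕ-inject≤ y r≤m)) (toℕ<n y))
    onto {inj₂ y , b} {inj₁ (i , x) , a} n with solve {suc i} {zero} (λ ()) x (inject≤ y r≤m)
    ... | q , refl , e = inj₁ (q , lt) , (zero , b) , (suc i , a) , (λ ()) , cong (λ z → inj₂ z , b) (ext e lt) , refl
      where lt = subst (λ z → toℕ z < r) (sym e) (subst (_< r) (sym (toℕ-inject≤ y r≤m)) (toℕ<n y))
    onto {inj₂ _ , _} {inj₂ _ , _} n = ⊥-elim (n refl)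
    row : J → Row
    row (inj₁ (q , _)) = q
    row (inj₂ (q , _)) = q
    J-ext : ∀ {j j′} → row j ≡ row j′ → j ≡ j′
    J-ext {inj₁ (_ , p)} {inj₁ (_ , p′)} refl = cong (λ z → inj₁ (_ , z)) (<-irrelevant p p′)
    J-ext {inj₁ (_ , p)} {inj₂ (_ , p′)} refl = ⊥-elim (<⇒≱ p p′)
    J-ext {inj₂ (_ , p)} {inj₁ (_ , p′)} refl = ⊥-elim (<⇒≱ p′ p)
    J-ext {inj₂ (_ , p)} {inj₂ (_ , p′)} refl = cong (λ z → inj₂ (_ , z)) (≤-irrelevant p p′)
    col : (j : J) → Y j → Fin (suc s)
    col (inj₁ _) (i , _) = i
    col (inj₂ _) (i , _) = suc i
    col-≢ : ∀ j {u v} → R j u v → col j u ≢ col j v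
    col-≢ (inj₁ _) n = n
    col-≢ (inj₂ _) n e = n (suc-injective e)
    split : ∀ {i j : Fin s} {x y : Fin m} → _≡_ {A = Trunc s m r} (inj₁ (i , x)) (inj₁ (j , y)) → i ≡ j × x ≡ y
    split refl = refl , refl
    same : ∀ j j′ {u u′} → φ j u ≡ φ j′ u′ →
      Σ (col j u ≡ col j′ u′) λ _ → val (row j) (col j u) ≡ val (row j′) (col j u)
    same (inj₁ (q , p)) (inj₁ (q′ , p′)) {zero , _} {zero , _} e = refl , toℕ-injective
      (trans (sym (toℕ-fromℕ< p)) (trans (cong (λ { (inj₂ z , _) → toℕ z ; (inj₁ _ , _) → 0 }) e) (toℕ-fromℕ< p′)))
    same (inj₁ (q , p)) (inj₁ (q′ , p′)) {suc i , _} {suc j , _} e with split (cong proj₁ e)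
    ... | refl , f = refl , f
    same (inj₁ (q , p)) (inj₂ (q′ , p′)) {suc i , _} {j , _} e with split (cong proj₁ e)
    ... | refl , f = refl , f
    same (inj₂ (q , p)) (inj₁ (q′ , p′)) {i , _} {suc j , _} e with split (cong proj₁ e)
    ... | refl , f = refl , f
    same (inj₂ (q , p)) (inj₂ (q′ , p′)) {i , _} {j , _} e with split (cong proj₁ e)
    ... | refl , f = refl , f
    one : ∀ {j j′ u v u′ v′} → R j u v → R j′ u′ v′ → φ j u ≡ φ j′ u′ → φ j v ≡ φ j′ v′ → j ≡ j′
    one {j} {j′} n n′ e f = J-ext (unique (col-≢ j n) (proj₂ (same j j′ e)) (proj₂ (same j j′ f)))

  -- `T` covers the pairs from different columns. What remains lies within single columns, of m
  -- points or of r points for the truncated one.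
  truncate-GDD : ∀ {k s m r A} → Decomp k (Trunc s m r × A) apartT → GDD k (Fin m) A → GDD k (Fin r) A →
    GDD k (Trunc s m r) A
  truncate-GDD {k} {s} {m} {r} {A} T G₀ G₁ = glue J Y R φ D′ (λ p → p refl) inj into onto one
    where
    J = ⊤ ⊎ (Fin s ⊎ ⊤)
    Y : J → Set
    Y (inj₁ _) = Trunc s m r × A
    Y (inj₂ (inj₁ _)) = Fin m × A
    Y (inj₂ (inj₂ _)) = Fin r × A
    R : ∀ j → Y j → Y j → Set
    R (inj₁ _) = apartT
    R (inj₂ (inj₁ _)) = apart
    R (inj₂ (inj₂ _)) = apart
    φ : ∀ j → Y j → Trunc s m r × A
    φ (inj₁ _) x = x
    φ (inj₂ (inj₁ i)) (x , a) = inj₁ (i , x) , a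
    φ (inj₂ (inj₂ i)) (x , a) = inj₂ x , a
    D′ : ∀ j → Decomp k (Y j) (R j)
    D′ (inj₁ _) = T
    D′ (inj₂ (inj₁ _)) = G₀
    D′ (inj₂ (inj₂ _)) = G₁
    inj : ∀ j {u v} → φ j u ≡ φ j v → u ≡ v
    inj (inj₁ _) e = e
    inj (inj₂ (inj₁ _)) refl = refl
    inj (inj₂ (inj₂ _)) refl = refl
    into : ∀ j {u v} → R j u v → apart (φ j u) (φ j v)
    into (inj₁ _) n e = n (cong part e)
    into (inj₂ (inj₁ _)) n refl = n refl
    into (inj₂ (inj₂ _)) n refl = n refl
    onto : ∀ {x y} → apart x y → Σ J λ j → Σ (Y j) λ u → Σ (Y j) λ v → R j u v × φ j u ≡ x × φ j v ≡ y
    onto {inj₁ (i , x) , a} {inj₁ (j , y) , b} n with i ≟ j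
    ... | yes refl = inj₂ (inj₁ i) , (x , a) , (y , b) , (λ { refl → n refl }) , refl , refl
    ... | no i≢j = inj₁ tt , _ , _ , (λ { refl → i≢j refl }) , refl , refl
    onto {inj₁ _ , a} {inj₂ _ , b} n = inj₁ tt , _ , _ , (λ ()) , refl , refl
    onto {inj₂ _ , a} {inj₁ _ , b} n = inj₁ tt , _ , _ , (λ ()) , refl , refl
    onto {inj₂ x , a} {inj₂ y , b} n = inj₂ (inj₂ tt) , (x , a) , (y , b) , (λ { refl → n refl }) , refl , refl
    one : ∀ {j j′ u v u′ v′} → R j u v → R j′ u′ v′ → φ j u ≡ φ j′ u′ → φ j v ≡ φ j′ v′ → j ≡ j′
    one {inj₁ _} {inj₁ _} _ _ _ _ = refl
    one {inj₁ _} {inj₂ (inj₁ _)} n _ refl refl = ⊥-elim (n refl)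
    one {inj₁ _} {inj₂ (inj₂ _)} n _ refl refl = ⊥-elim (n refl)
    one {inj₂ (inj₁ _)} {inj₁ _} _ n refl refl = ⊥-elim (n refl)
    one {inj₂ (inj₂ _)} {inj₁ _} _ n refl refl = ⊥-elim (n refl)
    one {inj₂ (inj₁ _)} {inj₂ (inj₁ _)} _ _ refl _ = refl
    one {inj₂ (inj₂ _)} {inj₂ (inj₂ _)} _ _ refl _ = refl

  -- The full columns are filled around the hole `F`, and only the truncated column with `F` carries
  -- a complete design. Thus a design on F + r A points is prolonged while m may be large.
  truncate-Design : ∀ {k s m r A F} → Decomp k (Trunc s m r × A) apartT → Holey k F (Fin m × A) →
    Design k (F ⊎ (Fin r × A)) → Design k (F ⊎ (Trunc s m r × A))
  truncate-Design {k} {s} {m} {r} {A} {F} T H D = glue J Y R φ D′ (λ p → p refl) inj into onto one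
    where
    J = ⊤ ⊎ (Fin s ⊎ ⊤)
    Y : J → Set
    Y (inj₁ _) = Trunc s m r × A
    Y (inj₂ (inj₁ _)) = F ⊎ (Fin m × A)
    Y (inj₂ (inj₂ _)) = F ⊎ (Fin r × A)
    R : ∀ j → Y j → Y j → Set
    R (inj₁ _) = apartT
    R (inj₂ (inj₁ _)) = hole
    R (inj₂ (inj₂ _)) = _≢_
    φ : ∀ j → Y j → F ⊎ (Trunc s m r × A)
    φ (inj₁ _) x = inj₂ x
    φ (inj₂ (inj₁ i)) (inj₁ x) = inj₁ x
    φ (inj₂ (inj₁ i)) (inj₂ (x , a)) = inj₂ (inj₁ (i , x) , a)
    φ (inj₂ (inj₂ i)) (inj₁ x) = inj₁ x
    φ (inj₂ (inj₂ i)) (inj₂ (x , a)) = inj₂ (inj₂ x , a)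
    D′ : ∀ j → Decomp k (Y j) (R j)
    D′ (inj₁ _) = T
    D′ (inj₂ (inj₁ _)) = H
    D′ (inj₂ (inj₂ _)) = D
    inj : ∀ j {u v} → φ j u ≡ φ j v → u ≡ v
    inj (inj₁ _) refl = refl
    inj (inj₂ (inj₁ _)) {inj₁ _} {inj₁ _} refl = refl
    inj (inj₂ (inj₁ _)) {inj₂ _} {inj₂ _} refl = refl
    inj (inj₂ (inj₂ _)) {inj₁ _} {inj₁ _} refl = refl
    inj (inj₂ (inj₂ _)) {inj₂ _} {inj₂ _} refl = refl
    into : ∀ j {u v} → R j u v → φ j u ≢ φ j v
    into (inj₁ _) n refl = n refl
    into (inj₂ (inj₁ i)) {u} {v} n e = hole⇒≢ n (inj (inj₂ (inj₁ i)) {u} {v} e)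
    into (inj₂ (inj₂ i)) {u} {v} n e = n (inj (inj₂ (inj₂ i)) {u} {v} e)
    onto : ∀ {x y} → x ≢ y → Σ J λ j → Σ (Y j) λ u → Σ (Y j) λ v → R j u v × φ j u ≡ x × φ j v ≡ y
    onto {inj₁ x} {inj₁ y} n = inj₂ (inj₂ tt) , inj₁ x , inj₁ y , (λ { refl → n refl }) , refl , refl
    onto {inj₁ x} {inj₂ (inj₁ (i , y) , b)} n = inj₂ (inj₁ i) , inj₁ x , inj₂ (y , b) , tt , refl , refl
    onto {inj₁ x} {inj₂ (inj₂ y , b)} n = inj₂ (inj₂ tt) , inj₁ x , inj₂ (y , b) , (λ ()) , refl , refl
    onto {inj₂ (inj₁ (i , y) , b)} {inj₁ x} n = inj₂ (inj₁ i) , inj₂ (y , b) , inj₁ x , tt , refl , refl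
    onto {inj₂ (inj₂ y , b)} {inj₁ x} n = inj₂ (inj₂ tt) , inj₂ (y , b) , inj₁ x , (λ ()) , refl , refl
    onto {inj₂ (inj₁ (i , x) , a)} {inj₂ (inj₁ (j , y) , b)} n with i ≟ j
    ... | yes refl = inj₂ (inj₁ i) , inj₂ (x , a) , inj₂ (y , b) , (λ { refl → n refl }) , refl , refl
    ... | no i≢j = inj₁ tt , _ , _ , (λ { refl → i≢j refl }) , refl , refl
    onto {inj₂ (inj₁ _ , a)} {inj₂ (inj₂ _ , b)} n = inj₁ tt , _ , _ , (λ ()) , refl , refl
    onto {inj₂ (inj₂ _ , a)} {inj₂ (inj₁ _ , b)} n = inj₁ tt , _ , _ , (λ ()) , refl , refl
    onto {inj₂ (inj₂ x , a)} {inj₂ (inj₂ y , b)} n =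
      inj₂ (inj₂ tt) , inj₂ (x , a) , inj₂ (y , b) , (λ { refl → n refl }) , refl , refl
    one : ∀ {j j′ u v u′ v′} → R j u v → R j′ u′ v′ → φ j u ≡ φ j′ u′ → φ j v ≡ φ j′ v′ → j ≡ j′
    one {inj₁ _} {inj₁ _} _ _ _ _ = refl
    one {inj₁ _} {inj₂ (inj₁ _)} {u′ = inj₂ _} {inj₂ _} n _ refl refl = ⊥-elim (n refl)
    one {inj₁ _} {inj₂ (inj₂ _)} {u′ = inj₂ _} {inj₂ _} n _ refl refl = ⊥-elim (n refl)
    one {inj₂ (inj₁ _)} {inj₁ _} {inj₂ _} {inj₂ _} _ n refl refl = ⊥-elim (n refl)
    one {inj₂ (inj₂ _)} {inj₁ _} {inj₂ _} {inj₂ _} _ n refl refl = ⊥-elim (n refl)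
    one {inj₂ (inj₁ _)} {inj₂ (inj₁ _)} {inj₂ _} {_} {inj₂ _} _ _ refl _ = refl
    one {inj₂ (inj₁ _)} {inj₂ (inj₁ _)} {inj₁ _} {inj₂ _} {inj₁ _} {inj₂ _} _ _ _ refl = refl
    one {inj₂ (inj₁ _)} {inj₂ (inj₂ _)} {inj₁ _} {inj₂ _} {inj₁ _} {inj₁ _} _ _ _ ()
    one {inj₂ (inj₁ _)} {inj₂ (inj₂ _)} {inj₁ _} {inj₂ _} {inj₁ _} {inj₂ _} _ _ _ ()
    one {inj₂ (inj₁ _)} {inj₂ (inj₂ _)} {inj₁ _} {_} {inj₂ _} {inj₁ _} _ _ () _
    one {inj₂ (inj₁ _)} {inj₂ (inj₂ _)} {inj₂ _} {_} {inj₂ _} {inj₁ _} _ _ () _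
    one {inj₂ (inj₂ _)} {inj₂ (inj₁ _)} {inj₁ _} {inj₁ _} {inj₂ _} {inj₁ _} _ _ () _
    one {inj₂ (inj₂ _)} {inj₂ (inj₁ _)} {inj₂ _} {inj₁ _} {inj₂ _} {inj₁ _} _ _ () _
    one {inj₂ (inj₂ _)} {inj₂ (inj₁ _)} {inj₁ _} {inj₁ _} {inj₁ _} {inj₂ _} _ _ _ ()
    one {inj₂ (inj₂ _)} {inj₂ (inj₁ _)} {inj₁ _} {inj₂ _} {inj₁ _} {inj₂ _} _ _ _ ()
    one {inj₂ (inj₂ _)} {inj₂ (inj₂ _)} _ _ _ _ = refl

-- Finite fields and groups with many endomorphisms of bijective difference

module Fields where
  open Designs
  open import Level using (0ℓ)
  open import Algebra.Bundles using (CommutativeRing)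
  open import Algebra.Structures using (IsCommutativeRing; IsAbelianGroup)
  open import Data.Nat as ℕ using (ℕ; zero; suc; _≤_; _<_; z≤n; s≤s; _^_; NonZero; _!)
  import Data.Nat.Properties as ℕ
  open import Data.Nat.DivMod using (_%_; _mod_; %-distribˡ-+; %-distribˡ-*; m<n⇒m%n≡m; m*n%n≡0; [m+kn]%n≡m%n)
  open import Data.Nat.Divisibility using (_∣_; ∣m+n∣m⇒∣n; ∣1⇒≡1; ∣-trans; m∣m*n; n∣m*n; ∣m⇒∣m*n)
  open import Data.Nat.Primality using (Prime; prime⇒nonZero; prime⇒nonTrivial; ¬prime[1])
  open import Data.Nat.Primality.Factorisation using (factorise; PrimeFactorisation)
  open import Data.Nat.Coprimality using (prime⇒coprime; coprime-Bézout)
  open import Data.Nat.GCD using (module Bézout)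
  open import Data.Nat.ListAction using (product)
  open import Data.List.Base using (List; []; _∷_)
  open import Data.List.Relation.Unary.All using (All; []; _∷_)
  open import Data.Fin using (Fin; zero; suc; toℕ; inject≤)
  open import Data.Fin.Properties using (_≟_; toℕ-injective; toℕ-fromℕ<; toℕ<n; any?; pigeonhole; *↔×; inject≤-injective; ¬∀⟶∃¬)
  open import Data.Product using (Σ; _×_; _,_; proj₁; proj₂)
  open import Data.Product.Properties using (≡-dec)
  open import Data.Product.Function.NonDependent.Propositional using (_×-↔_)
  open import Data.Sum using (inj₁; inj₂)
  open import Data.Unit using (⊤; tt)
  open import Data.Empty using (⊥; ⊥-elim)
  open import Relation.Nullary using (¬_; yes; no; Dec)
  import Relation.Nullary.Decidable as Dec
  open import Relation.Binary.PropositionalEquality using (_≡_; _≢_; refl; sym; trans; cong; cong₂; subst; isEquivalence; module ≡-Reasoning)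
  open import Relation.Binary.Definitions using (DecidableEquality)
  open import Function.Bundles using (_↔_; Inverse; mk↔ₛ′)
  open import Function.Properties.Inverse using (↔-refl; ↔-sym; ↔-trans)
  open RingSolver

  ≟-from : ∀ {m} {A : Set} → A ↔ Fin m → DecidableEquality A
  ≟-from i x y = Dec.map′ inj (cong to) (to x ≟ to y)
    where open Inverse i
          inj : to x ≡ to y → x ≡ y
          inj e = trans (sym (inverseʳ refl)) (trans (cong from e) (inverseʳ refl))

  mkRing : {A : Set} {_+_ _*_ : A → A → A} { -_ : A → A} {0# 1# : A} →
    (∀ a b c → (a + b) + c ≡ a + (b + c)) → (∀ a b → a + b ≡ b + a) → (∀ a → 0# + a ≡ a) → (∀ a → (- a) + a ≡ 0#) →
    (∀ a b c → (a * b) * c ≡ a * (b * c)) → (∀ a b → a * b ≡ b * a) → (∀ a → 1# * a ≡ a) →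
    (∀ a b c → (b + c) * a ≡ (b * a) + (c * a)) → IsCommutativeRing _≡_ _+_ _*_ -_ 0# 1#
  mkRing {_+_ = _+_} {_*_} { -_} +-assoc +-comm +-id +-inv *-assoc *-comm *-id distr = record
    { isRing = record
      { +-isAbelianGroup = record
        { isGroup = record
          { isMonoid = record
            { isSemigroup = record
              { isMagma = record { isEquivalence = isEquivalence ; ∙-cong = cong₂ _+_ }
              ; assoc = +-assoc }
            ; identity = +-id , (λ a → trans (+-comm a _) (+-id a)) }
          ; inverse = +-inv , (λ a → trans (+-comm a _) (+-inv a))
          ; ⁻¹-cong = cong -_ }
        ; comm = +-comm }
      ; *-cong = cong₂ _*_
      ; *-assoc = *-assoc
      ; *-identity = *-id , (λ a → trans (*-comm a _) (*-id a))
      ; distrib = (λ a b c → trans (*-comm a _) (trans (distr a b c) (cong₂ _+_ (*-comm b a) (*-comm c a)))) , distr }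
    ; *-comm = *-comm }

  record Field (m : ℕ) : Set₁ where
    infixl 6 _+_
    infixl 7 _*_
    field
      Carrier : Set
      _+_ _*_ : Carrier → Carrier → Carrier
      -_ : Carrier → Carrier
      0# 1# : Carrier
      isCommutativeRing : IsCommutativeRing _≡_ _+_ _*_ -_ 0# 1#
      size : Carrier ↔ Fin m
      inv : Carrier → Carrier
      inv-ok : ∀ {x} → x ≢ 0# → x * inv x ≡ 1#
      1≢0 : 1# ≢ 0#
    commutativeRing : CommutativeRing 0ℓ 0ℓ
    commutativeRing = record { isCommutativeRing = isCommutativeRing }
    open IsCommutativeRing isCommutativeRing public hiding (refl; sym; trans; reflexive; zero)
    _≟F_ : DecidableEquality Carrier
    _≟F_ = ≟-from size
    open IntegerSolver commutativeRing public using (solve; _:=_; _:+_; _:*_; _:-_; :-_; con)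

    *-nonzero : ∀ {x y} → x ≢ 0# → y ≢ 0# → x * y ≢ 0#
    *-nonzero {x} {y} n n′ e = n (trans (sym (trans (cong (x *_) (inv-ok n′)) (*-identityʳ x)))
      (trans (sym (*-assoc x y _)) (trans (cong (_* inv y) e) (zeroˡ _))))
    *-cancelˡ : ∀ {x y z} → x ≢ 0# → x * y ≡ x * z → y ≡ z
    *-cancelˡ {x} {y} {z} n e = trans (lem y) (trans (cong (inv x *_) e) (sym (lem z)))
      where lem : ∀ y → y ≡ inv x * (x * y)
            lem y = trans (sym (*-identityˡ y)) (trans (cong (_* y) (sym (inv-ok n)))
              (solve 3 (λ a b c → (a :* b) :* c := b :* (a :* c)) refl x (inv x) y))
    +-cancelʳ : ∀ {x y} z → x + z ≡ y + z → x ≡ y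
    +-cancelʳ {x} {y} z e = trans (lem x) (trans (cong (_+ - z) e) (sym (lem y)))
      where lem : ∀ x → x ≡ (x + z) + - z
            lem x = solve 2 (λ x z → x := (x :+ z) :+ (:- z)) refl x z
    sub≡0 : ∀ {x y} → x + - y ≡ 0# → x ≡ y
    sub≡0 {x} {y} e = trans (solve 2 (λ x y → x := (x :+ (:- y)) :+ y) refl x y)
      (trans (cong (_+ y) e) (+-identityˡ y))

  module _ (p : ℕ) .{{_ : NonZero p}} where
    private
      [_] : ℕ → Fin p
      [ n ] = n mod p
      toℕ-[] : ∀ n → toℕ [ n ] ≡ n % p
      toℕ-[] n = toℕ-fromℕ< _
      []-cong : ∀ {m n} → m % p ≡ n % p → [ m ] ≡ [ n ]
      []-cong {m} {n} e = toℕ-injective (trans (toℕ-[] m) (trans e (sym (toℕ-[] n))))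
      []-toℕ : ∀ a → [ toℕ a ] ≡ a
      []-toℕ a = toℕ-injective (trans (toℕ-[] _) (m<n⇒m%n≡m (toℕ<n a)))
      _⊕_ _⊗_ : Fin p → Fin p → Fin p
      a ⊕ b = [ toℕ a ℕ.+ toℕ b ]
      a ⊗ b = [ toℕ a ℕ.* toℕ b ]
      ⊖_ : Fin p → Fin p
      ⊖ a = [ (p ℕ.∸ 1) ℕ.* toℕ a ]
      ⊕-[] : ∀ m n → [ m ] ⊕ [ n ] ≡ [ m ℕ.+ n ]
      ⊕-[] m n = []-cong (trans (cong₂ (λ a b → (a ℕ.+ b) % p) (toℕ-[] m) (toℕ-[] n)) (sym (%-distribˡ-+ m n p)))
      ⊗-[] : ∀ m n → [ m ] ⊗ [ n ] ≡ [ m ℕ.* n ]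
      ⊗-[] m n = []-cong (trans (cong₂ (λ a b → (a ℕ.* b) % p) (toℕ-[] m) (toℕ-[] n)) (sym (%-distribˡ-* m n p)))
      lift₂ : ∀ {m n a b} → a ≡ [ m ] → b ≡ [ n ] → a ⊕ b ≡ [ m ℕ.+ n ]
      lift₂ refl refl = ⊕-[] _ _
      lift* : ∀ {m n a b} → a ≡ [ m ] → b ≡ [ n ] → a ⊗ b ≡ [ m ℕ.* n ]
      lift* refl refl = ⊗-[] _ _
      η : ∀ a → a ≡ [ toℕ a ]
      η a = sym ([]-toℕ a)
      ⊕-assoc : ∀ a b c → (a ⊕ b) ⊕ c ≡ a ⊕ (b ⊕ c)
      ⊕-assoc a b c = trans (lift₂ refl (η c)) (trans (cong [_] (ℕ.+-assoc (toℕ a) _ _)) (sym (lift₂ (η a) refl)))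
      ⊗-assoc : ∀ a b c → (a ⊗ b) ⊗ c ≡ a ⊗ (b ⊗ c)
      ⊗-assoc a b c = trans (lift* refl (η c)) (trans (cong [_] (ℕ.*-assoc (toℕ a) _ _)) (sym (lift* (η a) refl)))
      ⊕-comm : ∀ a b → a ⊕ b ≡ b ⊕ a
      ⊕-comm a b = cong [_] (ℕ.+-comm (toℕ a) _)
      ⊗-comm : ∀ a b → a ⊗ b ≡ b ⊗ a
      ⊗-comm a b = cong [_] (ℕ.*-comm (toℕ a) _)
      ⊕-idˡ : ∀ a → [ 0 ] ⊕ a ≡ a
      ⊕-idˡ a = trans (lift₂ refl (η a)) ([]-toℕ a)
      ⊗-idˡ : ∀ a → [ 1 ] ⊗ a ≡ a
      ⊗-idˡ a = trans (lift* refl (η a)) (trans (cong [_] (ℕ.*-identityˡ (toℕ a))) ([]-toℕ a))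
      ⊗-distˡ : ∀ a b c → (b ⊕ c) ⊗ a ≡ (b ⊗ a) ⊕ (c ⊗ a)
      ⊗-distˡ a b c = trans (lift* refl (η a)) (trans (cong [_] (ℕ.*-distribʳ-+ (toℕ a) (toℕ b) _)) (sym (⊕-[] _ _)))
      suc-pred-p : suc (p ℕ.∸ 1) ≡ p
      suc-pred-p = ℕ.suc-pred p
      ⊖-invˡ : ∀ a → (⊖ a) ⊕ a ≡ [ 0 ]
      ⊖-invˡ a = trans (lift₂ refl (η a)) ([]-cong (trans (cong (_% p)
        (trans (ℕ.+-comm _ (toℕ a)) (trans (cong (ℕ._* toℕ a) suc-pred-p) (ℕ.*-comm p (toℕ a)))))
        (trans (m*n%n≡0 (toℕ a) p) (sym (m*n%n≡0 0 p)))))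
      ring : IsCommutativeRing _≡_ _⊕_ _⊗_ ⊖_ [ 0 ] [ 1 ]
      ring = mkRing ⊕-assoc ⊕-comm ⊕-idˡ ⊖-invˡ ⊗-assoc ⊗-comm ⊗-idˡ ⊗-distˡ

      module _ (pr : Prime p) where
        finv : ∀ a → a ≢ [ 0 ] → Σ (Fin p) λ b → a ⊗ b ≡ [ 1 ]
        finv a a≢0 = go (coprime-Bézout (prime⇒coprime pr {{ℕ.≢-nonZero nz}} (toℕ<n a)))
          where
          n = toℕ a
          nz : n ≢ 0
          nz e = a≢0 (trans (η a) (cong [_] e))
          go : Bézout.Identity 1 p n → Σ (Fin p) λ b → a ⊗ b ≡ [ 1 ]
          -- Here 1 + y n is a multiple of p, so the inverse is - y.
          go (Bézout.+- x y eq) = ⊖ [ y ] , lem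
            where
            ay : [ y ] ⊗ a ≡ [ y ℕ.* n ]
            ay = lift* refl (η a)
            s0 : [ 1 ] ⊕ ([ y ] ⊗ a) ≡ [ 0 ]
            s0 = trans (lift₂ refl ay) ([]-cong (trans (cong (_% p) eq) (trans (m*n%n≡0 x p) (sym (m*n%n≡0 0 p)))))
            lem : a ⊗ (⊖ [ y ]) ≡ [ 1 ]
            lem = begin
              a ⊗ (⊖ [ y ])                                   ≡⟨ sym (⊕-idˡ _) ⟩
              [ 0 ] ⊕ (a ⊗ (⊖ [ y ]))                         ≡⟨ cong (_⊕ (a ⊗ (⊖ [ y ]))) (sym s0) ⟩
              ([ 1 ] ⊕ ([ y ] ⊗ a)) ⊕ (a ⊗ (⊖ [ y ]))         ≡⟨ ⊕-assoc _ _ _ ⟩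
              [ 1 ] ⊕ (([ y ] ⊗ a) ⊕ (a ⊗ (⊖ [ y ])))         ≡⟨ cong (λ z → [ 1 ] ⊕ (([ y ] ⊗ a) ⊕ z)) (⊗-comm a _) ⟩
              [ 1 ] ⊕ (([ y ] ⊗ a) ⊕ ((⊖ [ y ]) ⊗ a))         ≡⟨ cong ([ 1 ] ⊕_) (sym (⊗-distˡ a [ y ] (⊖ [ y ]))) ⟩
              [ 1 ] ⊕ (([ y ] ⊕ (⊖ [ y ])) ⊗ a)               ≡⟨ cong (λ z → [ 1 ] ⊕ (z ⊗ a)) (trans (⊕-comm [ y ] (⊖ [ y ])) (⊖-invˡ [ y ])) ⟩
              [ 1 ] ⊕ ([ 0 ] ⊗ a)                             ≡⟨ cong ([ 1 ] ⊕_) (lift* refl (η a)) ⟩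
              [ 1 ] ⊕ [ 0 ]                                   ≡⟨ trans (⊕-comm [ 1 ] [ 0 ]) (⊕-idˡ [ 1 ]) ⟩
              [ 1 ]                                           ∎
              where open ≡-Reasoning
          go (Bézout.-+ x y eq) = [ y ] , trans (lift* (η a) refl) ([]-cong (trans (cong (_% p)
            (trans (ℕ.*-comm n y) (sym eq))) ([m+kn]%n≡m%n 1 x p)))
        finv′ : Fin p → Fin p
        finv′ a with a ≟ [ 0 ]
        ... | yes _ = a
        ... | no n = proj₁ (finv a n)
        finv′-ok : ∀ {a} → a ≢ [ 0 ] → a ⊗ finv′ a ≡ [ 1 ]
        finv′-ok {a} n with a ≟ [ 0 ]
        ... | yes e = ⊥-elim (n e)
        ... | no n′ = proj₂ (finv a n′)

    ℤ/_ : Prime p → Field p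
    ℤ/ pr = record
      { Carrier = Fin p ; _+_ = _⊕_ ; _*_ = _⊗_ ; -_ = ⊖_ ; 0# = [ 0 ] ; 1# = [ 1 ]
      ; isCommutativeRing = ring ; size = ↔-refl ; inv = finv′ pr ; inv-ok = finv′-ok pr
      ; 1≢0 = λ e → ℕ.1+n≢0 (trans (sym (m<n⇒m%n≡m (ℕ.nonTrivial⇒n>1 p {{prime⇒nonTrivial pr}})))
          (trans (sym (toℕ-[] 1)) (trans (cong toℕ e) (trans (toℕ-[] 0) (m*n%n≡0 0 p))))) }

    mod-* : (pr : Prime p) → ∀ m n → Field._*_ (ℤ/ pr) (m mod p) (n mod p) ≡ (m ℕ.* n) mod p
    mod-* pr = ⊗-[]
    mod-+ : (pr : Prime p) → ∀ m n → Field._+_ (ℤ/ pr) (m mod p) (n mod p) ≡ (m ℕ.+ n) mod p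
    mod-+ pr = ⊕-[]

  -- Repeated doubling of the degree reaches the orders p^(2^i), which explains the exponents 2^t
  -- further on. The form t² + t instead of t² includes characteristic 2, because 0 and -1 differ in
  -- every field.
  module Quadratic {m : ℕ} (K : Field m) where
    open Field K

    -- x ↦ x² + x takes the same value at 0 and −1, so it misses some c, and then t² + t − c is irreducible.
    private
      sq : Carrier → Carrier
      sq x = x * x + x
      open Inverse size using (to; from; inverseˡ; inverseʳ)
      to-inj : ∀ {x y} → to x ≡ to y → x ≡ y
      to-inj e = trans (sym (inverseʳ refl)) (trans (cong from e) (inverseʳ refl))
      Hit : Fin m → Set
      Hit c = Σ (Fin m) λ x → to (sq (from x)) ≡ c
      not-all : ¬ (∀ c → Hit c)
      not-all h = dup (pigeonhole (ℕ.n<1+n m) f)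
        where
        s : Fin m → Carrier
        s c = from (proj₁ (h c))
        sqs : ∀ c → to (sq (s c)) ≡ c
        sqs c = proj₂ (h c)
        sq0 : sq 0# ≡ 0#
        sq0 = solve 0 (con (ℤ.+ 0) :* con (ℤ.+ 0) :+ con (ℤ.+ 0) := con (ℤ.+ 0)) refl
          where import Data.Integer as ℤ
        sq-1 : sq (- 1#) ≡ 0#
        sq-1 = trans (cong (_+ - 1#) (solve 1 (λ x → (:- x) :* (:- x) := x :* x) refl 1#))
          (trans (cong (_+ - 1#) (*-identityˡ 1#)) (-‿inverseʳ 1#))
        0≢-1 : 0# ≢ - 1#
        0≢-1 e = 1≢0 (trans (sym (+-identityʳ 1#)) (trans (cong (1# +_) e) (-‿inverseʳ 1#)))
        -- A section `s` of `sq` picks only one preimage of 0. The other one among 0 and -1, put in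
        -- front of the values of `s`, would embed m + 1 elements into m.
        missed : Σ Carrier λ z → ∀ c → s c ≢ z
        missed with s (to 0#) ≟F 0#
        ... | yes e = - 1# , λ c e′ → 0≢-1 (trans (sym e) (trans (cong s (trans (cong to (sym sq-1))
                (trans (cong (λ z → to (sq z)) (sym e′)) (sqs c)))) e′))
        ... | no n = 0# , λ c e′ → n (trans (cong s (trans (cong to (sym sq0))
                (trans (cong (λ z → to (sq z)) (sym e′)) (sqs c)))) e′)
        f : Fin (suc m) → Fin m
        f zero = to (proj₁ missed)
        f (suc c) = to (s c)
        dup : (Σ (Fin (suc m)) λ i → Σ (Fin (suc m)) λ j → (toℕ i < toℕ j) × (f i ≡ f j)) → ⊥
        dup (zero , suc c , _ , e) = proj₂ missed c (sym (to-inj e))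
        dup (suc b , suc c , s≤s b<c , e) = ℕ.<-irrefl (cong toℕ (trans (sym (sqs b)) (trans (cong (λ z → to (sq z)) (to-inj e)) (sqs c)))) b<c
      miss : Σ Carrier λ c → ∀ x → sq x ≢ c
      miss with ¬∀⟶∃¬ m Hit (λ c → any? (λ x → to (sq (from x)) ≟ c)) not-all
      ... | c , n = from c , λ x e → n (to x , trans (cong (λ z → to (sq z)) (inverseʳ refl))
              (trans (cong to e) (inverseˡ refl)))
      c = proj₁ miss
      P = Carrier × Carrier
      infixl 6 _⊕_
      infixl 7 _⊗_
      -- A pair (a , b) stands for a + b t with t² = c - t. The conjugate of t is -1 - t, which
      -- gives `norm` and `cj`.
      _⊕_ _⊗_ : P → P → P
      (a , b) ⊕ (a′ , b′) = a + a′ , b + b′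
      (a , b) ⊗ (a′ , b′) = a * a′ + c * (b * b′) , (a * b′ + b * a′) + - (b * b′)
      norm : P → Carrier
      norm (a , b) = (a * a + - (a * b)) + - (c * (b * b))
      norm≢0 : ∀ x → x ≢ (0# , 0#) → norm x ≢ 0#
      norm≢0 (a , b) n e with b ≟F 0#
      ... | yes refl = *-nonzero a≢0 a≢0 (trans (solve 2 (λ a c → a :* a :=
              (a :* a :+ (:- (a :* con (+ 0)))) :+ (:- (c :* (con (+ 0) :* con (+ 0))))) refl a c) e)
        where open import Data.Integer using (+_)
              a≢0 : a ≢ 0#
              a≢0 refl = n refl
      -- A zero of the norm with b nonzero makes - a / b a solution of x² + x = c.
      ... | no b≢0 = proj₂ miss (- (a * inv b)) (*-cancelˡ (*-nonzero b≢0 b≢0) (trans lem₁ (trans lem₂ (sym lem₃))))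
        where
        y = b * inv b
        lem₁ : b * b * sq (- (a * inv b)) ≡ (a * y) * (a * y) + - (a * b * y)
        lem₁ = solve 3 (λ a b i → b :* b :* ((:- (a :* i)) :* (:- (a :* i)) :+ (:- (a :* i))) :=
          (a :* (b :* i)) :* (a :* (b :* i)) :+ (:- (a :* b :* (b :* i)))) refl a b (inv b)
        lem₂ : (a * y) * (a * y) + - (a * b * y) ≡ a * a + - (a * b)
        lem₂ = trans (cong (λ z → (a * z) * (a * z) + - (a * b * z)) (inv-ok b≢0))
          (cong₂ (λ p q → p * p + - q) (*-identityʳ a) (*-identityʳ (a * b)))
        lem₃ : b * b * c ≡ a * a + - (a * b)
        lem₃ = sym (sub≡0 (trans (solve 3 (λ x y c → x :+ (:- (y :* c)) := x :+ (:- (c :* y))) refl (a * a + - (a * b)) (b * b) c) e))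
      cj : P → P
      cj (a , b) = a + - b , - b

    quadratic : Field (m ℕ.* m)
    quadratic = record
      { Carrier = P ; _+_ = _⊕_ ; _*_ = _⊗_ ; -_ = λ { (a , b) → - a , - b } ; 0# = 0# , 0# ; 1# = 1# , 0#
      ; isCommutativeRing = mkRing
          (λ { (a , b) (a′ , b′) (a″ , b″) → cong₂ _,_ (+-assoc _ _ _) (+-assoc _ _ _) })
          (λ { (a , b) (a′ , b′) → cong₂ _,_ (+-comm _ _) (+-comm _ _) })
          (λ { (a , b) → cong₂ _,_ (+-identityˡ _) (+-identityˡ _) })
          (λ { (a , b) → cong₂ _,_ (-‿inverseˡ _) (-‿inverseˡ _) })
          (λ { (a , b) (a′ , b′) (a″ , b″) → cong₂ _,_
            (solve 7 (λ c a b a′ b′ a″ b″ →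
              (a :* a′ :+ c :* (b :* b′)) :* a″ :+ c :* ((a :* b′ :+ b :* a′ :+ (:- (b :* b′))) :* b″) :=
              a :* (a′ :* a″ :+ c :* (b′ :* b″)) :+ c :* (b :* (a′ :* b″ :+ b′ :* a″ :+ (:- (b′ :* b″))))) refl c a b a′ b′ a″ b″)
            (solve 7 (λ c a b a′ b′ a″ b″ →
              (a :* a′ :+ c :* (b :* b′)) :* b″ :+ (a :* b′ :+ b :* a′ :+ (:- (b :* b′))) :* a″
                :+ (:- ((a :* b′ :+ b :* a′ :+ (:- (b :* b′))) :* b″)) :=
              a :* (a′ :* b″ :+ b′ :* a″ :+ (:- (b′ :* b″))) :+ b :* (a′ :* a″ :+ c :* (b′ :* b″))
                :+ (:- (b :* (a′ :* b″ :+ b′ :* a″ :+ (:- (b′ :* b″)))))) refl c a b a′ b′ a″ b″) })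
          (λ { (a , b) (a′ , b′) → cong₂ _,_
            (solve 5 (λ c a b a′ b′ → a :* a′ :+ c :* (b :* b′) := a′ :* a :+ c :* (b′ :* b)) refl c a b a′ b′)
            (solve 4 (λ a b a′ b′ → a :* b′ :+ b :* a′ :+ (:- (b :* b′)) := a′ :* b :+ b′ :* a :+ (:- (b′ :* b))) refl a b a′ b′) })
          (λ { (a , b) → cong₂ _,_
            (trans (solve 4 (λ u c a b → u :* a :+ c :* (con (+ 0) :* b) := u :* a) refl 1# c a b) (*-identityˡ a))
            (trans (solve 3 (λ u a b → u :* b :+ con (+ 0) :* a :+ (:- (con (+ 0) :* b)) := u :* b) refl 1# a b) (*-identityˡ b)) })
          (λ { (a , b) (a′ , b′) (a″ , b″) → cong₂ _,_
            (solve 7 (λ c a b a′ b′ a″ b″ → (a′ :+ a″) :* a :+ c :* ((b′ :+ b″) :* b) :=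
              (a′ :* a :+ c :* (b′ :* b)) :+ (a″ :* a :+ c :* (b″ :* b))) refl c a b a′ b′ a″ b″)
            (solve 6 (λ a b a′ b′ a″ b″ → (a′ :+ a″) :* b :+ (b′ :+ b″) :* a :+ (:- ((b′ :+ b″) :* b)) :=
              (a′ :* b :+ b′ :* a :+ (:- (b′ :* b))) :+ (a″ :* b :+ b″ :* a :+ (:- (b″ :* b)))) refl a b a′ b′ a″ b″) })
      ; size = ↔-trans (size ×-↔ size) (↔-sym *↔×)
      ; inv = λ x → let i = inv (norm x) in i * proj₁ (cj x) , i * proj₂ (cj x)
      ; inv-ok = λ { {a , b} n → let i = inv (norm (a , b)) in cong₂ _,_
          (trans (solve 4 (λ c a b i → a :* (i :* (a :+ (:- b))) :+ c :* (b :* (i :* (:- b))) :=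
            ((a :* a :+ (:- (a :* b))) :+ (:- (c :* (b :* b)))) :* i) refl c a b i) (inv-ok (norm≢0 (a , b) n)))
          (solve 3 (λ a b i → a :* (i :* (:- b)) :+ b :* (i :* (a :+ (:- b))) :+ (:- (b :* (i :* (:- b)))) := con (+ 0)) refl a b i) }
      ; 1≢0 = λ e → 1≢0 (cong proj₁ e) }
      where open import Data.Integer using (+_)

  -- An abelian group of order m with t endomorphisms whose differences are all bijective.
  record Rich (t m : ℕ) : Set₁ where
    infixl 6 _+_
    field
      A : Set
      size : A ↔ Fin m
      _+_ : A → A → A
      0# : A
      -_ : A → A
      isAbelianGroup : IsAbelianGroup _≡_ _+_ 0# -_
      μ : Fin t → A → A
      μ-+ : ∀ i x y → μ i (x + y) ≡ μ i x + μ i y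
      divide : ∀ {i j} → i ≢ j → ∀ x → Σ A λ y → μ i y ≡ x + μ j y
      cancel : ∀ {i j x y y′} → i ≢ j → μ i y ≡ x + μ j y → μ i y′ ≡ x + μ j y′ → y ≡ y′

  Field⇒Rich : ∀ {t m} → t ≤ m → Field m → Rich t m
  Field⇒Rich {t} t≤m K = record
    { A = Carrier ; size = size ; _+_ = _+_ ; 0# = 0# ; -_ = -_ ; isAbelianGroup = +-isAbelianGroup
    ; μ = λ i x → e i * x
    ; μ-+ = λ i → distribˡ (e i)
    ; divide = λ {i} {j} i≢j x → inv (e i + - e j) * x , div i≢j x
    ; cancel = λ i≢j p q → *-cancelˡ (diff i≢j) (trans (lem p) (sym (lem q))) }
    where
    open Field K
    open Inverse size using (from; to; inverseˡ)
    e : Fin t → Carrier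
    e i = from (inject≤ i t≤m)
    diff : ∀ {i j} → i ≢ j → e i + - e j ≢ 0#
    diff i≢j d = i≢j (inject≤-injective t≤m t≤m _ _ (trans (sym (inverseˡ refl)) (trans (cong to (sub≡0 d)) (inverseˡ refl))))
    div : ∀ {i j} → i ≢ j → ∀ x → e i * (inv (e i + - e j) * x) ≡ x + e j * (inv (e i + - e j) * x)
    div {i} {j} i≢j x = trans (solve 4 (λ a b u x → a :* (u :* x) := ((a :+ (:- b)) :* u) :* x :+ b :* (u :* x)) refl (e i) (e j) u x)
      (cong (_+ e j * (u * x)) (trans (cong (_* x) (inv-ok (diff i≢j))) (*-identityˡ x)))
      where u = inv (e i + - e j)
    lem : ∀ {i j x y} → e i * y ≡ x + e j * y → (e i + - e j) * y ≡ x
    lem {i} {j} {x} {y} p = trans (solve 3 (λ a b y → (a :+ (:- b)) :* y := a :* y :+ (:- (b :* y))) refl (e i) (e j) y)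
      (trans (cong (_+ - (e j * y)) p) (solve 2 (λ x z → x :+ z :+ (:- z) := x) refl x (e j * y)))

  Rich-one : ∀ {t} → Rich t 1
  Rich-one = record
    { A = ⊤ ; size = mk↔ₛ′ (λ _ → zero) (λ _ → tt) (λ { zero → refl }) (λ _ → refl)
    ; _+_ = λ _ _ → tt ; 0# = tt ; -_ = λ _ → tt
    ; isAbelianGroup = record { isGroup = record { isMonoid = record { isSemigroup = record
        { isMagma = record { isEquivalence = isEquivalence ; ∙-cong = λ _ _ → refl } ; assoc = λ _ _ _ → refl }
        ; identity = (λ _ → refl) , (λ _ → refl) } ; inverse = (λ _ → refl) , (λ _ → refl) ; ⁻¹-cong = λ _ → refl }
        ; comm = λ _ _ → refl }
    ; μ = λ _ _ → tt ; μ-+ = λ _ _ _ → refl ; divide = λ _ _ → tt , refl ; cancel = λ _ _ _ → refl }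

  Rich-* : ∀ {t m n} → Rich t m → Rich t n → Rich t (m ℕ.* n)
  Rich-* R S = record
    { A = R.A × S.A ; size = ↔-trans (R.size ×-↔ S.size) (↔-sym *↔×)
    ; _+_ = λ { (a , b) (a′ , b′) → a R.+ a′ , b S.+ b′ } ; 0# = R.0# , S.0# ; -_ = λ { (a , b) → R.- a , S.- b }
    ; isAbelianGroup = record { isGroup = record { isMonoid = record { isSemigroup = record
        { isMagma = record { isEquivalence = isEquivalence ; ∙-cong = λ { refl refl → refl } }
        ; assoc = λ _ _ _ → cong₂ _,_ (RG.assoc _ _ _) (SG.assoc _ _ _) }
        ; identity = (λ _ → cong₂ _,_ (RG.identityˡ _) (SG.identityˡ _)) , (λ _ → cong₂ _,_ (RG.identityʳ _) (SG.identityʳ _)) }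
        ; inverse = (λ _ → cong₂ _,_ (RG.inverseˡ _) (SG.inverseˡ _)) , (λ _ → cong₂ _,_ (RG.inverseʳ _) (SG.inverseʳ _))
        ; ⁻¹-cong = λ { refl → refl } }
        ; comm = λ _ _ → cong₂ _,_ (RG.comm _ _) (SG.comm _ _) }
    ; μ = λ { i (a , b) → R.μ i a , S.μ i b } ; μ-+ = λ i _ _ → cong₂ _,_ (R.μ-+ i _ _) (S.μ-+ i _ _)
    ; divide = λ { n (x , y) → (proj₁ (R.divide n x) , proj₁ (S.divide n y)) , cong₂ _,_ (proj₂ (R.divide n x)) (proj₂ (S.divide n y)) }
    ; cancel = λ n p q → cong₂ _,_ (R.cancel n (cong proj₁ p) (cong proj₁ q)) (S.cancel n (cong proj₂ p) (cong proj₂ q)) }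
    where module R = Rich R
          module S = Rich S
          module RG = IsAbelianGroup R.isAbelianGroup
          module SG = IsAbelianGroup S.isAbelianGroup

  Rich-^ : ∀ {t m} → Rich t m → ∀ n → Rich t (m ^ n)
  Rich-^ R zero = Rich-one
  Rich-^ R (suc n) = Rich-* R (Rich-^ R n)

  Rich-restrict : ∀ {s t m} → s ≤ t → Rich t m → Rich s m
  Rich-restrict s≤t R = record
    { A = A ; size = size ; _+_ = _+_ ; 0# = 0# ; -_ = -_ ; isAbelianGroup = isAbelianGroup
    ; μ = λ i → μ (inject≤ i s≤t) ; μ-+ = λ i → μ-+ _
    ; divide = λ n → divide (λ e → n (inject≤-injective s≤t s≤t _ _ e))
    ; cancel = λ n → cancel (λ e → n (inject≤-injective s≤t s≤t _ _ e)) }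
    where open Rich R

  -- The rows are the affine lines i ↦ a + μ i b. Two prescribed values fix the difference of μ i b
  -- and μ j b, hence b, and then a.
  Rich⇒OA : ∀ {t m} → Rich t m → OA t (Fin m)
  Rich⇒OA {t} {m} R = record
    { Row = A × A
    ; _≟R_ = ≡-dec (≟-from size) (≟-from size)
    ; val = λ { (a , b) i → to (a + μ i b) }
    ; solve = slv
    ; unique = λ { {i} {j} {a , b} {a′ , b′} n e f → unq n (to-inj e) (to-inj f) }
    ; row₀ = 0# , 0# ; sym₀ = to (0# + 0#) ; val₀ = λ i → cong (λ z → to (0# + z)) (μ0 i) }
    where
    open Rich R
    open Inverse size using (to; from; inverseˡ; inverseʳ)
    open IsAbelianGroup isAbelianGroup using (assoc; comm; identityʳ; identityˡ)
      renaming (inverseˡ to invˡ; inverseʳ to invʳ)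
    to-inj : ∀ {x y} → to x ≡ to y → x ≡ y
    to-inj e = trans (sym (inverseʳ refl)) (trans (cong from e) (inverseʳ refl))
    can : ∀ {x y} z → x + z ≡ y + z → x ≡ y
    can {x} {y} z e = trans (lem x) (trans (cong (_+ - z) e) (sym (lem y)))
      where lem : ∀ x → x ≡ (x + z) + - z
            lem x = sym (trans (assoc x z (- z)) (trans (cong (x +_) (invʳ z)) (identityʳ x)))
    μ0 : ∀ i → μ i 0# ≡ 0#
    μ0 i = can (μ i 0#) (trans (sym (μ-+ i 0# 0#)) (trans (cong (μ i) (identityˡ 0#)) (sym (identityˡ _))))
    slv : ∀ {i j} → i ≢ j → ∀ x y → Σ (A × A) λ q → to (proj₁ q + μ i (proj₂ q)) ≡ x × to (proj₁ q + μ j (proj₂ q)) ≡ y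
    slv {i} {j} n x y with divide n (from x + - from y)
    ... | b , p = (from y + - μ j b , b)
        , trans (cong to (trans (cong ((from y + - μ j b) +_) p) (arith (from x) (from y) (μ j b)))) (inverseˡ refl)
        , trans (cong to (trans (assoc (from y) _ _) (trans (cong (from y +_) (invˡ (μ j b))) (identityʳ (from y))))) (inverseˡ refl)
      where
      open ≡-Reasoning
      arith : ∀ x y z → (y + - z) + ((x + - y) + z) ≡ x
      arith x y z = begin
        (y + - z) + ((x + - y) + z)  ≡⟨ cong ((y + - z) +_) (comm _ z) ⟩
        (y + - z) + (z + (x + - y))  ≡⟨ sym (assoc _ z _) ⟩
        ((y + - z) + z) + (x + - y)  ≡⟨ cong (_+ (x + - y)) (trans (assoc y _ _) (trans (cong (y +_) (invˡ z)) (identityʳ y))) ⟩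
        y + (x + - y)                ≡⟨ comm y _ ⟩
        (x + - y) + y                ≡⟨ trans (assoc x _ _) (trans (cong (x +_) (invˡ y)) (identityʳ x)) ⟩
        x                            ∎
    unq : ∀ {i j a b a′ b′} → i ≢ j → a + μ i b ≡ a′ + μ i b′ → a + μ j b ≡ a′ + μ j b′ → (a , b) ≡ (a′ , b′)
    unq {i} {j} {a} {b} {a′} {b′} n e f with cancel {x = μ i b + - μ j b} n (sym (trans (assoc _ _ _) (trans (cong (μ i b +_) (invˡ (μ j b))) (identityʳ _)))) lem
      where
      open ≡-Reasoning
      lem : μ i b′ ≡ (μ i b + - μ j b) + μ j b′
      lem = can (a′ + μ j b) (begin
        μ i b′ + (a′ + μ j b)                       ≡⟨ trans (sym (assoc _ _ _)) (cong (_+ μ j b) (comm (μ i b′) a′)) ⟩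
        (a′ + μ i b′) + μ j b                       ≡⟨ cong (_+ μ j b) (sym e) ⟩
        (a + μ i b) + μ j b                         ≡⟨ trans (assoc a _ _) (trans (cong (a +_) (comm _ _)) (sym (assoc a _ _))) ⟩
        (a + μ j b) + μ i b                         ≡⟨ cong (_+ μ i b) f ⟩
        (a′ + μ j b′) + μ i b                       ≡⟨ cong (_+ μ i b) (comm a′ _) ⟩
        (μ j b′ + a′) + μ i b                       ≡⟨ trans (assoc _ a′ _) (cong (μ j b′ +_) (comm a′ _)) ⟩
        μ j b′ + (μ i b + a′)                       ≡⟨ cong (λ z → μ j b′ + (z + a′)) (sym (trans (assoc _ _ _) (trans (cong (μ i b +_) (invˡ (μ j b))) (identityʳ _)))) ⟩
        μ j b′ + (((μ i b + - μ j b) + μ j b) + a′) ≡⟨ cong (μ j b′ +_) (trans (assoc _ _ a′) (cong ((μ i b + - μ j b) +_) (comm _ a′))) ⟩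
        μ j b′ + ((μ i b + - μ j b) + (a′ + μ j b)) ≡⟨ trans (sym (assoc _ _ _)) (cong (_+ (a′ + μ j b)) (comm _ _)) ⟩
        ((μ i b + - μ j b) + μ j b′) + (a′ + μ j b) ∎)
    ... | refl = cong (_, b) (can (μ i b) e)

  ℕ^-distrib-* : ∀ a b n → (a ℕ.* b) ^ n ≡ a ^ n ℕ.* b ^ n
  ℕ^-distrib-* a b zero = refl
  ℕ^-distrib-* a b (suc n) = trans (cong (a ℕ.* b ℕ.*_) (ℕ^-distrib-* a b n)) (ℕ.[m*n]*[o*p]≡[m*o]*[n*p] a b (a ^ n) (b ^ n))

  private
    tower : ∀ {p} → Prime p → ∀ i → Field (p ^ (2 ^ i))
    tower {p} pr zero = subst Field (sym (ℕ.*-identityʳ p)) (ℤ/_ p {{prime⇒nonZero pr}} pr)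
    tower {p} pr (suc i) = subst Field (trans (sym (ℕ.^-distribˡ-+-* p (2 ^ i) (2 ^ i)))
      (cong (λ z → p ^ (2 ^ i ℕ.+ z)) (sym (ℕ.+-identityʳ _)))) (Quadratic.quadratic (tower pr i))

    n≤2^n : ∀ n → n ≤ 2 ^ n
    n≤2^n zero = z≤n
    n≤2^n (suc n) = ℕ.≤-trans (ℕ.+-mono-≤ (ℕ.m^n>0 2 n) (n≤2^n n)) (ℕ.≤-reflexive (cong (2 ^ n ℕ.+_) (sym (ℕ.+-identityʳ _))))

  prime>1 : ∀ {p} → Prime p → 1 < p
  prime>1 {p} pr = ℕ.nonTrivial⇒n>1 p {{prime⇒nonTrivial pr}}

  -- A prime factor p of Z may be smaller than t, but the field of order p^(2^t) has at least t
  -- elements. The orders are multiplied over all prime factors.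
  Rich-power : ∀ t Z → .{{NonZero Z}} → Rich t (Z ^ (2 ^ t))
  Rich-power t Z = subst (λ z → Rich t (z ^ (2 ^ t))) (sym (PrimeFactorisation.isFactorisation F))
    (go (PrimeFactorisation.factorsPrime F))
    where
    F = factorise Z
    go : ∀ {ps} → All Prime ps → Rich t (product ps ^ (2 ^ t))
    go [] = subst (Rich t) (sym (ℕ.^-zeroˡ (2 ^ t))) Rich-one
    go {p ∷ ps} (pr ∷ prs) = subst (Rich t) (sym (ℕ^-distrib-* p (product ps) (2 ^ t)))
      (Rich-* (Field⇒Rich (ℕ.≤-trans (n≤2^n t) (ℕ.≤-trans (n≤2^n (2 ^ t)) (ℕ.^-monoˡ-≤ (2 ^ t) (prime>1 pr)))) (tower pr t)) (go prs))

  ∣! : ∀ {d n} → 0 < d → d ≤ n → d ∣ n !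
  ∣! {suc d} {suc n} _ (s≤s d≤n) with ℕ.m≤n⇒m<n∨m≡n d≤n
  ... | inj₁ d<n = ∣-trans (∣! {suc d} {n} (s≤s z≤n) d<n) (n∣m*n (suc n))
  ... | inj₂ refl = m∣m*n (n !)

  Rich-prime : ∀ {t p} → t ≤ p → Prime p → Rich t p
  Rich-prime {p = p} t≤p pr = Field⇒Rich t≤p (ℤ/_ p {{prime⇒nonZero pr}} pr)

  -- A prime up to t divides t! and hence not t! z + 1, so the field of each prime factor offers t
  -- distinct multipliers.
  Rich-coprime : ∀ t z → Rich t (suc (t ! ℕ.* z))
  Rich-coprime t z = subst (Rich t) (sym (PrimeFactorisation.isFactorisation F))
    (go (PrimeFactorisation.factorsPrime F) (λ d∣ → subst (_ ∣_) (sym (PrimeFactorisation.isFactorisation F)) d∣))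
    where
    F = factorise (suc (t ! ℕ.* z))
    big : ∀ {p} → Prime p → p ∣ suc (t ! ℕ.* z) → t ≤ p
    big {p} pr d with ℕ.≤-total t p
    ... | inj₁ le = le
    ... | inj₂ ge = ⊥-elim (¬prime[1] (subst Prime (∣1⇒≡1 (∣m+n∣m⇒∣n (subst (p ∣_) (ℕ.+-comm 1 _) d)
            (∣m⇒∣m*n z (∣! (ℕ.<⇒≤ (prime>1 pr)) ge)))) pr))
    go : ∀ {ps} → All Prime ps → (∀ {d} → d ∣ product ps → d ∣ suc (t ! ℕ.* z)) → Rich t (product ps)
    go [] _ = Rich-one
    go {p ∷ ps} (pr ∷ prs) h = Rich-* (Rich-prime (big pr (h (m∣m*n (product ps)))) pr) (go prs (λ d → h (∣-trans d (n∣m*n p))))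

-- Blowing up a design with repeated pairs to a group divisible design

module Blowups where
  open Designs
  open Fields
  open import Level using (0ℓ)
  open import Algebra.Bundles using (CommutativeMonoid)
  open import Algebra.Structures using (IsAbelianGroup)
  open import Data.Nat using (ℕ; zero; suc; _*_; _<_; _<?_; _^_)
  open import Data.Nat.Properties using (<-cmp; <-irrefl; <-asym)
  open import Data.Fin using (Fin; zero; suc; toℕ; combine; remQuot)
  open import Data.Fin.Properties using (_≟_; remQuot-combine; combine-remQuot; punchInᵢ≢i; toℕ-injective; *↔×)
  open import Data.Vec using (Vec; []; _∷_; lookup; tabulate)
  open import Data.Vec.Properties using (tabulate∘lookup; lookup∘tabulate; tabulate-cong)
  open import Data.Vec.Functional using (removeAt)
  open import Data.Product using (Σ; _×_; _,_; proj₁; proj₂)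
  open import Data.Product.Function.NonDependent.Propositional using (_×-↔_)
  open import Data.Empty using (⊥-elim)
  open import Relation.Nullary using (yes; no)
  open import Relation.Nullary.Decidable using (_×-dec_)
  open import Relation.Binary.Definitions using (tri<; tri≈; tri>)
  open import Relation.Binary.PropositionalEquality using (_≡_; _≢_; refl; sym; trans; cong; cong₂; subst; subst₂; module ≡-Reasoning)
  open import Function.Bundles using (_↔_; Inverse; mk↔ₛ′)
  open import Function.Properties.Inverse using (↔-refl; ↔-sym; ↔-trans)
  import Algebra.Properties.CommutativeMonoid.Sum as Sum
  import Algebra.Solver.CommutativeMonoid as MonoidSolver

  -- A family of k-subsets of Fin v covering every pair exactly l times; the blocks through the pair
  -- i < j are told apart by the labels lab β i j.
  record MultiDesign (k v l : ℕ) : Set₁ where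
    field
      Ix : Set
      blk : Ix → Fin k → Fin v
      blk-inj : ∀ β {a b} → blk β a ≡ blk β b → a ≡ b
      lab : Ix → Fin v → Fin v → Fin l
      find : ∀ {i j} → toℕ i < toℕ j → ∀ t →
        Σ Ix λ β → (Σ (Fin k) λ a → blk β a ≡ i) × (Σ (Fin k) λ b → blk β b ≡ j) × lab β i j ≡ t
      only : ∀ {i j β β′ a b a′ b′} → toℕ i < toℕ j → blk β a ≡ i → blk β b ≡ j → blk β′ a′ ≡ i → blk β′ b′ ≡ j →
        lab β i j ≡ lab β′ i j → β ≡ β′

  Vec↔Fin : ∀ {A : Set} {m} → A ↔ Fin m → ∀ n → Vec A n ↔ Fin (m ^ n)
  Vec↔Fin i zero = mk↔ₛ′ (λ _ → zero) (λ _ → []) (λ { zero → refl }) (λ { [] → refl })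
  Vec↔Fin i (suc n) = ↔-trans (mk↔ₛ′ (λ { (x ∷ xs) → x , xs }) (λ p → proj₁ p ∷ proj₂ p) (λ _ → refl) (λ { (x ∷ xs) → refl }))
    (↔-trans (i ×-↔ Vec↔Fin i n) (↔-sym *↔×))

  lookup-ext : ∀ {A : Set} {n} {xs ys : Vec A n} → (∀ e → lookup xs e ≡ lookup ys e) → xs ≡ ys
  lookup-ext {xs = xs} {ys} h = trans (sym (tabulate∘lookup xs)) (trans (tabulate-cong h) (tabulate∘lookup ys))

  -- Points are Fin v × A^M with one coordinate per pair of Fin v.  In the coordinate of the pair (i , j)
  -- the endomorphisms attached to i and j are made equal, so that there the difference of two points of a
  -- block is governed by the label alone, while in all other coordinates it is arbitrary.
  module Blowup {k v l M′ : ℕ} (R : Rich v l) (D : MultiDesign k v l) (e₁ e₂ : Fin (suc M′) → Fin v)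
    (ix : Fin v → Fin v → Fin (suc M′)) (ix₁ : ∀ i j → e₁ (ix i j) ≡ i) (ix₂ : ∀ i j → e₂ (ix i j) ≡ j)
    (ix-eta : ∀ e → ix (e₁ e) (e₂ e) ≡ e) where
    open Rich R
    open MultiDesign D
    private
      M = suc M′
      open IsAbelianGroup isAbelianGroup using (assoc; comm; identityʳ; identityˡ; isCommutativeMonoid)
        renaming (inverseˡ to invˡ; inverseʳ to invʳ)
      cmon : CommutativeMonoid 0ℓ 0ℓ
      cmon = record { isCommutativeMonoid = isCommutativeMonoid }
      open Sum cmon using (sum; sum-remove; sum-cong-≗)
      open MonoidSolver cmon using (solve; _⊕_; _⊜_)
      open Inverse size using (to; from; inverseˡ; inverseʳ)
      from-inj : ∀ {x y} → from x ≡ from y → x ≡ y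
      from-inj e = trans (sym (inverseˡ refl)) (trans (cong to e) (inverseˡ refl))

      can : ∀ {x y} z → x + z ≡ y + z → x ≡ y
      can {x} {y} z e = trans (lem x) (trans (cong (_+ - z) e) (sym (lem y)))
        where lem : ∀ x → x ≡ (x + z) + - z
              lem x = sym (trans (assoc x z (- z)) (trans (cong (x +_) (invʳ z)) (identityʳ x)))
      sub-add : ∀ x y → (x + - y) + y ≡ x
      sub-add x y = trans (assoc x _ _) (trans (cong (x +_) (invˡ y)) (identityʳ x))

      d : Fin v → Fin M → Fin v
      d i e with (toℕ (e₁ e) <? toℕ (e₂ e)) ×-dec (i ≟ e₂ e)
      ... | yes _ = e₁ e
      ... | no _ = i
      -- The label is added at the first point of the pair only, so that it is the difference
      -- between its two points in their own coordinate.
      ℓ : Ix → Fin v → Fin M → A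
      ℓ β i e with i ≟ e₁ e
      ... | yes _ = from (lab β (e₁ e) (e₂ e))
      ... | no _ = 0#

      d-same : ∀ {i j} → toℕ i < toℕ j → d i (ix i j) ≡ d j (ix i j)
      d-same {i} {j} i<j with (toℕ (e₁ (ix i j)) <? toℕ (e₂ (ix i j))) ×-dec (i ≟ e₂ (ix i j))
                            | (toℕ (e₁ (ix i j)) <? toℕ (e₂ (ix i j))) ×-dec (j ≟ e₂ (ix i j))
      ... | yes (_ , p) | _ = ⊥-elim (<-irrefl (cong toℕ (trans p (ix₂ i j))) i<j)
      ... | no _ | yes _ = sym (ix₁ i j)
      ... | no _ | no n = ⊥-elim (n (subst₂ (λ y z → toℕ y < toℕ z) (sym (ix₁ i j)) (sym (ix₂ i j)) i<j , sym (ix₂ i j)))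
      d-diff : ∀ {i j e} → toℕ i < toℕ j → e ≢ ix i j → d i e ≢ d j e
      d-diff {i} {j} {e} i<j ne with (toℕ (e₁ e) <? toℕ (e₂ e)) ×-dec (i ≟ e₂ e) | (toℕ (e₁ e) <? toℕ (e₂ e)) ×-dec (j ≟ e₂ e)
      ... | yes (_ , p) | yes (_ , q) = λ _ → <-irrefl (cong toℕ (trans p (sym q))) i<j
      ... | yes (lt , p) | no _ = λ q → <-asym i<j (subst (λ z → toℕ j < toℕ z) (sym p) (subst (λ z → toℕ z < toℕ (e₂ e)) q lt))
      ... | no _ | yes (_ , q) = λ p → ne (trans (sym (ix-eta e)) (cong₂ ix (sym p) (sym q)))
      ... | no _ | no _ = λ p → <-irrefl (cong toℕ p) i<j
      ℓ-i : ∀ β i j → ℓ β i (ix i j) ≡ from (lab β i j)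
      ℓ-i β i j with i ≟ e₁ (ix i j)
      ... | yes _ = cong₂ (λ a b → from (lab β a b)) (ix₁ i j) (ix₂ i j)
      ... | no n = ⊥-elim (n (sym (ix₁ i j)))
      ℓ-j : ∀ β {i j} → toℕ i < toℕ j → ℓ β j (ix i j) ≡ 0#
      ℓ-j β {i} {j} i<j with j ≟ e₁ (ix i j)
      ... | yes p = ⊥-elim (<-irrefl (cong toℕ (sym (trans p (ix₁ i j)))) i<j)
      ... | no _ = refl

      -- The slopes are restricted to sum zero. In the coordinate of a pair the slope has no
      -- influence on the difference and is recovered from the sum; the label replaces the lost
      -- degree of freedom. The count is exact: l labels, l^(M - 1) slopes and l^M offsets for the
      -- l^(2M) pairs of points over i and j.
      ext : Vec A M′ → Fin M → A
      ext u zero = - sum (lookup u)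
      ext u (suc e) = lookup u e
      ext-sum : ∀ u → sum (ext u) ≡ 0#
      ext-sum u = invˡ _
      unext : ∀ t → sum t ≡ 0# → Σ (Vec A M′) λ u → ∀ e → ext u e ≡ t e
      unext t s0 = tabulate (λ e → t (suc e)) , λ { zero → can (sum (λ e → t (suc e)))
          (trans (trans (cong (λ z → - z + sum (λ e → t (suc e))) (sum-cong-≗ (lookup∘tabulate (λ e → t (suc e))))) (invˡ _)) (sym s0))
        ; (suc e) → lookup∘tabulate _ e }
      ext-inj : ∀ {u u′} e₀ → (∀ e → e ≢ e₀ → ext u e ≡ ext u′ e) → ∀ e → ext u e ≡ ext u′ e
      ext-inj {u} {u′} e₀ h e with e ≟ e₀
      ... | no n = h e n
      ... | yes refl = can (sum (removeAt (ext u) e)) (trans (trans (sym (sum-remove {i = e} (ext u))) (trans (ext-sum u) (sym (ext-sum u′))))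
              (trans (sum-remove {i = e} (ext u′)) (cong (ext u′ e +_) (sum-cong-≗ λ j → sym (h _ (punchInᵢ≢i e j))))))
      fixsum : ∀ e₀ (t : Fin M → A) → Σ (Fin M → A) λ t′ → sum t′ ≡ 0# × (∀ e → e ≢ e₀ → t′ e ≡ t e)
      fixsum e₀ t = t′ , trans (sum-remove {i = e₀} t′) (trans (cong₂ _+_ at (sum-cong-≗ λ j → off _ (punchInᵢ≢i e₀ j))) (invˡ _)) , off
        where
        t′ : Fin M → A
        t′ e with e ≟ e₀
        ... | yes _ = - sum (removeAt t e₀)
        ... | no _ = t e
        at : t′ e₀ ≡ - sum (removeAt t e₀)
        at with e₀ ≟ e₀
        ... | yes _ = refl
        ... | no n = ⊥-elim (n refl)
        off : ∀ e → e ≢ e₀ → t′ e ≡ t e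
        off e n with e ≟ e₀
        ... | yes p = ⊥-elim (n p)
        ... | no _ = refl

      Bl = Ix × Vec A M′ × Vec A M
      co : Bl → Fin v → Fin M → A
      co (β , u , g) i e = lookup g e + (ℓ β i e + μ (d i e) (ext u e))
      point : Bl → Fin v → Vec A M
      point B i = tabulate (co B i)
      at-point : ∀ B i e → lookup (point B i) e ≡ co B i e
      at-point B i e = lookup∘tabulate (co B i) e

      exist : ∀ {i j} → toℕ i < toℕ j → ∀ x y →
        Σ Bl λ B → (Σ (Fin k) λ a → blk (proj₁ B) a ≡ i) × (Σ (Fin k) λ b → blk (proj₁ B) b ≡ j) × point B i ≡ x × point B j ≡ y
      exist {i} {j} i<j x y with find i<j (to (lookup x (ix i j) + - lookup y (ix i j)))
      ... | β , ia , jb , lab≡ = (β , u , g) , ia , jb , lookup-ext px , lookup-ext py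
        where
        e₀ = ix i j
        -- Eliminating the offset g from both incidences leaves μ (d i e) u = s e + μ (d j e) u in
        -- every coordinate. The choice of the label makes `s` vanish at `e₀`, where the two
        -- endomorphisms agree.
        s : Fin M → A
        s e = (lookup x e + ℓ β j e) + - (lookup y e + ℓ β i e)
        s-ok : ∀ e → s e + (lookup y e + ℓ β i e) ≡ lookup x e + ℓ β j e
        s-ok e = sub-add _ _
        s₀ : s e₀ ≡ 0#
        s₀ = can (lookup y e₀ + ℓ β i e₀) (trans (s-ok e₀) (trans (trans (cong (lookup x e₀ +_) (ℓ-j β i<j)) (identityʳ _))
          (sym (trans (identityˡ _) (trans (cong (lookup y e₀ +_) (trans (ℓ-i β i j) (trans (cong from lab≡) (inverseʳ refl))))
            (trans (comm _ _) (sub-add _ _)))))))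
        raw : Fin M → A
        raw e with e ≟ e₀
        ... | yes _ = 0#
        ... | no n = proj₁ (divide (d-diff i<j n) (s e))
        raw-ok : ∀ e → e ≢ e₀ → μ (d i e) (raw e) ≡ s e + μ (d j e) (raw e)
        raw-ok e n with e ≟ e₀
        ... | yes p = ⊥-elim (n p)
        ... | no n′ = proj₂ (divide (d-diff i<j n′) (s e))
        t = fixsum e₀ raw
        U = unext (proj₁ t) (proj₁ (proj₂ t))
        u = proj₁ U
        m≡ : ∀ e → μ (d i e) (ext u e) ≡ s e + μ (d j e) (ext u e)
        m≡ e with e ≟ e₀
        ... | yes refl = trans (cong (λ z → μ z (ext u e)) (d-same i<j)) (sym (trans (cong (_+ μ (d j e) (ext u e)) s₀) (identityˡ _)))
        ... | no n = subst (λ z → μ (d i e) z ≡ s e + μ (d j e) z) (sym (trans (proj₂ U e) (proj₂ (proj₂ t) e n))) (raw-ok e n)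
        g = tabulate (λ e → lookup x e + - (ℓ β i e + μ (d i e) (ext u e)))
        px : ∀ e → lookup (point (β , u , g) i) e ≡ lookup x e
        px e = trans (at-point (β , u , g) i e) (trans (cong (_+ (ℓ β i e + μ (d i e) (ext u e)))
          (lookup∘tabulate (λ e → lookup x e + - (ℓ β i e + μ (d i e) (ext u e))) e)) (sub-add _ _))
        py : ∀ e → lookup (point (β , u , g) j) e ≡ lookup y e
        py e = trans (at-point (β , u , g) j e) (can (ℓ β i e + s e) (begin
            (G + (ℓ β j e + n)) + (ℓ β i e + s e)        ≡⟨ solve 5 (λ G a n b s → (G ⊕ (a ⊕ n)) ⊕ (b ⊕ s) ⊜ (G ⊕ (b ⊕ (s ⊕ n))) ⊕ a) refl G (ℓ β j e) n (ℓ β i e) (s e) ⟩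
            (G + (ℓ β i e + (s e + n))) + ℓ β j e        ≡⟨ cong (λ z → (G + (ℓ β i e + z)) + ℓ β j e) (sym (m≡ e)) ⟩
            (G + (ℓ β i e + μ (d i e) (ext u e))) + ℓ β j e ≡⟨ cong (_+ ℓ β j e) (trans (sym (at-point (β , u , g) i e)) (px e)) ⟩
            lookup x e + ℓ β j e                         ≡⟨ sym (s-ok e) ⟩
            s e + (lookup y e + ℓ β i e)                 ≡⟨ solve 3 (λ s y b → s ⊕ (y ⊕ b) ⊜ y ⊕ (b ⊕ s)) refl (s e) (lookup y e) (ℓ β i e) ⟩
            lookup y e + (ℓ β i e + s e)                 ∎))
          where open ≡-Reasoning
                G = lookup g e
                n = μ (d j e) (ext u e)

      unq : ∀ {i j a b a′ b′} (B B′ : Bl) → toℕ i < toℕ j → blk (proj₁ B) a ≡ i → blk (proj₁ B) b ≡ j →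
        blk (proj₁ B′) a′ ≡ i → blk (proj₁ B′) b′ ≡ j → point B i ≡ point B′ i → point B j ≡ point B′ j → B ≡ B′
      unq {i} {j} (β , u , g) (β′ , u′ , g′) i<j pa pb pa′ pb′ p q = step (only i<j pa pb pa′ pb′ (from-inj lab≡))
        where
        e₀ = ix i j
        m m′ n n′ : Fin M → A
        m e = μ (d i e) (ext u e)
        m′ e = μ (d i e) (ext u′ e)
        n e = μ (d j e) (ext u e)
        n′ e = μ (d j e) (ext u′ e)
        P : ∀ e → lookup g e + (ℓ β i e + m e) ≡ lookup g′ e + (ℓ β′ i e + m′ e)
        P e = trans (sym (at-point (β , u , g) i e)) (trans (cong (λ z → lookup z e) p) (at-point (β′ , u′ , g′) i e))
        Q : ∀ e → lookup g e + (ℓ β j e + n e) ≡ lookup g′ e + (ℓ β′ j e + n′ e)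
        Q e = trans (sym (at-point (β , u , g) j e)) (trans (cong (λ z → lookup z e) q) (at-point (β′ , u′ , g′) j e))
        open ≡-Reasoning
        -- At `e₀` the slope terms of i and j coincide, so comparing the two points leaves the
        -- labels.
        lab≡ : from (lab β i j) ≡ from (lab β′ i j)
        lab≡ = can (lookup g e₀ + n e₀) (begin
          from (lab β i j) + (lookup g e₀ + n e₀)      ≡⟨ solve 3 (λ a g n → a ⊕ (g ⊕ n) ⊜ g ⊕ (a ⊕ n)) refl _ _ _ ⟩
          lookup g e₀ + (from (lab β i j) + n e₀)      ≡⟨ cong₂ (λ a z → lookup g e₀ + (a + μ z (ext u e₀))) (sym (ℓ-i β i j)) (sym (d-same i<j)) ⟩
          lookup g e₀ + (ℓ β i e₀ + m e₀)              ≡⟨ P e₀ ⟩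
          lookup g′ e₀ + (ℓ β′ i e₀ + m′ e₀)           ≡⟨ cong₂ (λ a z → lookup g′ e₀ + (a + μ z (ext u′ e₀))) (ℓ-i β′ i j) (d-same i<j) ⟩
          lookup g′ e₀ + (from (lab β′ i j) + n′ e₀)   ≡⟨ solve 3 (λ a g n → g ⊕ (a ⊕ n) ⊜ a ⊕ (g ⊕ n)) refl _ _ _ ⟩
          from (lab β′ i j) + (lookup g′ e₀ + n′ e₀)   ≡⟨ cong (from (lab β′ i j) +_) (sym (zero-j β′ (lookup g′ e₀) (n′ e₀))) ⟩
          from (lab β′ i j) + (lookup g′ e₀ + (ℓ β′ j e₀ + n′ e₀)) ≡⟨ cong (from (lab β′ i j) +_) (sym (Q e₀)) ⟩
          from (lab β′ i j) + (lookup g e₀ + (ℓ β j e₀ + n e₀)) ≡⟨ cong (from (lab β′ i j) +_) (zero-j β (lookup g e₀) (n e₀)) ⟩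
          from (lab β′ i j) + (lookup g e₀ + n e₀)     ∎)
          where zero-j : ∀ β x y → x + (ℓ β j e₀ + y) ≡ x + y
                zero-j β x y = cong (x +_) (trans (cong (_+ y) (ℓ-j β i<j)) (identityˡ y))
        step : β ≡ β′ → (β , u , g) ≡ (β′ , u′ , g′)
        step refl = cong (β ,_) (cong₂ _,_ (lookup-ext (λ e → all (suc e))) (lookup-ext λ e →
            can (ℓ β i e + m e) (trans (P e) (cong (λ z → lookup g′ e + (ℓ β i e + μ (d i e) z)) (sym (all e))))))
          where
          drop : ∀ {g g′ l m m′} → g + (l + m) ≡ g′ + (l + m′) → g + m ≡ g′ + m′
          drop {g} {g′} {l} {m} {m′} h = can l (trans (solve 3 (λ g l m → (g ⊕ m) ⊕ l ⊜ g ⊕ (l ⊕ m)) refl g l m)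
            (trans h (solve 3 (λ g l m → g ⊕ (l ⊕ m) ⊜ (g ⊕ m) ⊕ l) refl g′ l m′)))
          cross : ∀ e → m′ e + n e ≡ m e + n′ e
          cross e = can (lookup g e + lookup g′ e) (begin
            (m′ e + n e) + (lookup g e + lookup g′ e)   ≡⟨ solve 4 (λ a b c d → (a ⊕ b) ⊕ (c ⊕ d) ⊜ (d ⊕ a) ⊕ (c ⊕ b)) refl _ _ _ _ ⟩
            (lookup g′ e + m′ e) + (lookup g e + n e)   ≡⟨ cong₂ _+_ (sym (drop (P e))) (drop (Q e)) ⟩
            (lookup g e + m e) + (lookup g′ e + n′ e)   ≡⟨ solve 4 (λ a b c d → (a ⊕ b) ⊕ (c ⊕ d) ⊜ (b ⊕ d) ⊕ (a ⊕ c)) refl _ _ _ _ ⟩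
            (m e + n′ e) + (lookup g e + lookup g′ e)   ∎)
          off : ∀ e → e ≢ e₀ → ext u e ≡ ext u′ e
          off e ne = cancel {x = m e + - n e} (d-diff i<j ne) (sym (sub-add _ _)) (can (n e) (trans (cross e)
            (sym (trans (solve 4 (λ a b c d → ((a ⊕ b) ⊕ c) ⊕ d ⊜ ((a ⊕ b) ⊕ d) ⊕ c) refl (m e) (- n e) (n′ e) (n e)) (cong (_+ n′ e) (sub-add _ _))))))
          all : ∀ e → ext u e ≡ ext u′ e
          all = ext-inj {u} {u′} e₀ off

    gdd : GDD k (Fin v) (Vec A M)
    gdd = record
        { Blk = Bl
        ; pt = λ B a → blk (proj₁ B) a , point B (blk (proj₁ B) a)
        ; irr = λ p → p refl
        ; edge = λ B n e → n (blk-inj (proj₁ B) e)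
        ; cover = cov
        ; uniq = λ {B} {B′} {a} {b} {a′} {b′} n n′ p q → uq B B′ n p q }
        where
        cov : ∀ {x y : Fin v × Vec A M} → apart x y → Σ Bl λ B → Σ (Fin k) λ a → Σ (Fin k) λ b → a ≢ b ×
          (blk (proj₁ B) a , point B (blk (proj₁ B) a)) ≡ x × (blk (proj₁ B) b , point B (blk (proj₁ B) b)) ≡ y
        cov {i , x} {j , y} n with <-cmp (toℕ i) (toℕ j)
        ... | tri≈ _ p _ = ⊥-elim (n (toℕ-injective p))
        ... | tri< i<j _ _ with exist i<j x y
        ... | B , (a , refl) , (b , refl) , p , q = B , a , b , (λ { refl → n refl }) , cong (_ ,_) p , cong (_ ,_) q
        cov {i , x} {j , y} n | tri> _ _ j<i with exist j<i y x
        ... | B , (a , refl) , (b , refl) , p , q = B , b , a , (λ { refl → n refl }) , cong (_ ,_) q , cong (_ ,_) p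
        split : ∀ {i j : Fin v} {f : Fin v → Vec A M} {h : Fin v → Vec A M} → (i , f i) ≡ (j , h j) → Σ (i ≡ j) λ _ → f i ≡ h i
        split {i} {j} {f} {h} e with cong proj₁ e
        ... | refl = refl , cong proj₂ e
        uq : ∀ B B′ {a b a′ b′} → a ≢ b →
          (blk (proj₁ B) a , point B (blk (proj₁ B) a)) ≡ (blk (proj₁ B′) a′ , point B′ (blk (proj₁ B′) a′)) →
          (blk (proj₁ B) b , point B (blk (proj₁ B) b)) ≡ (blk (proj₁ B′) b′ , point B′ (blk (proj₁ B′) b′)) → B ≡ B′
        uq B B′ {a} {b} n p q with split {f = point B} {h = point B′} p | split {f = point B} {h = point B′} q
        ... | p₁ , p₂ | q₁ , q₂ with <-cmp (toℕ (blk (proj₁ B) a)) (toℕ (blk (proj₁ B) b))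
        ... | tri< lt _ _ = unq B B′ lt refl refl (sym p₁) (sym q₁) p₂ q₂
        ... | tri≈ _ e _ = ⊥-elim (n (blk-inj (proj₁ B) (toℕ-injective e)))
        ... | tri> _ _ gt = unq B B′ gt refl refl (sym q₁) (sym p₁) q₂ p₂

  -- Coordinates are indexed by all ordered pairs of points through `combine`; this is the origin of
  -- the square in the exponent of the group size.
  blowup : ∀ {k v l} → Rich (suc v) l → MultiDesign k (suc v) l → GDD k (Fin (suc v)) (Fin (l ^ (suc v * suc v)))
  blowup {v = v} R D = GDD-iso ↔-refl (Vec↔Fin (Rich.size R) (suc v * suc v))
    (Blowup.gdd R D (λ e → proj₁ (remQuot {suc v} (suc v) e)) (λ e → proj₂ (remQuot {suc v} (suc v) e)) combine
      (λ i j → cong proj₁ (remQuot-combine i j)) (λ i j → cong proj₂ (remQuot-combine i j)) (combine-remQuot {suc v} (suc v)))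

-- The lattice spanned by the pair sets of k-subsets

module PairLattice where
  open import Level using (0ℓ)
  open import Algebra.Bundles using (AbelianGroup)
  open import Data.Nat as ℕ using (ℕ; zero; suc; _≤_; z≤n; s≤s)
  import Data.Nat.Properties as ℕ
  open import Data.Nat.Tactic.RingSolver using (solve-∀)
  open import Data.Fin using (Fin; zero; suc)
  open import Data.Fin.Properties using (_≟_)
  open import Data.List using (List; []; _∷_; length; filter; allFin)
  open import Data.List.Properties using (length-tabulate; filter-all)
  open import Data.List.Relation.Unary.All as All using (All; []; _∷_)
  open import Data.List.Relation.Unary.Any using (here; there)
  open import Data.List.Relation.Unary.AllPairs using ([]; _∷_)
  open import Data.List.Relation.Unary.Unique.Propositional using (Unique)
  open import Data.List.Relation.Unary.Unique.Propositional.Properties using (allFin⁺; filter⁺)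
  open import Data.List.Membership.Propositional using (_∈_; _∉_)
  open import Data.List.Membership.Propositional.Properties using (∈-filter⁻)
  open import Data.Product using (Σ; _×_; _,_; proj₁; proj₂)
  open import Data.Empty using (⊥-elim)
  open import Relation.Nullary using (yes; no; ¬?)
  open import Relation.Binary.PropositionalEquality as ≡ using (_≡_; _≢_)

  -- The binomial coefficient n over 2.
  tri : ℕ → ℕ
  tri zero = 0
  tri (suc n) = n ℕ.+ tri n

  2tri : ∀ n → tri (suc n) ℕ.* 2 ≡ suc n ℕ.* n
  2tri zero = ≡.refl
  2tri (suc n) = ≡.trans (ℕ.*-distribʳ-+ 2 (suc n) (tri (suc n))) (≡.trans (≡.cong (suc n ℕ.* 2 ℕ.+_) (2tri n)) (lem n))
    where lem : ∀ n → suc n ℕ.* 2 ℕ.+ suc n ℕ.* n ≡ suc (suc n) ℕ.* suc n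
          lem = solve-∀

  ∉⇒All : ∀ {A : Set} {x : A} {xs} → x ∉ xs → All (x ≢_) xs
  ∉⇒All x∉ = All.tabulate (λ {y} y∈ x≡y → x∉ (≡.subst (_∈ _) (≡.sym x≡y) y∈))

  module _ {v : ℕ} where
    private
      length-≢ : ∀ a {xs : List (Fin v)} → Unique xs → length xs ≤ suc (length (filter (λ x → ¬? (x ≟ a)) xs))
      length-≢ a [] = z≤n
      length-≢ a {x ∷ xs} (x∉ ∷ u) with x ≟ a
      ... | no n = s≤s (length-≢ a u)
      ... | yes ≡.refl = s≤s (ℕ.≤-reflexive (≡.cong length (≡.sym (filter-all (λ x → ¬? (x ≟ a)) (All.map (λ n e → n (≡.sym e)) x∉)))))

      avoid′ : ∀ n (A xs : List (Fin v)) → Unique xs → n ℕ.+ length A ≤ length xs →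
        Σ (List (Fin v)) λ R → Unique R × length R ≡ n × (∀ {x} → x ∈ R → x ∈ xs × x ∉ A)
      avoid′ zero [] xs u le = [] , [] , ≡.refl , λ ()
      avoid′ (suc n) [] (x ∷ xs) (x∉ ∷ u) (s≤s le) with avoid′ n [] xs u le
      ... | R , uR , len , sub = x ∷ R , ∉⇒All (λ x∈ → All.lookup x∉ (proj₁ (sub x∈)) ≡.refl) ∷ uR , ≡.cong suc len
            , λ { (here p) → here p , (λ ()) ; (there p) → there (proj₁ (sub p)) , (λ ()) }
      avoid′ n (a ∷ A) xs u le with avoid′ n A (filter (λ x → ¬? (x ≟ a)) xs) (filter⁺ _ u)
          (ℕ.≤-pred (ℕ.≤-trans (ℕ.≤-reflexive (≡.sym (ℕ.+-suc n (length A)))) (ℕ.≤-trans le (length-≢ a u))))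
      ... | R , uR , len , sub = R , uR , len , λ x∈ → proj₁ (∈-filter⁻ _ (proj₁ (sub x∈)))
            , λ { (here p) → proj₂ (∈-filter⁻ (λ x → ¬? (x ≟ a)) {xs = xs} (proj₁ (sub x∈))) p ; (there p) → proj₂ (sub x∈) p }

    avoid : ∀ n (A : List (Fin v)) → n ℕ.+ length A ≤ v → Σ (List (Fin v)) λ R → Unique R × length R ≡ n × (∀ {x} → x ∈ A → x ∉ R)
    avoid n A le with avoid′ n A (allFin v) (allFin⁺ v) (ℕ.≤-trans le (ℕ.≤-reflexive (≡.sym (length-tabulate _))))
    ... | R , u , len , sub = R , u , len , λ x∈A x∈R → proj₂ (sub x∈R) x∈A

  module PairSums (G : AbelianGroup 0ℓ 0ℓ) where
    open AbelianGroup G public renaming (_∙_ to infixl 6 _+_; ε to 0#; _⁻¹ to infix 8 -_; ∙-cong to +-cong; ∙-congˡ to +-congˡ; ∙-congʳ to +-congʳ)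

    row : ∀ {V : Set} → (V → V → Carrier) → V → List V → Carrier
    row w x [] = 0#
    row w x (y ∷ ys) = w x y + row w x ys

    pairs-sum : ∀ {V : Set} → (V → V → Carrier) → List V → Carrier
    pairs-sum w [] = 0#
    pairs-sum w (x ∷ xs) = row w x xs + pairs-sum w xs

  -- In the quotient of ℤ^{pairs} by the complete graphs on k vertices every pair becomes θ i + θ j + ρ.
  module Lattice (G : AbelianGroup 0ℓ 0ℓ) (k₂ v₂ : ℕ) (k+2≤v : 4 ℕ.+ k₂ ≤ 3 ℕ.+ v₂)
    (w : Fin (3 ℕ.+ v₂) → Fin (3 ℕ.+ v₂) → AbelianGroup.Carrier G)
    (w-sym : ∀ i j → AbelianGroup._≈_ G (w i j) (w j i))
    (clique : ∀ S → Unique S → length S ≡ 2 ℕ.+ k₂ → AbelianGroup._≈_ G (PairSums.pairs-sum G w S) (AbelianGroup.ε G)) where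
    open PairSums G
    open import Algebra.Properties.CommutativeMonoid.Mult commutativeMonoid renaming (_×_ to infixr 8 _·_)
    open import Algebra.Solver.CommutativeMonoid commutativeMonoid using (solve; _⊕_; _⊜_)
    open import Relation.Binary.Reasoning.Setoid setoid
    private
      v = 3 ℕ.+ v₂
      k = 2 ℕ.+ k₂
      k₁ = 1 ℕ.+ k₂

      cancel : ∀ {x y} z → x + z ≈ y + z → x ≈ y
      cancel {x} {y} z e = trans (lem x) (trans (+-congʳ e) (sym (lem y)))
        where lem : ∀ x → x ≈ (x + z) + - z
              lem x = sym (trans (assoc x z (- z)) (trans (+-congˡ (inverseʳ z)) (identityʳ x)))
      sub-add : ∀ x y → (x + - y) + y ≈ x
      sub-add x y = trans (assoc x _ _) (trans (+-congˡ (inverseˡ y)) (identityʳ x))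

      -- A common set `R` of k - 2 further points completes each of ac, bd, bc, ad to a k-set. In
      -- the alternating sum of these four cliques everything except the 4-cycle cancels. Finding
      -- `R` takes k + 2 ≤ v.
      square : ∀ {a b c d} → a ≢ b → a ≢ c → a ≢ d → b ≢ c → b ≢ d → c ≢ d → w a c + w b d ≈ w b c + w a d
      square {a} {b} {c} {d} ab ac ad bc bd cd with avoid k₂ (a ∷ b ∷ c ∷ d ∷ []) (≡.subst (_≤ v) (ℕ.+-comm 4 k₂) k+2≤v)
      ... | R , u , len , out = cancel ((ra + rb) + ((rc + rd) + (p + p))) (begin
          (w a c + w b d) + ((ra + rb) + ((rc + rd) + (p + p)))
            ≈⟨ solve 7 (λ x y a b c d p → (x ⊕ y) ⊕ ((a ⊕ b) ⊕ ((c ⊕ d) ⊕ (p ⊕ p))) ⊜ ((x ⊕ a) ⊕ (c ⊕ p)) ⊕ ((y ⊕ b) ⊕ (d ⊕ p))) refl _ _ ra rb rc rd p ⟩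
          ((w a c + ra) + (rc + p)) + ((w b d + rb) + (rd + p))
            ≈⟨ trans (+-cong (zap ac (here ≡.refl) (there (there (here ≡.refl)))) (zap bd (there (here ≡.refl)) (there (there (there (here ≡.refl))))))
                 (sym (+-cong (zap bc (there (here ≡.refl)) (there (there (here ≡.refl)))) (zap ad (here ≡.refl) (there (there (there (here ≡.refl)))))))  ⟩
          ((w b c + rb) + (rc + p)) + ((w a d + ra) + (rd + p))
            ≈⟨ solve 7 (λ x y a b c d p → ((x ⊕ b) ⊕ (c ⊕ p)) ⊕ ((y ⊕ a) ⊕ (d ⊕ p)) ⊜ (x ⊕ y) ⊕ ((a ⊕ b) ⊕ ((c ⊕ d) ⊕ (p ⊕ p)))) refl _ _ ra rb rc rd p ⟩
          (w b c + w a d) + ((ra + rb) + ((rc + rd) + (p + p))) ∎)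
        where
        ra = row w a R
        rb = row w b R
        rc = row w c R
        rd = row w d R
        p = pairs-sum w R
        zap : ∀ {x y} → x ≢ y → x ∈ (a ∷ b ∷ c ∷ d ∷ []) → y ∈ (a ∷ b ∷ c ∷ d ∷ []) → (w x y + row w x R) + (row w y R + p) ≈ 0#
        zap {x} {y} xy x∈ y∈ = clique (x ∷ y ∷ R) ((xy ∷ ∉⇒All (out x∈)) ∷ (∉⇒All (out y∈) ∷ u)) (≡.cong (λ z → suc (suc z)) len)

      two : Fin v
      two = suc (suc zero)
      -- By `square`, `κ` is the constant difference between the rows of 1 and 0. `θ` is the row of
      -- 0, and its own value at 0 and the constant `ρ` are fitted so that the formula holds in the
      -- rows of 0 and 1.
      o κ ρ : Carrier
      o = w zero (suc zero)
      κ = w (suc zero) two + - w zero two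
      ρ = κ + - o
      θ : Fin v → Carrier
      θ zero = o + - κ
      θ (suc i) = w zero (suc i)

      one-J : ∀ j → w (suc zero) (suc (suc j)) ≈ w zero (suc (suc j)) + κ
      one-J zero = sym (trans (comm _ _) (sub-add _ _))
      one-J (suc j) = cancel (w zero two) (begin
        w (suc zero) J + w zero two          ≈⟨ square (λ ()) (λ ()) (λ ()) (λ ()) (λ ()) (λ ()) ⟩
        w zero J + w (suc zero) two          ≈⟨ +-congˡ (sym (sub-add _ _)) ⟩
        w zero J + (κ + w zero two)          ≈⟨ sym (assoc _ _ _) ⟩
        (w zero J + κ) + w zero two          ∎)
        where J = suc (suc (suc j))

      w-θ : ∀ {i j} → i ≢ j → w i j ≈ (θ i + θ j) + ρ
      w-θ′ : ∀ i j → w (suc (suc i)) (suc zero) ≈ (θ (suc (suc i)) + θ (suc zero)) + ρ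
      w-θ {zero} {zero} n = ⊥-elim (n ≡.refl)
      w-θ {zero} {suc j} n = sym (begin
        ((o + - κ) + θ (suc j)) + (κ + - o)  ≈⟨ solve 5 (λ o k t k′ o′ → ((o ⊕ k) ⊕ t) ⊕ (k′ ⊕ o′) ⊜ t ⊕ ((o ⊕ o′) ⊕ (k ⊕ k′))) refl o (- κ) (θ (suc j)) κ (- o) ⟩
        θ (suc j) + ((o + - o) + (- κ + κ))  ≈⟨ +-congˡ (+-cong (inverseʳ o) (inverseˡ κ)) ⟩
        θ (suc j) + (0# + 0#)                ≈⟨ trans (+-congˡ (identityˡ 0#)) (identityʳ _) ⟩
        θ (suc j)                            ∎)
      w-θ {suc i} {zero} n = trans (w-sym _ _) (trans (w-θ {zero} {suc i} (λ ())) (+-congʳ (comm _ _)))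
      w-θ {suc zero} {suc zero} n = ⊥-elim (n ≡.refl)
      w-θ {suc zero} {suc (suc j)} n = sym (begin
        (o + θ (suc (suc j))) + (κ + - o)    ≈⟨ solve 4 (λ o t k o′ → (o ⊕ t) ⊕ (k ⊕ o′) ⊜ (t ⊕ k) ⊕ (o ⊕ o′)) refl o _ κ (- o) ⟩
        (θ (suc (suc j)) + κ) + (o + - o)    ≈⟨ trans (+-congˡ (inverseʳ o)) (identityʳ _) ⟩
        θ (suc (suc j)) + κ                  ≈⟨ sym (one-J j) ⟩
        w (suc zero) (suc (suc j))           ∎)
      w-θ {suc (suc i)} {suc zero} n = w-θ′ i i
      w-θ {suc (suc i)} {suc (suc j)} n = cancel o (begin
        w I J + o                             ≈⟨ square (λ ()) n (λ ()) (λ ()) (λ ()) (λ ()) ⟩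
        w zero J + w I (suc zero)             ≈⟨ +-congˡ (trans (w-sym _ _) (one-J i)) ⟩
        w zero J + (w zero I + κ)             ≈⟨ solve 3 (λ a b c → a ⊕ (b ⊕ c) ⊜ (b ⊕ a) ⊕ c) refl _ _ _ ⟩
        (w zero I + w zero J) + κ             ≈⟨ +-congˡ (sym (sub-add κ o)) ⟩
        (w zero I + w zero J) + (ρ + o)       ≈⟨ sym (assoc _ _ _) ⟩
        ((w zero I + w zero J) + ρ) + o       ∎)
        where I = suc (suc i)
              J = suc (suc j)
      w-θ′ i j = trans (w-sym _ _) (trans (w-θ {suc zero} {suc (suc i)} (λ ())) (+-congʳ (comm _ _)))

      Σθ : List (Fin v) → Carrier
      Σθ [] = 0#
      Σθ (x ∷ xs) = θ x + Σθ xs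

      row-θ : ∀ x xs → All (x ≢_) xs → row w x xs ≈ (length xs · θ x + Σθ xs) + length xs · ρ
      row-θ x [] [] = sym (trans (identityʳ _) (identityʳ _))
      row-θ x (y ∷ ys) (n ∷ ns) = trans (+-cong (w-θ n) (row-θ x ys ns))
        (solve 6 (λ a b r A B R → ((a ⊕ b) ⊕ r) ⊕ ((A ⊕ B) ⊕ R) ⊜ ((a ⊕ A) ⊕ (b ⊕ B)) ⊕ (r ⊕ R)) refl _ _ _ _ _ _)

      -- Each θ x occurs n - 1 times among the pairs; one further `Σθ xs` on the left avoids the
      -- subtraction.
      sum-θ : ∀ xs → Unique xs → Σθ xs + pairs-sum w xs ≈ length xs · Σθ xs + tri (length xs) · ρ
      sum-θ [] [] = refl
      sum-θ (x ∷ xs) (x∉ ∷ u) = begin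
        (θ x + Σθ xs) + (row w x xs + pairs-sum w xs)
          ≈⟨ +-congˡ (+-congʳ (row-θ x xs x∉)) ⟩
        (θ x + Σθ xs) + (((n · θ x + Σθ xs) + n · ρ) + pairs-sum w xs)
          ≈⟨ solve 5 (λ t s nt nr p → (t ⊕ s) ⊕ (((nt ⊕ s) ⊕ nr) ⊕ p) ⊜ ((t ⊕ s) ⊕ (nt ⊕ nr)) ⊕ (s ⊕ p)) refl _ _ _ _ _ ⟩
        ((θ x + Σθ xs) + (n · θ x + n · ρ)) + (Σθ xs + pairs-sum w xs)
          ≈⟨ +-congˡ (sum-θ xs u) ⟩
        ((θ x + Σθ xs) + (n · θ x + n · ρ)) + (n · Σθ xs + tri n · ρ)
          ≈⟨ solve 6 (λ t s nt nr ns tr → ((t ⊕ s) ⊕ (nt ⊕ nr)) ⊕ (ns ⊕ tr) ⊜ ((t ⊕ s) ⊕ (nt ⊕ ns)) ⊕ (nr ⊕ tr)) refl _ _ _ _ _ _ ⟩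
        ((θ x + Σθ xs) + (n · θ x + n · Σθ xs)) + (n · ρ + tri n · ρ)
          ≈⟨ +-cong (+-congˡ (sym (×-distrib-+ (θ x) (Σθ xs) n))) (sym (×-homo-+ ρ n (tri n))) ⟩
        suc n · (θ x + Σθ xs) + tri (suc n) · ρ ∎
        where n = length xs

      clique-θ : ∀ S → Unique S → length S ≡ k → k₁ · Σθ S + tri k · ρ ≈ 0#
      clique-θ S u len = cancel (Σθ S) (begin
        (k₁ · Σθ S + tri k · ρ) + Σθ S     ≈⟨ solve 3 (λ a b c → (a ⊕ b) ⊕ c ⊜ (c ⊕ a) ⊕ b) refl _ _ _ ⟩
        k · Σθ S + tri k · ρ               ≡⟨ ≡.cong (λ n → n · Σθ S + tri n · ρ) (≡.sym len) ⟩
        length S · Σθ S + tri (length S) · ρ ≈⟨ sym (sum-θ S u) ⟩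
        Σθ S + pairs-sum w S               ≈⟨ +-congˡ (clique S u len) ⟩
        Σθ S + 0#                          ≈⟨ comm _ _ ⟩
        0# + Σθ S                          ∎)

      τ : Carrier
      τ = k₁ · θ zero
      -- Exchanging one vertex of a clique for another does not change its vanishing sum, so k - 1
      -- times θ is constant.
      θ-τ : ∀ x → k₁ · θ x ≈ τ
      θ-τ x with x ≟ zero
      ... | yes ≡.refl = refl
      ... | no n with avoid k₁ (x ∷ zero ∷ []) (ℕ.≤-trans (≡.subst (ℕ._≤ 4 ℕ.+ k₂) (ℕ.+-comm 2 k₁) (ℕ.n≤1+n (3 ℕ.+ k₂))) k+2≤v)
      ... | R , u , len , out = cancel (k₁ · Σθ R + tri k · ρ) (trans (trans (lem x) (clique-θ (x ∷ R) (∉⇒All (out (here ≡.refl)) ∷ u) (≡.cong suc len)))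
              (sym (trans (lem zero) (clique-θ (zero ∷ R) (∉⇒All (out (there (here ≡.refl))) ∷ u) (≡.cong suc len)))))
        where lem : ∀ y → k₁ · θ y + (k₁ · Σθ R + tri k · ρ) ≈ k₁ · (θ y + Σθ R) + tri k · ρ
              lem y = trans (sym (assoc _ _ _)) (+-congʳ (sym (×-distrib-+ (θ y) (Σθ R) k₁)))
      Σθ-τ : ∀ xs → k₁ · Σθ xs ≈ length xs · τ
      Σθ-τ [] = ×-0 k₁
        where ×-0 : ∀ n → n · 0# ≈ 0#
              ×-0 zero = refl
              ×-0 (suc n) = trans (identityˡ _) (×-0 n)
      Σθ-τ (x ∷ xs) = trans (×-distrib-+ (θ x) (Σθ xs) k₁) (+-cong (θ-τ x) (Σθ-τ xs))

      base : k · τ + tri k · ρ ≈ 0#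
      base with avoid k [] (ℕ.≤-trans (ℕ.≤-reflexive (ℕ.+-identityʳ k)) (ℕ.≤-trans (ℕ.m≤n+m k 2) k+2≤v))
      ... | S , u , len , _ = trans (+-congʳ (trans (reflexive (≡.cong (_· τ) (≡.sym len))) (sym (Σθ-τ S)))) (clique-θ S u len)

    -- The sum over all pairs is (v - 1) Σθ plus v over 2 times ρ. The equation v - 1 = a (k - 1)
    -- turns the first part into a v τ, and v a = β k turns the whole into β times the relation
    -- `base`. The admissibility conditions are what makes these quotients integral.
    complete : ∀ a β → 2 ℕ.+ v₂ ≡ a ℕ.* k₁ → (3 ℕ.+ v₂) ℕ.* a ≡ β ℕ.* k → pairs-sum w (allFin v) ≈ 0#
    complete a β eq₁ eq₂ = cancel (Σθ V) (begin
      pairs-sum w V + Σθ V                              ≈⟨ comm _ _ ⟩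
      Σθ V + pairs-sum w V                              ≈⟨ sum-θ V (allFin⁺ v) ⟩
      length V · Σθ V + tri (length V) · ρ              ≡⟨ ≡.cong (λ n → n · Σθ V + tri n · ρ) lenV ⟩
      (Σθ V + (2 ℕ.+ v₂) · Σθ V) + tri v · ρ            ≈⟨ +-cong (+-congˡ (trans (trans (reflexive (≡.cong (_· Σθ V) eq₁)) (sym (×-assocˡ (Σθ V) a k₁))) (×-congʳ a (trans (Σθ-τ V) (reflexive (≡.cong (_· τ) lenV)))))) (reflexive (≡.cong (_· ρ) trieq)) ⟩
      (Σθ V + a · (v · τ)) + (β ℕ.* tri k) · ρ          ≈⟨ +-congʳ (+-congˡ (trans (×-assocˡ τ a v) (reflexive (≡.cong (_· τ) (≡.trans (ℕ.*-comm a v) eq₂))))) ⟩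
      (Σθ V + (β ℕ.* k) · τ) + (β ℕ.* tri k) · ρ        ≈⟨ +-cong (+-congˡ (sym (×-assocˡ τ β k))) (sym (×-assocˡ ρ β (tri k))) ⟩
      (Σθ V + β · (k · τ)) + β · (tri k · ρ)            ≈⟨ trans (assoc _ _ _) (+-congˡ (sym (×-distrib-+ (k · τ) (tri k · ρ) β))) ⟩
      Σθ V + β · (k · τ + tri k · ρ)                    ≈⟨ +-congˡ (trans (×-congʳ β base) (×-0 β)) ⟩
      Σθ V + 0#                                         ≈⟨ comm _ _ ⟩
      0# + Σθ V                                         ∎)
      where
      V = allFin v
      lenV : length V ≡ v
      lenV = length-tabulate {n = v} (λ i → i)
      ×-0 : ∀ n → n · 0# ≈ 0#
      ×-0 zero = refl
      ×-0 (suc n) = trans (identityˡ _) (×-0 n)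
      trieq : tri v ≡ β ℕ.* tri k
      trieq = ℕ.*-cancelʳ-≡ (tri v) (β ℕ.* tri k) 2 (≡.trans (2tri (2 ℕ.+ v₂)) (≡.trans (≡.cong (v ℕ.*_) eq₁)
        (≡.trans (≡.sym (ℕ.*-assoc v a k₁)) (≡.trans (≡.cong (ℕ._* k₁) eq₂) (≡.trans (ℕ.*-assoc β k k₁)
        (≡.trans (≡.cong (β ℕ.*_) (≡.sym (2tri k₁))) (≡.sym (ℕ.*-assoc β (tri k) 2))))))))

-- Lists of k-subsets and their pair counts

module SubsetLists where
  open Blowups using (MultiDesign)
  open PairLattice
  open import Data.Nat as ℕ using (ℕ; zero; suc; _+_; _*_; _≤_; _<_; z≤n; s≤s)
  import Data.Nat.Properties as ℕ
  open import Data.Nat.DivMod using (_mod_; m<n⇒m%n≡m)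
  open import Data.Nat.Tactic.RingSolver using (solve-∀)
  open import Data.Fin as Fin using (Fin; zero; suc; toℕ; cast)
  open import Data.Fin.Properties using (_≟_; suc-injective; toℕ<n; toℕ-injective; toℕ-fromℕ<; toℕ-cast)
  open import Data.List using (List; []; _∷_; length; map; _++_; lookup)
  open import Data.List.Properties using (length-map)
  open import Data.List.Relation.Unary.All as All using (All; []; _∷_)
  import Data.List.Relation.Unary.All.Properties as All
  open import Data.List.Relation.Unary.Any using (here; there; index)
  open import Data.List.Relation.Unary.Any.Properties using (lookup-index)
  open import Data.List.Relation.Unary.AllPairs using ([]; _∷_)
  open import Data.List.Relation.Unary.Unique.Propositional using (Unique)
  open import Data.List.Relation.Unary.Unique.Propositional.Properties using (map⁺)
  open import Data.List.Membership.Propositional using (_∈_; _∉_)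
  open import Data.List.Membership.Propositional.Properties using (∈-∃++; ∈-map⁺; ∈-map⁻; ∈-++⁺ˡ; ∈-++⁺ʳ; ∈-lookup)
  open import Data.List.Relation.Binary.Permutation.Propositional using (_↭_; refl; prep; swap; trans; ↭-sym)
  open import Data.List.Relation.Binary.Permutation.Propositional.Properties using (shift; ∈-resp-↭; ↭-length; All-resp-↭)
  open import Data.Product using (Σ; _×_; _,_; proj₁; proj₂)
  open import Data.Empty using (⊥; ⊥-elim)
  open import Relation.Nullary using (yes; no; Dec)
  open import Relation.Nullary.Decidable using (_×-dec_)
  open import Relation.Binary.Definitions using (DecidableEquality)
  open import Relation.Binary.PropositionalEquality as ≡ using (_≡_; _≢_; cong; cong₂; subst; sym; module ≡-Reasoning)

  module Rank {A : Set} (_≟A_ : DecidableEquality A) where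
    rank : List A → A → ℕ
    rank [] x = 0
    rank (p ∷ ps) x with x ≟A p
    ... | yes _ = 0
    ... | no _ = suc (rank ps x)

    rank< : ∀ {ps x} → x ∈ ps → rank ps x < length ps
    rank< {p ∷ ps} {x} x∈ with x ≟A p
    rank< x∈ | yes _ = s≤s z≤n
    rank< (here e) | no n = ⊥-elim (n e)
    rank< (there x∈) | no n = s≤s (rank< x∈)

    rank-inj : ∀ {ps x y} → x ∈ ps → y ∈ ps → rank ps x ≡ rank ps y → x ≡ y
    rank-inj {p ∷ ps} {x} {y} x∈ y∈ e with x ≟A p | y ≟A p
    rank-inj x∈ y∈ e | yes ≡.refl | yes ≡.refl = ≡.refl
    rank-inj (here e′) y∈ e | no n | no n′ = ⊥-elim (n e′)
    rank-inj (there _) (here e′) e | no n | no n′ = ⊥-elim (n′ e′)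
    rank-inj (there x∈) (there y∈) e | no n | no n′ = rank-inj x∈ y∈ (ℕ.suc-injective e)

    unrank : ∀ {ps n} → Unique ps → n < length ps → Σ A λ x → x ∈ ps × rank ps x ≡ n
    unrank {p ∷ ps} {zero} u lt = p , here ≡.refl , lem
      where lem : rank (p ∷ ps) p ≡ 0
            lem with p ≟A p
            ... | yes _ = ≡.refl
            ... | no n = ⊥-elim (n ≡.refl)
    unrank {p ∷ ps} {suc n} (p∉ ∷ u) (s≤s lt) with unrank u lt
    ... | x , x∈ , e = x , there x∈ , lem
      where lem : rank (p ∷ ps) x ≡ suc n
            lem with x ≟A p
            ... | yes e′ = ⊥-elim (All.lookup p∉ x∈ (sym e′))
            ... | no _ = cong suc e

  binom : ℕ → ℕ → ℕ
  binom n zero = 1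
  binom zero (suc k) = 0
  binom (suc n) (suc k) = binom n k + binom n (suc k)
  -- The numbers n - 1 over k - 1 and n - 2 over k - 2 of k-subsets through one and through two
  -- given points, extended by zero.
  b₁ b₂ : ℕ → ℕ → ℕ
  b₁ (suc n) (suc k) = binom n k
  b₁ _ _ = 0
  b₂ (suc n) (suc k) = b₁ n k
  b₂ _ _ = 0

  b₁-rec : ∀ n k → b₁ (suc n) k + b₁ (suc n) (suc k) ≡ binom (suc n) k
  b₁-rec n zero = ≡.refl
  b₁-rec n (suc k) = ≡.refl
  b₂-rec : ∀ n k → b₂ (suc (suc n)) k + b₂ (suc (suc n)) (suc k) ≡ b₁ (suc (suc n)) k
  b₂-rec n zero = ≡.refl
  b₂-rec n (suc k) = b₁-rec n k

  module _ {v : ℕ} where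
    δ : Fin v → Fin v → ℕ
    δ x i with x ≟ i
    ... | yes _ = 1
    ... | no _ = 0

    χ : List (Fin v) → Fin v → ℕ
    χ [] i = 0
    χ (x ∷ xs) i = δ x i + χ xs i

    cov : List (List (Fin v)) → Fin v → Fin v → ℕ
    cov [] i j = 0
    cov (S ∷ Bs) i j = χ S i * χ S j + cov Bs i j

    Valid : ℕ → List (Fin v) → Set
    Valid k S = Unique S × length S ≡ k

    δ-* : ∀ x {i j} → i ≢ j → δ x i * δ x j ≡ 0
    δ-* x {i} {j} n with x ≟ i | x ≟ j
    ... | yes ≡.refl | yes ≡.refl = ⊥-elim (n ≡.refl)
    ... | yes _ | no _ = ≡.refl
    ... | no _ | _ = ≡.refl

    χ-∉ : ∀ {S i} → i ∉ S → χ S i ≡ 0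
    χ-∉ {[]} i∉ = ≡.refl
    χ-∉ {x ∷ S} {i} i∉ with x ≟ i
    ... | yes e = ⊥-elim (i∉ (here (sym e)))
    ... | no _ = χ-∉ (λ i∈ → i∉ (there i∈))

    χ-∈ : ∀ {S i} → Unique S → i ∈ S → χ S i ≡ 1
    χ-∈ {x ∷ S} {i} (x∉ ∷ u) i∈ with x ≟ i
    χ-∈ {x ∷ S} (x∉ ∷ u) i∈ | yes ≡.refl = cong suc (χ-∉ (λ x∈ → All.lookup x∉ x∈ ≡.refl))
    χ-∈ (x∉ ∷ u) (here e) | no n = ⊥-elim (n (sym e))
    χ-∈ (x∉ ∷ u) (there i∈) | no n = χ-∈ u i∈

    χ-↭ : ∀ {S T} → S ↭ T → ∀ i → χ S i ≡ χ T i
    χ-↭ refl i = ≡.refl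
    χ-↭ (prep x p) i = cong (δ x i +_) (χ-↭ p i)
    χ-↭ (swap x y p) i = ≡.trans (cong (λ z → δ x i + (δ y i + z)) (χ-↭ p i)) (lem (δ x i) (δ y i) _)
      where lem : ∀ a b c → a + (b + c) ≡ b + (a + c)
            lem = solve-∀
    χ-↭ (trans p q) i = ≡.trans (χ-↭ p i) (χ-↭ q i)

    cov-++ : ∀ As Bs i j → cov (As ++ Bs) i j ≡ cov As i j + cov Bs i j
    cov-++ [] Bs i j = ≡.refl
    cov-++ (S ∷ As) Bs i j = ≡.trans (cong (_ +_) (cov-++ As Bs i j)) (sym (ℕ.+-assoc (χ S i * χ S j) _ _))

    open import Data.List.Membership.DecPropositional (_≟_ {v}) using (_∈?_)

    module FromList {k : ℕ} (Bs : List (List (Fin v))) (valid : All (Valid k) Bs) where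
      both? : ∀ S (i j : Fin v) → Dec (i ∈ S × j ∈ S)
      both? S i j = (i ∈? S) ×-dec (j ∈? S)

      -- Positions are collected instead of blocks because blocks may be repeated.
      pos : ∀ Bs (i j : Fin v) → List (Fin (length Bs))
      pos [] i j = []
      pos (S ∷ Bs) i j with both? S i j
      ... | yes _ = zero ∷ map suc (pos Bs i j)
      ... | no _ = map suc (pos Bs i j)

      length-pos : ∀ {Bs} → All (Valid k) Bs → ∀ i j → length (pos Bs i j) ≡ cov Bs i j
      length-pos [] i j = ≡.refl
      length-pos {S ∷ Bs} ((u , _) ∷ us) i j with both? S i j
      ... | yes (i∈ , j∈) rewrite χ-∈ u i∈ | χ-∈ u j∈ = cong suc (≡.trans (length-map suc (pos Bs i j)) (length-pos us i j))
      ... | no n = ≡.trans (length-map suc (pos Bs i j)) (≡.trans (length-pos us i j) (cong (_+ cov Bs i j) (sym zero′)))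
        where zero′ : χ S i * χ S j ≡ 0
              zero′ with i ∈? S | j ∈? S
              ... | yes p | yes q = ⊥-elim (n (p , q))
              ... | no p | _ = cong (_* χ S j) (χ-∉ p)
              ... | yes _ | no q = ≡.trans (cong (χ S i *_) (χ-∉ q)) (ℕ.*-zeroʳ (χ S i))

      pos-unique : ∀ Bs i j → Unique (pos Bs i j)
      pos-unique [] i j = []
      pos-unique (S ∷ Bs) i j with both? S i j
      ... | yes _ = ∉⇒All (λ z∈ → case′ (∈-map⁻ suc z∈)) ∷ map⁺ suc-injective (pos-unique Bs i j)
        where case′ : (Σ (Fin (length Bs)) λ y → y ∈ pos Bs i j × zero ≡ suc y) → ⊥
              case′ (_ , _ , ())
      ... | no _ = map⁺ suc-injective (pos-unique Bs i j)

      pos⁻ : ∀ Bs {i j β} → β ∈ pos Bs i j → i ∈ lookup Bs β × j ∈ lookup Bs β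
      pos⁻ (S ∷ Bs) {i} {j} β∈ with both? S i j
      pos⁻ (S ∷ Bs) (here ≡.refl) | yes p = p
      pos⁻ (S ∷ Bs) (there β∈) | yes p with ∈-map⁻ suc β∈
      ... | β′ , β′∈ , ≡.refl = pos⁻ Bs β′∈
      pos⁻ (S ∷ Bs) β∈ | no _ with ∈-map⁻ suc β∈
      ... | β′ , β′∈ , ≡.refl = pos⁻ Bs β′∈

      pos⁺ : ∀ Bs {i j} β → i ∈ lookup Bs β → j ∈ lookup Bs β → β ∈ pos Bs i j
      pos⁺ (S ∷ Bs) {i} {j} β i∈ j∈ with both? S i j
      pos⁺ (S ∷ Bs) zero i∈ j∈ | yes p = here ≡.refl
      pos⁺ (S ∷ Bs) (suc β) i∈ j∈ | yes p = there (∈-map⁺ suc (pos⁺ Bs β i∈ j∈))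
      pos⁺ (S ∷ Bs) zero i∈ j∈ | no n = ⊥-elim (n (i∈ , j∈))
      pos⁺ (S ∷ Bs) (suc β) i∈ j∈ | no n = ∈-map⁺ suc (pos⁺ Bs β i∈ j∈)

      len : ∀ β → length (lookup Bs β) ≡ k
      len β = proj₂ (All.lookup valid (∈-lookup {xs = Bs} β))

      blk : Fin (length Bs) → Fin k → Fin v
      blk β a = lookup (lookup Bs β) (cast (sym (len β)) a)

      lookup-inj : ∀ {S : List (Fin v)} → Unique S → ∀ {a b} → lookup S a ≡ lookup S b → a ≡ b
      lookup-inj (x∉ ∷ u) {zero} {zero} e = ≡.refl
      lookup-inj (x∉ ∷ u) {zero} {suc b} e = ⊥-elim (All.lookup x∉ (∈-lookup b) e)
      lookup-inj (x∉ ∷ u) {suc a} {zero} e = ⊥-elim (All.lookup x∉ (∈-lookup a) (sym e))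
      lookup-inj (x∉ ∷ u) {suc a} {suc b} e = cong suc (lookup-inj u e)

      cast-inj : ∀ {m n} (eq : m ≡ n) {a b : Fin m} → cast eq a ≡ cast eq b → a ≡ b
      cast-inj eq {a} {b} e = toℕ-injective (≡.trans (sym (toℕ-cast eq a)) (≡.trans (cong toℕ e) (toℕ-cast eq b)))

      ∈⇒blk : ∀ β {i} → i ∈ lookup Bs β → Σ (Fin k) λ a → blk β a ≡ i
      ∈⇒blk β i∈ = cast (len β) (index i∈) , ≡.trans (cong (lookup (lookup Bs β))
        (toℕ-injective (≡.trans (toℕ-cast (sym (len β)) _) (toℕ-cast (len β) (index i∈))))) (sym (lookup-index i∈))

      blk⇒∈ : ∀ β {a i} → blk β a ≡ i → i ∈ lookup Bs β
      blk⇒∈ β {a} ≡.refl = ∈-lookup {xs = lookup Bs β} (cast (sym (len β)) a)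

      open Rank (_≟_ {length Bs})

      multiDesign : ∀ {l} → (∀ {i j} → i ≢ j → cov Bs i j ≡ suc l) → MultiDesign k v (suc l)
      multiDesign {l} cov≡ = record
        { Ix = Fin (length Bs)
        ; blk = blk
        ; blk-inj = λ β e → cast-inj (sym (len β)) (lookup-inj (proj₁ (All.lookup valid (∈-lookup {xs = Bs} β))) e)
        ; lab = lab
        ; find = fnd
        ; only = λ {i} {j} {β} {β′} lt p q p′ q′ e → rank-inj (mem β p q) (mem β′ p′ q′)
            (≡.trans (sym (toℕ-lab (mem β p q) (ne lt))) (≡.trans (cong toℕ e) (toℕ-lab (mem β′ p′ q′) (ne lt)))) }
        where
        ne : ∀ {i j : Fin v} → toℕ i < toℕ j → i ≢ j
        ne lt ≡.refl = ℕ.<-irrefl ≡.refl lt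
        mem : ∀ β {i j a b} → blk β a ≡ i → blk β b ≡ j → β ∈ pos Bs i j
        mem β p q = pos⁺ Bs β (blk⇒∈ β p) (blk⇒∈ β q)
        lenP : ∀ {i j} → i ≢ j → length (pos Bs i j) ≡ suc l
        lenP {i} {j} n = ≡.trans (length-pos valid i j) (cov≡ n)
        -- The label is the rank among the blocks through the pair. There the rank is already below
        -- suc l, and `mod` merely makes the function total.
        lab : Fin (length Bs) → Fin v → Fin v → Fin (suc l)
        lab β i j = rank (pos Bs i j) β mod suc l
        toℕ-lab : ∀ {β i j} → β ∈ pos Bs i j → i ≢ j → toℕ (lab β i j) ≡ rank (pos Bs i j) β
        toℕ-lab {β} {i} {j} β∈ n = ≡.trans (toℕ-fromℕ< _) (m<n⇒m%n≡m (subst (rank (pos Bs i j) β <_) (lenP n) (rank< β∈)))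
        fnd : ∀ {i j} → toℕ i < toℕ j → ∀ t → Σ (Fin (length Bs)) λ β →
          (Σ (Fin k) λ a → blk β a ≡ i) × (Σ (Fin k) λ b → blk β b ≡ j) × lab β i j ≡ t
        fnd {i} {j} lt t with unrank (pos-unique Bs i j) (subst (toℕ t <_) (sym (lenP (ne lt))) (toℕ<n t))
        ... | β , β∈ , e = β , ∈⇒blk β (proj₁ (pos⁻ Bs β∈)) , ∈⇒blk β (proj₂ (pos⁻ Bs β∈))
            , toℕ-injective (≡.trans (toℕ-lab β∈ (ne lt)) e)

    combs : ℕ → List (Fin v) → List (List (Fin v))
    combs zero xs = [] ∷ []
    combs (suc k) [] = []
    combs (suc k) (x ∷ xs) = map (x ∷_) (combs k xs) ++ combs (suc k) xs

    combs-valid : ∀ k xs → Unique xs → All (λ S → Valid k S × (∀ i → i ∈ S → i ∈ xs)) (combs k xs)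
    combs-valid zero xs u = (([] , ≡.refl) , λ _ ()) ∷ []
    combs-valid (suc k) [] u = []
    combs-valid (suc k) (x ∷ xs) (x∉ ∷ u) = All.++⁺
      (All.map⁺ (All.map (λ { ((uS , l) , sub) → (∉⇒All (λ x∈ → All.lookup x∉ (sub _ x∈) ≡.refl) ∷ uS , cong suc l)
        , λ { _ (here e) → here e ; _ (there p) → there (sub _ p) } }) (combs-valid k xs u)))
      (All.map (λ { (val , sub) → val , λ _ p → there (sub _ p) }) (combs-valid (suc k) xs u))

    -- `combs` lists the elements of each subset in the order of `xs`, so a given list is found only
    -- up to permutation.
    combs-∋ : ∀ xs S → Unique S → (∀ {i} → i ∈ S → i ∈ xs) → Σ (List (Fin v)) λ S′ → S′ ∈ combs (length S) xs × S ↭ S′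
    combs-∋ xs [] u sub = [] , here ≡.refl , refl
    combs-∋ [] (y ∷ S) u sub with sub (here ≡.refl)
    ... | ()
    combs-∋ (x ∷ xs) S@(_ ∷ S₀) u sub with x ∈? S
    ... | no n with combs-∋ xs S u (λ {i} i∈ → drop i∈ (sub i∈))
      where drop : ∀ {i} → i ∈ S → i ∈ x ∷ xs → i ∈ xs
            drop i∈ (here ≡.refl) = ⊥-elim (n i∈)
            drop i∈ (there p) = p
    ... | S′ , S′∈ , p = S′ , ∈-++⁺ʳ _ S′∈ , p
    combs-∋ (x ∷ xs) S@(_ ∷ S₀) u sub | yes x∈ with ∈-∃++ x∈
    ... | As , Bs , eq = x ∷ proj₁ IH , ∈-++⁺ˡ (∈-map⁺ (x ∷_) (subst (λ n → proj₁ IH ∈ combs n xs) lenT (proj₁ (proj₂ IH))))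
        , trans S↭ (prep x (proj₂ (proj₂ IH)))
      where
      T = As ++ Bs
      S↭ : S ↭ x ∷ T
      S↭ = subst (_↭ x ∷ T) (sym eq) (shift x As Bs)
      lenT : length T ≡ length S₀
      lenT = ℕ.suc-injective (sym (↭-length S↭))
      uniq-↭ : ∀ {S T : List (Fin v)} → S ↭ T → Unique S → Unique T
      uniq-↭ refl u = u
      uniq-↭ (prep x p) (x∉ ∷ u) = All-resp-↭ p x∉ ∷ uniq-↭ p u
      uniq-↭ (swap x y p) ((xy ∷ x∉) ∷ (y∉ ∷ u)) = ((λ e → xy (sym e)) ∷ All-resp-↭ p y∉) ∷ (All-resp-↭ p x∉ ∷ uniq-↭ p u)
      uniq-↭ (trans p q) u = uniq-↭ q (uniq-↭ p u)
      uxT = uniq-↭ S↭ u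
      subT : Unique (x ∷ T) → ∀ {i} → i ∈ T → i ∈ xs
      subT (x∉ ∷ _) {i} i∈ with sub (∈-resp-↭ (↭-sym S↭) (there i∈))
      ... | here ≡.refl = ⊥-elim (All.lookup x∉ i∈ ≡.refl)
      ... | there p = p
      tl : ∀ {x : Fin v} {xs} → Unique (x ∷ xs) → Unique xs
      tl (_ ∷ u) = u
      IH = combs-∋ xs T (tl uxT) (subT uxT)

    sum₁ : List (List (Fin v)) → Fin v → ℕ
    sum₁ [] i = 0
    sum₁ (S ∷ Bs) i = χ S i + sum₁ Bs i

    private
      sum₁-++ : ∀ As Bs i → sum₁ (As ++ Bs) i ≡ sum₁ As i + sum₁ Bs i
      sum₁-++ [] Bs i = ≡.refl
      sum₁-++ (S ∷ As) Bs i = ≡.trans (cong (χ S i +_) (sum₁-++ As Bs i)) (sym (ℕ.+-assoc (χ S i) _ _))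
      sum₁-map : ∀ x Bs i → sum₁ (map (x ∷_) Bs) i ≡ length Bs * δ x i + sum₁ Bs i
      sum₁-map x [] i = ≡.refl
      sum₁-map x (S ∷ Bs) i = ≡.trans (cong (δ x i + χ S i +_) (sum₁-map x Bs i)) (lem (δ x i) (χ S i) (length Bs) _)
        where lem : ∀ d c n s → d + c + (n * d + s) ≡ suc n * d + (c + s)
              lem = solve-∀
      cov-map : ∀ x Bs {i j} → i ≢ j → cov (map (x ∷_) Bs) i j ≡ (δ x i * sum₁ Bs j + δ x j * sum₁ Bs i) + cov Bs i j
      cov-map x [] {i} {j} n = sym (cong₂ (λ a b → a + b + 0) (ℕ.*-zeroʳ (δ x i)) (ℕ.*-zeroʳ (δ x j)))
      cov-map x (S ∷ Bs) {i} {j} n = ≡.trans (cong ((δ x i + χ S i) * (δ x j + χ S j) +_) (cov-map x Bs n))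
        (≡.trans (lem (δ x i) (δ x j) (χ S i) (χ S j) (sum₁ Bs i) (sum₁ Bs j) (cov Bs i j))
          (cong (_+ ((δ x i * (χ S j + sum₁ Bs j) + δ x j * (χ S i + sum₁ Bs i)) + (χ S i * χ S j + cov Bs i j))) (δ-* x n)))
        where lem : ∀ d e a b s t c → (d + a) * (e + b) + ((d * t + e * s) + c) ≡ d * e + ((d * (b + t) + e * (a + s)) + (a * b + c))
              lem = solve-∀
      length-++ : ∀ (As Bs : List (List (Fin v))) → length (As ++ Bs) ≡ length As + length Bs
      length-++ [] Bs = ≡.refl
      length-++ (_ ∷ As) Bs = cong suc (length-++ As Bs)
      length-combs : ∀ k xs → length (combs k xs) ≡ binom (length xs) k
      length-combs zero xs = binom0 (length xs)
        where binom0 : ∀ n → 1 ≡ binom n 0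
              binom0 zero = ≡.refl
              binom0 (suc n) = ≡.refl
      length-combs (suc k) [] = ≡.refl
      length-combs (suc k) (x ∷ xs) = ≡.trans (length-++ (map (x ∷_) (combs k xs)) _)
        (cong₂ _+_ (≡.trans (length-map (x ∷_) (combs k xs)) (length-combs k xs)) (length-combs (suc k) xs))
      sum₁-combs : ∀ k xs i → sum₁ (combs k xs) i ≡ χ xs i * b₁ (length xs) k
      sum₁-combs zero xs i = sym (≡.trans (cong (χ xs i *_) (z (length xs))) (ℕ.*-zeroʳ (χ xs i)))
        where z : ∀ n → b₁ n 0 ≡ 0
              z zero = ≡.refl
              z (suc n) = ≡.refl
      sum₁-combs (suc k) [] i = ≡.refl
      sum₁-combs (suc k) (x ∷ xs) i = begin
        sum₁ (map (x ∷_) (combs k xs) ++ combs (suc k) xs) i  ≡⟨ sum₁-++ (map (x ∷_) (combs k xs)) _ i ⟩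
        sum₁ (map (x ∷_) (combs k xs)) i + sum₁ (combs (suc k) xs) i
          ≡⟨ cong₂ _+_ (≡.trans (sum₁-map x (combs k xs) i) (cong₂ (λ a b → a * δ x i + b) (length-combs k xs) (sum₁-combs k xs i))) (sum₁-combs (suc k) xs i) ⟩
        (binom n k * δ x i + χ xs i * b₁ n k) + χ xs i * b₁ n (suc k)  ≡⟨ lem₁ (binom n k) (δ x i) (χ xs i) (b₁ n k) (b₁ n (suc k)) ⟩
        δ x i * binom n k + χ xs i * (b₁ n k + b₁ n (suc k))           ≡⟨ cong (δ x i * binom n k +_) (lem₂ xs) ⟩
        δ x i * binom n k + χ xs i * binom n k                         ≡⟨ sym (ℕ.*-distribʳ-+ (binom n k) (δ x i) (χ xs i)) ⟩
        (δ x i + χ xs i) * binom n k                                   ∎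
        where
        open ≡-Reasoning
        n = length xs
        lem₁ : ∀ b d c p q → (b * d + c * p) + c * q ≡ d * b + c * (p + q)
        lem₁ = solve-∀
        lem₂ : ∀ xs → χ xs i * (b₁ (length xs) k + b₁ (length xs) (suc k)) ≡ χ xs i * binom (length xs) k
        lem₂ [] = ≡.refl
        lem₂ (y ∷ ys) = cong (χ (y ∷ ys) i *_) (b₁-rec (length ys) k)

    cov-combs : ∀ k xs {i j} → i ≢ j → cov (combs k xs) i j ≡ (χ xs i * χ xs j) * b₂ (length xs) k
    cov-combs zero xs {i} {j} ne = sym (≡.trans (cong (χ xs i * χ xs j *_) (z (length xs))) (ℕ.*-zeroʳ (χ xs i * χ xs j)))
      where z : ∀ n → b₂ n 0 ≡ 0
            z zero = ≡.refl
            z (suc n) = ≡.refl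
    cov-combs (suc k) [] ne = ≡.refl
    cov-combs (suc k) (x ∷ xs) {i} {j} ne = begin
      cov (map (x ∷_) (combs k xs) ++ combs (suc k) xs) i j  ≡⟨ cov-++ (map (x ∷_) (combs k xs)) _ i j ⟩
      cov (map (x ∷_) (combs k xs)) i j + cov (combs (suc k) xs) i j
        ≡⟨ cong₂ _+_ (≡.trans (cov-map x (combs k xs) ne) (cong₂ _+_ (cong₂ (λ a b → δ x i * a + δ x j * b) (sum₁-combs k xs j) (sum₁-combs k xs i)) (cov-combs k xs ne))) (cov-combs (suc k) xs ne) ⟩
      ((δ x i * (χ xs j * b₁ n k) + δ x j * (χ xs i * b₁ n k)) + χ xs i * χ xs j * b₂ n k) + χ xs i * χ xs j * b₂ n (suc k)
        ≡⟨ lem₁ (δ x i) (δ x j) (χ xs i) (χ xs j) (b₁ n k) (b₂ n k) (b₂ n (suc k)) ⟩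
      (δ x i * χ xs j + δ x j * χ xs i) * b₁ n k + χ xs i * χ xs j * (b₂ n k + b₂ n (suc k))
        ≡⟨ cong ((δ x i * χ xs j + δ x j * χ xs i) * b₁ n k +_) (lem₂ xs) ⟩
      (δ x i * χ xs j + δ x j * χ xs i) * b₁ n k + χ xs i * χ xs j * b₁ n k
        ≡⟨ lem₃ (δ x i) (δ x j) (χ xs i) (χ xs j) (b₁ n k) ⟩
      (0 + (δ x i * χ xs j + δ x j * χ xs i + χ xs i * χ xs j)) * b₁ n k
        ≡⟨ cong (λ z → (z + (δ x i * χ xs j + δ x j * χ xs i + χ xs i * χ xs j)) * b₁ n k) (sym (δ-* x ne)) ⟩
      (δ x i * δ x j + (δ x i * χ xs j + δ x j * χ xs i + χ xs i * χ xs j)) * b₁ n k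
        ≡⟨ lem₄ (δ x i) (δ x j) (χ xs i) (χ xs j) (b₁ n k) ⟩
      (δ x i + χ xs i) * (δ x j + χ xs j) * b₁ n k ∎
      where
      open ≡-Reasoning
      n = length xs
      lem₁ : ∀ d e a b p q r → ((d * (b * p) + e * (a * p)) + a * b * q) + a * b * r ≡ (d * b + e * a) * p + a * b * (q + r)
      lem₁ = solve-∀
      lem₃ : ∀ d e a b p → (d * b + e * a) * p + a * b * p ≡ (0 + (d * b + e * a + a * b)) * p
      lem₃ = solve-∀
      lem₄ : ∀ d e a b p → (d * e + (d * b + e * a + a * b)) * p ≡ (d + a) * (e + b) * p
      lem₄ = solve-∀
      -- The recursion for `b₂` applies from two elements on; in a shorter list the factor χ i · χ j
      -- vanishes for distinct i and j.
      lem₂ : ∀ xs → χ xs i * χ xs j * (b₂ (length xs) k + b₂ (length xs) (suc k)) ≡ χ xs i * χ xs j * b₁ (length xs) k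
      lem₂ [] = ≡.refl
      lem₂ (y ∷ []) = ≡.trans (cong (_* (b₂ 1 k + b₂ 1 (suc k))) z) (cong (_* b₁ 1 k) (sym z))
        where z : (δ y i + 0) * (δ y j + 0) ≡ 0
              z = ≡.trans (cong₂ _*_ (ℕ.+-identityʳ (δ y i)) (ℕ.+-identityʳ (δ y j))) (δ-* y ne)
      lem₂ (y ∷ y′ ∷ ys) = cong (χ (y ∷ y′ ∷ ys) i * χ (y ∷ y′ ∷ ys) j *_) (b₂-rec (length ys) k)

  binom-pos : ∀ n k → k ≤ n → 0 < binom n k
  binom-pos n zero _ = s≤s z≤n
  binom-pos (suc n) (suc k) (s≤s k≤n) = ℕ.<-≤-trans (binom-pos n k k≤n) (ℕ.m≤m+n _ _)

-- Designs with λ a multiple of Λ, or congruent to 1 modulo Λ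

module MultiDesigns where
  open Blowups using (MultiDesign)
  open PairLattice
  open SubsetLists
  open import Level using (0ℓ)
  open import Algebra.Bundles using (AbelianGroup)
  open import Data.Nat as ℕ using (ℕ; zero; suc; _≤_; _<_; z≤n; s≤s)
  import Data.Nat.Properties as ℕ
  open import Data.Nat.Tactic.RingSolver using (solve-∀)
  open import Data.Integer as ℤ using (ℤ; +_; 0ℤ)
  import Data.Integer.Properties as ℤ
  import Data.Integer.Tactic.RingSolver as ℤR
  open import Data.Fin using (Fin)
  open import Data.List using (List; []; _∷_; length; _++_; allFin)
  open import Data.List.Properties using (length-tabulate)
  open import Data.List.Relation.Unary.All as All using (All; []; _∷_)
  import Data.List.Relation.Unary.All.Properties as All
  open import Data.List.Relation.Unary.Unique.Propositional.Properties using (allFin⁺)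
  open import Data.List.Membership.Propositional.Properties using (∈-∃++; ∈-allFin)
  open import Data.Product using (Σ; _×_; _,_; proj₁)
  open import Relation.Binary.PropositionalEquality as ≡ using (_≡_; _≢_; refl; sym; trans; cong; cong₂; subst; module ≡-Reasoning)

  module _ (k v : ℕ) where
    private
      Λ = b₂ v k
      Comp : List (List (Fin v))
      Comp = combs k (allFin v)
      Comp-valid : All (Valid k) Comp
      Comp-valid = All.map proj₁ (combs-valid k (allFin v) (allFin⁺ v))
      χ-all : ∀ i → χ (allFin v) i ≡ 1
      χ-all i = χ-∈ (allFin⁺ v) (∈-allFin i)
      cov-Comp : ∀ {i j} → i ≢ j → cov Comp i j ≡ Λ
      cov-Comp {i} {j} n = trans (cov-combs k (allFin v) n) (trans (cong₂ (λ a b → a ℕ.* b ℕ.* b₂ (length (allFin v)) k) (χ-all i) (χ-all j))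
        (trans (ℕ.+-identityʳ _) (cong (λ n → b₂ n k) (length-tabulate {n = v} (λ i → i)))))

      times : ℕ → List (List (Fin v))
      times zero = []
      times (suc z) = Comp ++ times z
      times-valid : ∀ z → All (Valid k) (times z)
      times-valid zero = []
      times-valid (suc z) = All.++⁺ Comp-valid (times-valid z)
      cov-times : ∀ z {i j} → i ≢ j → cov (times z) i j ≡ z ℕ.* Λ
      cov-times zero n = refl
      cov-times (suc z) {i} {j} n = trans (cov-++ Comp (times z) i j) (cong₂ ℕ._+_ (cov-Comp n) (cov-times z n))

      fromList : ∀ {l} → 0 < l → (Bs : List (List (Fin v))) → All (Valid k) Bs → (∀ {i j} → i ≢ j → cov Bs i j ≡ l) → MultiDesign k v l
      fromList (s≤s _) Bs val h = FromList.multiDesign Bs val h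

      -- The device against negative coefficients: removing a block is the same, up to the constant
      -- function Λ, as adding all other k-subsets.
      complement : ∀ (P : List (List (Fin v))) → All (Valid k) P → Σ (List (List (Fin v))) λ C → All (Valid k) C ×
        (∀ {i j} → i ≢ j → cov C i j ℕ.+ cov P i j ≡ length P ℕ.* Λ)
      complement [] [] = [] , [] , λ _ → refl
      complement (S ∷ P) ((uS , lS) ∷ val) with complement P val | combs-∋ (allFin v) S uS (λ {i} _ → ∈-allFin i)
      ... | C , valC , h | S′ , S′∈ , p with ∈-∃++ (subst (λ n → S′ Data.List.Membership.Propositional.∈ combs n (allFin v)) lS S′∈)
        where import Data.List.Membership.Propositional
      ... | As , Bs , eq = (As ++ Bs) ++ C , All.++⁺ (All.++⁺ (All.++⁻ˡ As v′) (tl (All.++⁻ʳ As v′))) valC , λ {i} {j} n → begin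
          cov ((As ++ Bs) ++ C) i j ℕ.+ (χ S i ℕ.* χ S j ℕ.+ cov P i j)
            ≡⟨ cong₂ ℕ._+_ (trans (cov-++ (As ++ Bs) C i j) (cong (ℕ._+ cov C i j) (cov-++ As Bs i j)))
                 (cong (ℕ._+ cov P i j) (cong₂ ℕ._*_ (χ-↭ p i) (χ-↭ p j))) ⟩
          ((cov As i j ℕ.+ cov Bs i j) ℕ.+ cov C i j) ℕ.+ (χ S′ i ℕ.* χ S′ j ℕ.+ cov P i j)
            ≡⟨ lem (cov As i j) (cov Bs i j) (cov C i j) (χ S′ i ℕ.* χ S′ j) (cov P i j) ⟩
          (cov As i j ℕ.+ (χ S′ i ℕ.* χ S′ j ℕ.+ cov Bs i j)) ℕ.+ (cov C i j ℕ.+ cov P i j)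
            ≡⟨ cong₂ ℕ._+_ (trans (sym (cov-++ As (S′ ∷ Bs) i j)) (trans (cong (λ z → cov z i j) (sym eq)) (cov-Comp n))) (h n) ⟩
          Λ ℕ.+ length P ℕ.* Λ ∎
        where
        open ≡-Reasoning
        v′ : All (Valid k) (As ++ S′ ∷ Bs)
        v′ = subst (All (Valid k)) eq Comp-valid
        tl : ∀ {x xs} → All (Valid k) (x ∷ xs) → All (Valid k) xs
        tl (_ ∷ xs) = xs
        lem : ∀ a b c s p → ((a ℕ.+ b) ℕ.+ c) ℕ.+ (s ℕ.+ p) ≡ (a ℕ.+ (s ℕ.+ b)) ℕ.+ (c ℕ.+ p)
        lem = solve-∀

    completeMultiDesign : ∀ z → 0 < z ℕ.* b₂ v k → MultiDesign k v (z ℕ.* b₂ v k)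
    completeMultiDesign z pos = fromList pos (times z) (times-valid z) (cov-times z)

    Fun = Fin v → Fin v → ℤ
    -- Congruence modulo the lattice spanned by the k-subsets, restricted to pairs off the diagonal.
    -- The positive and the negative coefficients are kept in two lists.
    _∼_ : Fun → Fun → Set
    y ∼ y′ = Σ (List (List (Fin v))) λ P → Σ (List (List (Fin v))) λ N → All (Valid k) P × All (Valid k) N ×
      (∀ {i j} → i ≢ j → y i j ℤ.+ + cov P i j ≡ y′ i j ℤ.+ + cov N i j)
    pw : ∀ {y y′ : Fun} → (∀ i j → y i j ≡ y′ i j) → y ∼ y′
    pw h = [] , [] , [] , [] , λ {i} {j} _ → cong (ℤ._+ 0ℤ) (h i j)
    cov-++ℤ : ∀ (As Bs : List (List (Fin v))) i j → + cov (As ++ Bs) i j ≡ + cov As i j ℤ.+ + cov Bs i j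
    cov-++ℤ As Bs i j = trans (cong +_ (cov-++ As Bs i j)) (ℤ.pos-+ (cov As i j) (cov Bs i j))
    ∼-trans : ∀ {x y z} → x ∼ y → y ∼ z → x ∼ z
    ∼-trans {x} {y} {z} (P , N , vP , vN , h) (P′ , N′ , vP′ , vN′ , h′) = P ++ P′ , N ++ N′ , All.++⁺ vP vP′ , All.++⁺ vN vN′ ,
      λ {i} {j} n → trans (cong (λ t → x i j ℤ.+ t) (cov-++ℤ P P′ i j)) (trans (a₁ (x i j) (+ cov P i j) (+ cov P′ i j))
        (trans (cong (ℤ._+ + cov P′ i j) (h n)) (trans (a₂ (y i j) (+ cov N i j) (+ cov P′ i j)) (trans (cong (ℤ._+ + cov N i j) (h′ n))
          (trans (a₃ (z i j) (+ cov N i j) (+ cov N′ i j)) (cong (λ t → z i j ℤ.+ t) (sym (cov-++ℤ N N′ i j))))))))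
      where
      a₁ : ∀ x p q → x ℤ.+ (p ℤ.+ q) ≡ (x ℤ.+ p) ℤ.+ q
      a₁ = ℤR.solve-∀
      a₂ : ∀ x p q → (x ℤ.+ p) ℤ.+ q ≡ (x ℤ.+ q) ℤ.+ p
      a₂ = ℤR.solve-∀
      a₃ : ∀ x p q → (x ℤ.+ q) ℤ.+ p ≡ x ℤ.+ (p ℤ.+ q)
      a₃ = ℤR.solve-∀
    ∼-+ : ∀ {x x′ y y′ : Fun} → x ∼ x′ → y ∼ y′ → (λ i j → x i j ℤ.+ y i j) ∼ (λ i j → x′ i j ℤ.+ y′ i j)
    ∼-+ {x} {x′} {y} {y′} (P , N , vP , vN , h) (P′ , N′ , vP′ , vN′ , h′) = P ++ P′ , N ++ N′ , All.++⁺ vP vP′ , All.++⁺ vN vN′ ,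
      λ {i} {j} n → trans (cong (λ t → (x i j ℤ.+ y i j) ℤ.+ t) (cov-++ℤ P P′ i j)) (trans (a (x i j) (y i j) (+ cov P i j) (+ cov P′ i j))
        (trans (cong₂ ℤ._+_ (h n) (h′ n)) (trans (sym (a (x′ i j) (y′ i j) (+ cov N i j) (+ cov N′ i j)))
          (cong (λ t → (x′ i j ℤ.+ y′ i j) ℤ.+ t) (sym (cov-++ℤ N N′ i j))))))
      where
      a : ∀ x y p q → (x ℤ.+ y) ℤ.+ (p ℤ.+ q) ≡ (x ℤ.+ p) ℤ.+ (y ℤ.+ q)
      a = ℤR.solve-∀
    ∼-neg : ∀ {x x′ : Fun} → x ∼ x′ → (λ i j → ℤ.- x i j) ∼ (λ i j → ℤ.- x′ i j)
    ∼-neg {x} {x′} (P , N , vP , vN , h) = N , P , vN , vP , λ {i} {j} n → trans (a (x i j) (+ cov P i j) (+ cov N i j))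
        (trans (cong (λ t → ℤ.- t ℤ.+ (+ cov P i j ℤ.+ + cov N i j)) (h n)) (b (x′ i j) (+ cov P i j) (+ cov N i j)))
      where
      a : ∀ x p n → ℤ.- x ℤ.+ n ≡ ℤ.- (x ℤ.+ p) ℤ.+ (p ℤ.+ n)
      a = ℤR.solve-∀
      b : ∀ x p n → ℤ.- (x ℤ.+ n) ℤ.+ (p ℤ.+ n) ≡ ℤ.- x ℤ.+ p
      b = ℤR.solve-∀

    Quot : AbelianGroup 0ℓ 0ℓ
    Quot = record
      { Carrier = Fun ; _≈_ = _∼_ ; _∙_ = λ x y i j → x i j ℤ.+ y i j ; ε = λ _ _ → 0ℤ ; _⁻¹ = λ x i j → ℤ.- x i j
      ; isAbelianGroup = record
        { isGroup = record
          { isMonoid = record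
            { isSemigroup = record
              { isMagma = record
                { isEquivalence = record
                  { refl = λ {x} → pw {x} {x} (λ _ _ → refl)
                  ; sym = λ { {x} {y} (P , N , vP , vN , h) → N , P , vN , vP , λ n → sym (h n) }
                  ; trans = λ {x} {y} {z} → ∼-trans {x} {y} {z} }
                ; ∙-cong = λ {x} {y} {u} {t} → ∼-+ {x} {y} {u} {t} }
              ; assoc = λ x y z → pw (λ i j → ℤ.+-assoc (x i j) (y i j) (z i j)) }
            ; identity = (λ x → pw (λ i j → ℤ.+-identityˡ (x i j))) , (λ x → pw (λ i j → ℤ.+-identityʳ (x i j))) }
          ; inverse = (λ x → pw (λ i j → ℤ.+-inverseˡ (x i j))) , (λ x → pw (λ i j → ℤ.+-inverseʳ (x i j)))
          ; ⁻¹-cong = λ {x} {y} → ∼-neg {x} {y} }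
        ; comm = λ x y → pw (λ i j → ℤ.+-comm (x i j) (y i j)) } }

    open PairSums Quot using (row; pairs-sum)
    w : Fin v → Fin v → Fun
    w x y i j = + (δ x i ℕ.* δ y j ℕ.+ δ x j ℕ.* δ y i)
    w-sym : ∀ x y → w x y ∼ w y x
    w-sym x y = pw {w x y} {w y x} (λ i j → cong +_ (lem (δ x i) (δ y j) (δ x j) (δ y i)))
      where lem : ∀ a b c d → a ℕ.* b ℕ.+ c ℕ.* d ≡ d ℕ.* c ℕ.+ b ℕ.* a
            lem = solve-∀
    row-w : ∀ x S i j → row w x S i j ≡ + (δ x i ℕ.* χ S j ℕ.+ δ x j ℕ.* χ S i)
    row-w x [] i j = cong +_ (sym (cong₂ ℕ._+_ (ℕ.*-zeroʳ (δ x i)) (ℕ.*-zeroʳ (δ x j))))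
    row-w x (y ∷ S) i j = trans (cong (λ t → w x y i j ℤ.+ t) (row-w x S i j)) (cong +_ (lem (δ x i) (δ x j) (δ y i) (δ y j) (χ S i) (χ S j)))
      where lem : ∀ a b c d s t → (a ℕ.* d ℕ.+ b ℕ.* c) ℕ.+ (a ℕ.* t ℕ.+ b ℕ.* s) ≡ a ℕ.* (d ℕ.+ t) ℕ.+ b ℕ.* (c ℕ.+ s)
            lem = solve-∀
    sum-w : ∀ S {i j} → i ≢ j → pairs-sum w S i j ≡ + (χ S i ℕ.* χ S j)
    sum-w [] n = refl
    sum-w (x ∷ S) {i} {j} n = trans (cong₂ ℤ._+_ (row-w x S i j) (sum-w S n)) (cong +_ (trans (cong (ℕ._+ ((δ x i ℕ.* χ S j ℕ.+ δ x j ℕ.* χ S i) ℕ.+ χ S i ℕ.* χ S j)) (sym (δ-* x n)))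
        (lem (δ x i) (δ x j) (χ S i) (χ S j))))
      where lem : ∀ a b s t → a ℕ.* b ℕ.+ ((a ℕ.* t ℕ.+ b ℕ.* s) ℕ.+ s ℕ.* t) ≡ (a ℕ.+ s) ℕ.* (b ℕ.+ t)
            lem = solve-∀
    clique : ∀ S → Valid k S → pairs-sum w S ∼ (λ _ _ → 0ℤ)
    clique S val = [] , (S ∷ []) , [] , (val ∷ []) , λ {i} {j} n → trans (ℤ.+-identityʳ _) (trans (sum-w S n)
      (trans (cong +_ (sym (ℕ.+-identityʳ _))) (sym (ℤ.+-identityˡ _))))

    -- The hypothesis writes the constant 1 as the coverage of `N` minus that of `P`. Replacing - P
    -- by its complement adds `length P` times Λ, and copies of the family of all k-subsets supply
    -- every larger z.
    signed : pairs-sum w (allFin v) ∼ (λ _ _ → 0ℤ) → Σ ℕ λ z₀ → ∀ z → z₀ ≤ z → MultiDesign k v (suc (z ℕ.* b₂ v k))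
    signed (P , N , vP , vN , eq) with complement P vP
    ... | C , vC , hC = length P , λ z le → fromList (s≤s z≤n) (N ++ (C ++ times (z ℕ.∸ length P)))
            (All.++⁺ vN (All.++⁺ vC (times-valid (z ℕ.∸ length P)))) (λ {i} {j} n → begin
          cov (N ++ (C ++ times (z ℕ.∸ length P))) i j
            ≡⟨ trans (cov-++ N _ i j) (cong (cov N i j ℕ.+_) (trans (cov-++ C _ i j) (cong (cov C i j ℕ.+_) (cov-times (z ℕ.∸ length P) n)))) ⟩
          cov N i j ℕ.+ (cov C i j ℕ.+ (z ℕ.∸ length P) ℕ.* Λ)
            ≡⟨ cong (ℕ._+ (cov C i j ℕ.+ (z ℕ.∸ length P) ℕ.* Λ)) (sym (one n)) ⟩
          suc (cov P i j) ℕ.+ (cov C i j ℕ.+ (z ℕ.∸ length P) ℕ.* Λ)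
            ≡⟨ lem (cov P i j) (cov C i j) ((z ℕ.∸ length P) ℕ.* Λ) ⟩
          suc ((cov C i j ℕ.+ cov P i j) ℕ.+ (z ℕ.∸ length P) ℕ.* Λ)
            ≡⟨ cong (λ t → suc (t ℕ.+ (z ℕ.∸ length P) ℕ.* Λ)) (hC n) ⟩
          suc (length P ℕ.* Λ ℕ.+ (z ℕ.∸ length P) ℕ.* Λ)
            ≡⟨ cong suc (trans (sym (ℕ.*-distribʳ-+ Λ (length P) (z ℕ.∸ length P))) (cong (ℕ._* Λ) (ℕ.m+[n∸m]≡n le))) ⟩
          suc (z ℕ.* Λ) ∎)
        where
        open ≡-Reasoning
        lem : ∀ p c t → suc p ℕ.+ (c ℕ.+ t) ≡ suc ((c ℕ.+ p) ℕ.+ t)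
        lem = solve-∀
        one : ∀ {i j} → i ≢ j → suc (cov P i j) ≡ cov N i j
        one {i} {j} n = ℤ.+-injective (trans (cong (λ t → + t ℤ.+ + cov P i j) (sym (cong₂ ℕ._*_ (χ-all i) (χ-all j))))
          (trans (cong (ℤ._+ + cov P i j) (sym (sum-w (allFin v) n))) (trans (eq n) (ℤ.+-identityˡ _))))

  multiDesign : ∀ k₂ v₂ a β → 4 ℕ.+ k₂ ≤ 3 ℕ.+ v₂ → 2 ℕ.+ v₂ ≡ a ℕ.* (1 ℕ.+ k₂) → (3 ℕ.+ v₂) ℕ.* a ≡ β ℕ.* (2 ℕ.+ k₂) →
    Σ ℕ λ z₀ → ∀ z → z₀ ≤ z → MultiDesign (2 ℕ.+ k₂) (3 ℕ.+ v₂) (suc (z ℕ.* b₂ (3 ℕ.+ v₂) (2 ℕ.+ k₂)))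
  multiDesign k₂ v₂ a β le eq₁ eq₂ = signed (2 ℕ.+ k₂) (3 ℕ.+ v₂)
    (Lattice.complete (Quot k v) k₂ v₂ le (w k v) (w-sym k v) (λ S u l → clique k v S (u , l)) a β eq₁ eq₂)
    where k = 2 ℕ.+ k₂
          v = 3 ℕ.+ v₂

-- Fermat's theorem and the number of roots of a polynomial

module FiniteFields where
  open Fields
  open import Data.Nat as ℕ using (ℕ; zero; suc; _≤_; _<_; z≤n; s≤s)
  import Data.Nat.Properties as ℕ
  open import Data.Fin using (Fin; zero; suc; punchIn)
  open import Data.Fin.Properties using (punchInᵢ≢i)
  open import Data.Fin.Permutation using (Permutation; permutation)
  open import Data.List using (List; []; _∷_; length)
  open import Data.List.Relation.Unary.All as All using (All; []; _∷_)
  open import Data.List.Relation.Unary.AllPairs using ([]; _∷_)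
  open import Data.List.Relation.Unary.Unique.Propositional using (Unique)
  open import Data.Product using (_,_)
  open import Data.Empty using (⊥-elim)
  open import Relation.Nullary using (yes; no)
  open import Relation.Binary.PropositionalEquality using (_≡_; _≢_; refl; sym; trans; cong; cong₂)
  open import Function.Bundles using (Inverse)
  open import Algebra.Bundles using (CommutativeRing)
  import Algebra.Properties.CommutativeMonoid.Sum as Sum
  import Algebra.Properties.Semiring.Exp as Exp
  import Algebra.Properties.CommutativeSemiring.Exp as CExp

  module FieldTheory {m′ : ℕ} (K : Field (suc m′)) where
    open Field K
    open CommutativeRing commutativeRing using (*-commutativeMonoid; semiring; commutativeSemiring)
    open Exp semiring public using (_^_; ^-assocʳ)
    open CExp commutativeSemiring public using (^-distrib-*)
    private
      module Π = Sum *-commutativeMonoid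
      open Inverse size using (to; from; inverseˡ; inverseʳ)
      from-to : ∀ x → from (to x) ≡ x
      from-to x = inverseʳ refl

    private
      -- Puts the factor 1 at y = 0, so that a product over the nonzero y can run over the whole
      -- field.
      star : Carrier → Carrier → Carrier
      star x y with y ≟F 0#
      ... | yes _ = 1#
      ... | no _ = x
      star0 : ∀ x → star x 0# ≡ 1#
      star0 x with 0# ≟F 0#
      ... | yes _ = refl
      ... | no n = ⊥-elim (n refl)
      star≢ : ∀ x {y} → y ≢ 0# → star x y ≡ x
      star≢ x {y} n with y ≟F 0#
      ... | yes e = ⊥-elim (n e)
      ... | no _ = refl

    -- Multiplication by x permutes the nonzero elements; compare the products of all of them.
    fermat : ∀ {x} → x ≢ 0# → x ^ m′ ≡ 1#
    fermat {x} x≢0 = *-cancelˡ P≢0 (trans (*-comm P _) (trans (sym step) (sym (*-identityʳ P))))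
      where
      f : Fin (suc m′) → Carrier
      f i = star (from i) (from i)
      g : Fin (suc m′) → Carrier
      g i = star x (from i)
      P = Π.sum f
      prod≢0 : ∀ n (h : Fin n → Carrier) → (∀ i → h i ≢ 0#) → Π.sum h ≢ 0#
      prod≢0 zero h nz = 1≢0
      prod≢0 (suc n) h nz = *-nonzero (nz zero) (prod≢0 n (λ i → h (suc i)) (λ i → nz (suc i)))
      P≢0 : P ≢ 0#
      P≢0 = prod≢0 (suc m′) f nz
        where nz : ∀ i → f i ≢ 0#
              nz i with from i ≟F 0#
              ... | yes _ = 1≢0
              ... | no n = n
      xix : ∀ y → x * (inv x * y) ≡ y
      xix y = trans (sym (*-assoc x _ y)) (trans (cong (_* y) (inv-ok x≢0)) (*-identityˡ y))
      ixx : ∀ y → inv x * (x * y) ≡ y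
      ixx y = trans (sym (*-assoc _ x y)) (trans (cong (_* y) (trans (*-comm _ x) (inv-ok x≢0))) (*-identityˡ y))
      π : Permutation (suc m′) (suc m′)
      π = permutation (λ i → to (x * from i)) (λ i → to (inv x * from i))
        (λ i → trans (cong (λ z → to (x * z)) (from-to _)) (trans (cong to (xix (from i))) (inverseˡ refl)))
        (λ i → trans (cong (λ z → to (inv x * z)) (from-to _)) (trans (cong to (ixx (from i))) (inverseˡ refl)))
      fπ : ∀ i → f (to (x * from i)) ≡ g i * f i
      fπ i = trans (cong (λ z → star z z) (from-to _)) lem
        where lem : star (x * from i) (x * from i) ≡ star x (from i) * star (from i) (from i)
              lem with from i ≟F 0#
              ... | yes e = trans (trans (cong (star _) (trans (cong (x *_) e) (zeroʳ x))) (star0 _)) (sym (*-identityˡ 1#))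
              ... | no n = star≢ _ (*-nonzero x≢0 n)
      i₀ = to 0#
      prod-g : Π.sum g ≡ x ^ m′
      prod-g = trans (Π.sum-remove {i = i₀} g) (trans (cong₂ _*_ (trans (cong (star x) (from-to 0#)) (star0 x))
        (Π.sum-cong-≗ {m′} {λ j → g (punchIn i₀ j)} {λ _ → x} (λ j → star≢ x (λ e → punchInᵢ≢i i₀ j (trans (sym (inverseˡ refl)) (cong to e))))))
        (trans (*-identityˡ _) (Π.sum-replicate m′)))
      step : P ≡ x ^ m′ * P
      step = trans (Π.sum-permute f π) (trans (Π.sum-cong-≗ fπ) (trans (Π.∑-distrib-+ g f) (cong (_* P) prod-g)))

    eval : List Carrier → Carrier → Carrier
    eval [] x = 0#
    eval (a ∷ p) x = a + x * eval p x

    -- Division by X − r with remainder: p = p(r) + (X − r) · quot r p.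
    quot : Carrier → List Carrier → List Carrier
    quot r [] = []
    quot r (a ∷ []) = []
    quot r (a ∷ b ∷ p) = eval (b ∷ p) r ∷ quot r (b ∷ p)

    quot-ok : ∀ r p x → eval p x ≡ eval p r + (x + - r) * eval (quot r p) x
    quot-ok r [] x = sym (trans (+-identityˡ _) (zeroʳ _))
    quot-ok r (a ∷ []) x = solve 3 (λ a x r → a :+ x :* con (ℤ.+ 0) := (a :+ r :* con (ℤ.+ 0)) :+ (x :+ (:- r)) :* con (ℤ.+ 0)) refl a x r
      where import Data.Integer as ℤ
    quot-ok r (a ∷ b ∷ p) x = trans (cong (λ z → a + x * z) (quot-ok r (b ∷ p) x))
      (solve 5 (λ a x r e q → a :+ x :* (e :+ (x :+ (:- r)) :* q) := (a :+ r :* e) :+ (x :+ (:- r)) :* (e :+ x :* q)) refl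
        a x r (eval (b ∷ p) r) (eval (quot r (b ∷ p)) x))

    last : List Carrier → Carrier
    last [] = 0#
    last (a ∷ []) = a
    last (a ∷ b ∷ p) = last (b ∷ p)

    last-quot : ∀ r a b p → last (quot r (a ∷ b ∷ p)) ≡ last (b ∷ p)
    last-quot r a b [] = trans (cong (b +_) (zeroʳ r)) (+-identityʳ b)
    last-quot r a b (c ∷ p) = last-quot r b c p
    length-quot : ∀ r a p → length (quot r (a ∷ p)) ≡ length p
    length-quot r a [] = refl
    length-quot r a (b ∷ p) = cong suc (length-quot r b p)

    roots-≤ : ∀ n p → length p ≡ suc n → last p ≢ 0# → ∀ {rs} → Unique rs → All (λ r → eval p r ≡ 0#) rs → length rs ≤ n
    roots-≤ n p len lst {[]} u a = z≤n
    roots-≤ zero (a ∷ []) len lst {r ∷ rs} u (e ∷ _) = ⊥-elim (lst (trans (sym (trans (cong (a +_) (zeroʳ r)) (+-identityʳ a))) e))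
    roots-≤ (suc n) (a ∷ b ∷ p) len lst {r ∷ rs} (r∉ ∷ u) (e ∷ es) =
      s≤s (roots-≤ n (quot r (a ∷ b ∷ p)) (trans (length-quot r a (b ∷ p)) (ℕ.suc-injective len)) (λ z → lst (trans (sym (last-quot r a b p)) z)) u
        (All.zipWith (λ { {x} (n , ex) → root x n ex }) (r∉ , es)))
      where
      root : ∀ x → r ≢ x → eval (a ∷ b ∷ p) x ≡ 0# → eval (quot r (a ∷ b ∷ p)) x ≡ 0#
      root x n ex = *-cancelˡ {x + - r} (λ z → n (sym (sub≡0 z)))
        (trans (sym (trans (quot-ok r (a ∷ b ∷ p) x) (trans (cong (_+ (x + - r) * eval (quot r (a ∷ b ∷ p)) x) e) (+-identityˡ _))))
          (trans ex (sym (zeroʳ _))))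

    private
      mono : ℕ → List Carrier
      mono zero = 1# ∷ []
      mono (suc n) = 0# ∷ mono n
      eval-mono : ∀ n x → eval (mono n) x ≡ x ^ n
      eval-mono zero x = trans (cong (1# +_) (zeroʳ x)) (+-identityʳ 1#)
      eval-mono (suc n) x = trans (+-identityˡ _) (cong (x *_) (eval-mono n x))
      last-mono : ∀ n a → last (a ∷ mono n) ≡ 1#
      last-mono zero a = refl
      last-mono (suc n) a = last-mono n 0#
      length-mono : ∀ n → length (mono n) ≡ suc n
      length-mono zero = refl
      length-mono (suc n) = cong suc (length-mono n)

    power-roots-≤ : ∀ n c → 0 < n → ∀ {rs} → Unique rs → All (λ r → r ^ n ≡ c) rs → length rs ≤ n
    power-roots-≤ (suc n) c _ u a = roots-≤ (suc n) (- c ∷ mono n) (cong suc (length-mono n)) (λ e → 1≢0 (trans (sym (last-mono n _)) e)) u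
      (All.map (λ {r} e → trans (cong (- c +_) (trans (cong (r *_) (eval-mono n r)) e)) (-‿inverseˡ c)) a)

-- Infinitely many primes congruent to 1 modulo N

module PrimesInProgression where
  open Fields
  open FiniteFields
  open import Data.Nat using (ℕ; zero; suc; _+_; _*_; _∸_; _^_; _≤_; _<_; z≤n; s≤s; NonZero; _!; >-nonZero; ≢-nonZero)
  open import Data.Nat.Properties
  open import Data.Nat.DivMod using (_%_; _/_; _mod_; m≡m%n+[m/n]*n; m<n⇒m%n≡m)
  open import Data.Nat.Divisibility
  open import Data.Nat.GCD using (gcd; gcd[m,n]∣m; gcd[m,n]∣n; gcd-greatest; gcd-GCD; gcd-comm; module Bézout; c*gcd[m,n]≡gcd[cm,cn]; gcd[m,n]≡0⇒m≡0)
  open import Data.Nat.LCM using (lcm; m∣lcm[m,n]; n∣lcm[m,n]; lcm-least; gcd*lcm)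
  open import Data.Nat.Coprimality using (Coprime; coprime-divisor; gcd≡1⇒coprime)
  open import Data.Nat.Primality using (Prime; prime?; prime⇒irreducible; prime⇒nonZero; euclidsLemma; ¬prime[1])
  open import Data.Nat.Primality.Factorisation using (factorise)
  open import Data.Nat.ListAction using (product)
  open import Data.Nat.Tactic.RingSolver using (solve-∀)
  open import Data.Fin using (toℕ)
  open import Data.Fin.Properties using (toℕ-fromℕ<)
  open import Data.List using (List; []; _∷_; filter; upTo; map)
  open import Data.List.Relation.Unary.All as All using (All; []; _∷_)
  open import Data.List.Relation.Unary.All.Properties using (all-filter)
  open import Data.List.Relation.Unary.AllPairs using ([]; _∷_)
  open import Data.List.Relation.Unary.Any using (here; there)
  open import Data.List.Relation.Unary.Unique.Propositional using (Unique)
  open import Data.List.Relation.Unary.Unique.Propositional.Properties using (filter⁺; upTo⁺)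
  open import Data.List.Membership.Propositional using (_∈_)
  open import Data.List.Membership.Propositional.Properties using (∈-filter⁺; ∈-upTo⁺)
  open import Data.Product using (Σ; _×_; _,_; proj₁; proj₂)
  open import Data.Sum using (inj₁; inj₂)
  open import Data.Empty using (⊥-elim)
  open import Relation.Nullary using (¬_)
  open import Relation.Binary.PropositionalEquality using (_≡_; _≢_; refl; sym; trans; cong; cong₂; subst)

  binomial₂ : ∀ z r → Σ ℕ λ t → (1 + z) ^ r ≡ 1 + z * (r + z * t)
  binomial₂ z zero = 0 , sym (cong suc (trans (cong (z *_) (*-zeroʳ z)) (*-zeroʳ z)))
  binomial₂ z (suc r) with binomial₂ z r
  ... | t , e = r + t + z * t , trans (cong ((1 + z) *_) e) (lem z r t)
    where lem : ∀ z r t → (1 + z) * (1 + z * (r + z * t)) ≡ 1 + z * (suc r + z * (r + t + z * t))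
          lem = solve-∀

  prime-factor : ∀ n → 1 < n → Σ ℕ λ q → Prime q × q ∣ n
  prime-factor (suc n) lt with factorise (suc n)
  ... | record { factors = [] ; isFactorisation = e } = ⊥-elim (<-irrefl (sym e) lt)
  ... | record { factors = p ∷ ps ; isFactorisation = e ; factorsPrime = pr ∷ _ } = p , pr , subst (p ∣_) (sym e) (m∣m*n (product ps))

  fermatℕ : ∀ {q x} → Prime q → ¬ q ∣ x → q ∣ x ^ (q ∸ 1) ∸ 1
  fermatℕ {zero} pr = ⊥-elim (NonZero.nonZero (prime⇒nonZero pr))
  fermatℕ {suc m′} {x} pr q∤x = divides (x ^ m′ / suc m′) (cong (_∸ 1) (trans (m≡m%n+[m/n]*n (x ^ m′) (suc m′)) (cong (_+ x ^ m′ / suc m′ * suc m′) one)))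
    where
    q = suc m′
    K = ℤ/_ q pr
    open Field K using (0#) renaming (_*_ to _⊛_)
    open FieldTheory K using (fermat) renaming (_^_ to _^K_)
    tm : ∀ n → toℕ (n mod q) ≡ n % q
    tm n = toℕ-fromℕ< _
    nz : x mod q ≢ 0#
    nz e = q∤x (divides (x / q) (trans (m≡m%n+[m/n]*n x q) (cong (_+ x / q * q) (trans (sym (tm x)) (trans (cong toℕ e) (tm 0))))))
    pow : ∀ n → (x mod q) ^K n ≡ (x ^ n) mod q
    pow zero = refl
    pow (suc n) = trans (cong ((x mod q) ⊛_) (pow n)) (mod-* q pr x (x ^ n))
    one : x ^ m′ % q ≡ 1
    one = trans (sym (tm (x ^ m′))) (trans (cong toℕ (trans (sym (pow m′)) (fermat nz))) (trans (tm 1) (m<n⇒m%n≡m (prime>1 pr))))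

  -- In the distributive lattice of divisibility a divisor d of lcm a b is the lcm of gcd a d and
  -- gcd b d. The proof cancels common factors and works with coprime quotients.
  lcm-distrib : ∀ {d a b M} → 0 < d → 0 < a → d ∣ lcm a b → gcd a d ∣ M → gcd b d ∣ M → d ∣ M
  lcm-distrib {d} {a} {b} {M} d>0 a>0 d∣ g₁∣M g₂∣M with gcd[m,n]∣n a d | gcd[m,n]∣m a d
  ... | divides d₁ d≡ | divides a₁ a≡ = go g₁∣M
    where
    g₁ = gcd a d
    g = gcd a b
    instance
      nzd : NonZero d
      nzd = >-nonZero d>0
    g₁>0 : 0 < g₁
    g₁>0 = n≢0⇒n>0 (λ e → <-irrefl (sym (gcd[m,n]≡0⇒m≡0 e)) a>0)
    instance
      nzg₁ : NonZero g₁
      nzg₁ = >-nonZero g₁>0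
      nzg : NonZero g
      nzg = ≢-nonZero (λ e → <-irrefl (sym (gcd[m,n]≡0⇒m≡0 e)) a>0)
    cop : Coprime d₁ a₁
    cop = gcd≡1⇒coprime (*-cancelˡ-≡ (gcd d₁ a₁) 1 g₁ (trans (c*gcd[m,n]≡gcd[cm,cn] g₁ d₁ a₁)
      (trans (cong₂ gcd (trans (*-comm g₁ d₁) (sym d≡)) (trans (*-comm g₁ a₁) (sym a≡))) (trans (gcd-comm d a) (sym (*-identityʳ g₁))))))
    d₁g∣b : d₁ * g ∣ b
    d₁g∣b with gcd[m,n]∣n a b
    ... | divides c b≡ = subst (d₁ * g ∣_) (sym b≡) (*-monoˡ-∣ g (coprime-divisor cop (*-cancelˡ-∣ g₁ (subst (_∣ g₁ * (a₁ * c)) (trans d≡ (*-comm d₁ g₁)) (subst (d ∣_) lcm≡ d∣)))))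
      where
      lcm≡ : lcm a b ≡ g₁ * (a₁ * c)
      lcm≡ = *-cancelˡ-≡ (lcm a b) (g₁ * (a₁ * c)) g (trans (gcd*lcm a b) (trans (cong₂ _*_ a≡ b≡) (lem a₁ g₁ c g)))
        where lem : ∀ a g₁ c g → (a * g₁) * (c * g) ≡ g * (g₁ * (a * c))
              lem = solve-∀
    g₂ = gcd b d
    h = gcd g₁ g₂
    instance
      nzh : NonZero h
      nzh = ≢-nonZero (λ e → <-irrefl (sym (gcd[m,n]≡0⇒m≡0 e)) g₁>0)
    h∣g : h ∣ g
    h∣g = gcd-greatest (∣-trans (gcd[m,n]∣m g₁ g₂) (gcd[m,n]∣m a d)) (∣-trans (gcd[m,n]∣n g₁ g₂) (gcd[m,n]∣m b d))
    d₁h∣g₂ : d₁ * h ∣ g₂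
    d₁h∣g₂ = gcd-greatest (∣-trans (*-monoʳ-∣ d₁ h∣g) d₁g∣b) (subst (d₁ * h ∣_) (sym d≡) (*-monoʳ-∣ d₁ (gcd[m,n]∣m g₁ g₂)))
    go : g₁ ∣ M → d ∣ M
    go (divides m M≡) with gcd[m,n]∣n g₁ g₂ | gcd[m,n]∣m g₁ g₂
    ... | divides e g₂≡ | divides g₁′ g₁≡ = subst (_∣ M) (sym d≡) (subst (d₁ * g₁ ∣_) (sym M≡) (*-monoˡ-∣ g₁ (∣-trans d₁∣e
          (coprime-divisor {n = g₁′} cop′ (*-cancelʳ-∣ h (subst (_∣ (g₁′ * m) * h) g₂≡ (subst (g₂ ∣_) M≡′ g₂∣M)))))))
      where
      d₁∣e : d₁ ∣ e
      d₁∣e = *-cancelʳ-∣ h (subst (d₁ * h ∣_) g₂≡ d₁h∣g₂)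
      cop′ : Coprime e g₁′
      cop′ = gcd≡1⇒coprime (*-cancelˡ-≡ (gcd e g₁′) 1 h (trans (c*gcd[m,n]≡gcd[cm,cn] h e g₁′)
        (trans (cong₂ gcd (trans (*-comm h e) (sym g₂≡)) (trans (*-comm h g₁′) (sym g₁≡))) (trans (gcd-comm g₂ g₁) (sym (*-identityʳ h))))))
      M≡′ : M ≡ (g₁′ * m) * h
      M≡′ = trans M≡ (trans (cong (m *_) g₁≡) (lem m g₁′ h))
        where lem : ∀ m g h → m * (g * h) ≡ (g * m) * h
              lem = solve-∀

  module Orders (x : ℕ) (x>1 : 1 < x) where
    private
      instance
        nzx : NonZero x
        nzx = >-nonZero (<⇒≤ x>1)
    P : ℕ → ℕ
    P e = x ^ e ∸ 1

    pow≡ : ∀ e → x ^ e ≡ 1 + P e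
    pow≡ e = sym (m+[n∸m]≡n (m^n>0 x e))

    P-+ : ∀ a b → P (a + b) ≡ P a + x ^ a * P b
    P-+ a b = cong (_∸ 1) (trans (^-distribˡ-+-* x a b) (trans (cong (x ^ a *_) (pow≡ b)) (trans (*-suc (x ^ a) (P b)) (cong (_+ x ^ a * P b) (pow≡ a)))))

    P-∣ : ∀ {a b} → a ∣ b → P a ∣ P b
    P-∣ {a} (divides c refl) = go c
      where go : ∀ c → P a ∣ P (c * a)
            go zero = P a ∣0
            go (suc c) = subst (P a ∣_) (sym (P-+ a (c * a))) (∣m∣n⇒∣m+n ∣-refl (∣n⇒∣m*n (x ^ a) (go c)))

    -- Bézout writes gcd a b as a difference of multiples of a and b, and P (g + e) = P g + x ^ g *
    -- P e strips the smaller multiple off.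
    P-gcd : ∀ {d} a b → d ∣ P a → d ∣ P b → d ∣ P (gcd a b)
    P-gcd {d} a b da db with Bézout.identity (gcd-GCD a b)
    ... | Bézout.+- u w eq = drop (gcd a b) (w * b) (subst (λ z → d ∣ P z) (sym eq) (∣-trans da (P-∣ (n∣m*n u)))) (∣-trans db (P-∣ (n∣m*n w)))
      where drop : ∀ g e → d ∣ P (g + e) → d ∣ P e → d ∣ P g
            drop g e h h′ = ∣m+n∣m⇒∣n (subst (d ∣_) (trans (P-+ g e) (+-comm (P g) _)) h) (∣n⇒∣m*n (x ^ g) h′)
    ... | Bézout.-+ u w eq = drop (gcd a b) (u * a) (subst (λ z → d ∣ P z) (sym eq) (∣-trans db (P-∣ (n∣m*n w)))) (∣-trans da (P-∣ (n∣m*n u)))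
      where drop : ∀ g e → d ∣ P (g + e) → d ∣ P e → d ∣ P g
            drop g e h h′ = ∣m+n∣m⇒∣n (subst (d ∣_) (trans (P-+ g e) (+-comm (P g) _)) h) (∣n⇒∣m*n (x ^ g) h′)

    P>0 : ∀ {e} → 0 < e → 0 < P e
    P>0 {suc e} _ = m<n⇒0<n∸m (<-≤-trans x>1 (m≤m*n x (x ^ e) {{m^n≢0 x e}}))

    -- exps μ rs lists the exponents (μ · ∏ rs) / r for r in rs.
    exps : ℕ → List ℕ → List ℕ
    exps μ [] = []
    exps μ (r ∷ rs) = μ * product rs ∷ exps (μ * r) rs

    lcms : List ℕ → ℕ
    lcms [] = 1
    lcms (e ∷ es) = lcm (P e) (lcms es)

    L : ℕ → List ℕ → ℕ
    L μ rs = lcms (exps μ rs)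

    exps-spec : ∀ μ rs {e} → e ∈ exps μ rs → Σ ℕ λ r → r ∈ rs × r * e ≡ μ * product rs
    exps-spec μ (r ∷ rs) (here refl) = r , here refl , lem r μ (product rs)
      where lem : ∀ r μ p → r * (μ * p) ≡ μ * (r * p)
            lem = solve-∀
    exps-spec μ (r ∷ rs) (there e∈) with exps-spec (μ * r) rs e∈
    ... | s , s∈ , eq = s , there s∈ , trans eq (*-assoc μ r (product rs))

    exps-find : ∀ μ rs {r} → r ∈ rs → Σ ℕ λ e → e ∈ exps μ rs × r * e ≡ μ * product rs
    exps-find μ (r ∷ rs) (here refl) = μ * product rs , here refl , lem r μ (product rs)
      where lem : ∀ r μ p → r * (μ * p) ≡ μ * (r * p)
            lem = solve-∀
    exps-find μ (r ∷ rs) (there r∈) with exps-find (μ * r) rs r∈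
    ... | e , e∈ , eq = e , there e∈ , trans eq (*-assoc μ r (product rs))

    exps-scale : ∀ μ r rs → exps (μ * r) rs ≡ map (_* r) (exps μ rs)
    exps-scale μ r [] = refl
    exps-scale μ r (s ∷ rs) = cong₂ _∷_ (lem μ r (product rs)) (trans (cong (λ z → exps z rs) (lem μ r s)) (exps-scale (μ * s) r rs))
      where lem : ∀ a b c → a * b * c ≡ a * c * b
            lem = solve-∀

    lcms-∣ : ∀ {es e} → e ∈ es → P e ∣ lcms es
    lcms-∣ {e ∷ es} (here refl) = m∣lcm[m,n] (P e) (lcms es)
    lcms-∣ {e ∷ es} (there e∈) = ∣-trans (lcms-∣ e∈) (n∣lcm[m,n] (P e) (lcms es))

    lcms-least : ∀ es {M} → (∀ {e} → e ∈ es → P e ∣ M) → lcms es ∣ M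
    lcms-least [] h = 1∣ _
    lcms-least (e ∷ es) h = lcm-least (h (here refl)) (lcms-least es (λ e∈ → h (there e∈)))

    lcms-distrib : ∀ es {d M} → 0 < d → (∀ {e} → e ∈ es → 0 < P e) → d ∣ lcms es → (∀ {e} → e ∈ es → gcd (P e) d ∣ M) → d ∣ M
    lcms-distrib [] d>0 pos d∣ h = subst (_∣ _) (sym (∣1⇒≡1 d∣)) (1∣ _)
    lcms-distrib (e ∷ es) {d} d>0 pos d∣ h = lcm-distrib d>0 (pos (here refl)) d∣ (h (here refl))
      (lcms-distrib es g>0 (λ e∈ → pos (there e∈)) (gcd[m,n]∣m (lcms es) d)
        (λ {e′} e∈ → ∣-trans (gcd-greatest (gcd[m,n]∣m (P e′) (gcd (lcms es) d)) (∣-trans (gcd[m,n]∣n (P e′) _) (gcd[m,n]∣n (lcms es) d))) (h (there e∈))))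
      where g>0 : 0 < gcd (lcms es) d
            g>0 = n≢0⇒n>0 (λ z → <-irrefl (sym (gcd[m,n]≡0⇒m≡0 (trans (gcd-comm d (lcms es)) z))) d>0)

    map-∈ : ∀ {r} es {e} → e ∈ es → e * r ∈ map (_* r) es
    map-∈ (_ ∷ _) (here refl) = here refl
    map-∈ (_ ∷ es) (there e∈) = there (map-∈ es e∈)
    map-∈⁻ : ∀ {r} es {e} → e ∈ map (_* r) es → Σ ℕ λ e′ → e′ ∈ es × e ≡ e′ * r
    map-∈⁻ (e ∷ es) (here p) = e , here refl , p
    map-∈⁻ (e ∷ es) (there p) with map-∈⁻ es p
    ... | e′ , e′∈ , eq = e′ , there e′∈ , eq

    exps>0 : ∀ {μ rs} → 0 < μ → All Prime rs → ∀ {e} → e ∈ exps μ rs → 0 < e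
    exps>0 {μ} {rs} μ>0 prs {e} e∈ with exps-spec μ rs e∈
    ... | r , _ , eq = n≢0⇒n>0 (λ { refl → <-irrefl (trans (sym (*-zeroʳ r)) eq) (prod>0 μ>0 prs) })
      where prod>0 : ∀ {μ rs} → 0 < μ → All Prime rs → 0 < μ * product rs
            prod>0 {μ} h [] = subst (0 <_) (sym (*-identityʳ μ)) h
            prod>0 {μ} {r ∷ rs} h (pr ∷ prs) = subst (0 <_) (*-assoc μ r (product rs)) (prod>0 {μ * r} (*-mono-< {0} {μ} {0} {r} h (<⇒≤ (prime>1 pr))) prs)

    -- An lcm times the gcd is the product, so the point is that `B` and `L (μ * r) rs` have gcd
    -- `L μ rs`: for e in `exps μ rs` the exponents e r and e s, with distinct primes r and s, have
    -- gcd e. This recursion takes the place of the factorisation into cyclotomic values Φ_d(x).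
    L-rec : ∀ μ r rs → 0 < μ → Prime r → All Prime rs → All (r ≢_) rs →
      L μ (r ∷ rs) * L μ rs ≡ P (μ * product rs) * L (μ * r) rs
    L-rec μ r rs μ>0 pr prs ne = trans (*-comm (L μ (r ∷ rs)) (L μ rs)) (trans (cong (_* lcm B L₁) (sym g≡)) (gcd*lcm B L₁))
      where
      B = P (μ * product rs)
      L₁ = L (μ * r) rs
      L₀ = L μ rs
      instance
        nzr : NonZero r
        nzr = prime⇒nonZero pr
      B>0 : 0 < B
      B>0 = P>0 (lem μ>0 prs)
        where lem : ∀ {μ rs} → 0 < μ → All Prime rs → 0 < μ * product rs
              lem {μ} h [] = subst (0 <_) (sym (*-identityʳ μ)) h
              lem {μ} {r ∷ rs} h (pr ∷ prs) = subst (0 <_) (*-assoc μ r (product rs)) (lem {μ * r} (*-mono-< {0} {μ} {0} {r} h (<⇒≤ (prime>1 pr))) prs)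
      L₀∣L₁ : L₀ ∣ L₁
      L₀∣L₁ = lcms-least (exps μ rs) (λ {e} e∈ → ∣-trans (P-∣ (m∣m*n {e} r)) (lcms-∣ (subst (e * r ∈_) (sym (exps-scale μ r rs)) (map-∈ _ e∈))))
      L₀∣B : L₀ ∣ B
      L₀∣B = lcms-least (exps μ rs) (λ {e} e∈ → let s , _ , eq = exps-spec μ rs e∈ in P-∣ (divides s (sym eq)))
      d = gcd B L₁
      d∣L₀ : d ∣ L₀
      d∣L₀ = lcms-distrib (exps (μ * r) rs) (n≢0⇒n>0 (λ z → <-irrefl (sym (gcd[m,n]≡0⇒m≡0 z)) B>0))
        (λ e∈ → P>0 (exps>0 (*-mono-< {0} {μ} {0} {r} μ>0 (<⇒≤ (prime>1 pr))) prs e∈)) (gcd[m,n]∣n B L₁) each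
        where
        each : ∀ {e} → e ∈ exps (μ * r) rs → gcd (P e) d ∣ L₀
        each {e} e∈ with map-∈⁻ (exps μ rs) (subst (e ∈_) (exps-scale μ r rs) e∈)
        ... | e′ , e′∈ , refl with exps-spec μ rs e′∈
        ... | s , s∈ , eq = ∣-trans (P-gcd (e′ * r) (μ * product rs) (gcd[m,n]∣m (P (e′ * r)) d) (∣-trans (gcd[m,n]∣n (P (e′ * r)) d) (gcd[m,n]∣m B L₁)))
              (subst (λ z → P z ∣ L₀) (sym gcd≡) (lcms-∣ e′∈))
          where
          cop : gcd r s ≡ 1
          cop with prime⇒irreducible pr (gcd[m,n]∣m r s)
          ... | inj₁ e = e
          ... | inj₂ e with prime⇒irreducible (All.lookup prs s∈) (subst (_∣ s) e (gcd[m,n]∣n r s))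
          ... | inj₁ r≡1 = ⊥-elim (¬prime[1] (subst Prime r≡1 pr))
          ... | inj₂ r≡s = ⊥-elim (All.lookup ne s∈ r≡s)
          gcd≡ : gcd (e′ * r) (μ * product rs) ≡ e′
          gcd≡ = trans (cong (gcd (e′ * r)) (trans (sym eq) (*-comm s e′))) (trans (sym (c*gcd[m,n]≡gcd[cm,cn] e′ r s)) (trans (cong (e′ *_) cop) (*-identityʳ e′)))
      g≡ : gcd B L₁ ≡ L₀
      g≡ = ∣-antisym d∣L₀ (gcd-greatest L₀∣B L₀∣L₁)

  -- One factor comes from each of the two lists in `L-rec`, and 2 from comparing x^e with x^e - 1.
  -- The constant depends on `rs` alone, so x can be taken beyond it afterwards.
  Cst : List ℕ → ℕ
  Cst [] = 1
  Cst (r ∷ rs) = 2 * (Cst rs * Cst rs)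

  -- The product of the r minus the product of the r - 1: for distinct primes this is the degree of
  -- the lcm of the polynomials X^(m / r) - 1 with m the product of `rs`.
  Exponent : List ℕ → ℕ
  Exponent [] = 0
  Exponent (r ∷ rs) = product rs + (r ∸ 1) * Exponent rs

  Exponent< : ∀ {rs} → All Prime rs → Exponent rs < product rs
  Exponent< [] = s≤s z≤n
  Exponent< {r ∷ rs} (pr ∷ prs) = subst (product rs + (r ∸ 1) * Exponent rs <_) (cong (_* product rs) (m+[n∸m]≡n (<⇒≤ (prime>1 pr))))
    (+-monoʳ-< (product rs) (*-monoʳ-< (r ∸ 1) {{>-nonZero (m<n⇒0<n∸m (prime>1 pr))}} (Exponent< prs)))

  module Bounds (x : ℕ) (x>1 : 1 < x) where
    open Orders x x>1
    private
      instance
        nzx : NonZero x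
        nzx = >-nonZero (<⇒≤ x>1)

    -- `L-rec` divides by `L μ rs`, so an upper bound for the longer list uses a lower bound for the
    -- shorter one and conversely. All multiples μ are treated together because the recursion also
    -- visits μ r.
    bounds : ∀ rs → Unique rs → All Prime rs → ∀ μ → 0 < μ →
      x ^ (μ * Exponent rs) ≤ Cst rs * L μ rs × L μ rs ≤ Cst rs * x ^ (μ * Exponent rs)
    bounds [] u [] μ μ>0 = ≤-reflexive (cong (x ^_) (*-zeroʳ μ)) , ≤-reflexive (sym (trans (+-identityʳ _) (cong (x ^_) (*-zeroʳ μ))))
    bounds (r ∷ rs) (r∉ ∷ u) (pr ∷ prs) μ μ>0 = lower , upper
      where
      C = Cst rs
      E = Exponent rs
      r′ = r ∸ 1
      B = P (μ * product rs)
      L₀ = L μ rs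
      L₁ = L (μ * r) rs
      L′ = L μ (r ∷ rs)
      rec : L′ * L₀ ≡ B * L₁
      rec = L-rec μ r rs μ>0 pr prs r∉
      IH₀ = bounds rs u prs μ μ>0
      IH₁ = bounds rs u prs (μ * r) (*-mono-< {0} {μ} {0} {r} μ>0 (<⇒≤ (prime>1 pr)))
      X₀ = x ^ (μ * E)
      X₁ = x ^ (μ * r * E)
      Y = x ^ (μ * product rs)
      X′ = x ^ (μ * Exponent (r ∷ rs))
      instance
        nzX₀ : NonZero X₀
        nzX₀ = m^n≢0 x (μ * E)
      r≡ : r ≡ suc r′
      r≡ = sym (m+[n∸m]≡n (<⇒≤ (prime>1 pr)))
      X-rec : Y * X₁ ≡ X′ * X₀
      X-rec = trans (sym (^-distribˡ-+-* x (μ * product rs) (μ * r * E))) (trans (cong (x ^_) (trans (cong (λ z → μ * product rs + μ * z * E) r≡)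
        (lem μ (product rs) r′ E))) (^-distribˡ-+-* x (μ * Exponent (r ∷ rs)) (μ * E)))
        where lem : ∀ m p r e → m * p + m * suc r * e ≡ m * (p + r * e) + m * e
              lem = solve-∀
      open ≤-Reasoning
      Y≤2B : Y ≤ 2 * B
      Y≤2B = begin
        Y          ≡⟨ pow≡ (μ * product rs) ⟩
        1 + B      ≤⟨ +-monoˡ-≤ B (P>0 (e>0 prs)) ⟩
        B + B      ≡⟨ cong (B +_) (sym (+-identityʳ B)) ⟩
        2 * B      ∎
        where e>0 : ∀ {rs} → All Prime rs → 0 < μ * product rs
              e>0 prs = *-mono-< {0} {μ} {0} μ>0 (prod prs)
                where prod : ∀ {rs} → All Prime rs → 0 < product rs
                      prod [] = s≤s z≤n
                      prod {r ∷ rs} (pr ∷ prs) = *-mono-< {0} {r} {0} (<⇒≤ (prime>1 pr)) (prod prs)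
      lower : X′ ≤ 2 * (C * C) * L′
      lower = *-cancelʳ-≤ X′ (2 * (C * C) * L′) X₀ (begin
        X′ * X₀                  ≡⟨ sym X-rec ⟩
        Y * X₁                   ≤⟨ *-mono-≤ Y≤2B (proj₁ IH₁) ⟩
        2 * B * (C * L₁)         ≡⟨ l₁ B C L₁ ⟩
        2 * C * (B * L₁)         ≡⟨ cong (2 * C *_) (sym rec) ⟩
        2 * C * (L′ * L₀)        ≤⟨ *-monoʳ-≤ (2 * C) (*-monoʳ-≤ L′ (proj₂ IH₀)) ⟩
        2 * C * (L′ * (C * X₀))  ≡⟨ l₂ C L′ X₀ ⟩
        2 * (C * C) * L′ * X₀    ∎)
        where l₁ : ∀ b c l → 2 * b * (c * l) ≡ 2 * c * (b * l)
              l₁ = solve-∀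
              l₂ : ∀ c l x → 2 * c * (l * (c * x)) ≡ 2 * (c * c) * l * x
              l₂ = solve-∀
      upper : L′ ≤ 2 * (C * C) * X′
      upper = *-cancelʳ-≤ L′ (2 * (C * C) * X′) X₀ (begin
        L′ * X₀                  ≤⟨ *-monoʳ-≤ L′ (proj₁ IH₀) ⟩
        L′ * (C * L₀)            ≡⟨ l₁ L′ C L₀ ⟩
        C * (L′ * L₀)            ≡⟨ cong (C *_) rec ⟩
        C * (B * L₁)             ≤⟨ *-monoʳ-≤ C (*-mono-≤ (m∸n≤m Y 1) (proj₂ IH₁)) ⟩
        C * (Y * (C * X₁))       ≡⟨ l₂ C Y X₁ ⟩
        C * C * (Y * X₁)         ≡⟨ cong (C * C *_) X-rec ⟩
        C * C * (X′ * X₀)        ≤⟨ m≤m+n (C * C * (X′ * X₀)) (C * C * (X′ * X₀)) ⟩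
        C * C * (X′ * X₀) + C * C * (X′ * X₀) ≡⟨ l₃ C X′ X₀ ⟩
        2 * (C * C) * X′ * X₀    ∎)
        where l₁ : ∀ a b c → a * (b * c) ≡ b * (a * c)
              l₁ = solve-∀
              l₂ : ∀ c y x → c * (y * (c * x)) ≡ c * c * (y * x)
              l₂ = solve-∀
              l₃ : ∀ c x y → c * c * (x * y) + c * c * (x * y) ≡ 2 * (c * c) * x * y
              l₃ = solve-∀

  -- If x is a multiple of n = N · ∏ rs, where rs lists the primes up to N, then a prime factor of
  -- (x ^ n − 1) / lcm (x ^ (n / r) − 1) does not divide n, so that x has order exactly n modulo it.
  module PrimeSearch (N b : ℕ) (N>0 : 0 < N) (rs : List ℕ) (urs : Unique rs) (prs : All Prime rs)
    (rs-∋ : ∀ {r} → Prime r → r ∣ N → r ∈ rs) (x : ℕ) (n∣x : N * product rs ∣ x) (b!∣x : b ! ∣ x) (2C<x : 2 * suc (Cst rs) ≤ x) where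
    n = N * product rs
    prod>0 : ∀ {rs} → All Prime rs → 0 < product rs
    prod>0 [] = s≤s z≤n
    prod>0 {r ∷ rs} (pr ∷ prs) = *-mono-< {0} {r} {0} (<⇒≤ (prime>1 pr)) (prod>0 prs)
    n>0 : 0 < n
    n>0 = *-mono-< {0} {N} {0} N>0 (prod>0 prs)
    C = Cst rs
    x>1 : 1 < x
    x>1 = ≤-trans (*-monoʳ-≤ 2 (s≤s z≤n)) 2C<x
    open Orders x x>1
    Lc = L N rs
    E = Exponent rs
    instance
      nzx : NonZero x
      nzx = >-nonZero (<⇒≤ x>1)
    -- N times `E` is smaller than n, and the one remaining factor x outweighs the constant.
    Lc<P : Lc < P n
    Lc<P = ∸-monoˡ-≤ 1 (begin-strict
        suc Lc                     ≤⟨ s≤s (proj₂ (Bounds.bounds x x>1 rs urs prs N N>0)) ⟩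
        suc (C * x ^ (N * E))      <⟨ +-monoˡ-< (C * x ^ (N * E)) (≤-trans (s≤s (m^n>0 x (N * E))) (+-monoʳ-≤ 1 ≤-refl)) ⟩
        suc (x ^ (N * E)) + C * x ^ (N * E) ≤⟨ +-monoˡ-≤ (C * x ^ (N * E)) (+-monoˡ-≤ (x ^ (N * E)) (m^n>0 x (N * E))) ⟩
        (x ^ (N * E) + x ^ (N * E)) + C * x ^ (N * E) ≤⟨ +-monoʳ-≤ (x ^ (N * E) + x ^ (N * E)) (m≤m+n (C * x ^ (N * E)) (C * x ^ (N * E))) ⟩
        (x ^ (N * E) + x ^ (N * E)) + (C * x ^ (N * E) + C * x ^ (N * E)) ≡⟨ l (x ^ (N * E)) C ⟩
        2 * suc C * x ^ (N * E)    ≤⟨ *-monoˡ-≤ (x ^ (N * E)) 2C<x ⟩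
        x ^ suc (N * E)            ≤⟨ ^-monoʳ-≤ x (≤-trans (s≤s (≤-reflexive refl)) (NE<n)) ⟩
        x ^ n                      ∎)
      where
      open ≤-Reasoning
      l : ∀ y c → (y + y) + (c * y + c * y) ≡ 2 * suc c * y
      l = solve-∀
      NE<n : N * E < n
      NE<n = *-monoʳ-< N {{>-nonZero N>0}} (Exponent< prs)
    Lc∣P : Lc ∣ P n
    Lc∣P = lcms-least (exps N rs) (λ {e} e∈ → let s , _ , eq = exps-spec N rs e∈ in P-∣ (divides s (sym eq)))
    Q = quotient Lc∣P
    PQ : P n ≡ Q * Lc
    PQ = _∣_.equality Lc∣P
    Q>1 : 1 < Q
    Q>1 = ≰⇒> (λ le → <-irrefl refl (<-≤-trans Lc<P (≤-trans (≤-reflexive PQ) (≤-trans (*-monoˡ-≤ Lc le) (≤-reflexive (+-identityʳ Lc))))))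
    module Order (q : ℕ) (prq : Prime q) (q∣Q : q ∣ Q) where
      q∣P : q ∣ P n
      q∣P = subst (q ∣_) (sym PQ) (∣m⇒∣m*n Lc q∣Q)
      q∤x : ¬ q ∣ x
      q∤x h = ¬prime[1] (subst Prime (∣1⇒≡1 (∣m+n∣m⇒∣n (subst (q ∣_) (trans (pow≡ n) (+-comm 1 (P n))) (∣-trans h (x∣ n>0))) q∣P)) prq)
        where x∣ : ∀ {n} → 0 < n → x ∣ x ^ n
              x∣ {suc n} _ = m∣m*n (x ^ n)
      q>b : b < q
      q>b = ≰⇒> (λ le → q∤x (∣-trans (∣! (<⇒≤ (prime>1 prq)) le) b!∣x))
      -- As x^e - 1 divides `Lc`, `Q` divides (x^n - 1) / (x^e - 1), which is r modulo x^e - 1. If q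
      -- divided x^e - 1, it would divide r, hence n, hence x.
      q∤P : ∀ {r e} → r ∈ rs → e ∈ exps N rs → r * e ≡ n → ¬ q ∣ P e
      q∤P {r} {e} r∈ e∈ eq q∣Pe with binomial₂ (P e) r
      ... | t , bin = q∤x (∣-trans (∣-trans q∣r (divides e (trans (sym eq) (*-comm r e)))) n∣x)
        where
        instance
          nzPe : NonZero (P e)
          nzPe = >-nonZero (P>0 (exps>0 N>0 prs e∈))
        Pn≡ : P n ≡ P e * (r + P e * t)
        Pn≡ = cong (_∸ 1) (trans (trans (cong (x ^_) (trans (sym eq) (*-comm r e))) (sym (^-*-assoc x e r))) (trans (cong (_^ r) (pow≡ e)) bin))
        Q∣S : Q ∣ r + P e * t
        Q∣S with lcms-∣ e∈
        ... | divides c L≡ = divides c (*-cancelˡ-≡ (r + P e * t) (c * Q) (P e) (trans (sym Pn≡) (trans PQ (trans (cong (Q *_) L≡) (l Q c (P e))))))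
          where l : ∀ q c p → q * (c * p) ≡ p * (c * q)
                l = solve-∀
        q∣r : q ∣ r
        q∣r = ∣m+n∣m⇒∣n (subst (q ∣_) (+-comm r _) (∣-trans q∣Q Q∣S)) (∣m⇒∣m*n t q∣Pe)
      -- Otherwise a prime r divides n / gcd n (q - 1), and the gcd divides n / r. Together with
      -- Fermat's theorem q would divide x^(n / r) - 1, against `q∤P`.
      n∣q-1 : n ∣ q ∸ 1
      n∣q-1 with gcd[m,n]∣m n (q ∸ 1)
      ... | divides zero e = ⊥-elim (<-irrefl (sym e) n>0)
      ... | divides (suc zero) e = subst (_∣ q ∸ 1) (trans (sym (+-identityʳ _)) (sym e)) (gcd[m,n]∣n n (q ∸ 1))
      ... | divides c@(suc (suc _)) e with prime-factor c (s≤s (s≤s z≤n))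
      ... | r , prr , divides c′ c≡ with exps-find N rs (r∈rs (subst (r ∣_) (sym e) (∣m⇒∣m*n (gcd n (q ∸ 1)) (divides c′ c≡))))
        where
        r∈rs : r ∣ n → r ∈ rs
        r∈rs h with euclidsLemma N (product rs) prr h
        ... | inj₁ r∣N = rs-∋ prr r∣N
        ... | inj₂ r∣Π = go prs r∣Π
          where go : ∀ {rs} → All Prime rs → r ∣ product rs → r ∈ rs
                go [] h = ⊥-elim (¬prime[1] (subst Prime (∣1⇒≡1 h) prr))
                go {s ∷ rs} (ps ∷ pss) h with euclidsLemma s (product rs) prr h
                ... | inj₂ h′ = there (go pss h′)
                ... | inj₁ h′ with prime⇒irreducible ps h′
                ... | inj₁ r≡1 = ⊥-elim (¬prime[1] (subst Prime r≡1 prr))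
                ... | inj₂ r≡s = here r≡s
      ... | ee , ee∈ , eq = ⊥-elim (q∤P (proj₁ (proj₂ spec)) ee∈ (proj₂ (proj₂ spec)) (∣-trans (P-gcd n (q ∸ 1) q∣P (fermatℕ prq q∤x)) (P-∣ d∣ee)))
        where
        spec = exps-spec N rs ee∈
        d∣ee : gcd n (q ∸ 1) ∣ ee
        d∣ee = divides c′ (*-cancelˡ-≡ ee (c′ * gcd n (q ∸ 1)) r {{prime⇒nonZero prr}} (trans eq (trans e (trans (cong (_* gcd n (q ∸ 1)) c≡) (l c′ r (gcd n (q ∸ 1)))))))
          where l : ∀ c r g → c * r * g ≡ r * (c * g)
                l = solve-∀

    result : Σ ℕ λ q → Prime q × b < q × N ∣ q ∸ 1
    result = let q , prq , q∣Q = prime-factor Q Q>1 in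
      q , prq , Order.q>b q prq q∣Q , ∣-trans (m∣m*n (product rs)) (Order.n∣q-1 q prq q∣Q)

  primes≡1 : ∀ N b → 0 < N → Σ ℕ λ q → Prime q × b < q × N ∣ q ∸ 1
  primes≡1 N b N>0 = result
    where
    rs = filter prime? (upTo (suc N))
    n₀ = N * product rs
    prs₀ : All Prime rs
    prs₀ = all-filter prime? (upTo (suc N))
    prod>0 : ∀ {rs} → All Prime rs → 0 < product rs
    prod>0 [] = s≤s z≤n
    prod>0 {r ∷ rs} (pr ∷ prs) = *-mono-< {0} {r} {0} (<⇒≤ (prime>1 pr)) (prod>0 prs)
    open PrimeSearch N b N>0 rs (filter⁺ prime? (upTo⁺ (suc N))) prs₀
      (λ pr r∣N → ∈-filter⁺ prime? (∈-upTo⁺ (s≤s (∣⇒≤ {{>-nonZero N>0}} r∣N))) pr)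
      ((n₀ * (b !)) * (2 * suc (Cst rs))) (∣-trans (m∣m*n (b !)) (m∣m*n (2 * suc (Cst rs)))) (∣-trans (n∣m*n n₀) (m∣m*n (2 * suc (Cst rs))))
      (m≤n*m (2 * suc (Cst rs)) (n₀ * (b !)) {{>-nonZero (*-mono-< {0} {n₀} {0} (*-mono-< {0} {N} {0} N>0 (prod>0 prs₀)) (1≤n! b))}})
      using (result)

-- Greedy embedding of cliques with prescribed colours

module QuasiRandomness where
  open import Data.Nat using (ℕ; zero; suc; _+_; _*_; _≤_; _<_; z≤n; s≤s; _<?_; >-nonZero)
  open import Data.Nat.Properties hiding (suc-injective; _≟_)
  open import Data.Nat.Tactic.RingSolver using (solve-∀)
  open import Data.Fin using (Fin; zero; suc; toℕ)
  open import Data.Fin.Properties using (_≟_; any?; suc-injective)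
  open import Data.Product using (Σ; _×_; _,_)
  open import Data.Sum using (inj₁; inj₂)
  open import Data.Empty using (⊥; ⊥-elim)
  open import Relation.Nullary using (¬_; yes; no; Dec)
  open import Relation.Binary.PropositionalEquality using (_≡_; _≢_; refl; sym; trans; cong; cong₂; subst)
  import Algebra.Properties.CommutativeMonoid.Sum as Sum
  import Algebra.Properties.Semiring.Sum as SSum

  open Sum +-0-commutativeMonoid public using (sum; ∑-comm; ∑-distrib-+; sum-cong-≗)
  open SSum +-*-semiring public using (*-distribˡ-sum; *-distribʳ-sum)

  sum-mono : ∀ {n} {f g : Fin n → ℕ} → (∀ i → f i ≤ g i) → sum f ≤ sum g
  sum-mono {zero} h = z≤n
  sum-mono {suc n} h = +-mono-≤ (h zero) (sum-mono (λ i → h (suc i)))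

  sum-const : ∀ n c → sum {n} (λ _ → c) ≡ n * c
  sum-const zero c = refl
  sum-const (suc n) c = cong (c +_) (sum-const n c)

  sum-zero : ∀ {n} {f : Fin n → ℕ} → (∀ i → f i ≡ 0) → sum f ≡ 0
  sum-zero {n} h = trans (sum-cong-≗ h) (trans (sum-const n 0) (*-zeroʳ n))

  term≤sum : ∀ {n} (f : Fin n → ℕ) i → f i ≤ sum f
  term≤sum f zero = m≤m+n _ _
  term≤sum f (suc i) = ≤-trans (term≤sum (λ j → f (suc j)) i) (m≤n+m _ _)

  𝟙 : ∀ {a} {P : Set a} → Dec P → ℕ
  𝟙 (yes _) = 1
  𝟙 (no _) = 0

  𝟙≤1 : ∀ {a} {P : Set a} (d : Dec P) → 𝟙 d ≤ 1
  𝟙≤1 (yes _) = s≤s z≤n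
  𝟙≤1 (no _) = z≤n

  𝟙-yes : ∀ {a} {P : Set a} (d : Dec P) → P → 𝟙 d ≡ 1
  𝟙-yes (yes _) p = refl
  𝟙-yes (no n) p = ⊥-elim (n p)

  𝟙-no : ∀ {a} {P : Set a} (d : Dec P) → ¬ P → 𝟙 d ≡ 0
  𝟙-no (yes p) n = ⊥-elim (n p)
  𝟙-no (no _) n = refl

  𝟙-out : ∀ {a} {P : Set a} (d : Dec P) → 𝟙 d ≡ 1 → P
  𝟙-out (yes p) _ = p

  sum-at-most-one : ∀ {a n} {P : Fin n → Set a} (P? : ∀ i → Dec (P i)) → (∀ {i j} → P i → P j → i ≡ j) → sum (λ i → 𝟙 (P? i)) ≤ 1
  sum-at-most-one {n = zero} P? h = z≤n
  sum-at-most-one {n = suc n} P? h with P? zero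
  ... | yes p = ≤-reflexive (cong suc (sum-zero (λ i → 𝟙-no (P? (suc i)) (λ p′ → case (h p p′)))))
    where case : ∀ {i : Fin n} → zero ≡ suc i → ⊥
          case ()
  ... | no _ = sum-at-most-one (λ i → P? (suc i)) (λ p p′ → suc-injective (h p p′))

  sum-eq : ∀ {n} (j : Fin n) → sum (λ i → 𝟙 (i ≟ j)) ≡ 1
  sum-eq j = ≤-antisym (sum-at-most-one (_≟ j) (λ { refl refl → refl }))
    (subst (_≤ sum (λ i → 𝟙 (i ≟ j))) (𝟙-yes (j ≟ j) refl) (term≤sum (λ i → 𝟙 (i ≟ j)) j))

  sum² : ∀ {n} (f : Fin n → ℕ) → sum f * sum f ≡ sum (λ i → sum (λ j → f i * f j))
  sum² f = trans (*-distribʳ-sum (sum f) f) (sum-cong-≗ (λ i → *-distribˡ-sum (f i) f))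

  sum-linear : ∀ {m n} c (f : Fin m → Fin n → ℕ) → sum (λ i → sum (λ j → c * f i j)) ≡ c * sum (λ i → sum (f i))
  sum-linear c f = trans (sum-cong-≗ (λ i → sym (*-distribˡ-sum c (f i)))) (sym (*-distribˡ-sum c (λ i → sum (f i))))

  sum-+₂ : ∀ {m n} (f g : Fin m → Fin n → ℕ) → sum (λ i → sum (λ j → f i j + g i j)) ≡ sum (λ i → sum (f i)) + sum (λ i → sum (g i))
  sum-+₂ f g = trans (sum-cong-≗ (λ i → ∑-distrib-+ (f i) (g i))) (∑-distrib-+ (λ i → sum (f i)) (λ i → sum (g i)))

  -- 2 a b ≤ a² + b², and a gap |a − b| ≥ b / 2 leaves room for another (b / 2)².
  am-gm : ∀ a b → 8 * (a * b) ≤ 4 * (a * a + b * b)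
  am-gm a b with ≤-total a b
  ... | inj₁ le with m≤n⇒∃[o]m+o≡n le
  ... | o , refl = subst (8 * (a * (a + o)) ≤_) (lem a o) (m≤m+n _ (4 * (o * o)))
      where lem : ∀ a o → 8 * (a * (a + o)) + 4 * (o * o) ≡ 4 * (a * a + (a + o) * (a + o))
            lem = solve-∀
  am-gm a b | inj₂ le with m≤n⇒∃[o]m+o≡n le
  ... | o , refl = subst (8 * ((b + o) * b) ≤_) (lem b o) (m≤m+n _ (4 * (o * o)))
      where lem : ∀ b o → 8 * ((b + o) * b) + 4 * (o * o) ≡ 4 * ((b + o) * (b + o) + b * b)
            lem = solve-∀

  am-gm-gap : ∀ a b → 2 * a ≤ b → 8 * (a * b) + b * b ≤ 4 * (a * a + b * b)
  am-gm-gap a b le with m≤n⇒∃[o]m+o≡n le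
  ... | o , refl = subst (8 * (a * (2 * a + o)) + (2 * a + o) * (2 * a + o) ≤_) (l a o) (m≤m+n _ (4 * (a * o) + 3 * (o * o)))
      where l : ∀ a o → (8 * (a * (2 * a + o)) + (2 * a + o) * (2 * a + o)) + (4 * (a * o) + 3 * (o * o)) ≡ 4 * (a * a + (2 * a + o) * (2 * a + o))
            l = solve-∀

  -- A colouring of the pairs of Fin q with e colours such that, for y ≢ y′, only about 1 / e of the
  -- points x see y and y′ in the same colour.
  record QuasiRandom (q e f : ℕ) : Set where
    field
      J : Fin q → Fin q → Fin e → ℕ
      J≤1 : ∀ x y s → J x y s ≤ 1
      q≡ : q ≡ suc (e * f)
      total : ∀ y → e * f ≤ sum (λ x → sum (J x y))
      self : ∀ y → sum (λ x → sum (λ s → J x y s * J x y s)) ≤ e * f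
      cross : ∀ {y y′} → y ≢ y′ → sum (λ x → sum (λ s → J x y s * J x y′ s)) ≤ f

  -- A candidate set of density at least 1 / D has at most κ D bad points, so t of them leave a good
  -- point among q / D candidates once t κ D < q / D. Choosing it divides the densities by η at
  -- most.
  threshold : (κ η t D : ℕ) → ℕ
  threshold κ η zero D = 0
  threshold κ η (suc t) D = t * (κ * D) * D + threshold κ η t (D * η)

  module Greedy {q e f : ℕ} (R : QuasiRandom q e f) (e>0 : 0 < e) where
    open QuasiRandom R

    module Second (Y : Fin q → ℕ) (Y≤1 : ∀ y → Y y ≤ 1) where
      n : ℕ
      n = sum Y
      N : Fin q → Fin e → ℕ
      N x s = sum (λ y → Y y * J x y s)

      n≤q : n ≤ q
      n≤q = ≤-trans (sum-mono Y≤1) (≤-reflexive (trans (sum-const q 1) (*-identityʳ q)))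

      first : n * (e * f) ≤ sum (λ x → sum (N x))
      first = begin
        n * (e * f)                                        ≡⟨ *-distribʳ-sum (e * f) Y ⟩
        sum (λ y → Y y * (e * f))                          ≤⟨ sum-mono (λ y → *-monoʳ-≤ (Y y) (total y)) ⟩
        sum (λ y → Y y * sum (λ x → sum (J x y)))          ≡⟨ sum-cong-≗ (λ y → sym (sum-linear (Y y) (λ x → J x y))) ⟩
        sum (λ y → sum (λ x → sum (λ s → Y y * J x y s)))  ≡⟨ ∑-comm (λ y x → sum (λ s → Y y * J x y s)) ⟩
        sum (λ x → sum (λ y → sum (λ s → Y y * J x y s)))  ≡⟨ sum-cong-≗ (λ x → ∑-comm (λ y s → Y y * J x y s)) ⟩
        sum (λ x → sum (N x))                              ∎
        where open ≤-Reasoning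

      second : sum (λ x → sum (λ s → N x s * N x s)) ≤ f * (n * n) + (e * f) * n
      second = begin
        sum (λ x → sum (λ s → N x s * N x s))
          ≡⟨ sum-cong-≗ (λ x → sum-cong-≗ (λ s → sum² (λ y → Y y * J x y s))) ⟩
        sum (λ x → sum (λ s → sum (λ y → sum (λ y′ → (Y y * J x y s) * (Y y′ * J x y′ s)))))
          ≡⟨ sum-cong-≗ (λ x → ∑-comm (λ s y → sum (λ y′ → (Y y * J x y s) * (Y y′ * J x y′ s)))) ⟩
        sum (λ x → sum (λ y → sum (λ s → sum (λ y′ → (Y y * J x y s) * (Y y′ * J x y′ s)))))
          ≡⟨ ∑-comm (λ x y → sum (λ s → sum (λ y′ → (Y y * J x y s) * (Y y′ * J x y′ s)))) ⟩
        sum (λ y → sum (λ x → sum (λ s → sum (λ y′ → (Y y * J x y s) * (Y y′ * J x y′ s)))))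
          ≡⟨ sum-cong-≗ (λ y → sum-cong-≗ (λ x → ∑-comm (λ s y′ → (Y y * J x y s) * (Y y′ * J x y′ s)))) ⟩
        sum (λ y → sum (λ x → sum (λ y′ → sum (λ s → (Y y * J x y s) * (Y y′ * J x y′ s)))))
          ≡⟨ sum-cong-≗ (λ y → ∑-comm (λ x y′ → sum (λ s → (Y y * J x y s) * (Y y′ * J x y′ s)))) ⟩
        sum (λ y → sum (λ y′ → sum (λ x → sum (λ s → (Y y * J x y s) * (Y y′ * J x y′ s)))))
          ≡⟨ sum-cong-≗ (λ y → sum-cong-≗ (λ y′ → trans (sum-cong-≗ (λ x → sum-cong-≗ (λ s → l (Y y) (J x y s) (Y y′) (J x y′ s))))
               (sum-linear (Y y * Y y′) (λ x s → J x y s * J x y′ s)))) ⟩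
        sum (λ y → sum (λ y′ → (Y y * Y y′) * sum (λ x → sum (λ s → J x y s * J x y′ s))))
          ≤⟨ sum-mono (λ y → sum-mono (λ y′ → bound y y′)) ⟩
        sum (λ y → sum (λ y′ → f * (Y y * Y y′) + (e * f) * (Y y * 𝟙 (y′ ≟ y))))
          ≡⟨ sum-+₂ (λ y y′ → f * (Y y * Y y′)) (λ y y′ → (e * f) * (Y y * 𝟙 (y′ ≟ y))) ⟩
        sum (λ y → sum (λ y′ → f * (Y y * Y y′))) + sum (λ y → sum (λ y′ → (e * f) * (Y y * 𝟙 (y′ ≟ y))))
          ≡⟨ cong₂ _+_ (trans (sum-linear f (λ y y′ → Y y * Y y′)) (cong (f *_) (sym (sum² Y))))
               (trans (sum-linear (e * f) (λ y y′ → Y y * 𝟙 (y′ ≟ y))) (cong ((e * f) *_)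
                 (sum-cong-≗ (λ y → trans (sym (*-distribˡ-sum (Y y) (λ y′ → 𝟙 (y′ ≟ y)))) (trans (cong (Y y *_) (sum-eq y)) (*-identityʳ (Y y))))))) ⟩
        f * (n * n) + (e * f) * n ∎
        where
        open ≤-Reasoning
        l : ∀ a b c d → (a * b) * (c * d) ≡ (a * c) * (b * d)
        l = solve-∀
        l₂ : ∀ a c → (a * 1) * c ≡ c * (a * 1)
        l₂ = solve-∀
        bound : ∀ y y′ → (Y y * Y y′) * sum (λ x → sum (λ s → J x y s * J x y′ s)) ≤ f * (Y y * Y y′) + (e * f) * (Y y * 𝟙 (y′ ≟ y))
        bound y y′ with y′ ≟ y
        ... | yes refl = ≤-trans (*-mono-≤ (*-monoʳ-≤ (Y y) (Y≤1 y)) (self y)) (≤-trans (≤-reflexive (l₂ (Y y) (e * f))) (m≤n+m _ _))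
        ... | no n = ≤-trans (*-monoʳ-≤ (Y y * Y y′) (cross (λ p → n (sym p)))) (≤-trans (≤-reflexive (*-comm (Y y * Y y′) f)) (m≤m+n _ _))

      module _ (s₀ : Fin e) where
        -- Marks the x that see fewer than half of the expected n / e points of `Y` in colour `s₀`.
        bad : Fin q → ℕ
        bad x = 𝟙 (2 * (e * N x s₀) <? n)

        private
          pointwise : ∀ x s → 8 * ((e * N x s) * n) + 𝟙 (s ≟ s₀) * (bad x * (n * n)) ≤ 4 * ((e * N x s) * (e * N x s) + n * n)
          pointwise x s with s ≟ s₀
          ... | no _ = ≤-trans (≤-reflexive (+-identityʳ _)) (am-gm (e * N x s) n)
          ... | yes refl with 2 * (e * N x s) <? n
          ... | yes lt = ≤-trans (≤-reflexive (cong (8 * ((e * N x s) * n) +_) (l (n * n)))) (am-gm-gap (e * N x s) n (<⇒≤ lt))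
            where l : ∀ a → (a + 0) + 0 ≡ a
                  l = solve-∀
          ... | no _ = ≤-trans (≤-reflexive (+-identityʳ _)) (am-gm (e * N x s) n)

        -- Chebyshev's argument: `first` and `second` bound the sum of (e N - n)², and each bad
        -- point contributes at least n² / 4. Squares of differences appear as inequalities between
        -- 8 a b and 4 (a² + b²) in order to stay within ℕ.
        bad-bound : 0 < n → sum bad * n ≤ 4 * (e * e * (e * f)) + 4 * (e * n)
        bad-bound n>0 = *-cancelʳ-≤ _ _ n {{>-nonZero n>0}} (+-cancelˡ-≤ (8 * (e * n) * (n * (e * f))) _ _ (begin
          8 * (e * n) * (n * (e * f)) + sum bad * n * n
            ≤⟨ +-monoˡ-≤ _ (*-monoʳ-≤ (8 * (e * n)) first) ⟩
          8 * (e * n) * sum (λ x → sum (N x)) + sum bad * n * n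
            ≡⟨ cong₂ _+_ (trans (sym (sum-linear (8 * (e * n)) N)) (sum-cong-≗ (λ x → sum-cong-≗ (λ s → l₁ e n (N x s)))))
                 (trans (*-assoc (sum bad) n n) (trans (*-distribʳ-sum (n * n) bad) (sum-cong-≗ (λ x → sym (trans (sym (*-distribʳ-sum (bad x * (n * n)) (λ s → 𝟙 (s ≟ s₀))))
                   (trans (cong (_* (bad x * (n * n))) (sum-eq s₀)) (+-identityʳ _))))))) ⟩
          sum (λ x → sum (λ s → 8 * ((e * N x s) * n))) + sum (λ x → sum (λ s → 𝟙 (s ≟ s₀) * (bad x * (n * n))))
            ≡⟨ sym (sum-+₂ (λ x s → 8 * ((e * N x s) * n)) (λ x s → 𝟙 (s ≟ s₀) * (bad x * (n * n)))) ⟩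
          sum (λ x → sum (λ s → 8 * ((e * N x s) * n) + 𝟙 (s ≟ s₀) * (bad x * (n * n))))
            ≤⟨ sum-mono (λ x → sum-mono (pointwise x)) ⟩
          sum (λ x → sum (λ s → 4 * ((e * N x s) * (e * N x s) + n * n)))
            ≡⟨ trans (sum-cong-≗ (λ x → sum-cong-≗ (λ s → l₂ e (N x s) n))) (sum-+₂ {q} {e} (λ x s → 4 * (e * e) * (N x s * N x s)) (λ x s → 4 * (n * n))) ⟩
          sum (λ x → sum (λ s → 4 * (e * e) * (N x s * N x s))) + sum (λ (x : Fin q) → sum (λ (s : Fin e) → 4 * (n * n)))
            ≡⟨ cong₂ _+_ (sum-linear (4 * (e * e)) (λ x s → N x s * N x s)) (trans (sum-cong-≗ {q} (λ x → sum-const e (4 * (n * n)))) (sum-const q (e * (4 * (n * n))))) ⟩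
          4 * (e * e) * sum (λ x → sum (λ s → N x s * N x s)) + q * (e * (4 * (n * n)))
            ≤⟨ +-mono-≤ (*-monoʳ-≤ (4 * (e * e)) second) (≤-reflexive (cong (_* (e * (4 * (n * n)))) q≡)) ⟩
          4 * (e * e) * (f * (n * n) + (e * f) * n) + suc (e * f) * (e * (4 * (n * n)))
            ≡⟨ l₃ e f n ⟩
          8 * (e * n) * (n * (e * f)) + (4 * (e * e * (e * f)) + 4 * (e * n)) * n ∎))
          where
          open ≤-Reasoning
          l₁ : ∀ e n N → 8 * (e * n) * N ≡ 8 * ((e * N) * n)
          l₁ = solve-∀
          l₂ : ∀ e N n → 4 * ((e * N) * (e * N) + n * n) ≡ 4 * (e * e) * (N * N) + 4 * (n * n)
          l₂ = solve-∀
          l₃ : ∀ e f n → 4 * (e * e) * (f * (n * n) + (e * f) * n) + suc (e * f) * (e * (4 * (n * n))) ≡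
            8 * (e * n) * (n * (e * f)) + (4 * (e * e * (e * f)) + 4 * (e * n)) * n
          l₃ = solve-∀

        -- For sets of density at least 1 / D the bound does not involve q, so it is negligible for
        -- large q.
        few-bad : ∀ D → q ≤ D * n → sum bad ≤ 8 * (e * e) * D
        few-bad D dense = *-cancelʳ-≤ _ _ q {{>-nonZero q>0}} (begin
          sum bad * q                                    ≤⟨ *-monoʳ-≤ (sum bad) dense ⟩
          sum bad * (D * n)                              ≡⟨ l₁ (sum bad) D n ⟩
          D * (sum bad * n)                              ≤⟨ *-monoʳ-≤ D (bad-bound n>0) ⟩
          D * (4 * (e * e * (e * f)) + 4 * (e * n))      ≤⟨ *-monoʳ-≤ D (+-mono-≤ (*-monoʳ-≤ 4 (*-monoʳ-≤ (e * e) ef≤q)) (*-monoʳ-≤ 4 (*-mono-≤ (m≤m*n e e {{>-nonZero e>0}}) n≤q))) ⟩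
          D * (4 * (e * e * q) + 4 * (e * e * q))        ≡⟨ l₂ D e q ⟩
          8 * (e * e) * D * q                            ∎)
          where
          open ≤-Reasoning
          q>0 : 0 < q
          q>0 = subst (0 <_) (sym q≡) (s≤s z≤n)
          ef≤q : e * f ≤ q
          ef≤q = subst (e * f ≤_) (sym q≡) (n≤1+n _)
          n>0 : 0 < n
          n>0 = n≢0⇒n>0 (λ z → <-irrefl (sym (n≤0⇒n≡0 (subst (q ≤_) (trans (cong (D *_) z) (*-zeroʳ D)) dense))) q>0)
          l₁ : ∀ b d n → b * (d * n) ≡ d * (b * n)
          l₁ = solve-∀
          l₂ : ∀ d e q → d * (4 * (e * e * q) + 4 * (e * e * q)) ≡ 8 * (e * e) * d * q
          l₂ = solve-∀

    exceeds : ∀ {n} (f g : Fin n → ℕ) → sum g < sum f → Σ (Fin n) λ x → g x < f x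
    exceeds f g lt with any? (λ x → g x <? f x)
    ... | yes p = p
    ... | no none = ⊥-elim (<⇒≱ lt (sum-mono (λ x → ≮⇒≥ (λ h → none (x , h)))))

    degree : (Fin q → ℕ) → Fin q → Fin e → ℕ
    degree Y x s = sum (λ y → Y y * J x y s)

    private
      ¬bad : ∀ a b → 𝟙 (a <? b) ≡ 0 → b ≤ a
      ¬bad a b h with a <? b
      ... | no ge = ≮⇒≥ ge

    module Embed (κ η : ℕ) (few-bad′ : ∀ Y Y≤1 s D → q ≤ D * sum Y → sum (Second.bad Y Y≤1 s) ≤ κ * D)
      (η≡ : ∀ n → 2 * (e * n) ≡ η * n) where
      vertex : ∀ t D → t * (κ * D) * D < q → (Y₀ : Fin q → ℕ) → (∀ y → Y₀ y ≤ 1) → q ≤ D * sum Y₀ →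
        (Y : Fin t → Fin q → ℕ) → (∀ i y → Y i y ≤ 1) → (∀ i → q ≤ D * sum (Y i)) → (s : Fin t → Fin e) →
        Σ (Fin q) λ x → Y₀ x ≡ 1 × (∀ j → sum (Y j) ≤ η * degree (Y j) x (s j))
      vertex t D big Y₀ Y₀≤1 dense₀ Y Y≤1 dense s with exceeds Y₀ (λ x → sum (λ j → badAt j x)) room
        where
        badAt : Fin t → Fin q → ℕ
        badAt j = Second.bad (Y j) (Y≤1 j) (s j)
        few : sum (λ x → sum (λ j → badAt j x)) ≤ t * (κ * D)
        few = ≤-trans (≤-reflexive (∑-comm (λ x j → badAt j x))) (≤-trans (sum-mono (λ j → few-bad′ (Y j) (Y≤1 j) (s j) D (dense j)))
          (≤-reflexive (sum-const t (κ * D))))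
        room : sum (λ x → sum (λ j → badAt j x)) < sum Y₀
        room = *-cancelʳ-< D (sum (λ x → sum (λ j → badAt j x))) (sum Y₀) (begin-strict
          sum (λ x → sum (λ j → badAt j x)) * D  ≤⟨ *-monoˡ-≤ D few ⟩
          t * (κ * D) * D              <⟨ big ⟩
          q                                      ≤⟨ dense₀ ⟩
          D * sum Y₀                             ≡⟨ *-comm D _ ⟩
          sum Y₀ * D                             ∎)
          where open ≤-Reasoning
      ... | x , lt = x , ≤-antisym (Y₀≤1 x) (≤-trans (s≤s z≤n) lt)
          , λ j → ≤-trans (¬bad (2 * (e * degree (Y j) x (s j))) (sum (Y j)) (n≤0⇒n≡0 (≤-trans
              (term≤sum (λ j → Second.bad (Y j) (Y≤1 j) (s j) x) j) (≤-pred (≤-trans lt (Y₀≤1 x)))))) (≤-reflexive (η≡ _))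

      -- The first vertex is taken good for all later candidate sets. These are then cut down to the
      -- points it sees in the required colours, which costs a factor η of density.
      clique : ∀ t D → threshold κ η t D < q → (Y : Fin t → Fin q → ℕ) → (∀ i y → Y i y ≤ 1) → (∀ i → q ≤ D * sum (Y i)) →
        (s : Fin t → Fin t → Fin e) → Σ (Fin t → Fin q) λ b → (∀ i → Y i (b i) ≡ 1) × (∀ {i j} → toℕ i < toℕ j → J (b i) (b j) (s i j) ≡ 1)
      clique zero D big Y Y≤1 dense s = (λ ()) , (λ ()) , λ { {()} }
      clique (suc t) D big Y Y≤1 dense s
        with vertex t D (≤-<-trans (m≤m+n _ (threshold κ η t (D * η))) big) (Y zero) (Y≤1 zero) (dense zero)
               (λ j → Y (suc j)) (λ j → Y≤1 (suc j)) (λ j → dense (suc j)) (λ j → s zero (suc j))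
      ... | x , Yx , good
        with clique t (D * η) (≤-<-trans (m≤n+m _ (t * (κ * D) * D)) big)
               (λ j y → Y (suc j) y * J x y (s zero (suc j))) (λ j y → *-mono-≤ (Y≤1 (suc j) y) (J≤1 x y _))
               (λ j → ≤-trans (dense (suc j)) (≤-trans (*-monoʳ-≤ D (good j)) (≤-reflexive (l D η (degree (Y (suc j)) x (s zero (suc j)))))))
               (λ i j → s (suc i) (suc j))
        where l : ∀ d e n → d * (e * n) ≡ d * e * n
              l = solve-∀
      ... | b , b∈ , bJ = b′ , b′∈ , b′J
        where
        b′ : Fin (suc t) → Fin q
        b′ zero = x
        b′ (suc j) = b j
        b′∈ : ∀ i → Y i (b′ i) ≡ 1
        b′∈ zero = Yx
        b′∈ (suc j) = m*n≡1⇒m≡1 (Y (suc j) (b j)) _ (b∈ j)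
        b′J : ∀ {i j} → toℕ i < toℕ j → J (b′ i) (b′ j) (s i j) ≡ 1
        b′J {zero} {suc j} lt = m*n≡1⇒n≡1 (Y (suc j) (b j)) _ (b∈ j)
        b′J {suc i} {suc j} (s≤s lt) = bJ lt

    open Embed (8 * (e * e)) (2 * e) Second.few-bad (λ n → sym (*-assoc 2 e n)) public using (clique)

-- Cyclotomic classes form a quasi-random colouring

module CyclotomicClasses where
  open Designs
  open Fields
  open PairLattice using (∉⇒All)
  open FiniteFields
  open QuasiRandomness
  open import Data.Nat as ℕ using (ℕ; zero; suc; _≤_; _<_; z≤n; s≤s; >-nonZero)
  import Data.Nat.Properties as ℕ
  open import Data.Fin using (Fin; zero; suc; toℕ; cast)
  open import Data.Fin.Properties using (_≟_; toℕ-injective; toℕ-cast)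
  open import Data.List using (List; []; _∷_; length; map; filter; allFin; lookup; tabulate; cartesianProduct)
  open import Data.List.Properties using (length-map; length-tabulate)
  open import Data.List.Relation.Unary.All as All using (All; []; _∷_)
  import Data.List.Relation.Unary.All.Properties as All
  open import Data.List.Relation.Unary.AllPairs using ([]; _∷_)
  open import Data.List.Relation.Unary.Any using (here; there; index)
  open import Data.List.Relation.Unary.Any.Properties using (lookup-index)
  open import Data.List.Relation.Unary.Unique.Propositional using (Unique)
  open import Data.List.Relation.Unary.Unique.Propositional.Properties using (allFin⁺; filter⁺; tabulate⁺)
  open import Data.List.Membership.Propositional using (_∈_)
  open import Data.List.Membership.Propositional.Properties using (∈-filter⁺; ∈-filter⁻; ∈-map⁻; ∈-tabulate⁺; ∈-lookup)
  open import Data.Product using (Σ; _×_; _,_; proj₁; proj₂)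
  open import Data.Empty using (⊥-elim)
  open import Relation.Nullary using (¬_; yes; no; Dec; ¬?)
  open import Relation.Nullary.Decidable using (_×-dec_)
  open import Relation.Binary.PropositionalEquality using (_≡_; _≢_; refl; sym; trans; cong; subst)
  open import Function.Bundles using (Inverse)

  private
    map-unique : ∀ {A B : Set} {f : A → B} {xs} → Unique xs → (∀ {x y} → x ∈ xs → y ∈ xs → f x ≡ f y → x ≡ y) → Unique (map f xs)
    map-unique [] h = []
    map-unique {f = f} {x ∷ xs} (x∉ ∷ u) h = ∉⇒All (λ m → let y , y∈ , e = ∈-map⁻ f m in All.lookup x∉ y∈ (h (here refl) (there y∈) e))
      ∷ map-unique u (λ p q → h (there p) (there q))

    length-split : ∀ {A : Set} {P : A → Set} (P? : ∀ x → Dec (P x)) xs → length (filter P? xs) ℕ.+ length (filter (λ x → ¬? (P? x)) xs) ≡ length xs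
    length-split P? [] = refl
    length-split P? (x ∷ xs) with P? x
    ... | yes _ = cong suc (length-split P? xs)
    ... | no _ = trans (ℕ.+-suc _ _) (cong suc (length-split P? xs))

    fibres : ∀ {A B : Set} (_≟B_ : (x y : B) → Dec (x ≡ y)) (g : A → B) f (R : List B) xs → All (λ x → g x ∈ R) xs →
      (∀ z → length (filter (λ x → g x ≟B z) xs) ≤ f) → length xs ≤ length R ℕ.* f
    fibres _≟B_ g f [] [] [] h = z≤n
    fibres _≟B_ g f [] (x ∷ xs) (() ∷ _) h
    fibres {A} _≟B_ g f (z ∷ R) xs a h = ℕ.≤-trans (ℕ.≤-reflexive (sym (length-split (λ x → g x ≟B z) xs)))
      (ℕ.+-mono-≤ (h z) (fibres _≟B_ g f R (filter (λ x → ¬? (g x ≟B z)) xs)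
        (All.tabulate (λ {x} x∈ → let x∈xs , n = ∈-filter⁻ (λ x → ¬? (g x ≟B z)) {xs = xs} x∈ in drop n (All.lookup a x∈xs)))
        (λ z′ → ℕ.≤-trans (mono (λ x → g x ≟B z′) xs) (h z′))))
      where
      drop : ∀ {y} → ¬ y ≡ z → y ∈ z ∷ R → y ∈ R
      drop n (here e) = ⊥-elim (n e)
      drop n (there p) = p
      mono : ∀ {P : A → Set} (P? : ∀ x → Dec (P x)) xs → length (filter P? (filter (λ x → ¬? (g x ≟B z)) xs)) ≤ length (filter P? xs)
      mono P? [] = z≤n
      mono P? (x ∷ xs) with g x ≟B z
      ... | yes _ with P? x
      ... | yes _ = ℕ.m≤n⇒m≤1+n (mono P? xs)
      ... | no _ = mono P? xs
      mono P? (x ∷ xs) | no _ with P? x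
      ... | yes _ = s≤s (mono P? xs)
      ... | no _ = mono P? xs

    sum-filter : ∀ {n} {A : Set} {P : A → Set} (P? : ∀ x → Dec (P x)) (g : Fin n → A) → sum (λ i → 𝟙 (P? (g i))) ≡ length (filter P? (tabulate g))
    sum-filter {zero} P? g = refl
    sum-filter {suc n} P? g with P? (g zero)
    ... | yes _ = cong suc (sum-filter P? (λ i → g (suc i)))
    ... | no _ = sum-filter P? (λ i → g (suc i))

  -- The class of x, a coset of the f-th roots of unity, is recorded by the value x ^ f, which is an
  -- e-th root of unity.
  module Cyclotomy {e f : ℕ} (K : Field (suc (e ℕ.* f))) (e>0 : 0 < e) (f>0 : 0 < f) where
    open Field K
    open FieldTheory K
    private
      q : ℕ
      q = suc (e ℕ.* f)
      open Inverse size using (to; from; inverseˡ; inverseʳ)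
      from-inj : ∀ {x y} → from x ≡ from y → x ≡ y
      from-inj p = trans (sym (inverseˡ refl)) (trans (cong to p) (inverseˡ refl))
    _∖_ : Carrier → Carrier → Carrier
    x ∖ y = x + - y
    ∖≢0 : ∀ {x y} → x ≢ y → x ∖ y ≢ 0#
    ∖≢0 n z = n (sub≡0 z)
    1^ : ∀ n → 1# ^ n ≡ 1#
    1^ zero = refl
    1^ (suc n) = trans (*-identityˡ _) (1^ n)

    abstract
      els : List Carrier
      els = tabulate from
      els-unique : Unique els
      els-unique = tabulate⁺ {f = from} from-inj
      ∈-els : ∀ x → x ∈ els
      ∈-els x = subst (_∈ els) (inverseʳ refl) (∈-tabulate⁺ {f = from} (to x))
      R : List Carrier
      R = filter (λ z → (z ^ e) ≟F 1#) els
      R-unique : Unique R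
      R-unique = filter⁺ (λ z → (z ^ e) ≟F 1#) els-unique
      ∈-R : ∀ {x} → x ≢ 0# → x ^ f ∈ R
      ∈-R {x} n = ∈-filter⁺ (λ z → (z ^ e) ≟F 1#) (∈-els _) (trans (^-assocʳ x f e) (trans (cong (x ^_) (ℕ.*-comm f e)) (fermat n)))
      nz : List Carrier
      nz = filter (λ x → ¬? (x ≟F 0#)) els
      length-nz : e ℕ.* f ≤ length nz
      length-nz = ℕ.≤-pred (ℕ.≤-trans (ℕ.≤-reflexive (trans (sym (length-tabulate from)) (sym (length-split (λ x → x ≟F 0#) els))))
        (ℕ.+-monoˡ-≤ (length nz) (one (filter⁺ (λ x → x ≟F 0#) els-unique) (All.all-filter (λ x → x ≟F 0#) els))))
        where one : ∀ {xs : List Carrier} → Unique xs → All (_≡ 0#) xs → length xs ≤ 1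
              one [] [] = z≤n
              one (_ ∷ []) (_ ∷ []) = s≤s z≤n
              one ((n ∷ _) ∷ _) (p ∷ q ∷ _) = ⊥-elim (n (trans p (sym q)))
      -- At most e by counting roots. At least e, because the e f nonzero elements are distributed
      -- over `R` by x ^ f, with at most f in each fibre.
      length-R : length R ≡ e
      length-R = ℕ.≤-antisym (power-roots-≤ e 1# e>0 R-unique (All.all-filter (λ z → (z ^ e) ≟F 1#) els))
        (ℕ.*-cancelʳ-≤ e (length R) f {{>-nonZero f>0}} (ℕ.≤-trans length-nz (fibres _≟F_ (_^ f) f R nz
          (All.map ∈-R (All.all-filter (λ x → ¬? (x ≟F 0#)) els))
          (λ z → power-roots-≤ f z f>0 (filter⁺ (λ x → (x ^ f) ≟F z) {xs = nz} (filter⁺ (λ x → ¬? (x ≟F 0#)) els-unique)) (All.all-filter (λ x → (x ^ f) ≟F z) nz)))))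

      root : Fin e → Carrier
      root s = lookup R (cast (sym length-R) s)

      root-find : ∀ {x} → x ≢ 0# → Σ (Fin e) λ s → x ^ f ≡ root s
      root-find n = cast length-R (index (∈-R n)) , trans (lookup-index (∈-R n))
        (cong (lookup R) (toℕ-injective (sym (trans (toℕ-cast (sym length-R) (cast length-R (index (∈-R n)))) (toℕ-cast length-R _)))))

      root-inj : ∀ {s t} → root s ≡ root t → s ≡ t
      root-inj {s} {t} p = toℕ-injective (trans (sym (toℕ-cast (sym length-R) s)) (trans (cong toℕ (inj R-unique p)) (toℕ-cast (sym length-R) t)))
        where inj : ∀ {xs : List Carrier} → Unique xs → ∀ {a b} → lookup xs a ≡ lookup xs b → a ≡ b
              inj (x∉ ∷ u) {zero} {zero} e = refl
              inj (x∉ ∷ u) {zero} {suc b} e = ⊥-elim (All.lookup x∉ (∈-lookup b) e)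
              inj (x∉ ∷ u) {suc a} {zero} e = ⊥-elim (All.lookup x∉ (∈-lookup a) (sym e))
              inj (x∉ ∷ u) {suc a} {suc b} e = cong suc (inj u e)

    Col : Fin q → Fin q → Fin e → Set
    Col x y s = x ≢ y × (from x ∖ from y) ^ f ≡ root s
    col? : ∀ x y s → Dec (Col x y s)
    col? x y s = ¬? (x ≟ y) ×-dec ((from x ∖ from y) ^ f) ≟F root s

    private
      J : Fin q → Fin q → Fin e → ℕ
      J x y s = 𝟙 (col? x y s)
      J-sum : ∀ x y → sum (J x y) ℕ.+ 𝟙 (x ≟ y) ≡ 1
      J-sum x y = go (x ≟ y)
        where
        hit : x ≢ y → 1 ≤ sum (J x y)
        hit n with root-find (∖≢0 (λ e → n (from-inj e)))
        ... | s , p = subst (_≤ sum (J x y)) (𝟙-yes (col? x y s) (n , p)) (term≤sum (J x y) s)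
        go : (d : Dec (x ≡ y)) → sum (J x y) ℕ.+ 𝟙 d ≡ 1
        go (yes p) = cong (ℕ._+ 1) (sum-zero {e} {J x y} (λ s → 𝟙-no (col? x y s) (λ c → proj₁ c p)))
        go (no n) = trans (ℕ.+-identityʳ _) (ℕ.≤-antisym (sum-at-most-one (col? x y) (λ p q → root-inj (trans (sym (proj₂ p)) (proj₂ q)))) (hit n))
      JJ≤ : ∀ x y (g : Fin e → ℕ) → (∀ s → g s ≤ 1) → sum (λ s → J x y s ℕ.* g s) ≤ sum (J x y)
      JJ≤ x y g g≤1 = sum-mono {e} {λ s → J x y s ℕ.* g s} {J x y}
        (λ s → ℕ.≤-trans (ℕ.*-monoʳ-≤ (J x y s) (g≤1 s)) (ℕ.≤-reflexive (ℕ.*-identityʳ (J x y s))))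
      J-total : ∀ y → sum (λ x → sum (J x y)) ℕ.+ 1 ≡ q
      J-total y = trans (cong (sum (λ x → sum (J x y)) ℕ.+_) (sym (sum-eq y))) (trans (sym (∑-distrib-+ (λ x → sum (J x y)) (λ x → 𝟙 (x ≟ y))))
        (trans (sum-cong-≗ {q} {λ x → sum (J x y) ℕ.+ 𝟙 (x ≟ y)} {λ _ → 1} (λ x → J-sum x y)) (trans (sum-const q 1) (ℕ.*-identityʳ q))))
      J-total′ : ∀ y → sum (λ x → sum (J x y)) ≡ e ℕ.* f
      J-total′ y = ℕ.suc-injective (trans (ℕ.+-comm 1 _) (J-total y))

      Same : Fin q → Fin q → Fin q → Set
      Same y y′ x = x ≢ y × x ≢ y′ × (from x ∖ from y) ^ f ≡ (from x ∖ from y′) ^ f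
      same? : ∀ y y′ x → Dec (Same y y′ x)
      same? y y′ x = ¬? (x ≟ y) ×-dec (¬? (x ≟ y′) ×-dec ((from x ∖ from y) ^ f) ≟F ((from x ∖ from y′) ^ f))

      JJ : ∀ x y y′ → sum (λ s → J x y s ℕ.* J x y′ s) ≤ 𝟙 (same? y y′ x)
      JJ x y y′ = go (same? y y′ x)
        where
        none : ¬ Same y y′ x → ∀ s → J x y s ℕ.* J x y′ s ≡ 0
        none n s with col? x y s | col? x y′ s
        ... | yes (p , e) | yes (p′ , e′) = ⊥-elim (n (p , p′ , trans e (sym e′)))
        ... | yes _ | no _ = refl
        ... | no _ | _ = refl
        go : (d : Dec (Same y y′ x)) → sum (λ s → J x y s ℕ.* J x y′ s) ≤ 𝟙 d
        go (yes _) = ℕ.≤-trans (JJ≤ x y (J x y′) (λ s → 𝟙≤1 (col? x y′ s)))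
          (ℕ.m+n≤o⇒m≤o (sum (J x y)) (ℕ.≤-reflexive (J-sum x y)))
        go (no n) = ℕ.≤-reflexive (sum-zero (none n))

      -- The quotient (x - y) / (x - y′) is an f-th root of unity, and for distinct y and y′ this
      -- fractional linear function of x is injective.
      same-few : ∀ {y y′} → y ≢ y′ → sum (λ x → 𝟙 (same? y y′ x)) ≤ f
      same-few {y} {y′} n = ℕ.≤-trans (ℕ.≤-reflexive (sum-filter (same? y y′) (λ x → x)))
        (bound (filter (same? y y′) (allFin q)) (filter⁺ (same? y y′) (allFin⁺ q)) (All.all-filter (same? y y′) (allFin q)))
        where
        Y = from y
        Y′ = from y′
        u : Fin q → Carrier
        u x = (from x ∖ Y) * inv (from x ∖ Y′)
        d≢0 : ∀ {x} → x ≢ y′ → from x ∖ Y′ ≢ 0#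
        d≢0 p = ∖≢0 (λ e → p (from-inj e))
        unit : ∀ x → x ≢ y′ → (from x ∖ Y) ^ f ≡ (from x ∖ Y′) ^ f → u x ^ f ≡ 1#
        unit x p eq = trans (^-distrib-* _ _ f) (trans (cong (_* inv (from x ∖ Y′) ^ f) eq) (trans (sym (^-distrib-* _ _ f)) (trans (cong (_^ f) (inv-ok (d≢0 p))) (1^ f))))
        u-mul : ∀ {x} → x ≢ y′ → u x * (from x ∖ Y′) ≡ from x ∖ Y
        u-mul {x} p = trans (*-assoc _ _ _) (trans (cong ((from x ∖ Y) *_) (trans (*-comm _ _) (inv-ok (d≢0 p)))) (*-identityʳ _))
        inj : ∀ {x z} → x ≢ y′ → z ≢ y′ → u x ≡ u z → x ≡ z
        inj {x} {z} px pz eq = from-inj (*-cancelˡ (∖≢0 (λ p → n (from-inj p))) (trans (lem (from x) (from z) Y Y′) (trans (cong (λ t → (Y ∖ Y′) * from z + (t + - ((from z ∖ Y) * (from x ∖ Y′)))) cross) (trans (cong ((Y ∖ Y′) * from z +_) (-‿inverseʳ _)) (+-identityʳ _)))))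
          where
          cross : (from x ∖ Y) * (from z ∖ Y′) ≡ (from z ∖ Y) * (from x ∖ Y′)
          cross = trans (cong (_* (from z ∖ Y′)) (sym (u-mul px))) (trans (cong (λ t → t * (from x ∖ Y′) * (from z ∖ Y′)) eq)
            (trans (solve 3 (λ a b c → a :* b :* c := a :* c :* b) refl (u z) (from x ∖ Y′) (from z ∖ Y′)) (cong (_* (from x ∖ Y′)) (u-mul pz))))
          lem : ∀ a b c d → (c + - d) * a ≡ (c + - d) * b + ((a + - c) * (b + - d) + - ((b + - c) * (a + - d)))
          lem = solve 4 (λ a b c d → (c :+ (:- d)) :* a := (c :+ (:- d)) :* b :+ ((a :+ (:- c)) :* (b :+ (:- d)) :+ (:- ((b :+ (:- c)) :* (a :+ (:- d)))))) refl

        bound : ∀ L → Unique L → All (Same y y′) L → length L ≤ f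
        bound L uL aL = subst (_≤ f) (length-map u L) (power-roots-≤ f 1# f>0
          (map-unique uL (λ x∈ z∈ → inj (proj₁ (proj₂ (All.lookup aL x∈))) (proj₁ (proj₂ (All.lookup aL z∈)))))
          (All.map⁺ (All.map (λ { {x} (_ , p′ , eq) → unit x p′ eq }) aL)))

    quasiRandom : QuasiRandom q e f
    quasiRandom = record
      { J = J ; J≤1 = λ x y s → 𝟙≤1 (col? x y s) ; q≡ = refl
      ; total = λ y → ℕ.≤-reflexive (sym (J-total′ y))
      ; self = λ y → ℕ.≤-trans (sum-mono (λ x → JJ≤ x y (J x y) (λ s → 𝟙≤1 (col? x y s))))
          (ℕ.≤-reflexive (J-total′ y))
      ; cross = λ {y} {y′} n → ℕ.≤-trans (sum-mono (λ x → JJ x y y′)) (same-few n) }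

  pairs : ∀ k → List (Fin k × Fin k)
  pairs k = filter (λ p → toℕ (proj₁ p) ℕ.<? toℕ (proj₂ p)) (cartesianProduct (allFin k) (allFin k))

-- Developing a single base block over a field

module DifferenceFamilies where
  open Designs
  open Fields
  open FiniteFields
  open QuasiRandomness
  open CyclotomicClasses
  open import Data.Nat as ℕ using (ℕ; zero; suc; _<_)
  import Data.Nat.Properties as ℕ
  open import Data.Fin using (Fin; zero; suc; toℕ)
  open import Data.Fin.Properties using (toℕ-injective)
  open import Data.List using (List)
  open import Data.List.Relation.Unary.All using (All)
  open import Data.List.Relation.Unary.Unique.Propositional using (Unique)
  open import Data.Product using (Σ; _×_; _,_; proj₁; proj₂)
  open import Data.Sum using (_⊎_; inj₁; inj₂)
  open import Data.Bool.Properties using (T-irrelevant)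
  open import Data.Empty using (⊥-elim)
  open import Relation.Nullary using (Dec)
  open import Relation.Nullary.Decidable using (_×-dec_; True; toWitness; fromWitness)
  open import Relation.Binary.Definitions using (Tri; tri<; tri≈; tri>)
  open import Relation.Binary.PropositionalEquality using (_≡_; _≢_; refl; sym; trans; cong; cong₂; subst; subst₂)
  open import Function.Bundles using (Inverse)

  -- Developing one block whose differences, up to sign, represent every coset of the f-th roots of unity once.
  module Develop {m′ : ℕ} (K : Field (suc m′)) (2≢0 : Field._+_ K (Field.1# K) (Field.1# K) ≢ Field.0# K) (f′ k : ℕ)
    (b : Fin k → Field.Carrier K) (b-inj : ∀ {i j} → b i ≡ b j → i ≡ j)
    (coset : ∀ {x} → x ≢ Field.0# K → Σ (Fin k) λ i → Σ (Fin k) λ j → toℕ i < toℕ j ×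
      FieldTheory._^_ K (Field._+_ K (b i) (Field.-_ K (b j))) (2 ℕ.* f′) ≡ FieldTheory._^_ K x (2 ℕ.* f′))
    (same-pair : ∀ {i j i′ j′} → toℕ i < toℕ j → toℕ i′ < toℕ j′ →
      FieldTheory._^_ K (Field._+_ K (b i) (Field.-_ K (b j))) (2 ℕ.* f′) ≡ FieldTheory._^_ K (Field._+_ K (b i′) (Field.-_ K (b j′))) (2 ℕ.* f′) →
      (i , j) ≡ (i′ , j′)) where
    open Field K
    open FieldTheory K
    open Inverse size using (to; from; inverseʳ)
    private
      f = 2 ℕ.* f′
      _∖_ : Carrier → Carrier → Carrier
      x ∖ y = x + - y
      ∖≢0 : ∀ {x y} → x ≢ y → x ∖ y ≢ 0#
      ∖≢0 n z = n (sub≡0 z)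
      1^ : ∀ n → 1# ^ n ≡ 1#
      1^ zero = refl
      1^ (suc n) = trans (*-identityˡ _) (1^ n)
      neg^ : ∀ x → (- x) ^ f ≡ x ^ f
      neg^ x = trans (sym (^-assocʳ (- x) 2 f′)) (trans (cong (_^ f′) (solve 2 (λ x u → (:- x) :* ((:- x) :* u) := x :* (x :* u)) refl x 1#)) (^-assocʳ x 2 f′))
      swap^ : ∀ x y → (x ∖ y) ^ f ≡ (y ∖ x) ^ f
      swap^ x y = trans (cong (_^ f) (solve 2 (λ x y → x :+ (:- y) := :- (y :+ (:- x))) refl x y)) (neg^ _)

      -- Since f is even, -1 is an f-th root of unity, and h and - h give blocks with the same
      -- differences. One of the two is kept, by the order of the enumeration, lest every pair be
      -- covered twice.
      Pos : Carrier → Set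
      Pos h = (h ^ f ≡ 1#) × (toℕ (to h) < toℕ (to (- h)))
      pos? : ∀ h → Dec (Pos h)
      pos? h = ((h ^ f) ≟F 1#) ×-dec (toℕ (to h) ℕ.<? toℕ (to (- h)))
      to-inj : ∀ {x y} → to x ≡ to y → x ≡ y
      to-inj p = trans (sym (inverseʳ refl)) (trans (cong from p) (inverseʳ refl))
      neg-neg : ∀ x → - - x ≡ x
      neg-neg x = solve 1 (λ x → :- (:- x) := x) refl x
      Pos⇒≢0 : ∀ {h} → Pos h → h ≢ 0#
      Pos⇒≢0 (_ , lt) refl = ℕ.<-irrefl (cong (λ z → toℕ (to z)) (sym (trans (sym (+-identityˡ _)) (-‿inverseʳ 0#)))) lt
      either : ∀ {h} → h ≢ 0# → h ^ f ≡ 1# → Pos h ⊎ Pos (- h)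
      either {h} n p with ℕ.<-cmp (toℕ (to h)) (toℕ (to (- h)))
      ... | tri< lt _ _ = inj₁ (p , lt)
      ... | tri> _ _ gt = inj₂ (trans (neg^ h) p , subst (toℕ (to (- h)) <_) (cong (λ z → toℕ (to z)) (sym (neg-neg h))) gt)
      -- A tie would mean h = - h, impossible outside characteristic 2.
      ... | tri≈ _ e _ = ⊥-elim (*-nonzero 2≢0 n (trans (distribʳ h 1# 1#) (trans (cong₂ _+_ (*-identityˡ h) (trans (*-identityˡ h) (to-inj (toℕ-injective e)))) (-‿inverseʳ h))))

      Bl = Σ (Carrier × Carrier) λ B → True (pos? (proj₁ B))
      pt : Bl → Fin k → Carrier
      pt ((h , z) , _) a = h * b a + z
      Bl-ext : ∀ {B B′ : Bl} → proj₁ B ≡ proj₁ B′ → B ≡ B′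
      Bl-ext {_ , p} {_ , p′} refl = cong (_ ,_) (T-irrelevant p p′)
      Bl-pos : (B : Bl) → Pos (proj₁ (proj₁ B))
      Bl-pos (_ , p) = toWitness p

      cov : ∀ {x y} → x ≢ y → Σ Bl λ B → Σ (Fin k) λ a → Σ (Fin k) λ c → a ≢ c × pt B a ≡ x × pt B c ≡ y
      cov {x} {y} n with coset (∖≢0 n)
      ... | i , j , lt , pij = go (either h≢0 h^f)
        where
        i≢j : i ≢ j
        i≢j refl = ℕ.<-irrefl refl lt
        δ = x ∖ y
        d = b i ∖ b j
        d≢0 : d ≢ 0#
        d≢0 = ∖≢0 (λ e → i≢j (b-inj e))
        -- The multiplier that carries the difference of positions i and j to x - y; the choice of i
        -- and j in the same coset makes it an f-th root of unity.
        h = δ * inv d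
        hd : h * d ≡ δ
        hd = trans (*-assoc _ _ _) (trans (cong (δ *_) (trans (*-comm _ _) (inv-ok d≢0))) (*-identityʳ δ))
        h≢0 : h ≢ 0#
        h≢0 z = ∖≢0 n (trans (sym hd) (trans (cong (_* d) z) (zeroˡ d)))
        h^f : h ^ f ≡ 1#
        h^f = trans (^-distrib-* δ (inv d) f) (trans (cong (_* inv d ^ f) (sym pij)) (trans (sym (^-distrib-* d (inv d) f)) (trans (cong (_^ f) (inv-ok d≢0)) (1^ f))))
        go : Pos h ⊎ Pos (- h) → Σ Bl λ B → Σ (Fin k) λ a → Σ (Fin k) λ c → a ≢ c × pt B a ≡ x × pt B c ≡ y
        go (inj₁ p) = ((h , x + - (h * b i)) , fromWitness p) , i , j , i≢j
          , solve 2 (λ u x → u :+ (x :+ (:- u)) := x) refl (h * b i) x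
          , trans (solve 4 (λ h bi bj x → h :* bj :+ (x :+ (:- (h :* bi))) := x :+ (:- (h :* (bi :+ (:- bj))))) refl h (b i) (b j) x)
              (trans (cong (λ t → x + - t) hd) (solve 2 (λ x y → x :+ (:- (x :+ (:- y))) := y) refl x y))
        go (inj₂ p) = ((- h , x + h * b j) , fromWitness p) , j , i , (λ e → i≢j (sym e))
          , solve 3 (λ h bj x → (:- h) :* bj :+ (x :+ h :* bj) := x) refl h (b j) x
          , trans (solve 4 (λ h bi bj x → (:- h) :* bi :+ (x :+ h :* bj) := x :+ (:- (h :* (bi :+ (:- bj))))) refl h (b i) (b j) x)
              (trans (cong (λ t → x + - t) hd) (solve 2 (λ x y → x :+ (:- (x :+ (:- y))) := y) refl x y))

      finish : ∀ {h h′ z z′ a} → h ≡ h′ → h * b a + z ≡ h′ * b a + z′ → (h , z) ≡ (h′ , z′)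
      finish {h} {z = z} {z′} {a} refl e = cong (h ,_) (trans (solve 2 (λ u z → z := (:- u) :+ (u :+ z)) refl (h * b a) z)
        (trans (cong (- (h * b a) +_) e) (solve 2 (λ u z → (:- u) :+ (u :+ z) := z) refl (h * b a) z′)))

      unq : ∀ (B B′ : Bl) {a c a′ c′} → a ≢ c → a′ ≢ c′ → pt B a ≡ pt B′ a′ → pt B c ≡ pt B′ c′ → B ≡ B′
      unq B@((h , z) , _) B′@((h′ , z′) , _) {a} {c} {a′} {c′} n n′ p p′ = Bl-ext {B} {B′} (orient (ℕ.<-cmp (toℕ a) (toℕ c)) (ℕ.<-cmp (toℕ a′) (toℕ c′)))
        where
        hh : h * (b a ∖ b c) ≡ h′ * (b a′ ∖ b c′)
        hh = trans (solve 4 (λ h x y z → h :* (x :+ (:- y)) := (h :* x :+ z) :+ (:- (h :* y :+ z))) refl h (b a) (b c) z)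
          (trans (cong₂ (λ u w → u + - w) p p′) (solve 4 (λ h x y z → (h :* x :+ z) :+ (:- (h :* y :+ z)) := h :* (x :+ (:- y))) refl h′ (b a′) (b c′) z′))
        pw : (b a ∖ b c) ^ f ≡ (b a′ ∖ b c′) ^ f
        pw = trans (sym (strip (proj₁ (Bl-pos B)) (b a ∖ b c))) (trans (cong (_^ f) hh) (strip (proj₁ (Bl-pos B′)) (b a′ ∖ b c′)))
          where strip : ∀ {h} → h ^ f ≡ 1# → ∀ x → (h * x) ^ f ≡ x ^ f
                strip {h} e x = trans (^-distrib-* h x f) (trans (cong (_* x ^ f) e) (*-identityˡ _))
        same : a ≡ a′ → c ≡ c′ → (h , z) ≡ (h′ , z′)
        same refl refl = finish (*-cancelˡ (∖≢0 (λ e → n (b-inj e))) (trans (*-comm _ h) (trans hh (*-comm h′ _)))) p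
        -- Crossed positions force h = - h′, but only one of the two signs was kept.
        opposite : a ≡ c′ → c ≡ a′ → (h , z) ≡ (h′ , z′)
        opposite refl refl = ⊥-elim (ℕ.<-asym (proj₂ (Bl-pos B)) (subst₂ (λ u w → toℕ (to u) < toℕ (to w)) h′≡ (sym h≡) (proj₂ (Bl-pos B′))))
          where h≡ : h ≡ - h′
                h≡ = *-cancelˡ (∖≢0 (λ e → n (b-inj e))) (trans (*-comm _ h) (trans hh (solve 3 (λ h x y → h :* (y :+ (:- x)) := (x :+ (:- y)) :* (:- h)) refl h′ (b a) (b c))))
                h′≡ : h′ ≡ - h
                h′≡ = trans (sym (neg-neg h′)) (cong -_ (sym h≡))
        orient : Tri (toℕ a < toℕ c) (toℕ a ≡ toℕ c) (toℕ c < toℕ a) → Tri (toℕ a′ < toℕ c′) (toℕ a′ ≡ toℕ c′) (toℕ c′ < toℕ a′) → (h , z) ≡ (h′ , z′)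
        orient (tri≈ _ e _) _ = ⊥-elim (n (toℕ-injective e))
        orient _ (tri≈ _ e _) = ⊥-elim (n′ (toℕ-injective e))
        orient (tri< lt _ _) (tri< lt′ _ _) = let e = same-pair lt lt′ pw in same (cong proj₁ e) (cong proj₂ e)
        orient (tri< lt _ _) (tri> _ _ gt′) = let e = same-pair lt gt′ (trans pw (swap^ _ _)) in opposite (cong proj₁ e) (cong proj₂ e)
        orient (tri> _ _ gt) (tri< lt′ _ _) = let e = same-pair gt lt′ (trans (swap^ _ _) pw) in opposite (cong proj₂ e) (cong proj₁ e)
        orient (tri> _ _ gt) (tri> _ _ gt′) = let e = same-pair gt gt′ (trans (swap^ _ _) (trans pw (swap^ _ _))) in same (cong proj₂ e) (cong proj₁ e)

    design : Design k Carrier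
    design = record
      { Blk = Bl ; pt = pt ; irr = λ p → p refl
      ; edge = λ B n e → n (b-inj (*-cancelˡ (Pos⇒≢0 (Bl-pos B)) (+-cancelʳ _ e)))
      ; cover = cov
      ; uniq = λ {B} {B′} → unq B B′ }

-- Designs of large prime order

module CyclotomicDesigns where
  open Designs
  open Fields
  open SubsetLists using (module Rank)
  open FiniteFields
  open QuasiRandomness
  open CyclotomicClasses
  open DifferenceFamilies
  open import Data.Nat as ℕ using (ℕ; suc; _≤_; _<_; z≤n; s≤s; NonZero; >-nonZero)
  import Data.Nat.Properties as ℕ
  open import Data.Nat.DivMod using (_mod_; _%_; m<n⇒m%n≡m)
  open import Data.Nat.Divisibility using (_∣_; divides)
  open import Data.Nat.Primality using (Prime)
  open import Data.Nat.Tactic.RingSolver using (solve-∀)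
  open import Data.Fin using (Fin; toℕ; fromℕ<)
  open import Data.Fin.Properties using (_≟_; toℕ-injective; toℕ-fromℕ<; toℕ<n)
  open import Data.List using (List; _∷_; length; allFin; cartesianProduct)
  open import Data.List.Relation.Unary.Unique.Propositional using (Unique)
  open import Data.List.Relation.Unary.Unique.Propositional.Properties using (allFin⁺; filter⁺; cartesianProduct⁺)
  open import Data.List.Membership.Propositional using (_∈_)
  open import Data.List.Membership.Propositional.Properties using (∈-filter⁺; ∈-filter⁻; ∈-allFin; ∈-cartesianProduct⁺)
  open import Data.Product using (Σ; _×_; _,_; proj₁; proj₂)
  open import Data.Product.Properties using (≡-dec)
  open import Data.Empty using (⊥-elim)
  open import Relation.Binary.Definitions using (tri<; tri≈; tri>)
  open import Relation.Binary.PropositionalEquality using (_≡_; _≢_; refl; sym; trans; cong; subst)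
  open import Function.Bundles using (Inverse)

  private
    dense : ∀ q → q ≤ 1 ℕ.* sum {q} (λ _ → 1)
    dense q = ℕ.≤-reflexive (sym (trans (ℕ.+-identityʳ _) (trans (sum-const q 1) (ℕ.*-identityʳ q))))

  module Family {e f′ k : ℕ} (K : Field (suc (e ℕ.* (2 ℕ.* f′)))) (e>0 : 0 < e) (f>0 : 0 < 2 ℕ.* f′)
    (2≢0 : Field._+_ K (Field.1# K) (Field.1# K) ≢ Field.0# K)
    (PL : List (Fin k × Fin k)) (PL-unique : Unique PL) (PL∋ : ∀ {i j} → toℕ i < toℕ j → (i , j) ∈ PL)
    (PL< : ∀ {i j} → (i , j) ∈ PL → toℕ i < toℕ j) (len : length PL ≡ e) where
    open Field K using (size)
    open Cyclotomy K e>0 f>0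
    open Inverse size using (to; from; inverseˡ)
    open Rank (≡-dec (_≟_ {k}) (_≟_ {k}))
    private
      instance
        nze : NonZero e
        nze = >-nonZero e>0
    -- Every pair of positions is assigned a class of its own, so that the differences of the block
    -- represent each class once.
    s : Fin k → Fin k → Fin e
    s i j = rank PL (i , j) mod e
    private
      toℕ-s : ∀ {i j} → toℕ i < toℕ j → toℕ (s i j) ≡ rank PL (i , j)
      toℕ-s {i} {j} lt = trans (toℕ-fromℕ< _) (m<n⇒m%n≡m (subst (rank PL (i , j) <_) len (rank< (PL∋ lt))))

    fromClique : (b₀ : Fin k → Fin (suc (e ℕ.* (2 ℕ.* f′)))) → (∀ {i j} → toℕ i < toℕ j → Col (b₀ i) (b₀ j) (s i j)) →
      Design k (Field.Carrier K)
    fromClique b₀ edge = Develop.design K 2≢0 f′ k (λ i → from (b₀ i)) (λ e → b-inj (from-inj e)) coset same-pair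
      where
      from-inj : ∀ {x y} → from x ≡ from y → x ≡ y
      from-inj p = trans (sym (inverseˡ refl)) (trans (cong to p) (inverseˡ refl))
      b-inj : ∀ {i j} → b₀ i ≡ b₀ j → i ≡ j
      b-inj {i} {j} e with ℕ.<-cmp (toℕ i) (toℕ j)
      ... | tri< lt _ _ = ⊥-elim (proj₁ (edge lt) e)
      ... | tri≈ _ p _ = toℕ-injective p
      ... | tri> _ _ gt = ⊥-elim (proj₁ (edge gt) (sym e))
      coset : ∀ {x} → x ≢ Field.0# K → Σ (Fin k) λ i → Σ (Fin k) λ j → toℕ i < toℕ j ×
        FieldTheory._^_ K (from (b₀ i) ∖ from (b₀ j)) (2 ℕ.* f′) ≡ FieldTheory._^_ K x (2 ℕ.* f′)
      coset n with root-find n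
      ... | c , pc with unrank PL-unique (subst (toℕ c <_) (sym len) (toℕ<n c))
      ... | (i , j) , m , r = i , j , PL< m , trans (proj₂ (edge (PL< m))) (trans (cong root (toℕ-injective (trans (toℕ-s (PL< m)) r))) (sym pc))
      same-pair : ∀ {i j i′ j′} → toℕ i < toℕ j → toℕ i′ < toℕ j′ →
        FieldTheory._^_ K (from (b₀ i) ∖ from (b₀ j)) (2 ℕ.* f′) ≡ FieldTheory._^_ K (from (b₀ i′) ∖ from (b₀ j′)) (2 ℕ.* f′) → (i , j) ≡ (i′ , j′)
      same-pair lt lt′ e = rank-inj (PL∋ lt) (PL∋ lt′) (trans (sym (toℕ-s lt)) (trans (cong toℕ (root-inj (trans (sym (proj₂ (edge lt))) (trans e (proj₂ (edge lt′)))))) (toℕ-s lt′)))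

    design : threshold (8 ℕ.* (e ℕ.* e)) (2 ℕ.* e) k 1 < suc (e ℕ.* (2 ℕ.* f′)) → Design k (Field.Carrier K)
    design big = finish (Greedy.clique quasiRandom e>0 k 1 big (λ _ _ → 1) (λ _ _ → s≤s z≤n) (λ _ → dense (suc (e ℕ.* (2 ℕ.* f′)))) s)
      where
      finish : (Σ (Fin k → Fin (suc (e ℕ.* (2 ℕ.* f′)))) λ b → (∀ i → 1 ≡ 1) ×
        (∀ {i j} → toℕ i < toℕ j → QuasiRandom.J quasiRandom (b i) (b j) (s i j) ≡ 1)) → Design k (Field.Carrier K)
      finish (b₀ , _ , bJ) = fromClique b₀ (λ {i} {j} lt → 𝟙-out (col? (b₀ i) (b₀ j) (s i j)) (bJ lt))

  module _ (k : ℕ) where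
    private
      PL = pairs k
      e = length PL
      PL∋ : ∀ {i j} → toℕ i < toℕ j → (i , j) ∈ PL
      PL∋ {i} {j} lt = ∈-filter⁺ (λ p → toℕ (proj₁ p) ℕ.<? toℕ (proj₂ p)) (∈-cartesianProduct⁺ (∈-allFin i) (∈-allFin j)) lt
      PL< : ∀ {i j} → (i , j) ∈ PL → toℕ i < toℕ j
      PL< m = proj₂ (∈-filter⁻ (λ p → toℕ (proj₁ p) ℕ.<? toℕ (proj₂ p)) {xs = cartesianProduct (allFin k) (allFin k)} m)

    -- This is k (k - 1): one class for each of the `e` pairs of positions, and a factor 2 that
    -- makes the size f of the classes even.
    cyclotomic-modulus : ℕ
    cyclotomic-modulus = 2 ℕ.* e
    -- The summand 2 keeps the prime odd; the rest is what the greedy choice of k points asks for.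
    cyclotomic-bound : ℕ
    cyclotomic-bound = 2 ℕ.+ threshold (8 ℕ.* (e ℕ.* e)) (2 ℕ.* e) k 1

    private
      go : ∀ e′ f′ → e ≡ e′ → ∀ q → q ≡ suc (e′ ℕ.* (2 ℕ.* f′)) → Prime q → 2 < q → 0 < e′ → threshold (8 ℕ.* (e′ ℕ.* e′)) (2 ℕ.* e′) k 1 < q → Design k (Fin q)
      go e′ f′ e≡ q refl pr q>2 e>0 big = Family.design {e′} {f′} {k} (ℤ/_ q pr) e>0 (ℕ.n≢0⇒n>0 f≢0) 2≢0 PL
          (filter⁺ (λ p → toℕ (proj₁ p) ℕ.<? toℕ (proj₂ p)) (cartesianProduct⁺ (allFin⁺ k) (allFin⁺ k))) PL∋ PL< e≡ big
        where
        f≢0 : 2 ℕ.* f′ ≢ 0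
        f≢0 z = ℕ.<⇒≱ q>2 (ℕ.≤-trans (ℕ.≤-reflexive (cong suc (trans (cong (e′ ℕ.*_) z) (ℕ.*-zeroʳ e′)))) (s≤s z≤n))
        2≢0 : Field._+_ (ℤ/_ q pr) (1 mod q) (1 mod q) ≢ (0 mod q)
        2≢0 e = ℕ.1+n≢0 (trans (sym (m<n⇒m%n≡m q>2)) (trans (sym (tm 2)) (trans (cong toℕ (trans (sym (mod-+ q pr 1 1)) e)) (tm 0))))
          where tm : ∀ n → toℕ (n mod q) ≡ n % q
                tm n = toℕ-fromℕ< _

    cyclotomic : 2 ≤ k → 0 < cyclotomic-modulus × (∀ q → Prime q → cyclotomic-bound < q → cyclotomic-modulus ∣ q ℕ.∸ 1 → Design k (Fin q))
    cyclotomic 2≤k = ℕ.≤-trans e>0 (ℕ.m≤m+n e (e ℕ.+ 0)) , λ { q pr b (divides c eq) →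
        go e c refl q (trans (sym (ℕ.m+[n∸m]≡n {1} {q} (ℕ.≤-trans (s≤s z≤n) b))) (cong suc (trans eq (l c e)))) pr
          (ℕ.≤-<-trans (ℕ.m≤m+n 2 _) b) e>0 (ℕ.≤-<-trans (ℕ.m≤n+m _ 2) b) }
      where
      l : ∀ c e → c ℕ.* (2 ℕ.* e) ≡ e ℕ.* (2 ℕ.* c)
      l = solve-∀
      ∈⇒0<length : ∀ {A : Set} {x : A} {xs} → x ∈ xs → 0 < length xs
      ∈⇒0<length {xs = _ ∷ _} _ = s≤s z≤n
      e>0 : 0 < e
      e>0 = ∈⇒0<length (PL∋ {fromℕ< (ℕ.<⇒≤ 2≤k)} {fromℕ< 2≤k} (ℕ.≤-reflexive (trans (cong suc (toℕ-fromℕ< (ℕ.<⇒≤ 2≤k))) (sym (toℕ-fromℕ< 2≤k)))))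

-- The constructions in terms of orders

module DesignSizes where
  open Designs
  open Fields
  open Blowups
  open import Data.Nat using (ℕ; zero; suc; _+_; _*_; _^_; _≤_; _<_)
  open import Data.Nat.Properties using (*-suc; *-comm)
  open import Data.Fin using (Fin; zero; suc)
  open import Data.Fin.Properties using (_≟_; +↔⊎; *↔×)
  open import Data.Product using (Σ; _×_; _,_)
  open import Data.Product.Function.NonDependent.Propositional using (_×-↔_)
  open import Data.Sum using (_⊎_; inj₁; inj₂)
  open import Data.Sum.Function.Propositional using (_⊎-↔_)
  open import Data.Empty using (⊥; ⊥-elim)
  open import Relation.Binary.PropositionalEquality using (_≡_; refl; sym; trans; cong; subst)
  open import Function.Bundles using (_↔_; Inverse)
  open import Function.Properties.Inverse using (↔-refl; ↔-sym; ↔-trans)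

  Holey-iso : ∀ {k} {F U U′ : Set} → U ↔ U′ → Holey k F U → Holey k F U′
  Holey-iso {F = F} {U} {U′} i = transport φ (λ {x} → hole-irr {x = x}) inj (λ {u} {v} → into {u} {v}) onto
    where
    open Inverse i
    to-inj : ∀ {u v} → to u ≡ to v → u ≡ v
    to-inj e = trans (sym (inverseʳ refl)) (trans (cong from e) (inverseʳ refl))
    φ : F ⊎ U → F ⊎ U′
    φ (inj₁ x) = inj₁ x
    φ (inj₂ x) = inj₂ (to x)
    inj₂-injective : ∀ {x y : U′} → _≡_ {A = F ⊎ U′} (inj₂ x) (inj₂ y) → x ≡ y
    inj₂-injective refl = refl
    inj : ∀ {u v} → φ u ≡ φ v → u ≡ v
    inj {inj₁ _} {inj₁ _} refl = refl
    inj {inj₂ _} {inj₂ _} e = cong inj₂ (to-inj (inj₂-injective e))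
    into : ∀ {u v} → hole u v → hole (φ u) (φ v)
    into {inj₁ _} {inj₂ _} h = h
    into {inj₂ _} {inj₁ _} h = h
    into {inj₂ _} {inj₂ _} h e = h (to-inj e)
    onto : ∀ {x y} → hole x y → Σ (F ⊎ U) λ u → Σ (F ⊎ U) λ v → hole u v × φ u ≡ x × φ v ≡ y
    onto {inj₁ x} {inj₂ y} h = inj₁ x , inj₂ (from y) , h , refl , cong inj₂ (inverseˡ refl)
    onto {inj₂ x} {inj₁ y} h = inj₂ (from x) , inj₁ y , h , cong inj₂ (inverseˡ refl) , refl
    onto {inj₂ x} {inj₂ y} h = inj₂ (from x) , inj₂ (from y)
      , (λ e → h (trans (sym (inverseˡ refl)) (trans (cong to e) (inverseˡ refl)))) , cong inj₂ (inverseˡ refl) , cong inj₂ (inverseˡ refl)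

  module Sizes (k : ℕ) where
    B : ℕ → Set₁
    B n = Design k (Fin n)
    G : ℕ → ℕ → Set₁
    G u j = GDD k (Fin j) (Fin u)
    H : ℕ → ℕ → Set₁
    H f u = Holey k (Fin f) (Fin u)

    B-one : B 1
    B-one = record { Blk = ⊥ ; pt = λ () ; irr = λ p → p refl ; edge = λ () ; cover = λ { {zero} {zero} n → ⊥-elim (n refl) } ; uniq = λ { {()} } }

    H-product : ∀ {f m} → B f → Rich k (suc m) → B (suc m) → H f (f * m)
    H-product D R D₁ = Holey-iso (↔-sym *↔×) (product-hole _≟_ D (Rich⇒OA R) D₁)

    fill : ∀ {f u} → H f u → B f → B (f + u)
    fill h D = Design-iso (↔-sym +↔⊎) (fill-hole h D)

    B-* : ∀ {f m} → B f → Rich k (suc m) → B (suc m) → B (f * suc m)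
    B-* {f} {m} D R D₁ = subst B (sym (*-suc f m)) (fill (H-product D R D₁) D)

    B-^ : ∀ {m} → Rich k (suc m) → B (suc m) → ∀ n → B (suc m ^ n)
    B-^ R D zero = B-one
    B-^ {m} R D (suc n) = subst B (*-comm (suc m ^ n) (suc m)) (B-* (B-^ R D n) R D)

    G-fill : ∀ {f u j} → G u j → H f u → H f (j * u)
    G-fill g h = Holey-iso (↔-sym *↔×) (fill-groups _≟_ g h)

    G-fill₀ : ∀ {u j} → G u j → B u → B (j * u)
    G-fill₀ g D = Design-iso (↔-sym *↔×) (fill-groups₀ _≟_ g D)

    G-inflate : ∀ {m u j} → Rich j m → G u j → G (m * u) j
    G-inflate R g = GDD-iso ↔-refl (↔-sym *↔×) (inflate (Rich⇒OA R) g)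

    G-blowup : ∀ {v l} → 0 < v → Rich v l → MultiDesign k v l → G (l ^ (v * v)) v
    G-blowup {suc v} _ R M = blowup R M

    private
      Trunc↔ : ∀ m r → Fin (k * m + r) ↔ Trunc k m r
      Trunc↔ m r = ↔-trans +↔⊎ (*↔× ⊎-↔ ↔-refl)

    G-truncate : ∀ {u m r} → Rich (suc k) m → r ≤ m → G u k → G u (suc k) → G u m → G u r → G u (k * m + r)
    G-truncate {u} {m} {r} R r≤m g₀ g₁ gm gr = GDD-iso (↔-sym (Trunc↔ m r)) ↔-refl
      (truncate-GDD (truncate (Rich⇒OA R) r≤m g₀ g₁) gm gr)

    B-truncate : ∀ {f w m r} → Rich (suc k) m → r ≤ m → G w k → G w (suc k) → H f (m * w) → B (f + r * w) → B (f + (k * m + r) * w)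
    B-truncate {f} {w} {m} {r} R r≤m g₀ g₁ h D = Design-iso
      (↔-sym (↔-trans +↔⊎ (↔-refl ⊎-↔ ↔-trans *↔× (Trunc↔ m r ×-↔ ↔-refl))))
      (truncate-Design (truncate (Rich⇒OA R) r≤m g₀ g₁) (Holey-iso *↔× h) (Design-iso (↔-trans +↔⊎ (↔-refl ⊎-↔ *↔×)) D))

-- Ingredients: group divisible designs, representatives of residue classes, holes

module WilsonConstruction where
  open Designs
  open Fields
  open Blowups
  open SubsetLists using (b₂; binom-pos)
  open MultiDesigns using (completeMultiDesign; multiDesign)
  open PrimesInProgression using (binomial₂; primes≡1)
  open CyclotomicDesigns using (cyclotomic; cyclotomic-modulus; cyclotomic-bound)
  open DesignSizes
  open import Data.Nat using (ℕ; zero; suc; _+_; _*_; _∸_; _^_; _≤_; _<_; z≤n; s≤s; _⊔_; NonZero; >-nonZero; _≤?_)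
  open import Data.Nat.Properties
  open import Data.Nat.DivMod using (_/_; _%_; m≡m%n+[m/n]*n; m%n<n; m*n/n≡m; /-monoˡ-≤)
  open import Data.Nat.Divisibility
  open import Data.Nat.Induction using (<-rec)
  open import Data.Nat.Primality using (Prime)
  open import Data.Nat.Tactic.RingSolver using (solve-∀)
  open import Data.Product using (Σ; _×_; _,_; proj₁; proj₂)
  open import Data.Sum using (inj₁; inj₂)
  open import Relation.Nullary using (yes; no)
  open import Relation.Binary.PropositionalEquality using (_≡_; refl; sym; trans; cong; cong₂; subst)

  -- To second order (1 + y)^t - 1 is y (t + y z). Since t c divides y, a factor t can be taken out
  -- of the bracket, and what remains is 1 modulo c.
  step : ∀ y t c y′ → y ≡ t * c * y′ → Σ ℕ λ s → suc y ^ t ≡ suc (y * t * suc (c * s))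
  step y t c y′ e with binomial₂ y t
  ... | z , p = y′ * z , trans p (cong suc (trans (cong (λ u → y * (t + u * z)) e) (lem y t c y′ z)))
    where lem : ∀ y t c y′ z → y * (t + t * c * y′ * z) ≡ y * t * suc (c * (y′ * z))
          lem = solve-∀

  -- Raising q = 1 + τ c to suitable powers multiplies q − 1 by powers of τ, up to a factor ≡ 1 (mod c).
  powers : ∀ c τ j → Σ ℕ λ n → Σ ℕ λ s → suc (τ * c) ^ n ≡ suc (τ * c * τ ^ j * suc (c * s))
  powers c τ zero = 1 , 0 , trans (*-identityʳ _) (cong suc (sym (trans (cong₂ _*_ (*-identityʳ (τ * c)) (cong suc (*-zeroʳ c))) (*-identityʳ (τ * c)))))
  powers c τ (suc j) with powers c τ j
  ... | n , s , e with step (τ * c * τ ^ j * suc (c * s)) τ c (τ ^ j * suc (c * s)) (*-assoc (τ * c) (τ ^ j) (suc (c * s)))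
  ... | s′ , e′ = n * τ , s + s′ + c * s * s′ , trans (sym (^-*-assoc (suc (τ * c)) n τ)) (trans (cong (_^ τ) e) (trans e′ (cong suc (lem (τ * c) (τ ^ j) τ c s s′))))
    where lem : ∀ y T τ c s s′ → y * T * suc (c * s) * τ * suc (c * s′) ≡ y * (τ * T) * suc (c * (s + s′ + c * s * s′))
          lem = solve-∀

  -- v − 1 = a (k − 1) and v (v − 1) = β k (k − 1), where k₁ = k − 1.
  Adm : ℕ → ℕ → ℕ → Set
  Adm k k₁ v = Σ ℕ λ a → Σ ℕ λ β → v ≡ suc (a * k₁) × v * a ≡ β * k

  module Wilson (k₂ : ℕ) where
    k = 2 + k₂
    k₁ = 1 + k₂
    open Sizes k

    -- Supplies primes that are large, congruent to 1 modulo any given N, and themselves orders of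
    -- designs.
    base-prime : ∀ N b → 0 < N → Σ ℕ λ y → Prime (suc y) × b ≤ y × N ∣ y × B (suc y)
    base-prime N b N>0 = go (primes≡1 (N * cyclotomic-modulus k) (b + cyclotomic-bound k) (*-mono-< {0} {N} {0} N>0 (proj₁ cyc)))
      where
      cyc = cyclotomic k (s≤s (s≤s z≤n))
      go : (Σ ℕ λ q → Prime q × b + cyclotomic-bound k < q × N * cyclotomic-modulus k ∣ q ∸ 1) → Σ ℕ λ y → Prime (suc y) × b ≤ y × N ∣ y × B (suc y)
      go (suc y , pr , s≤s lt , d) = y , pr , m+n≤o⇒m≤o b lt , ∣-trans (m∣m*n _) d
        , proj₂ cyc (suc y) pr (s≤s (m+n≤o⇒n≤o b lt)) (∣-trans (n∣m*n N) d)

    private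
      -- A common multiple of the Λ of all point numbers up to n; the maximum with 1 covers those
      -- below k, where Λ is zero.
      P : ℕ → ℕ
      P zero = 1
      P (suc n) = (1 ⊔ b₂ (suc n) k) * P n
      P>0 : ∀ n → 0 < P n
      P>0 zero = s≤s z≤n
      P>0 (suc n) = *-mono-< {0} {1 ⊔ b₂ (suc n) k} {0} (m≤m⊔n 1 (b₂ (suc n) k)) (P>0 n)
      P-∣ : ∀ {j n} → 0 < j → j ≤ n → (1 ⊔ b₂ j k) ∣ P n
      P-∣ {suc j} {suc n} j>0 (s≤s le) with m≤n⇒m<n∨m≡n le
      ... | inj₁ lt = ∣-trans (P-∣ {suc j} {n} j>0 lt) (n∣m*n (1 ⊔ b₂ (suc n) k))
      ... | inj₂ refl = m∣m*n (P n)
      b₂>0 : ∀ j → k ≤ j → 0 < b₂ j k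
      b₂>0 (suc (suc j)) (s≤s (s≤s le)) = binom-pos j k₂ le

      -- The blow-up has group size l^(j²). Inflating by the missing power of l gives all j the same
      -- group size.
      GDD-of-size : ∀ {l} Λ z bb j → l ≡ z * Λ → Λ ≡ b₂ j k → 0 < l → 0 < j → j ≤ bb → Rich bb l → G (l ^ (bb * bb)) j
      GDD-of-size Λ z bb j refl refl l>0 j>0 le R = subst (λ x → G x j)
        (trans (sym (^-distribˡ-+-* (z * Λ) (bb * bb ∸ j * j) (j * j))) (cong ((z * Λ) ^_) (m∸n+n≡m (*-mono-≤ le le))))
        (G-inflate (Rich-^ Rj (bb * bb ∸ j * j)) (G-blowup j>0 Rj (completeMultiDesign k j z l>0)))
        where Rj = Rich-restrict le R

    -- Z^(2^bb) serves as λ for all j at once: it is a multiple of every `b₂ j k` and, as a 2^bb-th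
    -- power, the order of a rich group. The common group size is again a 2^bb-th power.
    small-GDDs : ∀ bb → 0 < bb → Σ ℕ λ w₀ → 0 < w₀ × k * k₁ ∣ w₀ × (∀ j → k ≤ j → j ≤ bb → G (w₀ ^ (2 ^ bb)) j)
    small-GDDs bb bb>0 = Z ^ (bb * bb) , m^n>0 Z (bb * bb) , ∣-trans (m∣m*n (P bb)) (Z∣Z^ (*-mono-< {0} {bb} {0} bb>0 bb>0)) , λ j k≤j le →
        subst (λ x → G x j) (trans (^-*-assoc Z (2 ^ bb) (bb * bb)) (trans (cong (Z ^_) (*-comm (2 ^ bb) (bb * bb))) (sym (^-*-assoc Z (bb * bb) (2 ^ bb)))))
          (each j k≤j le)
      where
      Z = k * k₁ * P bb
      Z>0 : 0 < Z
      Z>0 = *-mono-< {0} {k * k₁} {0} (s≤s z≤n) (P>0 bb)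
      instance
        nzZ : NonZero Z
        nzZ = >-nonZero Z>0
      Z∣Z^ : ∀ {n} → 0 < n → Z ∣ Z ^ n
      Z∣Z^ {suc n} _ = m∣m*n (Z ^ n)
      each : ∀ j → k ≤ j → j ≤ bb → G ((Z ^ (2 ^ bb)) ^ (bb * bb)) j
      each j k≤j le with Λ∣
        where
        Λ∣ : b₂ j k ∣ Z ^ (2 ^ bb)
        Λ∣ = ∣-trans (subst (_∣ P bb) (m≤n⇒m⊔n≡n (b₂>0 j k≤j)) (P-∣ (<-≤-trans (s≤s z≤n) k≤j) le)) (∣-trans (n∣m*n (k * k₁)) (Z∣Z^ (m^n>0 2 bb)))
      ... | divides z e = GDD-of-size (b₂ j k) z bb j e refl (m^n>0 Z (2 ^ bb)) (<-≤-trans (s≤s z≤n) k≤j) le (Rich-power bb Z)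

    module Closure (F : ℕ) (k≤F : k ≤ F) (richF : ∀ z → Rich (suc k) (suc (F * z))) where
      bound : ℕ
      bound = 2 * k + (k * F) * suc k

      -- A large j is k m + r with m = 1 + F z and k ≤ r ≤ m. Truncating a transversal design with
      -- groups of order m reduces j to k, k + 1, m and r, all at least k and either small or below
      -- j.
      all-GDDs : ∀ U bb → bound ≤ bb → (∀ j → k ≤ j → j ≤ bb → G U j) → ∀ j → k ≤ j → G U j
      all-GDDs U bb le g = <-rec (λ j → k ≤ j → G U j) body
        where
        F>0 : 0 < F
        F>0 = <-≤-trans (s≤s z≤n) k≤F
        kF>0 : 0 < k * F
        kF>0 = *-mono-< {0} {k} {0} (s≤s z≤n) F>0
        instance
          nzkF : NonZero (k * F)
          nzkF = >-nonZero kF>0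
        g₀ : G U k
        g₀ = g k ≤-refl (≤-trans (≤-trans (m≤m+n k _) (m≤m+n (2 * k) _)) le)
        g₁ : G U (suc k)
        g₁ = g (suc k) (n≤1+n k) (≤-trans (≤-trans (≤-trans (≤-trans (+-monoˡ-≤ k {1} {k} (s≤s z≤n)) (≤-reflexive (cong (k +_) (sym (+-identityʳ k))))) ≤-refl) (m≤m+n (2 * k) _)) le)
        body : ∀ j → (∀ {i} → i < j → k ≤ i → G U i) → k ≤ j → G U j
        body j rec k≤j with j ≤? bb
        ... | yes j≤bb = g j k≤j j≤bb
        ... | no j≰bb = subst (G U) j≡ (G-truncate (richF z) r≤m g₀ g₁ (rec m<j k≤m) (rec (≤-<-trans r≤m m<j) (m≤m+n k ρ)))
          where
          bound≤j : bound ≤ j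
          bound≤j = ≤-trans le (<⇒≤ (≰⇒> j≰bb))
          t = j ∸ 2 * k
          z = t / (k * F)
          -- The quotient by k F is used for m; adding k to the remainder keeps the truncated group
          -- at k points or more, as the induction hypothesis demands.
          ρ = t % (k * F)
          m = suc (F * z)
          r = k + ρ
          j≡ : k * m + r ≡ j
          j≡ = trans (lem k F z ρ) (trans (cong (2 * k +_) (sym (m≡m%n+[m/n]*n t (k * F)))) (m+[n∸m]≡n (m+n≤o⇒m≤o (2 * k) bound≤j)))
            where lem : ∀ k F z ρ → k * suc (F * z) + (k + ρ) ≡ 2 * k + (ρ + z * (k * F))
                  lem = solve-∀
          z≥ : suc k ≤ z
          z≥ = ≤-trans (≤-reflexive (sym (m*n/n≡m (suc k) (k * F)))) (/-monoˡ-≤ (k * F) (≤-trans (≤-reflexive (*-comm (suc k) (k * F)))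
            (≤-trans (≤-reflexive (sym (m+n∸m≡n (2 * k) ((k * F) * suc k)))) (∸-monoˡ-≤ (2 * k) bound≤j))))
          r≤m : r ≤ m
          r≤m = begin
            k + ρ           ≤⟨ +-mono-≤ k≤F (<⇒≤ (m%n<n t (k * F))) ⟩
            F + k * F       ≡⟨ *-comm (suc k) F ⟩
            F * suc k       ≤⟨ *-monoʳ-≤ F z≥ ⟩
            F * z           ≤⟨ n≤1+n _ ⟩
            suc (F * z)     ∎
            where open ≤-Reasoning
          k≤m : k ≤ m
          k≤m = ≤-trans (m≤m+n k ρ) r≤m
          m<j : m < j
          m<j = begin-strict
            m               <⟨ m<m+n m {r} (<-≤-trans (s≤s z≤n) (m≤m+n k ρ)) ⟩
            m + r           ≤⟨ +-monoˡ-≤ r (m≤n*m m k) ⟩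
            k * m + r       ≡⟨ j≡ ⟩
            j               ∎
            where open ≤-Reasoning

    ^-minus-one : ∀ W y n → W ∣ y → Σ ℕ λ c → suc y ^ n ≡ suc (W * c)
    ^-minus-one W y n (divides q e) with binomial₂ y n
    ... | t , p = q * (n + y * t) , trans p (cong suc (trans (cong (_* (n + y * t)) e) (lem q W (n + y * t))))
      where lem : ∀ q W x → q * W * x ≡ W * (q * x)
            lem = solve-∀

    private
      -- A prime q = 1 + y with y a multiple of Λ W is a possible λ, lies beyond z₀ Λ, and is the
      -- order of a design. The blow-up over v points has groups of size a power of q, which can be
      -- filled, and its order v q^(v²) is v modulo W.
      representative′ : ∀ W v Λ z₀ → 0 < W → 0 < Λ → k ≤ v → (∀ z → z₀ ≤ z → MultiDesign k v (suc (z * Λ))) → Σ ℕ λ c → B (v + W * c)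
      representative′ W v Λ z₀ W>0 Λ>0 k≤v M = go (base-prime (Λ * W) (Λ * z₀ + v) (*-mono-< {0} {Λ} {0} Λ>0 W>0))
       where
       go : (Σ ℕ λ y → Prime (suc y) × Λ * z₀ + v ≤ y × Λ * W ∣ y × B (suc y)) → Σ ℕ λ c → B (v + W * c)
       go (y , pr , big , d@(divides q e) , D) with ^-minus-one W y (v * v) (∣-trans (n∣m*n Λ) d)
       ... | c , p = v * c , subst B (trans (cong (v *_) p) (lem v W c)) (G-fill₀ g (B-^ (Rich-prime (≤-trans k≤y (n≤1+n y)) pr) D (v * v)))
         where
         lem : ∀ v W c → v * suc (W * c) ≡ v + W * (v * c)
         lem = solve-∀
         v≤y : v ≤ y
         v≤y = m+n≤o⇒n≤o (Λ * z₀) big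
         k≤y : k ≤ y
         k≤y = ≤-trans k≤v v≤y
         y≡ : y ≡ (q * W) * Λ
         y≡ = trans e (lem′ q Λ W)
           where lem′ : ∀ q l w → q * (l * w) ≡ q * w * l
                 lem′ = solve-∀
         z₀≤ : z₀ ≤ q * W
         z₀≤ = *-cancelʳ-≤ z₀ (q * W) Λ {{>-nonZero Λ>0}} (≤-trans (≤-reflexive (*-comm z₀ Λ)) (≤-trans (m+n≤o⇒m≤o (Λ * z₀) big) (≤-reflexive y≡)))
         g : G (suc y ^ (v * v)) v
         g = G-blowup (<-≤-trans (s≤s z≤n) k≤v) (Rich-prime (≤-trans v≤y (n≤1+n y)) pr) (subst (λ x → MultiDesign k v (suc x)) (sym y≡) (M (q * W) z₀≤))

    representative : ∀ W v → 0 < W → Adm k k₁ v → 2 + k ≤ v → Σ ℕ λ c → B (v + W * c)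
    representative W (suc zero) _ _ (s≤s ())
    representative W (suc (suc zero)) _ _ (s≤s (s≤s ()))
    representative W (suc (suc (suc v₂))) W>0 (a , β , e₁ , e₂) le = let z₀ , M = multiDesign k₂ v₂ a β le (suc-injective e₁) e₂ in
      representative′ W (3 + v₂) (b₂ (3 + v₂) k) z₀ W>0 (b₂>0 (3 + v₂) (≤-trans (m≤n+m k 2) le)) (≤-trans (m≤n+m k 2) le) M

    -- A design of order f is a hole in one of order f Q with f (Q − 1) = w₀ ^ E · g, where g is rich.
    module Extend (bb c E′ : ℕ) (E≡ : 2 ^ bb ≡ suc E′) (c>0 : 0 < c) (richC : ∀ z → Rich bb (suc (c * z))) where
      extension : ∀ f w₀ → 0 < f → 0 < w₀ → B f → Σ ℕ λ g → H f (w₀ ^ suc E′ * g) × Rich bb g × 0 < g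
      extension f w₀ f>0 w₀>0 D = go (base-prime (w₀ * (f ^ E′ * c ^ suc E′)) k
          (*-mono-< {0} {w₀} {0} w₀>0 (*-mono-< {0} {f ^ E′} {0} (m^n>0 f {{>-nonZero f>0}} E′) (m^n>0 c {{>-nonZero c>0}} (suc E′)))))
        where
        go : (Σ ℕ λ y → Prime (suc y) × k ≤ y × w₀ * (f ^ E′ * c ^ suc E′) ∣ y × B (suc y)) → Σ ℕ λ g → H f (w₀ ^ suc E′ * g) × Rich bb g × 0 < g
        go (y , pr , k≤y , divides x e , Dq) = build (powers c τ E′)
          where
          fE = f ^ E′
          cE = c ^ E′
          -- `powers` turns y = τ c into y τ^E′, and one more `step`, possible since f^E′ c^E′
          -- divides τ, multiplies by that number. Then f (Q - 1) is (f y)^(E′ + 1) up to factors 1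
          -- modulo c, and w₀ dividing y puts w₀^(E′ + 1) into it.
          τ = x * w₀ * fE * cE
          y≡ : y ≡ τ * c
          y≡ = trans e (lem x w₀ fE c cE)
            where lem : ∀ x w f c C → x * (w * (f * (c * C))) ≡ x * w * f * C * c
                  lem = solve-∀
          c″ = x * fE * c ^ suc E′
          y≡′ : y ≡ w₀ * c″
          y≡′ = trans e (lem x w₀ fE (c ^ suc E′))
            where lem : ∀ x w f C → x * (w * (f * C)) ≡ w * (x * f * C)
                  lem = solve-∀
          c″>0 : 0 < c″
          c″>0 = n≢0⇒n>0 (λ z → <⇒≱ (<-≤-trans (s≤s z≤n) k≤y) (≤-reflexive (trans y≡′ (trans (cong (w₀ *_) z) (*-zeroʳ w₀)))))
          Rq : Rich k (suc y)
          Rq = Rich-prime (≤-trans k≤y (n≤1+n y)) pr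
          build : (Σ ℕ λ n → Σ ℕ λ s → suc (τ * c) ^ n ≡ suc (τ * c * τ ^ E′ * suc (c * s))) → Σ ℕ λ g → H f (w₀ ^ suc E′ * g) × Rich bb g × 0 < g
          build (n , s , p) with step (τ * c * τ ^ E′ * suc (c * s)) (fE * cE) c (x * w₀ * τ ^ E′ * suc (c * s)) (lem (x * w₀) fE cE c (τ ^ E′) (suc (c * s)))
            where lem : ∀ x f C c T s → x * f * C * c * T * s ≡ f * C * c * (x * T * s)
                  lem = solve-∀
          ... | s′ , p′ = (f * c″) ^ suc E′ * (suc (c * s) * suc (c * s′)) , subst (H f) final (H-product D (subst (Rich k) Q≡ (Rich-^ Rq N)) (subst B Q≡ (B-^ Rq Dq N)))
                , Rich-* (subst (λ z → Rich bb ((f * c″) ^ z)) E≡ (Rich-power bb (f * c″) {{>-nonZero fc>0}})) (Rich-* (richC s) (richC s′))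
                , *-mono-< {0} {(f * c″) ^ suc E′} {0} (m^n>0 (f * c″) {{>-nonZero fc>0}} (suc E′)) (s≤s z≤n)
            where
            fc>0 : 0 < f * c″
            fc>0 = *-mono-< {0} {f} {0} f>0 c″>0
            N = n * (fE * cE)
            Y = τ * c * τ ^ E′ * suc (c * s) * (fE * cE) * suc (c * s′)
            Q≡ : suc y ^ N ≡ suc Y
            Q≡ = trans (cong (λ z → suc z ^ N) y≡) (trans (sym (^-*-assoc (suc (τ * c)) n (fE * cE))) (trans (cong (_^ (fE * cE)) p) p′))
            final : f * Y ≡ w₀ ^ suc E′ * ((f * c″) ^ suc E′ * (suc (c * s) * suc (c * s′)))
            final = trans (l₁ f (τ * c) (τ ^ E′) (suc (c * s)) fE cE (suc (c * s′)))
              (trans (cong₂ (λ u t → f * u * t * (suc (c * s) * suc (c * s′))) (sym y≡) power)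
              (trans (cong (_* (suc (c * s) * suc (c * s′))) (trans (cong (λ u → (f * u) ^ suc E′) y≡′) (trans (cong (_^ suc E′) (l₂ f w₀ c″)) (ℕ^-distrib-* w₀ (f * c″) (suc E′)))))
              (*-assoc (w₀ ^ suc E′) ((f * c″) ^ suc E′) _)))
              where
              l₁ : ∀ f y T σ fE cE σ′ → f * (y * T * σ * (fE * cE) * σ′) ≡ f * y * (fE * (T * cE)) * (σ * σ′)
              l₁ = solve-∀
              l₂ : ∀ f w c → f * (w * c) ≡ w * (f * c)
              l₂ = solve-∀
              power : fE * (τ ^ E′ * cE) ≡ (f * y) ^ E′
              power = trans (cong (fE *_) (sym (ℕ^-distrib-* τ c E′))) (trans (sym (ℕ^-distrib-* f (τ * c) E′)) (cong (λ u → (f * u) ^ E′) (sym y≡)))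

-- All large admissible orders

module WilsonTheorem where
  open Designs
  open Fields
  open DesignSizes
  open WilsonConstruction
  open import Data.Nat using (ℕ; zero; suc; _+_; _*_; _∸_; _^_; _≤_; _<_; z≤n; s≤s; _⊔_; NonZero; >-nonZero; >-nonZero⁻¹; _!)
  open import Data.Nat.Properties
  open import Data.Nat.DivMod using (_/_; _%_; m≡m%n+[m/n]*n; m%n<n; m*n/n≡m; /-monoˡ-≤)
  open import Data.Nat.Divisibility
  open import Data.Nat.Tactic.RingSolver using (solve-∀)
  open import Data.Product using (Σ; _×_; _,_)
  open import Data.Sum using (_⊎_; inj₁; inj₂)
  open import Data.Empty using (⊥-elim)
  open import Relation.Nullary using (Dec; yes; no)
  open import Relation.Binary.PropositionalEquality using (_≡_; refl; sym; trans; cong; subst)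

  uniform : ∀ m (P : ℕ → ℕ → Set₁) → (∀ ρ → Σ ℕ λ n₀ → ∀ n → n₀ ≤ n → P ρ n) → Σ ℕ λ n₀ → ∀ ρ → ρ < m → ∀ n → n₀ ≤ n → P ρ n
  uniform zero P h = 0 , λ _ ()
  uniform (suc m) P h with uniform m P h | h m
  ... | n₁ , H₁ | n₂ , H₂ = n₁ ⊔ n₂ , λ ρ ρ<m n le → pick ρ (m≤n⇒m<n∨m≡n (≤-pred ρ<m)) n le
    where pick : ∀ ρ → ρ < m ⊎ ρ ≡ m → ∀ n → n₁ ⊔ n₂ ≤ n → P ρ n
          pick ρ (inj₁ lt) n le = H₁ ρ lt n (≤-trans (m≤m⊔n n₁ n₂) le)
          pick ρ (inj₂ refl) n le = H₂ n (≤-trans (m≤n⊔m n₁ n₂) le)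

  module Admissible (k k₁ : ℕ) .{{_ : NonZero k₁}} where
    private
      A = Adm k k₁

    up : ∀ {v} x → A v → A (v + k * k₁ * x)
    up {v} x (a , β , refl , e) = a + k * x , β + k₁ * x * a + v * x + k * k₁ * x * x
      , cong suc (l₁ a k k₁ x) , trans (l₂ v a k k₁ x) (trans (cong (_+ k * (k₁ * x * a + v * x + k * k₁ * x * x)) e) (l₃ β k (k₁ * x * a) (v * x) (k * k₁ * x * x)))
      where
      l₁ : ∀ a k k₁ x → a * k₁ + k * k₁ * x ≡ (a + k * x) * k₁
      l₁ = solve-∀
      l₂ : ∀ v a k k₁ x → (v + k * k₁ * x) * (a + k * x) ≡ v * a + k * (k₁ * x * a + v * x + k * k₁ * x * x)
      l₂ = solve-∀
      l₃ : ∀ β k p q r → β * k + k * (p + q + r) ≡ (β + p + q + r) * k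
      l₃ = solve-∀

    down : ∀ {v} x → 0 < v → A (v + k * k₁ * x) → A v
    down {suc v} x _ (a , β , e₁ , e₂) = a′ , quotient d , v≡ , _∣_.equality d
      where
      a′ = a ∸ k * x
      l₀ : ∀ a k x → k * x * a ≡ k * a * x
      l₀ = solve-∀
      le : k * x ≤ a
      le = *-cancelʳ-≤ (k * x) a k₁ (≤-trans (≤-trans (≤-reflexive (l₀ k₁ k x)) (m≤n+m (k * k₁ * x) v)) (≤-reflexive (suc-injective e₁)))
      a≡ : a ≡ a′ + k * x
      a≡ = sym (m∸n+n≡m le)
      v≡ : suc v ≡ suc (a′ * k₁)
      v≡ = cong suc (+-cancelʳ-≡ (k * k₁ * x) v (a′ * k₁) (trans (suc-injective e₁) (trans (cong (_* k₁) a≡) (l a′ k k₁ x))))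
        where l : ∀ a k k₁ x → (a + k * x) * k₁ ≡ a * k₁ + k * k₁ * x
              l = solve-∀
      d : k ∣ suc v * a′
      d = ∣m+n∣m⇒∣n {m = k * (k₁ * x * a′ + suc v * x + k * k₁ * x * x)} (divides β (trans (l (suc v) a′ k k₁ x) (trans (cong ((suc v + k * k₁ * x) *_) (sym a≡)) e₂))) (m∣m*n (k₁ * x * a′ + suc v * x + k * k₁ * x * x))
        where l : ∀ v a k k₁ x → k * (k₁ * x * a + v * x + k * k₁ * x * x) + v * a ≡ (v + k * k₁ * x) * (a + k * x)
              l = solve-∀

    adm? : ∀ v → Dec (A v)
    adm? zero = no λ { (_ , _ , () , _) }
    adm? (suc v) with k₁ ∣? v
    ... | no n = no λ { (a , _ , e , _) → n (divides a (suc-injective e)) }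
    ... | yes (divides a e) with k ∣? (suc v * a)
    ... | yes (divides β e′) = yes (a , β , cong suc e , e′)
    ... | no n = no λ { (a′ , β , e₁ , e₂) → n (divides β (trans (cong (suc v *_) (*-cancelʳ-≡ a a′ k₁ (trans (sym e) (suc-injective e₁)))) e₂)) }

    transfer : ∀ {n v} x y → 0 < v → k * k₁ ∣ x → k * k₁ ∣ y → n + x ≡ v + y → A n → A v
    transfer {n} {v} x y v>0 (divides c refl) (divides d refl) e a = down d v>0
      (subst A (cong (v +_) (*-comm d (k * k₁))) (subst A (trans (cong (n +_) (*-comm (k * k₁) c)) e) (up c a)))

  -- The class of n modulo W is reached from an admissible v with v + u ≡ n.
  module Residues (k k₁ f w W u u′ : ℕ) .{{_ : NonZero k₁}} .{{_ : NonZero W}} (B : ℕ → Set₁) (kk∣w : k * k₁ ∣ w) (w∣W : w ∣ W) (w∣u : w ∣ u)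
    (W≡ : W ≡ u′ + u)
    (orders : ∀ v x → v ≡ f + w * x → Adm k k₁ v → 2 + k ≤ v → Σ ℕ λ c → Σ ℕ λ z₀ → ∀ z → z₀ ≤ z → B (v + W * c + (u + W * z))) where
    open Admissible k k₁
    private
      -- The shift by W times this number brings the representative above both f and k + 2. In `v`,
      -- `u′` stands for - u modulo W.
      s : ℕ
      s = f + (2 + k)
      v : ℕ → ℕ
      v ρ = ρ + u′ + W * s
      s≤v : ∀ ρ → s ≤ v ρ
      s≤v ρ = ≤-trans (m≤n*m s W) (m≤n+m (W * s) (ρ + u′))
      f≤v : ∀ ρ → f ≤ v ρ
      f≤v ρ = ≤-trans (m≤m+n f (2 + k)) (s≤v ρ)
      P : ℕ → ℕ → Set₁
      P ρ n = n % W ≡ ρ → (Σ ℕ λ x → Σ ℕ λ y → n + w * x ≡ f + w * y) → Adm k k₁ n → B n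
      n≡ : ∀ n ρ → n % W ≡ ρ → n + W * suc s ≡ v ρ + (W * (n / W) + u)
      n≡ n ρ e = trans (cong (_+ W * suc s) (trans (m≡m%n+[m/n]*n n W) (cong (_+ n / W * W) e))) (trans (l ρ (n / W) W s)
        (trans (cong (λ t → ρ + t + W * s + W * (n / W)) W≡) (l′ ρ u′ u (W * s) (W * (n / W)))))
        where l : ∀ ρ t W s → ρ + t * W + W * suc s ≡ ρ + W + W * s + W * t
              l = solve-∀
              l′ : ∀ ρ a b c d → ρ + (a + b) + c + d ≡ ρ + a + c + (d + b)
              l′ = solve-∀
      w∣shift : ∀ t → w ∣ W * t + u
      w∣shift t = ∣m∣n⇒∣m+n (∣-trans w∣W (m∣m*n t)) w∣u
      adm-v : ∀ ρ n → n % W ≡ ρ → Adm k k₁ n → Adm k k₁ (v ρ)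
      adm-v ρ n e = transfer (W * suc s) (W * (n / W) + u) (<-≤-trans (<-≤-trans (s≤s z≤n) (m≤n+m (2 + k) f)) (s≤v ρ))
        (∣-trans kk∣w (∣-trans w∣W (m∣m*n (suc s)))) (∣-trans kk∣w (w∣shift (n / W))) (n≡ n ρ e)
      w∣v : ∀ ρ n → n % W ≡ ρ → (Σ ℕ λ x → Σ ℕ λ y → n + w * x ≡ f + w * y) → w ∣ v ρ ∸ f
      w∣v ρ n e (x , y , e′) = ∣m+n∣m⇒∣n {m = W * (n / W) + u + w * x} (subst (w ∣_)
          (+-cancelˡ-≡ f (w * y + W * suc s) _ (trans (sym (+-assoc f (w * y) (W * suc s))) (trans (cong (_+ W * suc s) (sym e′))
            (trans (l₂ n (w * x) (W * suc s)) (trans (cong (_+ w * x) (n≡ n ρ e)) (trans (cong (λ t → t + (W * (n / W) + u) + w * x) (sym (m+[n∸m]≡n (f≤v ρ))))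
              (l₃ f (v ρ ∸ f) (W * (n / W) + u) (w * x))))))))
          (∣m∣n⇒∣m+n (m∣m*n y) (∣-trans w∣W (m∣m*n (suc s)))))
        (∣m∣n⇒∣m+n (w∣shift (n / W)) (m∣m*n x))
        where
        l₂ : ∀ a b c → a + b + c ≡ a + c + b
        l₂ = solve-∀
        l₃ : ∀ f d p q → f + d + p + q ≡ f + (p + q + d)
        l₃ = solve-∀
      use : ∀ ρ → (Σ ℕ λ c → Σ ℕ λ z₀ → ∀ z → z₀ ≤ z → B (v ρ + W * c + (u + W * z))) → Σ ℕ λ n₀ → ∀ n → n₀ ≤ n → P ρ n
      use ρ (c , z₀ , D) = (suc s + c + z₀) * W , λ n le e _ _ → subst B (last n e (t≥ n le)) (D (n / W ∸ (suc s + c)) (z≥ n le))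
        where
        t≥ : ∀ n → (suc s + c + z₀) * W ≤ n → suc s + c + z₀ ≤ n / W
        t≥ n le = ≤-trans (≤-reflexive (sym (m*n/n≡m (suc s + c + z₀) W))) (/-monoˡ-≤ W le)
        z≥ : ∀ n → (suc s + c + z₀) * W ≤ n → z₀ ≤ n / W ∸ (suc s + c)
        z≥ n le = ≤-trans (≤-reflexive (sym (m+n∸m≡n (suc s + c) z₀))) (∸-monoˡ-≤ (suc s + c) (t≥ n le))
        last : ∀ n → n % W ≡ ρ → suc s + c + z₀ ≤ n / W → v ρ + W * c + (u + W * (n / W ∸ (suc s + c))) ≡ n
        last n e le = +-cancelʳ-≡ (W * suc s) _ n (trans (l (v ρ) u W c (n / W ∸ (suc s + c)) s)
          (trans (cong (λ t → v ρ + (W * t + u)) (m+[n∸m]≡n (m+n≤o⇒m≤o (suc s + c) le))) (sym (n≡ n ρ e))))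
          where l : ∀ v u W c d s → v + W * c + (u + W * d) + W * suc s ≡ v + (W * (suc s + c + d) + u)
                l = solve-∀
      classes′ : ∀ ρ → Dec (Adm k k₁ (v ρ)) → Dec (w ∣ v ρ ∸ f) → Σ ℕ λ n₀ → ∀ n → n₀ ≤ n → P ρ n
      classes′ ρ (no ¬A) _ = 0 , λ n _ e _ A → ⊥-elim (¬A (adm-v ρ n e A))
      classes′ ρ (yes _) (no w∤) = 0 , λ n _ e xy _ → ⊥-elim (w∤ (w∣v ρ n e xy))
      classes′ ρ (yes A) (yes (divides x x≡)) = use ρ (orders (v ρ) x
        (trans (sym (m+[n∸m]≡n (f≤v ρ))) (cong (f +_) (trans x≡ (*-comm x w)))) A (≤-trans (m≤n+m (2 + k) f) (s≤v ρ)))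

    eventually : Σ ℕ λ n₀ → ∀ n → n₀ ≤ n → (Σ ℕ λ x → Σ ℕ λ y → n + w * x ≡ f + w * y) → Adm k k₁ n → B n
    eventually = let n₀ , h = uniform W P (λ ρ → classes′ ρ (adm? (v ρ)) (w ∣? (v ρ ∸ f))) in n₀ , λ n le → h (n % W) (m%n<n n W) n le refl

  module Final (k k₁ F bb w : ℕ) .{{_ : NonZero k}} .{{_ : NonZero k₁}}
    (representative : ∀ W v → 0 < W → Adm k k₁ v → 2 + k ≤ v → Σ ℕ λ c → Sizes.B k (v + W * c)) (F>0 : 0 < F) (richF : ∀ z → Rich (suc k) (suc (F * z)))
    (all : ∀ U → (∀ j → k ≤ j → j ≤ bb → Sizes.G k U j) → ∀ j → k ≤ j → Sizes.G k U j) (k<bb : suc k ≤ bb) (w>0 : 0 < w) (kk∣w : k * k₁ ∣ w)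
    (small : ∀ j → k ≤ j → j ≤ bb → Sizes.G k w j)
    (extend : ∀ f → 0 < f → Sizes.B k f → Σ ℕ λ g → Sizes.H k f (w * g) × Rich bb g × 0 < g) where
    open Sizes k
    open Admissible k k₁

    module Class (f g : ℕ) (h : ∀ j → k ≤ j → H f (j * (g * w))) (Rg : Rich bb g) (g>0 : 0 < g) where
      W : ℕ
      W = w * k * g * F
      W>0 : 0 < W
      W>0 = *-mono-< {0} {w * k * g} {0} (*-mono-< {0} {w * k} {0} (*-mono-< {0} {w} {0} w>0 (>-nonZero⁻¹ k)) g>0) F>0

      -- A representative v + W c equals f + r w, the order carried by the hole and the truncated
      -- group. The k long groups of g (1 + F z) points, each of weight w, add w k g + W z. From z =
      -- r + k on, the long groups are longer than r and the holey design exists.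
      orders : ∀ v x → v ≡ f + w * x → Adm k k₁ v → 2 + k ≤ v → Σ ℕ λ c → Σ ℕ λ z₀ → ∀ z → z₀ ≤ z → B (v + W * c + (w * k * g + W * z))
      orders v x v≡ A le with representative W v W>0 A le
      ... | c , D = c , r + k , λ z z≥ → subst B (eq z) (B-truncate (Rich-* (Rich-restrict k<bb Rg) (richF z)) (r≤m z (m+n≤o⇒m≤o r z≥))
            (small k ≤-refl (≤-trans (n≤1+n k) k<bb)) (small (suc k) (n≤1+n k) k<bb)
            (subst (H f) (l₂ (suc (F * z)) g w) (h (suc (F * z)) (≤-trans (m+n≤o⇒n≤o r z≥) (z≤ z)))) (subst B (trans (cong (_+ W * c) v≡) (l₁ f w x k g F c)) D))
        where
        r = x + k * g * F * c
        l₁ : ∀ f w x k g F c → f + w * x + w * k * g * F * c ≡ f + (x + k * g * F * c) * w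
        l₁ = solve-∀
        l₂ : ∀ y g w → y * (g * w) ≡ g * y * w
        l₂ = solve-∀
        z≤ : ∀ z → z ≤ suc (F * z)
        z≤ z = ≤-trans (m≤n*m z F {{>-nonZero F>0}}) (n≤1+n _)
        r≤m : ∀ z → r ≤ z → r ≤ g * suc (F * z)
        r≤m z le = ≤-trans le (≤-trans (z≤ z) (m≤n*m (suc (F * z)) g {{>-nonZero g>0}}))
        eq : ∀ z → f + (k * (g * suc (F * z)) + r) * w ≡ v + W * c + (w * k * g + W * z)
        eq z = trans (l₃ f k g F z r w) (trans (cong (λ u → u + (w * k * g + W * z)) (sym (l₁ f w x k g F c))) (cong (λ u → u + W * c + (w * k * g + W * z)) (sym v≡)))
          where l₃ : ∀ f k g F z r w → f + (k * (g * suc (F * z)) + r) * w ≡ f + r * w + (w * k * g + w * k * g * F * z)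
                l₃ = solve-∀

      eventually : Σ ℕ λ n₀ → ∀ n → n₀ ≤ n → (Σ ℕ λ x → Σ ℕ λ y → n + w * x ≡ f + w * y) → Adm k k₁ n → B n
      eventually = Residues.eventually k k₁ f w W (w * k * g) (w * k * g * (F ∸ 1)) {{>-nonZero (>-nonZero⁻¹ k₁)}} {{>-nonZero W>0}} B kk∣w
        (divides (k * g * F) (l₁ w k g F)) (divides (k * g) (l₂ w k g)) (trans (cong (w * k * g *_) (sym (m+[n∸m]≡n F>0))) (l₃ (w * k * g) (F ∸ 1))) orders
        where
        l₁ : ∀ w k g F → w * k * g * F ≡ k * g * F * w
        l₁ = solve-∀
        l₂ : ∀ w k g → w * k * g ≡ k * g * w
        l₂ = solve-∀
        l₃ : ∀ u F → u * suc F ≡ u * F + u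
        l₃ = solve-∀

    -- Residues are refined in two rounds. The class of n modulo w selects the hole f; g and the
    -- modulus W depend on f, so the classes modulo W can be treated only afterwards.
    theorem : Σ ℕ λ n₀ → ∀ n → n₀ ≤ n → Adm k k₁ n → B n
    theorem = let n₀ , h = uniform w (λ c n → n % w ≡ c → Adm k k₁ n → B n) classes in n₀ , λ n le → h (n % w) (m%n<n n w) n le refl
      where
      instance
        nzw : NonZero w
        nzw = >-nonZero w>0
      n≡ : ∀ n c → n % w ≡ c → n + w * (2 + k) ≡ (c + w * (2 + k)) + w * (n / w)
      n≡ n c e = trans (cong (_+ w * (2 + k)) (trans (m≡m%n+[m/n]*n n w) (cong (_+ n / w * w) e))) (l c (n / w) w (2 + k))
        where l : ∀ c t w s → c + t * w + w * s ≡ c + w * s + w * t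
              l = solve-∀
      big : ∀ c → 2 + k ≤ c + w * (2 + k)
      big c = ≤-trans (m≤n*m (2 + k) w) (m≤n+m _ c)
      classes : ∀ c → Σ ℕ λ n₀ → ∀ n → n₀ ≤ n → n % w ≡ c → Adm k k₁ n → B n
      classes c with adm? (c + w * (2 + k))
      ... | no ¬A = 0 , λ n _ e A → ⊥-elim (¬A (transfer (w * (2 + k)) (w * (n / w)) (<-≤-trans (s≤s z≤n) (big c)) (∣-trans kk∣w (m∣m*n (2 + k))) (∣-trans kk∣w (m∣m*n (n / w))) (n≡ n c e) A))
      ... | yes A with representative w (c + w * (2 + k)) w>0 A (big c)
      ... | c₁ , D with extend (c + w * (2 + k) + w * c₁) (<-≤-trans (s≤s z≤n) (≤-trans (big c) (m≤m+n _ (w * c₁)))) D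
      ... | g , Hg , Rg , g>0 = let n₀ , h = Class.eventually f g H′ Rg g>0 in
            n₀ , λ n le e A′ → h n le (2 + k + c₁ , n / w , eq n e) A′
        where
        f = c + w * (2 + k) + w * c₁
        H′ : ∀ j → k ≤ j → H f (j * (g * w))
        H′ j k≤j = G-fill (all (g * w) (λ i k≤i i≤bb → G-inflate (Rich-restrict i≤bb Rg) (small i k≤i i≤bb)) j k≤j) (subst (H f) (*-comm w g) Hg)
        eq : ∀ n → n % w ≡ c → n + w * (2 + k + c₁) ≡ f + w * (n / w)
        eq n e = trans (cong (n +_) (*-distribˡ-+ w (2 + k) c₁)) (trans (sym (+-assoc n _ _)) (trans (cong (_+ w * c₁) (n≡ n c e)) (l (c + w * (2 + k)) (w * (n / w)) (w * c₁))))
          where l : ∀ a b d → a + b + d ≡ a + d + b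
                l = solve-∀

  module _ (k₂ : ℕ) where
    open Wilson k₂
    open Sizes k
    private
      go : ∀ F bb c E′ → 0 < F → k ≤ F → (∀ z → Rich (suc k) (suc (F * z))) → 2 * k + (k * F) * suc k ≤ bb → suc k ≤ bb → 0 < c → 2 ^ bb ≡ suc E′ →
        (∀ z → Rich bb (suc (c * z))) → Σ ℕ λ n₀ → ∀ n → n₀ ≤ n → Adm k k₁ n → B n
      go F bb c E′ F>0 k≤F richF le k<bb c>0 E≡ richC with small-GDDs bb (<-≤-trans (s≤s z≤n) k<bb)
      ... | w₀ , w₀>0 , d , sm = Final.theorem k k₁ F bb (w₀ ^ suc E′) representative F>0 richF (λ U → Closure.all-GDDs F k≤F richF U bb le) k<bb
            (m^n>0 w₀ {{>-nonZero w₀>0}} (suc E′)) (∣-trans d (m∣m*n (w₀ ^ E′))) (λ j p q → subst (λ e → G (w₀ ^ e) j) E≡ (sm j p q))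
            (λ f f>0 D → Extend.extension bb c E′ E≡ c>0 richC f w₀ f>0 w₀>0 D)

    -- The factorials are chosen so that 1 + F z and 1 + (bb !) z are orders of rich groups, and
    -- `bb` is the range from which truncation reaches every number of groups.
    wilson : Σ ℕ λ n₀ → ∀ n → n₀ ≤ n → Adm k k₁ n → B n
    wilson = go F bb (bb !) (2 ^ bb ∸ 1) (1≤n! (suc k)) (≤-trans (n≤1+n k) (∣⇒≤ {{>-nonZero (1≤n! (suc k))}} (∣! {suc k} {suc k} (s≤s z≤n) ≤-refl)))
        (Rich-coprime (suc k)) ≤-refl k<bb (1≤n! bb) (sym (m+[n∸m]≡n (m^n>0 2 bb))) (Rich-coprime bb)
      where
      F = suc k !
      bb = 2 * k + (k * F) * suc k
      k<bb : suc k ≤ bb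
      k<bb = ≤-trans (≤-trans (+-monoˡ-≤ k {1} {k} (s≤s z≤n)) (≤-reflexive (cong (k +_) (sym (+-identityʳ k))))) (m≤m+n (2 * k) _)

-- The upper bound for the sum of maximum average degrees

module MadBounds where
  open import Defs
  open QuasiRandomness
  open import Data.Nat using (ℕ; zero; suc; _+_; _*_; _∸_; _≤_; _<_; z≤n; s≤s; _<ᵇ_)
  open import Data.Nat.Properties hiding (_≟_; suc-injective; ≤-isPreorder)
  open import Data.Nat.Tactic.RingSolver using (solve-∀)
  open import Data.Bool using (Bool; true; false; _∧_; T)
  open import Data.Fin using (Fin; zero; suc; toℕ)
  open import Data.Fin.Properties using (_≟_; toℕ-injective)
  open import Data.Vec using (Vec; []; _∷_; lookup)
  open import Data.List using (List; []; _∷_; map; _++_; foldr; concatMap; allFin; tabulate)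
  open import Data.List.Membership.Propositional using (_∈_)
  open import Data.List.Membership.Propositional.Properties using (∈-map⁺; ∈-++⁺ˡ; ∈-++⁺ʳ)
  open import Data.List.Relation.Unary.Any using (here; there)
  open import Data.Product using (_×_; _,_)
  open import Data.Sum using (inj₁; inj₂)
  import Data.Integer as ℤ
  import Data.Integer.Properties as ℤ
  open import Data.Rational as ℚ using (ℚ; 0ℚ; _/_; _⊔_) renaming (_≤_ to _≤ℚ_)
  import Data.Rational.Properties as ℚ
  open import Data.Rational.Unnormalised as ℚᵘ using (ℚᵘ; mkℚᵘ; *≤*; *≡*)
  import Data.Rational.Unnormalised.Properties as ℚᵘ
  open import Data.Empty using (⊥-elim)
  open import Relation.Nullary using (¬_; Dec; yes; no)
  open import Relation.Nullary.Decidable using (⌊_⌋)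
  open import Relation.Binary.Definitions using (tri<; tri≈; tri>)
  open import Relation.Binary.PropositionalEquality using (_≡_; refl; sym; trans; cong; cong₂; subst; subst₂)

  frac-≤ : ∀ {m d m′ d′} → m * suc d′ ≤ m′ * suc d → (ℤ.+ m) / suc d ≤ℚ (ℤ.+ m′) / suc d′
  frac-≤ {m} {d} {m′} {d′} h = ℚ.toℚᵘ-cancel-≤ (ℚᵘ.≤-respˡ-≃ (ℚᵘ.≃-sym (ℚ.toℚᵘ-fromℚᵘ (mkℚᵘ (ℤ.+ m) d)))
    (ℚᵘ.≤-respʳ-≃ (ℚᵘ.≃-sym (ℚ.toℚᵘ-fromℚᵘ (mkℚᵘ (ℤ.+ m′) d′)))
      (*≤* (subst₂ ℤ._≤_ (ℤ.pos-* m (suc d′)) (ℤ.pos-* m′ (suc d)) (ℤ.+≤+ h)))))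

  frac-+ : ∀ m m′ d → (ℤ.+ m) / suc d ℚ.+ (ℤ.+ m′) / suc d ≡ (ℤ.+ (m + m′)) / suc d
  frac-+ m m′ d = ℚ.toℚᵘ-injective (ℚᵘ.≃-trans (ℚ.toℚᵘ-homo-+ ((ℤ.+ m) / suc d) ((ℤ.+ m′) / suc d))
    (ℚᵘ.≃-trans (ℚᵘ.+-cong (ℚ.toℚᵘ-fromℚᵘ (mkℚᵘ (ℤ.+ m) d)) (ℚ.toℚᵘ-fromℚᵘ (mkℚᵘ (ℤ.+ m′) d)))
      (ℚᵘ.≃-trans (*≡* (eq (ℤ.+ m) (ℤ.+ m′) (ℤ.+ suc d))) (ℚᵘ.≃-sym (ℚ.toℚᵘ-fromℚᵘ (mkℚᵘ (ℤ.+ (m + m′)) d))))))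
    where
    open import Data.Integer.Tactic.RingSolver using () renaming (solve-∀ to ℤ-solve)
    eq : ∀ a b c → (a ℤ.* c ℤ.+ b ℤ.* c) ℤ.* c ≡ (a ℤ.+ b) ℤ.* (c ℤ.* c)
    eq = ℤ-solve

  b2n : Bool → ℕ
  b2n true = 1
  b2n false = 0

  b2n-⌊⌋ : ∀ {P : Set} (d : Dec P) → b2n ⌊ d ⌋ ≡ 𝟙 d
  b2n-⌊⌋ (yes _) = refl
  b2n-⌊⌋ (no _) = refl

  b2n-∧ : ∀ a b → b2n (a ∧ b) ≡ b2n a * b2n b
  b2n-∧ true b = sym (+-identityʳ (b2n b))
  b2n-∧ false b = refl

  b2n≤1 : ∀ b → b2n b ≤ 1
  b2n≤1 true = s≤s z≤n
  b2n≤1 false = z≤n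

  private
    countB-++ : ∀ xs ys → countB (xs ++ ys) ≡ countB xs + countB ys
    countB-++ [] ys = refl
    countB-++ (true ∷ xs) ys = cong suc (countB-++ xs ys)
    countB-++ (false ∷ xs) ys = countB-++ xs ys

    countB-tabulate : ∀ {n} {A B : Set} (h : A → B) (f : B → Bool) (g : Fin n → A) → countB (map f (map h (tabulate g))) ≡ sum (λ i → b2n (f (h (g i))))
    countB-tabulate {zero} h f g = refl
    countB-tabulate {suc n} h f g with f (h (g zero))
    ... | true = cong suc (countB-tabulate h f (λ i → g (suc i)))
    ... | false = countB-tabulate h f (λ i → g (suc i))

    countB-concatMap : ∀ {n} {A B : Set} (f : B → Bool) (h : A → List B) (g : Fin n → A) →
      countB (map f (concatMap h (tabulate g))) ≡ sum (λ i → countB (map f (h (g i))))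
    countB-concatMap {zero} f h g = refl
    countB-concatMap {suc n} f h g = trans (cong countB (map-++ f (h (g zero)) _)) (trans (countB-++ (map f (h (g zero))) _)
      (cong (countB (map f (h (g zero))) +_) (countB-concatMap f h (λ i → g (suc i)))))
      where open import Data.List.Properties using (map-++)

  countB-pairs : ∀ n (f : Fin n × Fin n → Bool) → countB (map f (pairs n)) ≡ sum (λ i → sum (λ j → b2n (f (i , j))))
  countB-pairs n f = trans (countB-concatMap f (λ i → map (λ j → (i , j)) (allFin n)) (λ i → i))
    (sum-cong-≗ (λ i → countB-tabulate (λ j → (i , j)) f (λ j → j)))

  size-sum : ∀ {n} (S : Vec Bool n) → size S ≡ sum (λ i → b2n (lookup S i))
  size-sum [] = refl
  size-sum (true ∷ S) = cong suc (size-sum S)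
  size-sum (false ∷ S) = size-sum S

  lt : ∀ {n} → Fin n → Fin n → ℕ
  lt i j = b2n (toℕ i <ᵇ toℕ j)

  lt-yes : ∀ {n} {i j : Fin n} → toℕ i < toℕ j → lt i j ≡ 1
  lt-yes {i = i} {j} h with toℕ i <ᵇ toℕ j | <⇒<ᵇ h
  ... | true | _ = refl

  lt-no : ∀ {n} {i j : Fin n} → ¬ toℕ i < toℕ j → lt i j ≡ 0
  lt-no {i = i} {j} h with toℕ i <ᵇ toℕ j in e
  ... | true = ⊥-elim (h (<ᵇ⇒< (toℕ i) (toℕ j) (subst T (sym e) _)))
  ... | false = refl

  lt-total : ∀ {n} (i j : Fin n) → lt i j + lt j i + 𝟙 (i ≟ j) ≡ 1
  lt-total i j with <-cmp (toℕ i) (toℕ j)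
  ... | tri< p q r = cong₂ _+_ (cong₂ _+_ (lt-yes {i = i} p) (lt-no {i = j} r)) (𝟙-no (i ≟ j) (λ e → q (cong toℕ e)))
  ... | tri≈ p q r = cong₂ _+_ (cong₂ _+_ (lt-no {i = i} p) (lt-no {i = j} r)) (𝟙-yes (i ≟ j) (toℕ-injective q))
  ... | tri> p q r = cong₂ _+_ (cong₂ _+_ (lt-no {i = i} p) (lt-yes {i = j} r)) (𝟙-no (i ≟ j) (λ e → q (cong toℕ e)))

  module Edges {k n : ℕ} (c : Colouring k n) where
    col : Fin k → Fin n → Fin n → ℕ
    col a i j = 𝟙 (c i j ≟ a)

    edges-sum : ∀ a S → edgesIn c a S ≡ sum (λ i → sum (λ j → b2n (lookup S i) * (b2n (lookup S j) * (lt i j * col a i j))))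
    edges-sum a S = trans (countB-pairs n _) (sum-cong-≗ (λ i → sum-cong-≗ (λ j →
      trans (b2n-∧ (lookup S i) _) (cong (b2n (lookup S i) *_) (trans (b2n-∧ (lookup S j) _) (cong (b2n (lookup S j) *_)
        (trans (b2n-∧ (toℕ i <ᵇ toℕ j) _) (cong (lt i j *_) (b2n-⌊⌋ (c i j ≟ a))))))))))

    total : Fin k → ℕ
    total a = sum (λ i → sum (λ j → lt i j * col a i j))

    edges≤total : ∀ a S → edgesIn c a S ≤ total a
    edges≤total a S = ≤-trans (≤-reflexive (edges-sum a S)) (sum-mono (λ i → sum-mono (λ j →
      ≤-trans (*-mono-≤ (b2n≤1 (lookup S i)) (*-monoˡ-≤ _ (b2n≤1 (lookup S j)))) (≤-reflexive (l (lt i j * col a i j))))))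
      where l : ∀ x → 1 * (1 * x) ≡ x
            l = solve-∀

    edges-size : ∀ a S → 2 * edgesIn c a S + size S ≤ size S * size S
    edges-size a S = begin
      2 * edgesIn c a S + size S
        ≡⟨ cong₂ _+_ (trans (cong (λ e → e + (e + 0)) (edges-sum a S)) (cong (sum (λ i → sum (y i)) +_) (trans (+-identityʳ _) (∑-comm y))))
             (trans (size-sum S) (sum-cong-≗ diag)) ⟩
      sum (λ i → sum (y i)) + sum (λ i → sum (λ j → y j i)) + sum (λ i → sum (λ j → s i * 𝟙 (j ≟ i)))
        ≡⟨ cong (_+ sum (λ i → sum (λ j → s i * 𝟙 (j ≟ i)))) (sym (sum-+₂ y (λ i j → y j i))) ⟩
      sum (λ i → sum (λ j → y i j + y j i)) + sum (λ i → sum (λ j → s i * 𝟙 (j ≟ i)))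
        ≡⟨ sym (sum-+₂ (λ i j → y i j + y j i) (λ i j → s i * 𝟙 (j ≟ i))) ⟩
      sum (λ i → sum (λ j → y i j + y j i + s i * 𝟙 (j ≟ i)))
        ≤⟨ sum-mono (λ i → sum-mono (bound i)) ⟩
      sum (λ i → sum (λ j → s i * s j))
        ≡⟨ sym (sum² s) ⟩
      sum s * sum s
        ≡⟨ cong (λ z → z * z) (sym (size-sum S)) ⟩
      size S * size S ∎
      where
      open ≤-Reasoning
      s : Fin n → ℕ
      s i = b2n (lookup S i)
      y : Fin n → Fin n → ℕ
      y i j = s i * (s j * (lt i j * col a i j))
      diag : ∀ i → s i ≡ sum (λ j → s i * 𝟙 (j ≟ i))
      diag i = sym (trans (sym (*-distribˡ-sum (s i) (λ j → 𝟙 (j ≟ i)))) (trans (cong (s i *_) (sum-eq i)) (*-identityʳ (s i))))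
      col≤1 : ∀ i j → lt i j * col a i j ≤ lt i j
      col≤1 i j = ≤-trans (*-monoʳ-≤ (lt i j) (𝟙≤1 (c i j ≟ a))) (≤-reflexive (*-identityʳ (lt i j)))
      diag-≤ : ∀ i j → s i * 𝟙 (j ≟ i) ≤ s i * (s j * 𝟙 (i ≟ j))
      diag-≤ i j with j ≟ i
      ... | no _ = ≤-trans (≤-reflexive (*-zeroʳ (s i))) z≤n
      ... | yes refl = lem
        where
        sq : ∀ b → b2n b * 1 ≤ b2n b * (b2n b * 1)
        sq true = s≤s z≤n
        sq false = z≤n
        lem : s i * 1 ≤ s i * (s i * 𝟙 (i ≟ i))
        lem = subst (λ z → s i * 1 ≤ s i * (s i * z)) (sym (𝟙-yes (i ≟ i) refl)) (sq (lookup S i))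
      bound : ∀ i j → y i j + y j i + s i * 𝟙 (j ≟ i) ≤ s i * s j
      bound i j = begin
        y i j + y j i + s i * 𝟙 (j ≟ i)
          ≤⟨ +-mono-≤ (+-mono-≤ (*-monoʳ-≤ (s i) (*-monoʳ-≤ (s j) (col≤1 i j))) (*-monoʳ-≤ (s j) (*-monoʳ-≤ (s i) (col≤1 j i)))) (diag-≤ i j) ⟩
        s i * (s j * lt i j) + s j * (s i * lt j i) + s i * (s j * 𝟙 (i ≟ j))
          ≡⟨ l (s i) (s j) (lt i j) (lt j i) (𝟙 (i ≟ j)) ⟩
        s i * s j * (lt i j + lt j i + 𝟙 (i ≟ j))
          ≡⟨ trans (cong (s i * s j *_) (lt-total i j)) (*-identityʳ _) ⟩
        s i * s j ∎
        where l : ∀ a b p q r → a * (b * p) + b * (a * q) + a * (b * r) ≡ a * b * (p + q + r)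
              l = solve-∀

    total-sum : 2 * sum total + n ≤ n * n
    total-sum = begin
      2 * sum total + n
        ≤⟨ +-monoˡ-≤ n (*-monoʳ-≤ 2 all) ⟩
      2 * sum {n} (λ i → sum {n} (λ j → lt i j)) + n
        ≡⟨ cong₂ _+_ (cong (sum {n} (λ i → sum {n} (lt i)) +_) (trans (+-identityʳ _) (∑-comm {n} {n} lt))) (trans (sym (trans (sum-const n 1) (*-identityʳ n))) (sum-cong-≗ {n} (λ i → sym (sum-eq i)))) ⟩
      sum {n} (λ i → sum {n} (λ j → lt i j)) + sum {n} (λ i → sum {n} (λ j → lt j i)) + sum {n} (λ i → sum {n} (λ j → 𝟙 (j ≟ i)))
        ≡⟨ cong₂ _+_ (sym (sum-+₂ {n} {n} lt (λ i j → lt j i))) (∑-comm {n} {n} (λ i j → 𝟙 (j ≟ i))) ⟩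
      sum {n} (λ i → sum {n} (λ j → lt i j + lt j i)) + sum {n} (λ i → sum {n} (λ j → 𝟙 (i ≟ j)))
        ≡⟨ sym (sum-+₂ {n} {n} (λ i j → lt i j + lt j i) (λ i j → 𝟙 (i ≟ j))) ⟩
      sum {n} (λ i → sum {n} (λ j → lt i j + lt j i + 𝟙 (i ≟ j)))
        ≡⟨ sum-cong-≗ {n} (λ i → trans (sum-cong-≗ (λ j → lt-total i j)) (trans (sum-const n 1) (*-identityʳ n))) ⟩
      sum {n} (λ i → n)
        ≡⟨ sum-const n n ⟩
      n * n ∎
      where
      open ≤-Reasoning
      all : sum total ≤ sum {n} (λ i → sum {n} (λ j → lt i j))
      all = begin
        sum (λ a → sum {n} (λ i → sum {n} (λ j → lt i j * col a i j)))   ≡⟨ ∑-comm (λ a i → sum (λ j → lt i j * col a i j)) ⟩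
        sum {n} (λ i → sum (λ a → sum {n} (λ j → lt i j * col a i j)))   ≡⟨ sum-cong-≗ (λ i → ∑-comm (λ a j → lt i j * col a i j)) ⟩
        sum {n} (λ i → sum {n} (λ j → sum (λ a → lt i j * col a i j)))   ≡⟨ sum-cong-≗ (λ i → sum-cong-≗ (λ j → sym (*-distribˡ-sum (lt i j) (λ a → col a i j)))) ⟩
        sum {n} (λ i → sum {n} (λ j → lt i j * sum (λ a → col a i j)))   ≤⟨ sum-mono (λ i → sum-mono (λ j → ≤-trans (*-monoʳ-≤ (lt i j) (sum-at-most-one (c i j ≟_) (λ p q → trans (sym p) q))) (≤-reflexive (*-identityʳ (lt i j))))) ⟩
        sum {n} (λ i → sum {n} (λ j → lt i j))                           ∎

  allSubsets-∋ : ∀ {n} (S : Vec Bool n) → S ∈ allSubsets n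
  allSubsets-∋ [] = here refl
  allSubsets-∋ (true ∷ S) = ∈-++⁺ˡ (∈-map⁺ (true ∷_) (allSubsets-∋ S))
  allSubsets-∋ (false ∷ S) = ∈-++⁺ʳ _ (∈-map⁺ (false ∷_) (allSubsets-∋ S))

  module MaxFold {A : Set} (d : A → ℚ) where
    fold = foldr (λ S m → d S ⊔ m) 0ℚ
    fold-≤ : ∀ xs {B} → 0ℚ ≤ℚ B → (∀ S → d S ≤ℚ B) → fold xs ≤ℚ B
    fold-≤ [] h₀ h = h₀
    fold-≤ (x ∷ xs) h₀ h = ℚ.⊔-lub (h x) (fold-≤ xs h₀ h)
    fold-≥0 : ∀ xs → 0ℚ ≤ℚ fold xs
    fold-≥0 [] = ℚ.≤-refl
    fold-≥0 (x ∷ xs) = ℚ.≤-trans (fold-≥0 xs) (ℚ.p≤q⊔p (d x) (fold xs))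
    fold-≥ : ∀ {xs S} → S ∈ xs → d S ≤ℚ fold xs
    fold-≥ {x ∷ xs} (here refl) = ℚ.p≤p⊔q (d x) (fold xs)
    fold-≥ {x ∷ xs} (there m) = ℚ.≤-trans (fold-≥ m) (ℚ.p≤q⊔p (d x) (fold xs))

  private
    fold-sum-≤ : ∀ {k n} (g : Fin n → Fin k) (f : Fin k → ℚ) (X : Fin n → ℕ) d → (∀ i → f (g i) ≤ℚ (ℤ.+ X i) / suc d) →
      foldr (λ a s → f a ℚ.+ s) 0ℚ (tabulate g) ≤ℚ (ℤ.+ sum X) / suc d
    fold-sum-≤ {n = zero} g f X d h = frac-≤ {0} {0} {0} {d} z≤n
    fold-sum-≤ {n = suc n} g f X d h = ℚ.≤-trans (ℚ.+-mono-≤ (h zero) (fold-sum-≤ (λ i → g (suc i)) f (λ i → X (suc i)) d (λ i → h (suc i))))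
      (ℚ.≤-reflexive (frac-+ (X zero) (sum (λ i → X (suc i))) d))
    fold-sum-≥ : ∀ {k n} (g : Fin n → Fin k) (f : Fin k → ℚ) (X : Fin n → ℕ) d → (∀ i → (ℤ.+ X i) / suc d ≤ℚ f (g i)) →
      (ℤ.+ sum X) / suc d ≤ℚ foldr (λ a s → f a ℚ.+ s) 0ℚ (tabulate g)
    fold-sum-≥ {n = zero} g f X d h = frac-≤ {0} {d} {0} {0} z≤n
    fold-sum-≥ {n = suc n} g f X d h = ℚ.≤-trans (ℚ.≤-reflexive (sym (frac-+ (X zero) (sum (λ i → X (suc i))) d)))
      (ℚ.+-mono-≤ (h zero) (fold-sum-≥ (λ i → g (suc i)) f (λ i → X (suc i)) d (λ i → h (suc i))))

  totalMad-≤ : ∀ {k n} (c : Colouring k n) (X : Fin k → ℕ) d → (∀ a → Mad c a ≤ℚ (ℤ.+ X a) / suc d) → totalMad c ≤ℚ (ℤ.+ sum X) / suc d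
  totalMad-≤ c X d h = fold-sum-≤ (λ i → i) (Mad c) X d h

  totalMad-≥ : ∀ {k n} (c : Colouring k n) (X : Fin k → ℕ) d → (∀ a → (ℤ.+ X a) / suc d ≤ℚ Mad c a) → (ℤ.+ sum X) / suc d ≤ℚ totalMad c
  totalMad-≥ c X d h = fold-sum-≥ (λ i → i) (Mad c) X d h

  Mad-≥ : ∀ {k n} (c : Colouring k n) a S → density (edgesIn c a S) (size S) ≤ℚ Mad c a
  Mad-≥ c a S = MaxFold.fold-≥ (λ S → density (edgesIn c a S) (size S)) (allSubsets-∋ S)

  Mad-≥0 : ∀ {k n} (c : Colouring k n) a → 0ℚ ≤ℚ Mad c a
  Mad-≥0 {n = n} c a = MaxFold.fold-≥0 (λ S → density (edgesIn c a S) (size S)) (allSubsets n)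

  -- With q = p + 1 this is 2 e / s ≤ (q − 1) / 2 + E / q, which is tight at K_q and K_{q+1} and amounts to (s − q)(s − q − 1) ≥ 0.
  density-bound : ∀ p e E s → 2 * e + s ≤ s * s → e ≤ E → 4 * (suc p * e) ≤ (suc p * p + 2 * E) * s
  density-bound p e E s h e≤E = ≤-trans (case (≤-total s (suc (suc p) * 1 + p))) (*-monoˡ-≤ s (+-monoʳ-≤ (suc p * p) (*-monoʳ-≤ 2 e≤E)))
    where
    q = suc p
    square : ∀ s → s * (2 * q) + s ≤ s * s + q * p + 2 * q
    square s with ≤-total s q
    ... | inj₁ le with m≤n⇒∃[o]m+o≡n le
    ... | o , eq = lem o eq
      where
      lem : ∀ o → s + o ≡ q → s * (2 * q) + s ≤ s * s + q * p + 2 * q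
      lem o e = subst (λ z → s * (2 * z) + s ≤ s * s + z * p + 2 * z) e (+-cancelʳ-≤ (s + o) _ _ (subst₂ _≤_ (l₁ s o) (sym (trans (cong (λ z → s * s + (s + o) * p + 2 * (s + o) + z) e) (l₂ s o p e))) (m≤m+n _ (o * o + o))))
        where
        l₁ : ∀ s o → s * s * 2 + s * o * 2 + 2 * s + o ≡ s * (2 * (s + o)) + s + (s + o)
        l₁ = solve-∀
        l₂ : ∀ s o p → s + o ≡ suc p → s * s + (s + o) * p + 2 * (s + o) + suc p ≡ s * s * 2 + s * o * 2 + 2 * s + o + (o * o + o)
        l₂ s o p e = trans (l₃ s o p) (trans (cong (λ z → s * s + (s + o) * z + (s + o) + z) (sym e)) (l₄ s o))
          where l₃ : ∀ s o p → s * s + (s + o) * p + 2 * (s + o) + suc p ≡ s * s + (s + o) * suc p + (s + o) + suc p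
                l₃ = solve-∀
                l₄ : ∀ s o → s * s + (s + o) * (s + o) + (s + o) + (s + o) ≡ s * s * 2 + s * o * 2 + 2 * s + o + (o * o + o)
                l₄ = solve-∀
    square s | inj₂ le with m≤n⇒m<n∨m≡n le
    ... | inj₂ refl = ≤-reflexive (l p)
      where l : ∀ p → suc p * (2 * suc p) + suc p ≡ suc p * suc p + suc p * p + 2 * suc p
            l = solve-∀
    ... | inj₁ lt′ with m≤n⇒∃[o]m+o≡n lt′
    ... | o , refl = subst₂ _≤_ refl (sym (l p o)) (m≤m+n _ (o * o + o))
      where l : ∀ p o → (suc (suc p) + o) * (suc (suc p) + o) + suc p * p + 2 * suc p ≡ (suc (suc p) + o) * (2 * suc p) + (suc (suc p) + o) + (o * o + o)
            l = solve-∀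
    -- For s at least 2 q the term 2 e s alone suffices. Below, 2 e + s ≤ s² is multiplied by o = 2
    -- q - s, and the square inequality bounds o s.
    case : _ → 4 * (q * e) ≤ (q * p + 2 * e) * s
    case (inj₂ big) = ≤-trans (≤-trans (≤-reflexive (l₁ q e)) (*-monoʳ-≤ (2 * e) (≤-trans (≤-reflexive (l₂ p)) big))) (*-monoˡ-≤ s (m≤n+m (2 * e) (q * p)))
      where l₁ : ∀ q e → 4 * (q * e) ≡ 2 * e * (2 * q)
            l₁ = solve-∀
            l₂ : ∀ p → 2 * suc p ≡ suc (suc p) * 1 + p
            l₂ = solve-∀
    case (inj₁ small) with m≤n⇒∃[o]m+o≡n small
    ... | o , eq = +-cancelʳ-≤ (o * s) _ _ (begin
        4 * (q * e) + o * s                         ≡⟨ cong (_+ o * s) (l₁ q e) ⟩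
        2 * e * (2 * q) + o * s                     ≡⟨ cong (λ z → 2 * e * z + o * s) (sym eq′) ⟩
        2 * e * (s + o) + o * s                     ≡⟨ l₂ e s o ⟩
        2 * e * s + o * (2 * e + s)                 ≤⟨ +-monoʳ-≤ (2 * e * s) (*-monoʳ-≤ o h) ⟩
        2 * e * s + o * (s * s)                     ≤⟨ +-monoʳ-≤ (2 * e * s) key ⟩
        2 * e * s + (q * p * s + o * s)             ≡⟨ l₃ e s (q * p) o ⟩
        (q * p + 2 * e) * s + o * s                 ∎)
      where
      open ≤-Reasoning
      eq′ : s + o ≡ 2 * q
      eq′ = trans eq (l p)
        where l : ∀ p → suc (suc p) * 1 + p ≡ 2 * suc p
              l = solve-∀
      l₁ : ∀ q e → 4 * (q * e) ≡ 2 * e * (2 * q)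
      l₁ = solve-∀
      l₂ : ∀ e s o → 2 * e * (s + o) + o * s ≡ 2 * e * s + o * (2 * e + s)
      l₂ = solve-∀
      l₃ : ∀ e s x o → 2 * e * s + (x * s + o * s) ≡ (x + 2 * e) * s + o * s
      l₃ = solve-∀
      -- o s ≤ q p + o is the square inequality with 2 q = s + o.
      os : o * s ≤ q * p + o
      os = +-cancelˡ-≤ (s * s + s) (o * s) (q * p + o) (subst₂ _≤_ (trans (cong (λ z → s * z + s) (sym eq′)) (l₄ s o)) (trans (cong (s * s + q * p +_) (sym eq′)) (l₅ s (q * p) o)) (square s))
        where l₄ : ∀ s o → s * (s + o) + s ≡ s * s + s + o * s
              l₄ = solve-∀
              l₅ : ∀ s x o → s * s + x + (s + o) ≡ s * s + s + (x + o)
              l₅ = solve-∀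
      key : o * (s * s) ≤ q * p * s + o * s
      key = ≤-trans (≤-reflexive (sym (*-assoc o s s))) (≤-trans (*-monoˡ-≤ s os) (≤-reflexive (*-distribʳ-+ s (q * p) o)))

  -- Over the common denominator 2 q, with q = p + 1, the k constants q (q - 1) and the doubled edge
  -- numbers each sum to at most n (n - 1).
  totalMad-upper : ∀ {k n} p (c : Colouring k n) → k * (suc p * p) ≤ n * (n ∸ 1) → totalMad c ≤ℚ (ℤ.+ (n * (n ∸ 1))) / suc p
  totalMad-upper {k} {n} p c h = ℚ.≤-trans (totalMad-≤ c X (2 * p + 1) each) (frac-≤ {sum X} {2 * p + 1} {n * (n ∸ 1)} {p} final)
    where
    open Edges c
    X : Fin k → ℕ
    X a = suc p * p + 2 * total a
    den : ∀ e s → (∀ E → e ≤ E → 4 * (suc p * e) ≤ (suc p * p + 2 * E) * s) → ∀ E → e ≤ E → density e s ≤ℚ (ℤ.+ (suc p * p + 2 * E)) / suc (2 * p + 1)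
    den e zero b E le = frac-≤ {0} {0} {suc p * p + 2 * E} {2 * p + 1} z≤n
    den e (suc v) b E le = frac-≤ {2 * e} {v} {suc p * p + 2 * E} {2 * p + 1} (≤-trans (≤-reflexive (l e p)) (b E le))
      where l : ∀ e p → 2 * e * suc (2 * p + 1) ≡ 4 * (suc p * e)
            l = solve-∀
    each : ∀ a → Mad c a ≤ℚ (ℤ.+ X a) / suc (2 * p + 1)
    each a = MaxFold.fold-≤ (λ S → density (edgesIn c a S) (size S)) (allSubsets n) (frac-≤ {0} {0} {X a} {2 * p + 1} z≤n)
      (λ S → den (edgesIn c a S) (size S) (λ E le → density-bound p (edgesIn c a S) E (size S) (edges-size a S) le) (total a) (edges≤total a S))
    sumX : sum X ≡ k * (suc p * p) + 2 * sum total
    sumX = trans (∑-distrib-+ (λ _ → suc p * p) (λ a → 2 * total a)) (cong₂ _+_ (sum-const k (suc p * p)) (sym (*-distribˡ-sum 2 total)))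
    tot : 2 * sum total ≤ n * (n ∸ 1)
    tot = tot′ n total-sum
      where tot′ : ∀ n → 2 * sum total + n ≤ n * n → 2 * sum total ≤ n * (n ∸ 1)
            tot′ zero h = ≤-trans (m≤m+n _ 0) h
            tot′ (suc m) h = +-cancelʳ-≤ (suc m) _ _ (≤-trans h (≤-reflexive (trans (*-suc (suc m) m) (+-comm (suc m) (suc m * m)))))
    final : sum X * suc p ≤ n * (n ∸ 1) * suc (2 * p + 1)
    final = ≤-trans (*-monoˡ-≤ (suc p) (≤-trans (≤-reflexive sumX) (+-mono-≤ h tot))) (≤-reflexive (l (n * (n ∸ 1)) p))
      where l : ∀ x p → (x + x) * suc p ≡ x * suc (2 * p + 1)
            l = solve-∀

-- The lower bound: colouring the edges by the blocks of a design

module DesignColourings where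
  open import Defs using (Colouring; edgesIn; size; density; Mad; totalMad)
  open Designs
  open SubsetLists using (module Rank)
  open QuasiRandomness
  open MadBounds
  open import Data.Nat using (ℕ; zero; suc; _+_; _*_; _∸_; _≤_; _<_; z≤n; s≤s; _<?_)
  open import Data.Nat.Properties hiding (_≟_; suc-injective)
  open import Data.Nat.Tactic.RingSolver using (solve-∀)
  open import Data.Bool using (Bool)
  open import Data.Fin using (Fin; zero; suc; toℕ; fromℕ<; inject≤)
  open import Data.Fin.Properties using (_≟_; any?; toℕ<n; toℕ-injective; toℕ-fromℕ<; toℕ-inject≤; inject≤-injective; suc-injective)
  open import Data.Vec using (Vec; lookup; tabulate)
  open import Data.Vec.Properties using (lookup∘tabulate)
  open import Data.List using (List; filter; allFin; cartesianProduct; length)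
  open import Data.List.Relation.Unary.Unique.Propositional using (Unique)
  open import Data.List.Relation.Unary.Unique.Propositional.Properties using (allFin⁺; filter⁺; cartesianProduct⁺)
  open import Data.List.Membership.Propositional using (_∈_)
  open import Data.List.Membership.Propositional.Properties using (∈-filter⁺; ∈-filter⁻; ∈-allFin; ∈-cartesianProduct⁺)
  open import Data.Product using (Σ; _×_; _,_; proj₁; proj₂)
  open import Data.Product.Properties using (≡-dec)
  open import Data.Sum using (_⊎_; inj₁; inj₂)
  open import Data.Empty using (⊥-elim)
  import Data.Integer as ℤ
  open import Data.Rational as ℚ using (ℚ; _/_) renaming (_≤_ to _≤ℚ_)
  import Data.Rational.Properties as ℚ
  open import Relation.Nullary using (¬_; Dec; yes; no; ¬?)
  open import Relation.Nullary.Decidable using (⌊_⌋; _×-dec_)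
  open import Relation.Binary.PropositionalEquality using (_≡_; _≢_; refl; sym; trans; cong; cong₂; subst)

  sum-unique : ∀ {n} (f : Fin n → ℕ) i → (∀ j → j ≢ i → f j ≡ 0) → sum f ≡ f i
  sum-unique f zero h = trans (cong (f zero +_) (sum-zero (λ j → h (suc j) (λ ())))) (+-identityʳ _)
  sum-unique f (suc i) h = trans (cong (_+ sum (λ j → f (suc j))) (h zero (λ ()))) (sum-unique (λ j → f (suc j)) i (λ j n → h (suc j) (λ e → n (suc-injective e))))

  private
    rotate : ∀ {l m n} (g : Fin l → Fin m → Fin n → ℕ) → sum (λ x → sum (λ y → sum (g x y))) ≡ sum (λ c → sum (λ x → sum (λ y → g x y c)))
    rotate g = trans (sum-cong-≗ (λ x → ∑-comm (g x))) (∑-comm (λ x c → sum (λ y → g x y c)))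

    off-diagonal : ∀ n → sum {n} (λ a → sum {n} (λ b → 𝟙 (¬? (a ≟ b)))) + n ≡ n * n
    off-diagonal n = trans (cong (sum {n} (λ a → sum {n} (λ b → 𝟙 (¬? (a ≟ b)))) +_) (trans (sym (trans (sum-const n 1) (*-identityʳ n))) (sum-cong-≗ {n} (λ a → sym (trans (sum-cong-≗ {n} (λ b → flip a b)) (sum-eq a))))))
      (trans (sym (sum-+₂ {n} {n} (λ a b → 𝟙 (¬? (a ≟ b))) (λ a b → 𝟙 (a ≟ b)))) (trans (sum-cong-≗ {n} (λ a → trans (sum-cong-≗ {n} (λ b → split (a ≟ b))) (trans (sum-const n 1) (*-identityʳ n)))) (sum-const n n)))
      where
      split : ∀ {P : Set} (d : Dec P) → 𝟙 (¬? d) + 𝟙 d ≡ 1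
      split (yes _) = refl
      split (no _) = refl
      flip : ∀ (a b : Fin n) → 𝟙 (a ≟ b) ≡ 𝟙 (b ≟ a)
      flip a b with a ≟ b | b ≟ a
      ... | yes _ | yes _ = refl
      ... | no _ | no _ = refl
      ... | yes e | no n = ⊥-elim (n (sym e))
      ... | no n | yes e = ⊥-elim (n (sym e))

  module Tuple {p n : ℕ} (φ : Fin p → Fin n) (φ-inj : ∀ {a b} → φ a ≡ φ b → a ≡ b) where
    -- An indicator, φ being injective, but written as a sum over positions so that summation over i
    -- and j can be exchanged with it.
    W : Fin n → Fin n → ℕ
    W i j = sum (λ a → sum (λ b → 𝟙 (¬? (a ≟ b)) * (𝟙 (φ a ≟ i) * 𝟙 (φ b ≟ j))))

    private
      term : ∀ i j a b → ¬ (a ≢ b × φ a ≡ i × φ b ≡ j) → 𝟙 (¬? (a ≟ b)) * (𝟙 (φ a ≟ i) * 𝟙 (φ b ≟ j)) ≡ 0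
      term i j a b h with a ≟ b | φ a ≟ i | φ b ≟ j
      ... | yes _ | _ | _ = refl
      ... | no _ | no _ | _ = refl
      ... | no _ | yes _ | no _ = refl
      ... | no n | yes x | yes y = ⊥-elim (h (n , x , y))

    W-none : ∀ {i j} → (∀ a b → ¬ (a ≢ b × φ a ≡ i × φ b ≡ j)) → W i j ≡ 0
    W-none {i} {j} h = sum-zero (λ a → sum-zero (λ b → term i j a b (h a b)))

    W-one : ∀ a b → a ≢ b → W (φ a) (φ b) ≡ 1
    W-one a b n = trans (sum-unique (λ a′ → sum (λ b′ → 𝟙 (¬? (a′ ≟ b′)) * (𝟙 (φ a′ ≟ φ a) * 𝟙 (φ b′ ≟ φ b)))) a
        (λ a′ ne → sum-zero (λ b′ → term (φ a) (φ b) a′ b′ (λ { (_ , e , _) → ne (φ-inj e) }))))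
      (trans (sum-unique (λ b′ → 𝟙 (¬? (a ≟ b′)) * (𝟙 (φ a ≟ φ a) * 𝟙 (φ b′ ≟ φ b))) b (λ b′ ne → term (φ a) (φ b) a b′ (λ { (_ , _ , e) → ne (φ-inj e) })))
        (cong₂ _*_ (𝟙-yes (¬? (a ≟ b)) n) (cong₂ _*_ (𝟙-yes (φ a ≟ φ a) refl) (𝟙-yes (φ b ≟ φ b) refl))))

    W-cases : ∀ i j → (Σ (Fin p) λ a → Σ (Fin p) λ b → a ≢ b × φ a ≡ i × φ b ≡ j) ⊎ W i j ≡ 0
    W-cases i j with any? (λ a → any? (λ b → ¬? (a ≟ b) ×-dec ((φ a ≟ i) ×-dec (φ b ≟ j))))
    ... | yes w = inj₁ w
    ... | no none = inj₂ (W-none (λ a b h → none (a , b , h)))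

    sum-hit : ∀ x → sum (λ i → 𝟙 (x ≟ i)) ≡ 1
    sum-hit x = trans (sum-unique {n} (λ i → 𝟙 (x ≟ i)) x (λ j ne → 𝟙-no (x ≟ j) (λ e → ne (sym e)))) (𝟙-yes (x ≟ x) refl)

    W-sum : sum (λ i → sum (W i)) + p ≡ p * p
    W-sum = trans (cong (_+ p) (trans (rotate (λ i j a → sum (λ b → 𝟙 (¬? (a ≟ b)) * (𝟙 (φ a ≟ i) * 𝟙 (φ b ≟ j)))))
        (sum-cong-≗ (λ a → trans (rotate (λ i j b → 𝟙 (¬? (a ≟ b)) * (𝟙 (φ a ≟ i) * 𝟙 (φ b ≟ j)))) (sum-cong-≗ (λ b → inner a b)))))) (off-diagonal p)
      where
      inner : ∀ a b → sum (λ i → sum (λ j → 𝟙 (¬? (a ≟ b)) * (𝟙 (φ a ≟ i) * 𝟙 (φ b ≟ j)))) ≡ 𝟙 (¬? (a ≟ b))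
      inner a b = trans (sum-linear (𝟙 (¬? (a ≟ b))) (λ i j → 𝟙 (φ a ≟ i) * 𝟙 (φ b ≟ j)))
        (trans (cong (𝟙 (¬? (a ≟ b)) *_) (trans (sum-cong-≗ (λ i → trans (sym (*-distribˡ-sum (𝟙 (φ a ≟ i)) (λ j → 𝟙 (φ b ≟ j)))) (trans (cong (𝟙 (φ a ≟ i) *_) (sum-hit (φ b))) (*-identityʳ _)))) (sum-hit (φ a)))) (*-identityʳ _))

  module Blocks {p₂ m : ℕ} (D : Design (2 + p₂) (Fin m)) where
    open Decomp D
    private
      p = 2 + p₂
    z₀ z₁ : Fin (2 + p₂)
    z₀ = zero
    z₁ = suc zero
    pt-inj : ∀ B {a b} → pt B a ≡ pt B b → a ≡ b
    pt-inj B {a} {b} e with a ≟ b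
    ... | yes q = q
    ... | no n = ⊥-elim (edge B n e)
    -- Blocks form an arbitrary type. Their first two points determine them and lie in a finite
    -- decidable set, which makes them countable and usable as colours.
    code : Blk → Fin m × Fin m
    code B = pt B z₀ , pt B z₁
    code-inj : ∀ {B B′} → code B ≡ code B′ → B ≡ B′
    code-inj e = uniq {a = z₀} {z₁} {z₀} {z₁} (λ ()) (λ ()) (cong proj₁ e) (cong proj₂ e)

    _≟²_ : (x y : Fin m × Fin m) → Dec (x ≡ y)
    _≟²_ = ≡-dec _≟_ _≟_
    IsCode : Fin m × Fin m → Set
    IsCode c = Σ Blk λ B → code B ≡ c
    isCode? : ∀ c → Dec (IsCode c)
    isCode? (x , y) with x ≟ y
    ... | yes refl = no λ { (B , e) → edge B {z₀} {z₁} (λ ()) (trans (cong proj₁ e) (sym (cong proj₂ e))) }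
    ... | no n with cover n
    ... | B , a , b , a≢b , refl , refl with code B ≟² (pt B a , pt B b)
    ... | yes e = yes (B , e)
    ... | no ne = no λ { (B′ , e) → ne (trans (cong code (uniq a≢b (λ ()) (sym (cong proj₁ e)) (sym (cong proj₂ e)))) e) }

    open Rank _≟²_
    module Enumerate (Cs : List (Fin m × Fin m)) (Cs-unique : Unique Cs) (Cs∋ : ∀ B → code B ∈ Cs) (Cs⁻ : ∀ {c} → c ∈ Cs → IsCode c) where
      β : ℕ
      β = length Cs
      idx : Blk → Fin β
      idx B = fromℕ< (rank< (Cs∋ B))
      toℕ-idx : ∀ B → toℕ (idx B) ≡ rank Cs (code B)
      toℕ-idx B = toℕ-fromℕ< _
      bl : Fin β → Blk
      bl i = proj₁ (Cs⁻ (proj₁ (proj₂ (unrank Cs-unique (toℕ<n i)))))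
      idx-bl : ∀ i → idx (bl i) ≡ i
      idx-bl i = toℕ-injective (trans (toℕ-idx (bl i)) (trans (cong (rank Cs) (proj₂ (Cs⁻ (proj₁ (proj₂ (unrank Cs-unique (toℕ<n i))))))) (proj₂ (proj₂ (unrank Cs-unique (toℕ<n i))))))
      idx-inj : ∀ {B B′} → idx B ≡ idx B′ → B ≡ B′
      idx-inj {B} {B′} e = code-inj (rank-inj (Cs∋ B) (Cs∋ B′) (trans (sym (toℕ-idx B)) (trans (cong toℕ e) (toℕ-idx B′))))
      bl-idx : ∀ B → bl (idx B) ≡ B
      bl-idx B = idx-inj (idx-bl (idx B))

      private
        Wc : Fin β → Fin m → Fin m → ℕ
        Wc c = Tuple.W (pt (bl c)) (pt-inj (bl c))
        pairs : ∀ x y → sum (λ c → Wc c x y) ≡ 𝟙 (¬? (x ≟ y))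
        pairs x y with x ≟ y
        ... | yes refl = sum-zero (λ c → Tuple.W-none (pt (bl c)) (pt-inj (bl c)) (λ { a b (n , e , e′) → n (pt-inj (bl c) (trans e (sym e′))) }))
        ... | no n with cover n
        ... | B , a , b , a≢b , refl , refl = trans (sum-unique (λ c → Wc c (pt B a) (pt B b)) (idx B) (λ c ne → Tuple.W-none (pt (bl c)) (pt-inj (bl c))
                (λ { a′ b′ (n′ , e , e′) → ne (trans (sym (idx-bl c)) (cong idx (uniq n′ a≢b e e′))) })))
              (hit (bl (idx B)) (bl-idx B))
          where hit : ∀ B′ → B′ ≡ B → Tuple.W (pt B′) (pt-inj B′) (pt B a) (pt B b) ≡ 1
                hit _ refl = Tuple.W-one (pt B) (pt-inj B) a b a≢b

      private
        total-W : sum {β} (λ c → sum {m} (λ x → sum {m} (Wc c x))) ≡ sum {m} (λ x → sum {m} (λ y → 𝟙 (¬? (x ≟ y))))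
        total-W = trans (sym (rotate {m} {m} {β} (λ x y c → Wc c x y)))
          (sum-cong-≗ {m} {λ x → sum {m} (λ y → sum {β} (λ c → Wc c x y))} {λ x → sum {m} (λ y → 𝟙 (¬? (x ≟ y)))}
            (λ x → sum-cong-≗ {m} {λ y → sum {β} (λ c → Wc c x y)} {λ y → 𝟙 (¬? (x ≟ y))} (pairs x)))
        blocks-W : sum {β} (λ c → sum {m} (λ x → sum {m} (Wc c x))) + β * p ≡ β * (p * p)
        blocks-W = trans (cong (sum {β} (λ c → sum {m} (λ x → sum {m} (Wc c x))) +_) (sym (sum-const β p)))
          (trans (sym (∑-distrib-+ {β} (λ c → sum {m} (λ x → sum {m} (Wc c x))) (λ _ → p)))
            (trans (sum-cong-≗ {β} {λ c → sum {m} (λ x → sum {m} (Wc c x)) + p} {λ _ → p * p} (λ c → Tuple.W-sum (pt (bl c)) (pt-inj (bl c)))) (sum-const β (p * p))))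

      count : β * (p * p) + m ≡ m * m + β * p
      count = trans (cong (_+ m) (trans (sym blocks-W) (cong (_+ β * p) total-W)))
        (trans (l (sum {m} (λ x → sum {m} (λ y → 𝟙 (¬? (x ≟ y))))) (β * p) m) (cong (_+ β * p) (off-diagonal m)))
        where l : ∀ a b c → a + b + c ≡ a + c + b
              l = solve-∀

      count′ : β * (p * (p ∸ 1)) ≡ m * (m ∸ 1)
      count′ = +-cancelʳ-≡ (β * p + m) _ _ (trans (l₁ β p₂ m) (trans count (trans (cong (_+ β * p) (sym (sq m))) (l₂ (m * (m ∸ 1)) m (β * p)))))
        where l₁ : ∀ b p m → b * (suc (suc p) * suc p) + (b * suc (suc p) + m) ≡ b * (suc (suc p) * suc (suc p)) + m
              l₁ = solve-∀
              l₂ : ∀ a b c → a + b + c ≡ a + (c + b)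
              l₂ = solve-∀
              sq : ∀ m → m * (m ∸ 1) + m ≡ m * m
              sq zero = refl
              sq (suc m) = l m
                where l : ∀ m → suc m * m + suc m ≡ suc m * suc m
                      l = solve-∀

      module Colour {k n : ℕ} (m≤n : m ≤ n) (β≤k : β ≤ k) (dflt : Fin k) where
        ι : Fin m → Fin n
        ι x = inject≤ x m≤n
        ι-inj : ∀ {x y} → ι x ≡ ι y → x ≡ y
        ι-inj e = inject≤-injective m≤n m≤n _ _ e
        κ : Blk → Fin k
        κ B = inject≤ (idx B) β≤k
        colour′ : ∀ {x y : Fin m} → Dec (x ≡ y) → Fin k
        colour′ (yes _) = dflt
        colour′ (no n) = κ (proj₁ (cover n))
        -- All edges outside the design go to the default colour. Additional edges in a colour can
        -- only raise the density on the points of its block.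
        colour : Colouring k n
        colour i j with toℕ i <? m | toℕ j <? m
        ... | yes p | yes q = colour′ (fromℕ< p ≟ fromℕ< q)
        ... | _ | _ = dflt
        colour-ι : ∀ x y → colour (ι x) (ι y) ≡ colour′ (x ≟ y)
        colour-ι x y with toℕ (ι x) <? m | toℕ (ι y) <? m
        ... | yes p | yes q = cong₂ (λ a b → colour′ (a ≟ b)) (back x p) (back y q)
          where back : ∀ z (r : toℕ (ι z) < m) → fromℕ< r ≡ z
                back z r = toℕ-injective (trans (toℕ-fromℕ< r) (toℕ-inject≤ z m≤n))
        ... | no p | _ = ⊥-elim (p (subst (_< m) (sym (toℕ-inject≤ x m≤n)) (toℕ<n x)))
        ... | yes _ | no q = ⊥-elim (q (subst (_< m) (sym (toℕ-inject≤ y m≤n)) (toℕ<n y)))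
        colour-block : ∀ B {a b} → a ≢ b → colour (ι (pt B a)) (ι (pt B b)) ≡ κ B
        colour-block B {a} {b} n = trans (colour-ι (pt B a) (pt B b)) (go (pt B a ≟ pt B b))
          where go : (d : Dec (pt B a ≡ pt B b)) → colour′ d ≡ κ B
                go (yes e) = ⊥-elim (n (pt-inj B e))
                go (no ne) with cover ne
                ... | B′ , a′ , b′ , n′ , e , e′ = cong κ (uniq n′ n e e′)

        module _ (B : Blk) where
          private
            φ : Fin p → Fin n
            φ a = ι (pt B a)
            φ-inj : ∀ {a b} → φ a ≡ φ b → a ≡ b
            φ-inj e = pt-inj B (ι-inj e)
            open Tuple φ φ-inj using (W; W-cases; W-one; W-sum; sum-hit)
            on? : ∀ i → Dec (Σ (Fin p) λ a → φ a ≡ i)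
            on? i = any? (λ a → φ a ≟ i)
            S : Vec Bool n
            S = tabulate (λ i → ⌊ on? i ⌋)
            s : ∀ i → b2n (lookup S i) ≡ 𝟙 (on? i)
            s i = trans (cong b2n (lookup∘tabulate (λ i → ⌊ on? i ⌋) i)) (b2n-⌊⌋ (on? i))
            on-φ : ∀ a → 𝟙 (on? (φ a)) ≡ 1
            on-φ a = 𝟙-yes (on? (φ a)) (a , refl)
            size≤p : size S ≤ p
            size≤p = ≤-trans (≤-reflexive (trans (size-sum S) (sum-cong-≗ s))) (≤-trans (sum-mono (λ i → hits i (on? i)))
              (≤-reflexive (trans (∑-comm (λ i a → 𝟙 (φ a ≟ i))) (trans (sum-cong-≗ (λ a → sum-hit (φ a))) (trans (sum-const p 1) (*-identityʳ p))))))
              where hits : ∀ i (d : Dec (Σ (Fin p) λ a → φ a ≡ i)) → 𝟙 d ≤ sum (λ a → 𝟙 (φ a ≟ i))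
                    hits i (no _) = z≤n
                    hits i (yes (a , e)) = ≤-trans (≤-reflexive (sym (𝟙-yes (φ a ≟ i) e))) (term≤sum (λ a → 𝟙 (φ a ≟ i)) a)
            open Edges colour using (col; edges-sum; edges-size)
            e = edgesIn colour (κ B) S
            y : Fin n → Fin n → ℕ
            y i j = b2n (lookup S i) * (b2n (lookup S j) * (lt i j * col (κ B) i j))
            y-φ : ∀ a b → a ≢ b → y (φ a) (φ b) ≡ lt (φ a) (φ b)
            y-φ a b ne = trans (cong₂ (λ u w → u * (w * (lt (φ a) (φ b) * col (κ B) (φ a) (φ b)))) (trans (s (φ a)) (on-φ a)) (trans (s (φ b)) (on-φ b)))
              (trans (cong (λ u → 1 * (1 * (lt (φ a) (φ b) * u))) (𝟙-yes (colour (φ a) (φ b) ≟ κ B) (colour-block B ne))) (l (lt (φ a) (φ b))))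
              where l : ∀ x → 1 * (1 * (x * 1)) ≡ x
                    l = solve-∀
            W≤ : ∀ i j → W i j ≤ y i j + y j i
            W≤ i j with W-cases i j
            ... | inj₂ z = ≤-trans (≤-reflexive z) z≤n
            ... | inj₁ (a , b , ne , refl , refl) = ≤-reflexive (trans (W-one a b ne) (trans (sym (lt-total (φ a) (φ b)))
                  (trans (cong (lt (φ a) (φ b) + lt (φ b) (φ a) +_) (𝟙-no (φ a ≟ φ b) (λ e → ne (φ-inj e)))) (trans (+-identityʳ _)
                    (sym (cong₂ _+_ (y-φ a b ne) (y-φ b a (λ e → ne (sym e)))))))))
            many : p * p ≤ 2 * e + p
            many = begin
              p * p                                                      ≡⟨ sym W-sum ⟩
              sum (λ i → sum (W i)) + p                                  ≤⟨ +-monoˡ-≤ p (sum-mono (λ i → sum-mono (W≤ i))) ⟩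
              sum (λ i → sum (λ j → y i j + y j i)) + p                  ≡⟨ cong (_+ p) (sum-+₂ y (λ i j → y j i)) ⟩
              sum (λ i → sum (y i)) + sum (λ i → sum (λ j → y j i)) + p  ≡⟨ cong (λ z → sum (λ i → sum (y i)) + z + p) (∑-comm (λ i j → y j i)) ⟩
              sum (λ i → sum (y i)) + sum (λ i → sum (y i)) + p          ≡⟨ cong (λ z → z + z + p) (sym (edges-sum (κ B) S)) ⟩
              e + e + p                                                  ≡⟨ cong (_+ p) (cong (e +_) (sym (+-identityʳ e))) ⟩
              2 * e + p                                                  ∎
              where open ≤-Reasoning
            enough : p * suc p₂ ≤ 2 * e
            enough = +-cancelʳ-≤ p _ _ (≤-trans (≤-reflexive (l p₂)) many)
              where l : ∀ p → suc (suc p) * suc p + suc (suc p) ≡ suc (suc p) * suc (suc p)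
                    l = solve-∀
            dens : ∀ t → 2 * e + t ≤ t * t → t ≤ p → (ℤ.+ suc p₂) / 1 ≤ℚ density e t
            dens zero h _ = ⊥-elim (<⇒≱ (s≤s z≤n) (≤-trans enough (≤-trans (m≤m+n _ 0) h)))
            dens (suc t) h le = frac-≤ {suc p₂} {0} {2 * e} {t} (≤-trans (*-monoʳ-≤ (suc p₂) le) (≤-trans (≤-reflexive (*-comm (suc p₂) p)) (≤-trans enough (≤-reflexive (sym (*-identityʳ _))))))

          Mad-block : (ℤ.+ suc p₂) / 1 ≤ℚ Mad colour (κ B)
          Mad-block = ℚ.≤-trans (dens (size S) (edges-size (κ B) S) size≤p) (Mad-≥ colour (κ B) S)

        private
          X : Fin k → ℕ
          X a = sum (λ i → 𝟙 (inject≤ {β} i β≤k ≟ a)) * suc p₂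
          X-ok : ∀ a → (ℤ.+ X a) / 1 ≤ℚ Mad colour a
          X-ok a with any? (λ i → inject≤ {β} i β≤k ≟ a)
          ... | no none = ℚ.≤-trans (frac-≤ {X a} {0} {0} {0} (≤-reflexive (cong (λ z → z * suc p₂ * 1) (sum-zero (λ i → 𝟙-no (inject≤ i β≤k ≟ a) (λ e → none (i , e))))))) (Mad-≥0 colour a)
          ... | yes (i , refl) = ℚ.≤-trans (frac-≤ {X a} {0} {suc p₂} {0} (*-monoˡ-≤ 1 (≤-trans (*-monoˡ-≤ (suc p₂)
                  (sum-at-most-one (λ j → inject≤ j β≤k ≟ a) (λ e e′ → inject≤-injective β≤k β≤k _ _ (trans e (sym e′))))) (≤-reflexive (+-identityʳ _)))))
                (subst (λ c → (ℤ.+ suc p₂) / 1 ≤ℚ Mad colour c) (cong (λ j → inject≤ j β≤k) (idx-bl i)) (Mad-block (bl i)))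
          sumX : sum X ≡ suc p₂ * β
          sumX = trans (sym (*-distribʳ-sum (suc p₂) (λ a → sum (λ i → 𝟙 (inject≤ {β} i β≤k ≟ a))))) (trans (cong (_* suc p₂) (trans (∑-comm (λ a i → 𝟙 (inject≤ {β} i β≤k ≟ a)))
            (trans (sum-cong-≗ {β} (λ i → trans (sum-unique {k} (λ a → 𝟙 (inject≤ i β≤k ≟ a)) (inject≤ i β≤k) (λ a ne → 𝟙-no (inject≤ i β≤k ≟ a) (λ e → ne (sym e)))) (𝟙-yes (inject≤ i β≤k ≟ inject≤ i β≤k) refl)))
              (trans (sum-const β 1) (*-identityʳ β))))) (*-comm β (suc p₂)))

        total-≥ : (ℤ.+ (suc p₂ * β)) / 1 ≤ℚ totalMad colour
        total-≥ = subst (λ x → (ℤ.+ x) / 1 ≤ℚ totalMad colour) sumX (totalMad-≥ colour X 0 X-ok)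

  -- A design on m ≤ n points, its blocks coloured differently and all other edges arbitrarily.
  design-colouring : ∀ {p₂ m n k} → Design (2 + p₂) (Fin m) → m ≤ n → 0 < k → ∀ β → β * ((2 + p₂) * (1 + p₂)) ≡ m * (m ∸ 1) → β ≤ k →
    Σ (Colouring k n) λ c → (ℤ.+ (suc p₂ * β)) / 1 ≤ℚ totalMad c
  design-colouring {p₂} {m} {n} {k} D m≤n k>0 β eq β≤k = go (*-cancelʳ-≡ E.β β ((2 + p₂) * (1 + p₂)) (trans E.count′ (sym eq)))
    where
    open Blocks D
    module E = Enumerate (filter isCode? (cartesianProduct (allFin m) (allFin m))) (filter⁺ isCode? (cartesianProduct⁺ (allFin⁺ m) (allFin⁺ m)))
      (λ B → ∈-filter⁺ isCode? (∈-cartesianProduct⁺ (∈-allFin _) (∈-allFin _)) (B , refl))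
      (λ c∈ → proj₂ (∈-filter⁻ isCode? {xs = cartesianProduct (allFin m) (allFin m)} c∈))
    go : E.β ≡ β → Σ (Colouring k n) λ c → (ℤ.+ (suc p₂ * β)) / 1 ≤ℚ totalMad c
    go e = colour , subst (λ b → (ℤ.+ (suc p₂ * b)) / 1 ≤ℚ totalMad colour) e total-≥
      where open E.Colour m≤n (subst (_≤ k) (sym e) β≤k) (fromℕ< k>0)

-- The exact value and the approximation

module MaxMad where
  open import Defs
  open WilsonConstruction using (Adm)
  open WilsonTheorem using (wilson)
  open MadBounds using (frac-≤; frac-+; totalMad-upper)
  open DesignColourings using (design-colouring)
  open import Data.Nat using (ℕ; suc; _+_; _*_; _∸_; _≤_; _<_; z≤n; s≤s)
  open import Data.Nat.Properties
  open import Data.Nat.DivMod using (m≡m%n+[m/n]*n; m%n<n) renaming (_/_ to _div_; _%_ to _mod_)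
  open import Data.Nat.Divisibility using (_∣_; divides)
  open import Data.Nat.Tactic.RingSolver using (solve-∀)
  open import Data.Product using (Σ; _×_; _,_; proj₁; proj₂)
  import Data.Integer as ℤ
  open import Data.Rational as ℚ using (ℚ; _/_; _-_) renaming (_≤_ to _≤ℚ_)
  import Data.Rational.Properties as ℚ
  open import Relation.Binary.PropositionalEquality using (_≡_; sym; trans; cong)

  module Asymptotics (p₂ : ℕ) where
    p = 2 + p₂
    p₁ = 1 + p₂

    exact : Σ ℕ λ n₀ → (n k : ℕ) → n₀ < n → p₁ ∣ (n ∸ 1) → k * (p * p₁) ≡ n * (n ∸ 1) →
      (Σ (Colouring k n) λ c → totalMad c ≡ ℕtoℚ (p₁ * k))
      × ((c : Colouring k n) → totalMad c ≤ℚ ℕtoℚ (p₁ * k))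
      × ((ℤ.+ (n * (n ∸ 1))) / p ≡ ℕtoℚ (p₁ * k))
    -- The successor forces n ≥ 2, so that k is positive and a default colour exists.
    exact = suc (proj₁ (wilson p₂)) , go
      where
      go : (n k : ℕ) → suc (proj₁ (wilson p₂)) < n → p₁ ∣ (n ∸ 1) → k * (p * p₁) ≡ n * (n ∸ 1) →
        (Σ (Colouring k n) λ c → totalMad c ≡ ℕtoℚ (p₁ * k))
        × ((c : Colouring k n) → totalMad c ≤ℚ ℕtoℚ (p₁ * k))
        × ((ℤ.+ (n * (n ∸ 1))) / p ≡ ℕtoℚ (p₁ * k))
      go (suc (suc n₂)) k (s≤s le) (divides a e) eq = (proj₁ C , ℚ.≤-antisym (upper (proj₁ C)) (proj₂ C)) , upper , value
        where
        n = suc (suc n₂)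
        cross : p₁ * k * p ≡ n * suc n₂ * 1
        cross = trans (l p₁ k p) (trans eq (sym (*-identityʳ _)))
          where l : ∀ a b c → a * b * c ≡ b * (c * a)
                l = solve-∀
        value : (ℤ.+ (n * suc n₂)) / p ≡ ℕtoℚ (p₁ * k)
        value = ℚ.≤-antisym (frac-≤ {n * suc n₂} {p₁} {p₁ * k} {0} (≤-reflexive (sym cross))) (frac-≤ {p₁ * k} {0} {n * suc n₂} {p₁} (≤-reflexive cross))
        upper : (c : Colouring k n) → totalMad c ≤ℚ ℕtoℚ (p₁ * k)
        upper c = ℚ.≤-trans (totalMad-upper p₁ c (≤-reflexive eq)) (ℚ.≤-reflexive value)
        adm : Adm p p₁ n
        adm = a , k , cong suc e , *-cancelʳ-≡ (n * a) (k * p) p₁ (trans (*-assoc n a p₁) (trans (cong (n *_) (sym e)) (trans (sym eq) (sym (*-assoc k p p₁)))))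
        k>0 : ∀ k → k * (p * p₁) ≡ n * suc n₂ → 0 < k
        k>0 (suc k) _ = s≤s z≤n
        C = design-colouring (proj₂ (wilson p₂) n (m≤n⇒m≤1+n (≤-trans (n≤1+n _) le)) adm) ≤-refl (k>0 k eq) k eq ≤-refl

    approximate : Σ ℕ λ C → Σ ℕ λ N → (n k : ℕ) → N ≤ n → k * (p * p₁) ≤ n * (n ∸ 1) → n * (n ∸ 1) < suc k * (p * p₁) →
      ((c : Colouring k n) → totalMad c ≤ℚ (ℤ.+ (n * (n ∸ 1))) / p)
      × (Σ (Colouring k n) λ c → ((ℤ.+ (n * (n ∸ 1))) / p) - ℕtoℚ (C * n) ≤ℚ totalMad c)
    -- With d = p (p - 1) and r = n - m < d, the loss n (n - 1) - m (m - 1) = r (m + n - 1) is at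
    -- most 2 d n, and dividing by p gives 2 (p - 1) n. The summand d in the threshold keeps m large
    -- enough for the design to exist.
    approximate = 2 * p₁ , suc n₀ + p * p₁ , λ n k N≤n lo hi → (λ c → totalMad-upper p₁ c lo) , lower n k N≤n hi
      where
      n₀ = proj₁ (wilson p₂)
      -- The largest m ≤ n with p (p − 1) ∣ m − 1, for which m is admissible and n − m is bounded.
      module _ (n₁ k r t : ℕ) (split : n₁ ≡ r + t * (p * p₁)) (r< : r < p * p₁) (N≤n : suc n₀ + p * p₁ ≤ suc n₁) (hi : suc n₁ * n₁ < suc k * (p * p₁)) where
        private
          d = p * p₁
          m = suc (t * d)
          td≥ : suc n₀ ≤ t * d
          td≥ = +-cancelʳ-≤ d _ _ (≤-trans N≤n (≤-trans (s≤s (≤-reflexive split)) (≤-trans (+-monoˡ-≤ (t * d) r<) (≤-reflexive (+-comm d (t * d))))))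
          t>0 : ∀ t → suc n₀ ≤ t * d → 0 < t
          t>0 (suc t) _ = s≤s z≤n
          -- The number of blocks of a design of order m, as m - 1 = t d.
          β = m * t
          β>0 : 0 < β
          β>0 = ≤-trans (t>0 t td≥) (m≤m+n t _)
          td≤ : t * d ≤ n₁
          td≤ = ≤-trans (m≤n+m (t * d) r) (≤-reflexive (sym split))
          βd : β * d ≡ m * (t * d)
          βd = *-assoc m t d
          β≤k : β ≤ k
          β≤k = ℕ-pred (*-cancelʳ-< d β (suc k) (≤-<-trans (≤-trans (≤-reflexive βd) (*-mono-≤ (s≤s td≤) td≤)) hi))
            where ℕ-pred : ∀ {a b} → a < suc b → a ≤ b
                  ℕ-pred (s≤s x) = x
          adm : Adm p p₁ m
          adm = p * t , β , cong suc (l₁ p p₁ t) , l₂ m p t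
            where l₁ : ∀ p q t → t * (p * q) ≡ p * t * q
                  l₁ = solve-∀
                  l₂ : ∀ m p t → m * (p * t) ≡ m * t * p
                  l₂ = solve-∀
          C = design-colouring {n = suc n₁} (proj₂ (wilson p₂) m (≤-trans (n≤1+n n₀) (m≤n⇒m≤1+n td≥)) adm) (s≤s td≤) (≤-trans β>0 β≤k) β βd β≤k
          cross : suc n₁ * n₁ * 1 ≤ (p₁ * β + 2 * p₁ * suc n₁) * p
          cross = begin
            suc n₁ * n₁ * 1                                        ≡⟨ *-identityʳ _ ⟩
            suc n₁ * n₁                                            ≡⟨ cong (λ z → suc z * z) split ⟩
            suc (r + t * d) * (r + t * d)                          ≡⟨ l₁ r (t * d) ⟩
            m * (t * d) + r * (m + (r + t * d))                    ≤⟨ +-monoʳ-≤ (m * (t * d)) (*-mono-≤ (<⇒≤ r<) (+-mono-≤ (s≤s td≤) (≤-trans (≤-reflexive (sym split)) (n≤1+n n₁)))) ⟩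
            m * (t * d) + d * (suc n₁ + suc n₁)                    ≡⟨ l₂ m t p p₁ (suc n₁) ⟩
            (p₁ * β + 2 * p₁ * suc n₁) * p                         ∎
            where
            open ≤-Reasoning
            l₁ : ∀ r x → suc (r + x) * (r + x) ≡ suc x * x + r * (suc x + (r + x))
            l₁ = solve-∀
            l₂ : ∀ m t p q n → m * (t * (p * q)) + p * q * (n + n) ≡ (q * (m * t) + 2 * q * n) * p
            l₂ = solve-∀
        lower′ : Σ (Colouring k (suc n₁)) λ c → ((ℤ.+ (suc n₁ * n₁)) / p) - ℕtoℚ (2 * p₁ * suc n₁) ≤ℚ totalMad c
        lower′ = proj₁ C , ℚ.≤-trans (ℚ.≤-trans (ℚ.+-monoˡ-≤ (ℚ.- z) below) (ℚ.≤-reflexive cancel)) (proj₂ C)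
          where
          y z : ℚ
          y = ℕtoℚ (p₁ * β)
          z = ℕtoℚ (2 * p₁ * suc n₁)
          below : (ℤ.+ (suc n₁ * n₁)) / p ≤ℚ y ℚ.+ z
          below = ℚ.≤-trans (frac-≤ {suc n₁ * n₁} {p₁} {p₁ * β + 2 * p₁ * suc n₁} {0} cross) (ℚ.≤-reflexive (sym (frac-+ (p₁ * β) (2 * p₁ * suc n₁) 0)))
          cancel : y ℚ.+ z ℚ.+ ℚ.- z ≡ y
          cancel = trans (ℚ.+-assoc y z (ℚ.- z)) (trans (cong (y ℚ.+_) (ℚ.+-inverseʳ z)) (ℚ.+-identityʳ y))
      lower : (n k : ℕ) → suc n₀ + p * p₁ ≤ n → n * (n ∸ 1) < suc k * (p * p₁) → Σ (Colouring k n) λ c → ((ℤ.+ (n * (n ∸ 1))) / p) - ℕtoℚ (2 * p₁ * n) ≤ℚ totalMad c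
      lower (suc n₁) k = lower′ n₁ k (n₁ mod (p * p₁)) (n₁ div (p * p₁)) (m≡m%n+[m/n]*n n₁ (p * p₁)) (m%n<n n₁ (p * p₁))

open import Defs
open import Data.Nat using (ℕ; suc; _+_; _*_; _∸_; _≤_; _<_; s≤s; NonZero)
open import Data.Nat.Divisibility using (_∣_)
open import Data.Nat.Combinatorics using (_C_)
open import Data.Product using (Σ; _×_; _,_; proj₁; proj₂)
open import Relation.Binary.PropositionalEquality using (_≡_)
open import Data.Integer using (+_)
open import Data.Rational using (ℚ; _/_; _-_) renaming (_≤_ to _≤ℚ_)

theorem6p1 : (p : ℕ) → .{{_ : NonZero p}} → 3 ≤ p →
    (Σ ℕ λ n₀ → (n k : ℕ) → n₀ < n → (p C 2) ∣ (n C 2) → (p ∸ 1) ∣ (n ∸ 1) →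
    k * (p * (p ∸ 1)) ≡ n * (n ∸ 1) →
    (Σ (Colouring k n) λ c → totalMad c ≡ ℕtoℚ ((p ∸ 1) * k))
    × ((c : Colouring k n) → totalMad c ≤ℚ ℕtoℚ ((p ∸ 1) * k))
    × ((+ (n * (n ∸ 1))) / p ≡ ℕtoℚ ((p ∸ 1) * k)))
    ×
    (Σ ℕ λ C → Σ ℕ λ N → (n k : ℕ) → N ≤ n →
    k * (p * (p ∸ 1)) ≤ n * (n ∸ 1) → n * (n ∸ 1) < suc k * (p * (p ∸ 1)) →
    ((c : Colouring k n) → totalMad c ≤ℚ (+ (n * (n ∸ 1))) / p)
    × (Σ (Colouring k n) λ c → ((+ (n * (n ∸ 1))) / p) - ℕtoℚ (C * n) ≤ℚ totalMad c))
theorem6p1 (suc (suc p₂)) (s≤s (s≤s _)) = (proj₁ exact , λ n k n₀<n _ → proj₂ exact n k n₀<n) , approximate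
  where
  open MaxMad.Asymptotics p₂
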